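{- There exists $C_0>0$ such that for every $C\ge C_0$, every $C$-expander $G$ is Hamilton-connected, i.e. for every two distinct vertices $x,y$ of $G$ there is a path from $x$ to $y$ containing all vertices of $G$.
   Context: For a graph $G$ and $X\subseteq V(G)$, $N(X)$ is the set of vertices not in $X$ adjacent to some vertex of $X$. An $n$-vertex graph $G$ with $n\ge 3$ is a $C$-expander if (a) $|N(X)|\ge C|X|$ for all $X\subseteq V(G)$ with $|X|<n/2C$, and (b) there is an edge between any two disjoint sets $X,Y\subseteq V(G)$ with $|X|,|Y|\ge n/2C$.
   Formalization: The expansion parameter C (and the constant C_0) ranges over rational numbers instead of real numbers; a C-expander with irrational C is also a C'-expander for some slightly smaller rational C' ≥ C_0. -}

module Defs where

open import Data.Nat using (ℕ; suc) renaming (_≤_ to _ℕ≤_)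
open import Data.Bool using (Bool; true; false; _∧_; _∨_; not)
open import Data.Fin using (Fin)
open import Data.Fin.Subset using (Subset; _∈_; _∉_; ∣_∣)
open import Data.Vec using (tabulate; lookup; foldr)
open import Data.List using (List; head; last)
open import Data.List.Membership.Propositional using () renaming (_∈_ to _∈ₗ_)
open import Data.List.Relation.Unary.Unique.Propositional using (Unique)
open import Data.List.Relation.Unary.Linked using (Linked)
open import Data.Maybe using (just)
open import Data.Integer using (+_)
open import Data.Rational using (ℚ; _/_; _*_; _<_; _≤_; 0ℚ)
open import Data.Product using (Σ; _×_; ∃)
open import Relation.Binary.PropositionalEquality using (_≡_; _≢_)

record Graph (n : ℕ) : Set where
  field
    adj     : Fin n → Fin n → Bool
    symm    : ∀ u v → adj u v ≡ adj v u
    irrefl  : ∀ v → adj v v ≡ false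
open Graph public

_~[_]_ : ∀ {n} → Fin n → Graph n → Fin n → Set
u ~[ G ] v = adj G u v ≡ true

anyFin : ∀ {n} → (Fin n → Bool) → Bool
anyFin {n} f = foldr (λ _ → Bool) _∨_ false (tabulate f)

N : ∀ {n} → Graph n → Subset n → Subset n
N G X = tabulate λ v → not (lookup X v) ∧ anyFin (λ u → lookup X u ∧ adj G u v)

ℕtoℚ : ℕ → ℚ
ℕtoℚ k = + k / 1

two : ℚ
two = ℕtoℚ 2

Disjoint : ∀ {n} → Subset n → Subset n → Set
Disjoint {n} X Y = ∀ (v : Fin n) → v ∈ X → v ∉ Y

-- C-expander (C a positive rational; n ≥ 3).
--  (a) |N(X)| ≥ C|X| whenever |X| < n/(2C)   [written as 2C|X| < n, C > 0]
--  (b) an edge between any two disjoint X, Y with |X|, |Y| ≥ n/(2C) [i.e. n ≤ 2C|X|]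
record IsExpander {n : ℕ} (C : ℚ) (G : Graph n) : Set where
  field
    n≥3       : 3 ℕ≤ n
    expand    : ∀ (X : Subset n) → two * C * ℕtoℚ ∣ X ∣ < ℕtoℚ n →
                  C * ℕtoℚ ∣ X ∣ ≤ ℕtoℚ ∣ N G X ∣
    connected : ∀ (X Y : Subset n) → Disjoint X Y →
                  ℕtoℚ n ≤ two * C * ℕtoℚ ∣ X ∣ →
                  ℕtoℚ n ≤ two * C * ℕtoℚ ∣ Y ∣ →
                  Σ (Fin n) λ u → Σ (Fin n) λ v → u ∈ X × v ∈ Y × u ~[ G ] v

record HamiltonPath {n : ℕ} (G : Graph n) (x y : Fin n) : Set where
  field
    path     : List (Fin n)
    unique   : Unique path
    spanning : ∀ (v : Fin n) → v ∈ₗ path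
    starts   : head path ≡ just x
    ends     : last path ≡ just y
    edges    : Linked (λ u v → adj G u v ≡ true) path

HamiltonConnected : ∀ {n} → Graph n → Set
HamiltonConnected {n} G = ∀ (x y : Fin n) → x ≢ y → HamiltonPath G x y

-- Let m = n/1000. By hypothesis any two disjoint sets of m vertices are joined by an edge, and sets of at most 8m
-- vertices expand; when n ≤ 2C the graph is complete.
-- (1) By the extendability method of Friedman and Pippenger one embeds a chain of gadgets from x to y, connecting
-- vertices through pairs of binary trees. A gadget is a set W with Hamilton paths from c to t₁ and from c to t₃, followed
-- by a long path from t₁ to a neighbour t₂ of t₃. With every W replaced by a virtual edge c t₁ the chain is an xy-path T.
-- (2) The vertices off the chain are covered by few paths. Take a maximum system of paths and long cycles. If it had many
-- ends, rotations from two of them, confined to distant parts of the system so that their effects can be superposed,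
-- would reach m vertices each, and an edge between the two sets would enlarge the system. Then the cycles are opened.
-- (3) The ends of these paths are absorbed two at a time: an edge on one of the long paths of T is deleted, and
-- rotations on both sides join the two new ends to the two path ends. This leaves a two-factor of the graph with virtual
-- edges, each component of which meets a gadget (or y).
-- (4) The gadgets are treated one by one. If the edges c t₁ and t₂ t₃ lie on different cycles, exchanging them for c t₃
-- and t₁ t₂ merges these cycles; in either case the virtual edge at c is then replaced by a Hamilton path of W. In the end one
-- cycle through the virtual edge xy remains, which is the Hamilton path.

module Submission where

open import Data.Nat
open import Data.Nat.Properties
open import Data.Nat.DivMod using (m*n/n≡m; m≡m%n+[m/n]*n; m%n<n; m/n*n≤m; /-monoˡ-≤)
open import Data.Bool using (Bool; true; false; not)
open import Data.Fin using (Fin)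
import Data.Fin.Properties as Finₚ
open import Data.List using (List; []; _∷_; _++_; length; map; allFin; concatMap; take; reverse; head; last)
import Data.List.Properties
open import Data.List.Properties using (length-++; length-map; ++-assoc; ++-identityʳ; length-tabulate; length-take; length-reverse)
open import Data.List.Membership.Propositional using (_∈_; _∉_)
open import Data.List.Membership.Propositional.Properties
open import Data.List.Relation.Unary.Any using (here; there; any?)
open import Data.List.Relation.Unary.All using (All; []; _∷_)
import Data.List.Relation.Unary.All as All
open import Data.List.Relation.Unary.AllPairs using ([]; _∷_)
open import Data.List.Relation.Unary.Linked using (Linked; []; [-]; _∷_)
open import Data.List.Relation.Unary.Unique.Propositional using (Unique)
import Data.List.Relation.Unary.Unique.Propositional.Properties as Uniqueₚ
open import Data.Product using (Σ; _×_; _,_; proj₁; proj₂)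
open import Data.Sum using (_⊎_; inj₁; inj₂)
import Data.Sum
open import Data.Empty using (⊥; ⊥-elim)
open import Data.Unit using (⊤; tt)
open import Data.Maybe using (just)
open import Function using (_∘_; id; case_of_)
open import Relation.Nullary using (¬_; Dec; yes; no; contradiction)
open import Relation.Binary.PropositionalEquality hiding (J)
open import Relation.Binary.Definitions using (DecidableEquality)
open import Data.Nat.Tactic.RingSolver using (solve-∀)

-- Two separate chains of rotations can be superposed only if the property to be preserved is local.
-- Having no cycle is not local; having no cycle shorter than `g` is. Hence the covering system is
-- optimised among systems whose cycles have at least `g` vertices; only then are the cycles opened,
-- at a cost of about n/`g` new ends, and the ends minimised again among acyclic systems. Rotations
-- inside the chain may create cycles; there the side of each rotation is chosen so that every
-- component keeps a special vertex, and the gadgets repair the rest. The scales follow, with s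
-- about log₂ m. A ladder has about s rungs of length about 2s, so a gadget has order s² vertices,
-- and the long paths get the same order so as to fill a constant fraction of it. Absorbing one end
-- alters about 2s vertices and spoils at most that many long paths of length about 2s²; with about
-- n/`g` ends this asks for `g` of order s³. Everything else is a fixed power of s, and the powers
-- needed stay below m once s ≥ 512, whence C₀.

-- The argument is classical: it runs under a double negation, which is removed at the end because a Hamilton path can be searched for.
DN : Set → Set
DN A = ¬ ¬ A

return : ∀ {A} → A → DN A
return a k = k a

infixl 1 _>>=_
_>>=_ : ∀ {A B : Set} → DN A → (A → DN B) → DN B
(m >>= f) k = m λ a → f a k

lem : (A : Set) → DN (A ⊎ ¬ A)
lem A k = k (inj₂ λ a → k (inj₁ a))

dn-stable : ∀ {A : Set} → Dec A → DN A → A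
dn-stable (yes a) _ = a
dn-stable (no ¬a) h = ⊥-elim (h ¬a)

-- Duplicate-free lists as finite sets, under double negation

_⊑_ : ∀ {A : Set} → List A → List A → Set
xs ⊑ ys = ∀ {v} → v ∈ xs → v ∈ ys

remove : ∀ {A : Set} {p : A} {F} → p ∈ F →
  Σ (List A) λ F' → (length F ≡ suc (length F')) × (∀ {z} → z ∈ F → z ≢ p → z ∈ F') × (F' ⊑ F)
remove {F = p ∷ F} (here refl) = F , refl , (λ { (here e) ne → contradiction e ne ; (there i) _ → i }) , there
remove {F = x ∷ F} (there i) with remove i
... | F' , e , f , g = x ∷ F' , cong suc e , (λ { (here e) _ → here e ; (there j) ne → there (f j ne) })
                     , (λ { (here e) → here e ; (there j) → there (g j) })

∉-head : ∀ {A : Set} {x : A} {xs} → Unique (x ∷ xs) → x ∉ xs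
∉-head (a ∷ _) i = All.lookup a i refl

uniq-tail : ∀ {A : Set} {x : A} {xs} → Unique (x ∷ xs) → Unique xs
uniq-tail (_ ∷ u) = u

uniq-∷ : ∀ {A : Set} {x : A} {xs} → x ∉ xs → Unique xs → Unique (x ∷ xs)
uniq-∷ h u = All.tabulate (λ { i refl → h i }) ∷ u

pigeon : ∀ {A : Set} {xs ys : List A} → Unique xs → xs ⊑ ys → length xs ≤ length ys
pigeon {xs = []} u s = z≤n
pigeon {xs = x ∷ xs} u s with remove (s (here refl))
... | ys' , e , f , _ rewrite e =
  s≤s (pigeon (uniq-tail u) λ i → f (s (there i)) λ { refl → ∉-head u i })

uniq-++ : ∀ {A : Set} {xs ys : List A} → Unique xs → Unique ys → (∀ {v} → v ∈ xs → v ∉ ys) → Unique (xs ++ ys)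
uniq-++ u w h = Uniqueₚ.++⁺ u w λ (i , j) → h i j

uniq-++ˡ : ∀ {A : Set} (xs : List A) {ys} → Unique (xs ++ ys) → Unique xs
uniq-++ˡ [] u = []
uniq-++ˡ (x ∷ xs) u = uniq-∷ (λ i → ∉-head u (∈-++⁺ˡ i)) (uniq-++ˡ xs (uniq-tail u))

uniq-++ʳ : ∀ {A : Set} (xs : List A) {ys} → Unique (xs ++ ys) → Unique ys
uniq-++ʳ [] u = u
uniq-++ʳ (x ∷ xs) u = uniq-++ʳ xs (uniq-tail u)

uniq-disj : ∀ {A : Set} (xs : List A) {ys v} → Unique (xs ++ ys) → v ∈ xs → v ∉ ys
uniq-disj (x ∷ xs) u (here refl) j = ∉-head u (∈-++⁺ʳ xs j)
uniq-disj (x ∷ xs) u (there i) j = uniq-disj xs (uniq-tail u) i j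

∈-take : ∀ {A : Set} k {xs : List A} → take k xs ⊑ xs
∈-take (suc k) {x ∷ xs} (here e) = here e
∈-take (suc k) {x ∷ xs} (there i) = there (∈-take k i)

uniq-take : ∀ {A : Set} k {xs : List A} → Unique xs → Unique (take k xs)
uniq-take zero u = []
uniq-take (suc k) {[]} u = []
uniq-take (suc k) {x ∷ xs} u = uniq-∷ (λ i → ∉-head u (∈-take k i)) (uniq-take k (uniq-tail u))

-- Excluded middle, applied once per entry, turns an arbitrary predicate into a finite list; only
-- such lists can be counted.
enumL : ∀ {A : Set} (P : A → Set) (l : List A) → Unique l →
  DN (Σ (List A) λ xs → Unique xs × (∀ v → v ∈ l → P v → v ∈ xs) × (∀ v → v ∈ xs → P v × v ∈ l))
enumL P [] u = return ([] , [] , (λ _ ()) , (λ _ ()))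
enumL P (x ∷ l) u = enumL P l (uniq-tail u) >>= λ (xs , ux , f , g) → lem (P x) >>= λ where
  (inj₁ px) → return (x ∷ xs , uniq-∷ (λ i → ∉-head u (proj₂ (g _ i))) ux
    , (λ { _ (here e) _ → here e ; _ (there i) pv → there (f _ i pv) })
    , (λ { _ (here refl) → px , here refl ; _ (there i) → proj₁ (g _ i) , there (proj₂ (g _ i)) }))
  (inj₂ np) → return (xs , ux , (λ { _ (here refl) pv → ⊥-elim (np pv) ; _ (there i) pv → f _ i pv })
    , λ _ i → proj₁ (g _ i) , there (proj₂ (g _ i)))

enum : ∀ {n} (P : Fin n → Set) →
  DN (Σ (List (Fin n)) λ xs → Unique xs × (∀ v → P v → v ∈ xs) × (∀ v → v ∈ xs → P v))
enum {n} P = enumL P (allFin n) (Uniqueₚ.allFin⁺ n) >>= λ (xs , u , f , g) →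
  return (xs , u , (λ v → f v (∈-allFin v)) , λ v i → proj₁ (g v i))

-- Finite choice: a double negation is moved past a quantifier by induction on the list it ranges
-- over. Both directions of the correspondence are returned, so that properties of the chosen
-- objects can be read off from their origins.
chooseL : ∀ {A B : Set} (R : A → B → Set) (xs : List A) → (∀ x → x ∈ xs → DN (Σ B (R x))) →
  DN (Σ (List B) λ ys → (length ys ≡ length xs) × (∀ x → x ∈ xs → Σ B λ y → y ∈ ys × R x y)
     × (∀ y → y ∈ ys → Σ A λ x → x ∈ xs × R x y))
chooseL R [] h = return ([] , refl , (λ _ ()) , (λ _ ()))
chooseL R (x ∷ xs) h = chooseL R xs (λ v i → h v (there i)) >>= λ (ys , e , f , g) → h x (here refl) >>= λ (y , r) →
  return (y ∷ ys , cong suc e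
    , (λ { _ (here refl) → y , here refl , r ; _ (there i) → let (z , j , q) = f _ i in z , there j , q })
    , (λ { _ (here refl) → x , here refl , r ; _ (there i) → let (z , j , q) = g _ i in z , there j , q }))

module Split {A : Set} (_≟_ : DecidableEquality A) where
  _∈?_ : (x : A) (xs : List A) → Dec (x ∈ xs)
  x ∈? xs = any? (x ≟_) xs

  record Parts (xs ys : List A) : Set where
    field
      ins outs : List A
      size     : length xs ≡ length ins + length outs
      ins⊑     : ins ⊑ xs
      ins∈     : ins ⊑ ys
      outs⊑    : outs ⊑ xs
      outs∉    : ∀ {v} → v ∈ outs → v ∉ ys
      uins     : Unique xs → Unique ins
      uouts    : Unique xs → Unique outs
      cover    : ∀ {v} → v ∈ xs → v ∈ ins ⊎ v ∈ outs

  split : ∀ xs ys → Parts xs ys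
  split [] ys = record { ins = [] ; outs = [] ; size = refl ; ins⊑ = λ () ; ins∈ = λ () ; outs⊑ = λ ()
    ; outs∉ = λ () ; uins = λ u → u ; uouts = λ u → u ; cover = λ () }
  split (x ∷ xs) ys with x ∈? ys | split xs ys
  ... | yes i | P = record { ins = x ∷ ins ; outs = outs ; size = cong suc size
    ; ins⊑ = λ { (here e) → here e ; (there j) → there (ins⊑ j) }
    ; ins∈ = λ { (here refl) → i ; (there j) → ins∈ j }
    ; outs⊑ = λ j → there (outs⊑ j) ; outs∉ = outs∉
    ; uins = λ u → uniq-∷ (λ j → ∉-head u (ins⊑ j)) (uins (uniq-tail u))
    ; uouts = λ u → uouts (uniq-tail u)
    ; cover = λ { (here e) → inj₁ (here e) ; (there j) → Data.Sum.map₁ there (cover j) } }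
    where open Parts P
  ... | no ni | P = record { ins = ins ; outs = x ∷ outs
    ; size = trans (cong suc size) (sym (+-suc (length ins) (length outs)))
    ; ins⊑ = λ j → there (ins⊑ j) ; ins∈ = ins∈
    ; outs⊑ = λ { (here e) → here e ; (there j) → there (outs⊑ j) }
    ; outs∉ = λ { (here refl) → ni ; (there j) → outs∉ j }
    ; uins = λ u → uins (uniq-tail u)
    ; uouts = λ u → uniq-∷ (λ j → ∉-head u (outs⊑ j)) (uouts (uniq-tail u))
    ; cover = λ { (here e) → inj₂ (here e) ; (there j) → Data.Sum.map₂ there (cover j) } }
    where open Parts P

  outs≥ : ∀ {xs ys} (P : Parts xs ys) → Unique xs → length xs ≤ length ys + length (Parts.outs P)
  outs≥ P u = ≤-trans (≤-reflexive size) (+-monoˡ-≤ _ (pigeon (uins u) ins∈))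
    where open Parts P

  avoid : ∀ {xs ys} → Unique xs → length ys < length xs → Σ A λ v → v ∈ xs × v ∉ ys
  avoid {xs} {ys} u lt with split xs ys
  ... | P with Parts.outs P in eq | outs≥ P u
  ... | [] | le = ⊥-elim (<⇒≱ lt (subst (length xs ≤_) (+-identityʳ _) le))
  ... | v ∷ _ | le = v , Parts.outs⊑ P (subst (v ∈_) (sym eq) (here refl)) , Parts.outs∉ P (subst (v ∈_) (sym eq) (here refl))

maxWit : (P : ℕ → Set) (b : ℕ) → (∀ k → P k → k ≤ b) → ∀ k → P k → DN (Σ ℕ λ k → P k × (∀ j → P j → j ≤ k))
maxWit P b h k pk = go b k pk (m≤n+m b k)
  where
  go : ∀ f k → P k → b ≤ k + f → DN (Σ ℕ λ k → P k × (∀ j → P j → j ≤ k))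
  go zero k pk le = return (k , pk , λ j pj → ≤-trans (h j pj) (subst (b ≤_) (+-identityʳ k) le))
  go (suc f) k pk le = lem (Σ ℕ λ j → P j × k < j) >>= λ where
    (inj₁ (j , pj , lt)) → go f j pj (≤-trans le (subst (_≤ j + f) (sym (+-suc k f)) (+-monoˡ-≤ f lt)))
    (inj₂ none) → return (k , pk , λ j pj → ≮⇒≥ λ lt → none (j , pj , lt))

minWit : (P : ℕ → Set) → ∀ k → P k → DN (Σ ℕ λ k → P k × (∀ j → P j → k ≤ j))
minWit P k pk = go k k pk ≤-refl
  where
  go : ∀ f k → P k → k ≤ f → DN (Σ ℕ λ k → P k × (∀ j → P j → k ≤ j))
  go zero k pk le = return (k , pk , λ j _ → ≤-trans le z≤n)
  go (suc f) k pk le = lem (Σ ℕ λ j → P j × j < k) >>= λ where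
    (inj₁ (j , pj , lt)) → go f j pj (≤-pred (≤-trans lt le))
    (inj₂ none) → return (k , pk , λ j pj → ≮⇒≥ λ lt → none (j , pj , lt))


-- Two-matchings as involutions on ports

-- A graph of maximum degree two is an involution on the half-edges (v , b); its fixed points are the free half-edges.
Port : ℕ → Set
Port n = Fin n × Bool

M : ℕ → Set
M n = Port n → Port n

module _ {n : ℕ} where
  vt : Port n → Fin n
  vt = proj₁

  sw : Port n → Port n
  sw (v , b) = v , not b

  sw-sw : ∀ p → sw (sw p) ≡ p
  sw-sw (v , true) = refl
  sw-sw (v , false) = refl

  sw≢ : ∀ p → sw p ≢ p
  sw≢ (v , true) ()
  sw≢ (v , false) ()

  sw-inj : ∀ {p q} → sw p ≡ sw q → p ≡ q
  sw-inj {p} {q} e = trans (sym (sw-sw p)) (trans (cong sw e) (sw-sw q))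

  same-vt : ∀ {p q} → vt p ≡ vt q → p ≡ q ⊎ p ≡ sw q
  same-vt {v , true} {.v , true} refl = inj₁ refl
  same-vt {v , true} {.v , false} refl = inj₂ refl
  same-vt {v , false} {.v , true} refl = inj₂ refl
  same-vt {v , false} {.v , false} refl = inj₁ refl

  infix 4 _≟V_ _≟P_
  _≟V_ : DecidableEquality (Fin n)
  _≟V_ = Finₚ._≟_

  _≟P_ : DecidableEquality (Port n)
  (v , b) ≟P (w , c) with v ≟V w | b Data.Bool.≟ c
  ... | yes refl | yes refl = yes refl
  ... | no ne | _ = no λ { refl → ne refl }
  ... | yes _ | no ne = no λ { refl → ne refl }

  module SV = Split _≟V_
  module SP = Split _≟P_

  ports : List (Fin n) → List (Port n)
  ports [] = []
  ports (v ∷ vs) = (v , false) ∷ (v , true) ∷ ports vs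

  ports-length : ∀ vs → length (ports vs) ≡ 2 * length vs
  ports-length [] = refl
  ports-length (v ∷ vs) = trans (cong (λ k → suc (suc k)) (ports-length vs))
    (sym (*-distribˡ-+ 2 1 (length vs)))

  ∈-ports : ∀ {vs} z → vt z ∈ vs → z ∈ ports vs
  ∈-ports (v , false) (here refl) = here refl
  ∈-ports (v , true) (here refl) = there (here refl)
  ∈-ports z (there i) = there (there (∈-ports z i))

  Inv : M n → Set
  Inv μ = ∀ p → μ (μ p) ≡ p

  -- For a free `p` this is the Pósa rotation that replaces the edge from `q` to `μ q` by the edge
  -- `p` `q` and leaves `μ q` free. If `q` is free as well, then `μ q` is `q` and the formula merely
  -- adds the edge, because the clause for `q` is tried before the one for `μ q`.
  rot : M n → Port n → Port n → M n
  rot μ p q z with z ≟P p | z ≟P q | z ≟P μ q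
  ... | yes _ | _ | _ = q
  ... | no _ | yes _ | _ = p
  ... | no _ | no _ | yes _ = z
  ... | no _ | no _ | no _ = μ z

  module _ (μ : M n) (p q : Port n) where
    rot-p : rot μ p q p ≡ q
    rot-p with p ≟P p
    ... | yes _ = refl
    ... | no ne = contradiction refl ne

    rot-q : rot μ p q q ≡ p
    rot-q with q ≟P p | q ≟P q
    ... | yes e | _ = e
    ... | no _ | yes _ = refl
    ... | no _ | no ne = contradiction refl ne

    rot-r : μ q ≢ p → μ q ≢ q → rot μ p q (μ q) ≡ μ q
    rot-r n₁ n₂ with μ q ≟P p | μ q ≟P q | μ q ≟P μ q
    ... | yes e | _ | _ = contradiction e n₁
    ... | no _ | yes e | _ = contradiction e n₂
    ... | no _ | no _ | yes _ = refl
    ... | no _ | no _ | no ne = contradiction refl ne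

    rot-o : ∀ {z} → z ≢ p → z ≢ q → z ≢ μ q → rot μ p q z ≡ μ z
    rot-o {z} n₁ n₂ n₃ with z ≟P p | z ≟P q | z ≟P μ q
    ... | yes e | _ | _ = contradiction e n₁
    ... | no _ | yes e | _ = contradiction e n₂
    ... | no _ | no _ | yes e = contradiction e n₃
    ... | no _ | no _ | no _ = refl

    data RotCase (z : Port n) : Set where
      atp : z ≡ p → RotCase z
      atq : z ≢ p → z ≡ q → RotCase z
      atr : z ≢ p → z ≢ q → z ≡ μ q → RotCase z
      off : z ≢ p → z ≢ q → z ≢ μ q → RotCase z

    rotCase : ∀ z → RotCase z
    rotCase z with z ≟P p | z ≟P q | z ≟P μ q
    ... | yes e | _ | _ = atp e
    ... | no a | yes e | _ = atq a e
    ... | no a | no b | yes e = atr a b e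
    ... | no a | no b | no c = off a b c

    module _ (inv : Inv μ) (fp : μ p ≡ p) (p≢q : p ≢ q) where
      μq≢p : μ q ≢ p
      μq≢p e = p≢q (trans (sym fp) (trans (cong μ (sym e)) (inv q)))

      rotInv : Inv (rot μ p q)
      rotInv z with rotCase z
      ... | atp refl = trans (cong (rot μ p q) rot-p) rot-q
      ... | atq _ refl = trans (cong (rot μ p q) rot-q) rot-p
      ... | atr a b refl = trans (cong (rot μ p q) (rot-r μq≢p b)) (rot-r μq≢p b)
      ... | off a b c = trans (cong (rot μ p q) (rot-o a b c)) (trans (rot-o
              (λ e → a (trans (sym (inv z)) (trans (cong μ e) fp)))
              (λ e → c (trans (sym (inv z)) (cong μ e)))
              (λ e → b (trans (sym (inv z)) (trans (cong μ e) (inv q))))) (inv z))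

      rot-free : ∀ z → rot μ p q z ≡ z → z ≢ p × (z ≡ μ q ⊎ μ z ≡ z)
      rot-free z e with rotCase z
      ... | atp refl = ⊥-elim (p≢q (trans (sym e) rot-p))
      ... | atq a refl = ⊥-elim (p≢q (trans (sym rot-q) e))
      ... | atr a b refl = a , inj₁ refl
      ... | off a b c = a , inj₂ (trans (sym (rot-o a b c)) e)

  cut : M n → Port n → M n
  cut μ q z with z ≟P q | z ≟P μ q
  ... | yes _ | _ = z
  ... | no _ | yes _ = z
  ... | no _ | no _ = μ z

  module _ (μ : M n) (q : Port n) where
    cut-q : cut μ q q ≡ q
    cut-q with q ≟P q
    ... | yes _ = refl
    ... | no ne = contradiction refl ne

    cut-r : cut μ q (μ q) ≡ μ q
    cut-r with μ q ≟P q | μ q ≟P μ q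
    ... | yes _ | _ = refl
    ... | no _ | yes _ = refl
    ... | no _ | no ne = contradiction refl ne

    cut-o : ∀ {z} → z ≢ q → z ≢ μ q → cut μ q z ≡ μ z
    cut-o {z} a b with z ≟P q | z ≟P μ q
    ... | yes e | _ = contradiction e a
    ... | no _ | yes e = contradiction e b
    ... | no _ | no _ = refl

    data CutCase (z : Port n) : Set where
      atq : z ≡ q → CutCase z
      atr : z ≡ μ q → CutCase z
      off : z ≢ q → z ≢ μ q → CutCase z

    cutCase : ∀ z → CutCase z
    cutCase z with z ≟P q | z ≟P μ q
    ... | yes e | _ = atq e
    ... | no _ | yes e = atr e
    ... | no a | no b = off a b

    cutInv : Inv μ → Inv (cut μ q)
    cutInv inv z with cutCase z
    ... | atq refl = trans (cong (cut μ q) cut-q) cut-q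
    ... | atr refl = trans (cong (cut μ q) cut-r) cut-r
    ... | off a b = trans (cong (cut μ q) (cut-o a b)) (trans (cut-o
            (λ e → b (trans (sym (inv z)) (cong μ e)))
            (λ e → a (trans (sym (inv z)) (trans (cong μ e) (inv q))))) (inv z))

    cut-free : ∀ z → cut μ q z ≡ z → z ≡ q ⊎ z ≡ μ q ⊎ μ z ≡ z
    cut-free z e with cutCase z
    ... | atq x = inj₁ x
    ... | atr x = inj₂ (inj₁ x)
    ... | off a b = inj₂ (inj₂ (trans (sym (cut-o a b)) e))

  -- `E` is a parameter because the covering paths use edges of the graph, whereas the structure on
  -- the chain contains virtual edges and only has to be free of loops. `R` confines the matching to
  -- a vertex set.
  record PM (E : Fin n → Fin n → Set) (R : Fin n → Set) (μ : M n) : Set where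
    field
      inv  : Inv μ
      edge : ∀ z → μ z ≢ z → E (vt z) (vt (μ z))
      dom  : ∀ z → μ z ≢ z → R (vt z)

    domμ : ∀ z → μ z ≢ z → R (vt (μ z))
    domμ z ne = dom (μ z) λ e → ne (trans (sym e) (inv z))

  module _ {E : Fin n → Fin n → Set} {R : Fin n → Set} (E-sym : ∀ {u v} → E u v → E v u) where
    rotPM : ∀ {μ} p q → PM E R μ → μ p ≡ p → p ≢ q → E (vt p) (vt q) → R (vt p) → R (vt q) → PM E R (rot μ p q)
    rotPM {μ} p q P fp p≢q e rp rq = record { inv = rotInv μ p q inv fp p≢q ; edge = ed ; dom = dm }
      where
      open PM P
      ed : ∀ z → rot μ p q z ≢ z → E (vt z) (vt (rot μ p q z))
      ed z ne with rotCase μ p q z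
      ... | atp refl rewrite rot-p μ p q = e
      ... | atq a refl rewrite rot-q μ p q = E-sym e
      ... | atr a b refl = ⊥-elim (ne (rot-r μ p q (μq≢p μ p q inv fp p≢q) b))
      ... | off a b c rewrite rot-o μ p q a b c = edge z ne
      dm : ∀ z → rot μ p q z ≢ z → R (vt z)
      dm z ne with rotCase μ p q z
      ... | atp refl = rp
      ... | atq a refl = rq
      ... | atr a b refl = ⊥-elim (ne (rot-r μ p q (μq≢p μ p q inv fp p≢q) b))
      ... | off a b c rewrite rot-o μ p q a b c = dom z ne

    cutPM : ∀ {μ} q → PM E R μ → PM E R (cut μ q)
    cutPM {μ} q P = record { inv = cutInv μ q inv ; edge = ed ; dom = dm }
      where
      open PM P
      ed : ∀ z → cut μ q z ≢ z → E (vt z) (vt (cut μ q z))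
      ed z ne with cutCase μ q z
      ... | atq refl = ⊥-elim (ne (cut-q μ q))
      ... | atr refl = ⊥-elim (ne (cut-r μ q))
      ... | off a b rewrite cut-o μ q a b = edge z ne
      dm : ∀ z → cut μ q z ≢ z → R (vt z)
      dm z ne with cutCase μ q z
      ... | atq refl = ⊥-elim (ne (cut-q μ q))
      ... | atr refl = ⊥-elim (ne (cut-r μ q))
      ... | off a b rewrite cut-o μ q a b = dom z ne

  -- One step of a walk: the edge at `p` is crossed and the vertex reached will be left through its
  -- other port. A port thus encodes a vertex together with a direction of travel; at a free port
  -- the walk turns round.
  nx : M n → Port n → Port n
  nx μ p = sw (μ p)

  it : M n → ℕ → Port n → Port n
  it μ zero p = p
  it μ (suc k) p = it μ k (nx μ p)

  it-suc : ∀ μ k p → it μ (suc k) p ≡ nx μ (it μ k p)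
  it-suc μ zero p = refl
  it-suc μ (suc k) p = it-suc μ k (nx μ p)

  it-+ : ∀ μ j k p → it μ (j + k) p ≡ it μ k (it μ j p)
  it-+ μ zero k p = refl
  it-+ μ (suc j) k p = it-+ μ j k (nx μ p)

  it-comm : ∀ μ j k p → it μ j (it μ k p) ≡ it μ k (it μ j p)
  it-comm μ j k p = trans (sym (it-+ μ k j p)) (trans (cong (λ x → it μ x p) (+-comm k j)) (it-+ μ j k p))

  module _ {μ : M n} (inv : Inv μ) where
    nx-inj : ∀ {p q} → nx μ p ≡ nx μ q → p ≡ q
    nx-inj {p} {q} e = trans (sym (inv p)) (trans (cong μ (sw-inj e)) (inv q))

    it-inj : ∀ k {p q} → it μ k p ≡ it μ k q → p ≡ q
    it-inj zero e = e
    it-inj (suc k) e = nx-inj (it-inj k e)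

    nx-back : ∀ a → nx μ (sw (nx μ a)) ≡ sw a
    nx-back a = cong sw (trans (cong μ (sw-sw (μ a))) (inv a))

    -- A walk leaving a vertex by one port and coming back through the same port turns round at a free port.
    palindrome : ∀ i a → it μ i a ≡ sw a → Σ ℕ λ j → μ (it μ j a) ≡ it μ j a
    palindrome zero a e = ⊥-elim (sw≢ a (sym e))
    palindrome (suc zero) a e = zero , sw-inj e
    palindrome (suc (suc i)) a e =
      let (j , f) = palindrome i (nx μ a) (nx-inj (trans (sym (it-suc μ i (nx μ a))) (trans e (sym (nx-back a)))))
      in suc j , f

    it-back : ∀ j i a → it μ j (sw (it μ (j + i) a)) ≡ sw (it μ i a)
    it-back zero i a = refl
    it-back (suc j) i a = trans (cong (it μ j) (trans (cong (λ x → nx μ (sw x)) (it-suc μ (j + i) a))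
      (nx-back (it μ (j + i) a)))) (it-back j i a)

  -- The second clause is essential: a path walked to its end and back also returns to `p`. The
  -- period `suc k` need not be the least one.
  Cyc : M n → Port n → ℕ → Set
  Cyc μ p k = (it μ (suc k) p ≡ p) × (∀ i → μ (it μ i p) ≢ it μ i p)

  -- No cycle of a forbidden length. With `Lim` bounding the length by `g` this excludes short
  -- cycles; with `Lim` always true it says that the matching is a union of paths.
  NSC : (ℕ → Set) → M n → Set
  NSC Lim μ = ∀ p k → Lim k → ¬ Cyc μ p k

  it-per : ∀ μ {p k} → it μ (suc k) p ≡ p → ∀ i → it μ (i * suc k) p ≡ p
  it-per μ e zero = refl
  it-per μ {p} {k} e (suc i) = trans (it-+ μ (suc k) (i * suc k) p) (trans (cong (it μ (i * suc k)) e) (it-per μ e i))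

  cyc-shift : ∀ μ {p k} j → Cyc μ p k → Cyc μ (it μ j p) k
  cyc-shift μ {p} {k} j (e , f) = trans (it-comm μ (suc k) j p) (cong (it μ j) e)
    , λ i h → f (j + i) (subst (λ x → μ x ≡ x) (sym (it-+ μ j i p)) h)

  cyc-sw : ∀ {μ} → Inv μ → ∀ {p k} → Cyc μ p k → Cyc μ (sw p) k
  cyc-sw {μ} inv {p} {k} (e , f) = trans (cong (it μ (suc k)) (cong sw (sym e')))
      (trans (it-back inv (suc k) 0 p) refl) , nf
    where
    e' : it μ (suc k + 0) p ≡ p
    e' = trans (cong (λ x → it μ x p) (+-identityʳ (suc k))) e
    nf : ∀ i → μ (it μ i (sw p)) ≢ it μ i (sw p)
    nf i h = f j (nx-fr (subst (λ x → μ x ≡ x) q h))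
      where
      -- After `i` steps the reversed walk stands `i` steps before some multiple of the period of
      -- the forward walk. The multiple by i+1 is chosen so that the difference is positive.
      j = pred (i * suc k + suc k ∸ i)
      big : i ≤ i * suc k
      big = m≤m*n i (suc k)
      N≡ : i + suc j ≡ i * suc k + suc k
      N≡ = trans (cong (i +_) (suc-pred (i * suc k + suc k ∸ i) {{>-nonZero (m<n⇒0<n∸m (≤-<-trans big (m<m+n _ (s≤s z≤n))))}}))
             (m+[n∸m]≡n (≤-trans big (m≤m+n _ _)))
      q : it μ i (sw p) ≡ sw (it μ (suc j) p)
      q = trans (cong (λ x → it μ i (sw x)) (trans (sym (it-per μ {p} {k} e (suc i)))
            (cong (λ x → it μ x p) (trans (+-comm (suc k) (i * suc k)) (sym N≡))))) (it-back inv i (suc j) p)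
      nx-fr : μ (sw (it μ (suc j) p)) ≡ sw (it μ (suc j) p) → μ (it μ j p) ≡ it μ j p
      nx-fr h' = sym (trans (sym (inv (it μ j p))) (subst (λ x → μ x ≡ x) z h'))
        where z : sw (it μ (suc j) p) ≡ μ (it μ j p)
              z = trans (cong sw (it-suc μ j p)) (sw-sw _)

  -- The walk from `a` reaches `p` before it has turned round and come back to `a`. With `a` the far
  -- port of the vertex of `q`, this is the situation in which the new edge `p` `q` closes a cycle.
  Hit : M n → Port n → Port n → Set
  Hit μ p a = Σ ℕ λ i → (it μ i a ≡ p) × (∀ j → j ≤ i → it μ j a ≢ sw a)

  hit-free : ∀ {μ p a} → μ a ≡ a → p ≢ a → ¬ Hit μ p a
  hit-free fa ne (zero , e , _) = ne (sym e)
  hit-free {μ} {p} {a} fa ne (suc i , _ , h) = h 1 (s≤s z≤n) (cong sw fa)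

  -- Both walks arrive at the same port and steps are injective, so cancelling the shorter one shows
  -- that the longer one passed through the other starting port, which `Hit` forbids. Hence one of
  -- the two ports of a vertex is always safe for a rotation.
  hit-one : ∀ {μ} → Inv μ → ∀ p a → ¬ (Hit μ p a × Hit μ p (sw a))
  hit-one {μ} inv p a ((i , e , h) , (j , e' , h')) with ≤-total i j
  ... | inj₁ le = h' (j ∸ i) (m∸n≤m j i) (trans (it-inj inv i (trans (sym (it-+ μ (j ∸ i) i (sw a)))
          (trans (cong (λ x → it μ x (sw a)) (m∸n+n≡m le)) (trans e' (sym e))))) (sym (sw-sw a)))
  ... | inj₂ le = h (i ∸ j) (m∸n≤m i j) (it-inj inv j (trans (sym (it-+ μ (i ∸ j) j a))
          (trans (cong (λ x → it μ x a) (m∸n+n≡m le)) (trans e (sym e')))))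

  -- A cycle of the rotated matching either uses the new edge, and then its remainder is an old walk
  -- from `sw q` to `p` no longer than the cycle, or it avoids `p` and `q` and was a cycle already.
  -- The bound on the hit matters when two modifications are superposed.
  rotNSC≤ : ∀ {Lim μ} p q → Inv μ → μ p ≡ p → p ≢ q → (∀ k → Lim k → (h : Hit μ p (sw q)) → ¬ proj₁ h ≤ k) →
    NSC Lim μ → NSC Lim (rot μ p q)
  rotNSC≤ {Lim} {μ} p q inv fp p≢q nh N P k L C = start (it? k)
    where
    μ' = rot μ p q
    inv' = rotInv μ p q inv fp p≢q
    r-free : ∀ {x} → x ≢ p → x ≢ q → μ' x ≢ x → μ' x ≡ μ x
    r-free {x} a b ne with rotCase μ p q x
    ... | atp e = contradiction e a
    ... | atq _ e = contradiction e b
    ... | atr _ b' refl = ⊥-elim (ne (rot-r μ p q (μq≢p μ p q inv fp p≢q) b'))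
    ... | off a' b' c = rot-o μ p q a' b' c
    thru-p : ¬ Cyc μ' p k
    thru-p C'@(e , f) = fin (agree k ≤-refl) (trans (cong (it μ' k) (sym nxp)) e)
      where
      nxp : nx μ' p ≡ sw q
      nxp = cong sw (rot-p μ p q)
      nq : ∀ j → it μ' j (sw q) ≢ q
      nq j h with palindrome inv' j (sw q) (trans h (sym (sw-sw q)))
      ... | i , z = f (suc i) (subst (λ x → μ' (it μ' i x) ≡ it μ' i x) (sym nxp) z)
      -- The old and the new walk from `sw q` coincide until the old one meets `p`; at that moment a
      -- `Hit` has been found and the comparison stops.
      agree : ∀ j → j ≤ k → Σ (Hit μ p (sw q)) (λ h → proj₁ h ≤ k) ⊎ (it μ' j (sw q) ≡ it μ j (sw q)) × (∀ i → i ≤ j → it μ i (sw q) ≢ q)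
      agree zero _ = inj₂ (refl , λ { _ z≤n → nq 0 })
      agree (suc j) j≤k with agree j (<⇒≤ j≤k)
      ... | inj₁ h = inj₁ h
      ... | inj₂ (e₁ , h) with it μ j (sw q) ≟P p
      ... | yes e₂ = inj₁ ((j , e₂ , λ i le h' → h i le (trans h' (sw-sw q))) , <⇒≤ j≤k)
      ... | no ne = inj₂ (e₃ , λ i le h' → case m≤n⇒m<n∨m≡n le of λ
              { (inj₁ lt) → h i (≤-pred lt) h' ; (inj₂ refl) → nq (suc j) (trans e₃ h') })
        where
        x = it μ' j (sw q)
        e₃ : it μ' (suc j) (sw q) ≡ it μ (suc j) (sw q)
        e₃ = trans (it-suc μ' j (sw q)) (trans (cong sw (trans (r-free (λ e₄ → ne (trans (sym e₁) e₄)) (nq j)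
               (subst (λ y → μ' (it μ' j y) ≢ it μ' j y) nxp (f (suc j)))) (cong μ e₁))) (sym (it-suc μ j (sw q))))
      fin : Σ (Hit μ p (sw q)) (λ h → proj₁ h ≤ k) ⊎ (it μ' k (sw q) ≡ it μ k (sw q)) × (∀ i → i ≤ k → it μ i (sw q) ≢ q) →
            it μ' k (sw q) ≡ p → ⊥
      fin (inj₁ (h , le)) _ = nh k L h le
      fin (inj₂ (e₁ , h)) e₂ = nh k L (k , trans (sym e₁) e₂ , λ j le h' → h j le (trans h' (sw-sw q))) ≤-refl
    through : ∀ i → ¬ (it μ' i P ≡ p ⊎ it μ' i P ≡ q)
    through i (inj₁ e) = thru-p (subst (λ x → Cyc μ' x k) e (cyc-shift μ' {k = k} i C))
    through i (inj₂ e) = thru-p (subst (λ x → Cyc μ' x k) (sw-sw p) (cyc-sw inv' {k = k}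
      (subst (λ x → Cyc μ' x k) (trans (it-suc μ' i P) (trans (cong (nx μ') e) (cong sw (rot-q μ p q)))) (cyc-shift μ' {k = k} (suc i) C))))
    same : ∀ i → μ' (it μ' i P) ≡ μ (it μ' i P)
    same i = r-free (λ e → through i (inj₁ e)) (λ e → through i (inj₂ e)) (proj₂ C i)
    it? : ∀ i → it μ' i P ≡ it μ i P
    it? zero = refl
    it? (suc i) = trans (it-suc μ' i P) (trans (cong sw (trans (same i) (cong μ (it? i)))) (sym (it-suc μ i P)))
    start : it μ' k P ≡ it μ k P → ⊥
    start _ = N P k L (trans (sym (it? (suc k))) (proj₁ C) , λ i e →
      proj₂ C i (trans (same i) (trans (cong μ (it? i)) (trans e (sym (it? i))))))

  rotNSC : ∀ {Lim μ} p q → Inv μ → μ p ≡ p → p ≢ q → ¬ Hit μ p (sw q) → NSC Lim μ → NSC Lim (rot μ p q)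
  rotNSC p q inv fp p≢q nh = rotNSC≤ p q inv fp p≢q λ _ _ h _ → nh h


-- Pósa rotations by breadth-first levels

-- |Γ(X) ∩ P| is bounded below by bounding every list that contains Γ(X) ∩ P.
Cov : ∀ {n} → (Fin n → Fin n → Set) → List (Fin n) → (Fin n → Set) → List (Fin n) → Set
Cov Adj X P Y = ∀ u w → u ∈ X → Adj u w → P w → w ∈ Y

thrice : ∀ {A B : Set} (xs : List A) (f g : A → A) → length (xs ++ map f xs ++ map g xs) ≡ 3 * length xs
thrice xs f g = trans (length-++ xs) (cong (length xs +_) (trans (length-++ (map f xs))
  (cong₂ _+_ (length-map f xs) (trans (length-map g xs) (sym (+-identityʳ _))))))

module Growth {n : ℕ} (Adj : Fin n → Fin n → Set) (μ₀ : M n) (p₀ : Port n) (inv₀ : Inv μ₀)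
  (A : Fin n → Set) (Ok : M n → Port n → Set) (ok₀ : Ok μ₀ p₀)
  (step : ∀ μ p w → Ok μ p → A w → Adj (vt p) w → (∀ j → μ (w , j) ≡ μ₀ (w , j)) →
    DN (Σ Bool λ j → (μ₀ (w , j) ≢ (w , j)) × (μ p ≡ p) × (Inv μ) × (p ≢ (w , j)) × Ok (rot μ p (w , j)) (μ₀ (w , j)))) where

  nb : Bool → Fin n → Fin n
  nb b x = vt (μ₀ (x , b))

  End : Fin n → Set
  End v = (v ≡ vt p₀) ⊎ Σ (Fin n) λ w → Σ Bool λ j → A w × (v ≡ nb j w)

  Zone : Fin n → Set
  Zone u = A u ⊎ End u

  -- An endpoint obtained by successive rotations, with its own matching. The trace `τ` contains all
  -- vertices whose ports have changed; each rotation adds two of them, the pivot and the new end,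
  -- which gives the bound on `len`.
  record Ch (X E : List (Fin n)) (i : ℕ) (v : Fin n) : Set where
    field
      μ    : M n
      p    : Port n
      τ    : List (Fin n)
      end  : vt p ≡ v
      ok   : Ok μ p
      tail : v ∈ τ
      strt : vt p₀ ∈ τ
      chg  : ∀ z → μ z ≢ μ₀ z → vt z ∈ τ
      -- An edge that was lost had an endpoint of some intermediate path at one of its ends.
      chx  : ∀ z → μ z ≢ μ₀ z → vt z ∈ X ⊎ vt (μ₀ z) ∈ X
      sub  : ∀ u → u ∈ τ → u ∈ E
      len  : length τ ≤ suc (2 * i)
      zone : ∀ u → u ∈ τ → Zone u
      endz : End v

  ch-mono : ∀ {X X' E E' i v} → (∀ u → u ∈ X → u ∈ X') → (∀ u → u ∈ E → u ∈ E') → Ch X E i v → Ch X' E' i v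
  ch-mono f g c = record { Ch c ; chx = λ z ne → Data.Sum.map (f _) (f _) (Ch.chx c z ne) ; sub = λ u i → g u (Ch.sub c u i) }

  ch-len : ∀ {X E i i' v} → i ≤ i' → Ch X E i v → Ch X E i' v
  ch-len le c = record { Ch c ; len = ≤-trans (Ch.len c) (s≤s (*-monoʳ-≤ 2 le)) }

  -- `E` contains the traces of all endpoints at once. Since traces are extended rather than
  -- rebuilt, it grows by one pivot per new endpoint and stays linear in the number of endpoints,
  -- with no factor for the length of a trace.
  record Lev (i : ℕ) : Set where
    field
      X E   : List (Fin n)
      uX    : Unique X
      lX    : length X ≡ 2 ^ i
      lE    : length E ≤ 2 * 2 ^ i
      chain : ∀ v → v ∈ X → Ch X E i v

  lev₀ : Lev 0
  lev₀ = record { X = vt p₀ ∷ [] ; E = vt p₀ ∷ [] ; uX = uniq-∷ (λ ()) [] ; lX = refl ; lE = s≤s z≤n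
    ; chain = λ { v (here refl) → record { μ = μ₀ ; p = p₀ ; τ = vt p₀ ∷ [] ; end = refl ; ok = ok₀ ; tail = here refl ; strt = here refl
      ; chg = λ z ne → ⊥-elim (ne refl) ; chx = λ z ne → ⊥-elim (ne refl) ; sub = λ u i → i ; len = s≤s z≤n
      ; zone = λ { u (here e) → inj₂ (inj₁ e) } ; endz = inj₁ refl } } }

  module _ {i : ℕ} (L : Lev i) where
    open Lev L

    Nw : Fin n → Set
    Nw y = Σ (Fin n) λ w → Ch (y ∷ X) (y ∷ w ∷ E) (suc i) y

    hull : List (Fin n) → List (Fin n)
    hull ys = (X ++ ys) ++ map (nb false) (X ++ ys) ++ map (nb true) (X ++ ys)

    in-nb : ∀ b {x ys} → x ∈ X ++ ys → nb b x ∈ hull ys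
    in-nb false {x} {ys} i = ∈-++⁺ʳ (X ++ ys) (∈-++⁺ˡ (∈-map⁺ (nb false) i))
    in-nb true {x} {ys} i = ∈-++⁺ʳ (X ++ ys) (∈-++⁺ʳ (map (nb false) (X ++ ys)) (∈-map⁺ (nb true) i))

    back : ∀ z → nb (proj₂ (μ₀ z)) (vt (μ₀ z)) ≡ vt z
    back z = cong vt (inv₀ z)

    in-back : ∀ z {ys} → vt (μ₀ z) ∈ X ++ ys → vt z ∈ hull ys
    in-back z i = subst (_∈ hull _) (back z) (in-nb (proj₂ (μ₀ z)) i)

    -- Let `w` be an allowed neighbour of an endpoint. If an edge at `w` has been lost, then `w` or
    -- its old neighbour there is an earlier endpoint. Otherwise a rotation at `w` makes one of its
    -- old neighbours an endpoint, old or new. So every such `w` lies in `X ++ ys` or is matched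
    -- into it, which at most 3(|X| + |ys|) vertices are.
    newfull : DN (Σ (List (Fin n)) λ ys → Unique ys × (∀ v → v ∈ ys → v ∉ X × Nw v) × Cov Adj X A (hull ys))
    newfull = enum (λ y → y ∉ X × Nw y) >>= λ (ys , uys , inn , out) →
      return (ys , uys , out , λ u w u∈ a aw → dn-stable (SV._∈?_ w (hull ys)) (cov ys inn u w u∈ a aw))
      where
      cov : ∀ ys → (∀ v → v ∉ X × Nw v → v ∈ ys) → ∀ u w → u ∈ X → Adj u w → A w → DN (w ∈ hull ys)
      cov ys inn u w u∈ a aw abs = step μ p w ok aw (subst (λ x → Adj x w) (sym end) a) intact λ s → build s abs
        where
        open Ch (chain u u∈)
        intact : ∀ j → μ (w , j) ≡ μ₀ (w , j)
        intact j with μ (w , j) ≟P μ₀ (w , j)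
        ... | yes e = e
        ... | no ne with chx (w , j) ne
        ... | inj₁ k = ⊥-elim (abs (∈-++⁺ˡ (∈-++⁺ˡ k)))
        ... | inj₂ k = ⊥-elim (abs (in-back (w , j) (∈-++⁺ˡ k)))
        build : (Σ Bool λ j → (μ₀ (w , j) ≢ (w , j)) × (μ p ≡ p) × (Inv μ) × (p ≢ (w , j)) × Ok (rot μ p (w , j)) (μ₀ (w , j))) → DN (w ∈ hull ys)
        build (j , ne , fp , inv , p≢q , ok') with SV._∈?_ (nb j w) X
        ... | yes k = return (in-back (w , j) (∈-++⁺ˡ k))
        ... | no k = return (in-back (w , j) (∈-++⁺ʳ X (inn y (k , w , record
            { μ = μ' ; p = μ₀ q ; τ = y ∷ w ∷ τ ; end = refl ; ok = ok' ; tail = here refl ; strt = there (there strt)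
            ; chg = λ z d → Data.Sum.[ (λ e → e) , (λ e → there (there (chg z e))) ] (cases z d)
            ; chx = λ z d → Data.Sum.[ casex z d , (λ e → Data.Sum.map there there (chx z e)) ] (cases z d)
            ; sub = λ { _ (here e) → here e ; _ (there (here e)) → there (here e) ; v (there (there l)) → there (there (sub v l)) }
            ; len = ≤-trans (s≤s (s≤s len)) (≤-reflexive (cong suc (sym (*-suc 2 i))))
            ; zone = λ { _ (here refl) → inj₂ (inj₂ (w , j , aw , refl)) ; _ (there (here refl)) → inj₁ aw ; v (there (there l)) → zone v l }
            ; endz = inj₂ (w , j , aw , refl) }))))
          where
          q = (w , j)
          y = nb j w
          μ' = rot μ p q
          cases : ∀ z → μ' z ≢ μ₀ z → vt z ∈ y ∷ w ∷ τ ⊎ μ z ≢ μ₀ z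
          cases z d with rotCase μ p q z
          ... | atp refl = inj₁ (there (there (subst (_∈ τ) (sym end) tail)))
          ... | atq _ refl = inj₁ (there (here refl))
          ... | atr _ _ e = inj₁ (here (cong vt (trans e (intact j))))
          ... | off a b c = inj₂ λ e → d (trans (rot-o μ p q a b c) e)
          casex : ∀ z → μ' z ≢ μ₀ z → vt z ∈ y ∷ w ∷ τ → vt z ∈ y ∷ X ⊎ vt (μ₀ z) ∈ y ∷ X
          casex z d _ with rotCase μ p q z
          ... | atp refl = inj₁ (there (subst (_∈ X) (sym end) u∈))
          ... | atq _ refl = inj₂ (here refl)
          ... | atr _ _ e = inj₁ (here (cong vt (trans e (intact j))))
          ... | off a b c = Data.Sum.map there there (chx z λ e → d (trans (rot-o μ p q a b c) e))

    hull-length : ∀ ys → length (hull ys) ≡ 3 * (length X + length ys)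
    hull-length ys = trans (thrice {B = ⊤} (X ++ ys) (nb false) (nb true)) (cong (3 *_) (length-++ X))

    endX : ∀ v → v ∈ X → End v
    endX v k = Ch.endz (chain v k)

  Ex : ℕ → ℕ → Set
  Ex c m = ∀ X → Unique X → length X ≤ m → (∀ v → v ∈ X → End v) → ∀ Y → Cov Adj X A Y → c * length X ≤ length Y

  double : ∀ a → 2 * a + (a + a) ≡ 2 * (2 * a)
  double = solve-∀

  -- Expansion by 6 inside a set of size 3(|X| + |ys|) gives |ys| ≥ |X|. Only |X| of the new
  -- endpoints are kept, so that level sizes are exact powers of two.
  up : ∀ {m i} → Ex 6 m → 2 ^ i ≤ m → Lev i → DN (Lev (suc i))
  up {m} {i} ex le L = newfull L >>= λ (ys , uys , out , cov) → pick ys uys out cov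
    where
    open Lev L
    pick : ∀ ys → Unique ys → (∀ v → v ∈ ys → v ∉ X × Nw L v) → Cov Adj X A (hull L ys) → DN (Lev (suc i))
    pick ys uys out cov = chooseL (λ v w → Ch (v ∷ X) (v ∷ w ∷ E) (suc i) v) zs (λ v k → return (proj₂ (out v (∈-take _ k)))) >>= fin
      where
      big : length X ≤ length ys
      big = +-cancelˡ-≤ (length X) _ _ (*-cancelˡ-≤ 3 (≤-trans (≤-reflexive (trans (cong (3 *_) (cong (length X +_) (sym (+-identityʳ _)))) (sym (*-assoc 3 2 (length X)))))
              (≤-trans (ex X uX (≤-trans (≤-reflexive lX) le) (endX L) (hull L ys) cov) (≤-reflexive (hull-length L ys)))))
      zs = take (length X) ys
      lz : length zs ≡ length X
      lz = trans (length-take (length X) ys) (m≤n⇒m⊓n≡m big)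
      X' = X ++ zs
      fin : _ → DN (Lev (suc i))
      fin (ws , lw , f , _) = return record
        { X = X' ; E = E' ; uX = uniq-++ uX (uniq-take _ uys) (λ a b → proj₁ (out _ (∈-take _ b)) a)
        ; lX = trans (length-++ X) (trans (cong₂ _+_ lX (trans lz lX)) (cong (2 ^ i +_) (sym (+-identityʳ _))))
        ; lE = ≤-trans (≤-reflexive (trans (length-++ E) (cong (length E +_) (length-++ zs))))
                (≤-trans (+-mono-≤ lE (≤-reflexive (cong₂ _+_ (trans lz lX) (trans lw (trans lz lX)))))
                  (≤-reflexive (double (2 ^ i))))
        ; chain = λ v k → case ∈-++⁻ X k of λ
            { (inj₁ a) → ch-len (n≤1+n i) (ch-mono (λ _ → ∈-++⁺ˡ) (λ _ → ∈-++⁺ˡ) (chain v a))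
            ; (inj₂ b) → let (w , w∈ , c) = f v b in ch-mono
                (λ { _ (here refl) → ∈-++⁺ʳ X b ; _ (there a) → ∈-++⁺ˡ a })
                (λ { _ (here refl) → ∈-++⁺ʳ E (∈-++⁺ˡ b) ; _ (there (here refl)) → ∈-++⁺ʳ E (∈-++⁺ʳ zs w∈) ; _ (there (there a)) → ∈-++⁺ˡ a }) c } }
        where E' = E ++ zs ++ ws

  grow : ∀ {m} → Ex 6 m → ∀ d → (∀ i → i < d → 2 ^ i ≤ m) → DN (Lev d)
  grow ex zero h = return lev₀
  grow ex (suc d) h = grow ex d (λ i lt → h i (m≤n⇒m≤1+n lt)) >>= up ex (h d ≤-refl)

-- Sets outside a small bad list expand

module Core {n : ℕ} (Adj : Fin n → Fin n → Set) (nb : Bool → Fin n → Fin n)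
  (nb-sym : ∀ j w → Σ Bool λ i → nb i (nb j w) ≡ w) where

  AB : (Fin n → Set) → List (Fin n) → Fin n → Set
  AB P B w = P w × w ∉ B × (∀ j → nb j w ∉ B)

  blow : List (Fin n) → List (Fin n)
  blow B = B ++ map (nb false) B ++ map (nb true) B

  cov-AB : ∀ {X P B Y} → Cov Adj X (AB P B) Y → Cov Adj X P (Y ++ blow B)
  cov-AB {X} {P} {B} {Y} c u w u∈ a pw with SV._∈?_ w (blow B)
  ... | yes i = ∈-++⁺ʳ Y i
  ... | no ni = ∈-++⁺ˡ (c u w u∈ a (pw , (λ i → ni (∈-++⁺ˡ i)) , λ j i → ni (near j i)))
    where
    near : ∀ j → nb j w ∈ B → w ∈ blow B
    near j i with nb-sym j w
    ... | false , e = ∈-++⁺ʳ B (∈-++⁺ˡ (subst (_∈ map (nb false) B) e (∈-map⁺ (nb false) i)))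
    ... | true , e = ∈-++⁺ʳ B (∈-++⁺ʳ (map (nb false) B) (subst (_∈ map (nb true) B) e (∈-map⁺ (nb true) i)))

  record Result (Cl P : Fin n → Set) (B₀ : List (Fin n)) (D₁ m β : ℕ) : Set where
    field
      Xb   : List (Fin n)
      lXb  : length Xb ≤ β
      good : ∀ X → Unique X → (∀ v → v ∈ X → Cl v × v ∉ Xb) → length X ≤ m → ∀ Y → Cov Adj X (AB P (B₀ ++ Xb)) Y → D₁ * length X ≤ length Y

  module _ (Cl P : Fin n → Set) (B₀ : List (Fin n)) (D₁ m β : ℕ) (β≤m : β ≤ m)
    (small : ∀ X → Unique X → (∀ v → v ∈ X → Cl v) → length X ≤ 2 * m → ∀ Y → Cov Adj X (AB P (B₀ ++ X)) Y →
       length Y ≤ D₁ * length X → length X ≤ β) where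

    Bad : ℕ → Set
    Bad k = Σ (List (Fin n)) λ X → Unique X × (∀ v → v ∈ X → Cl v) × (length X ≡ k) × (length X ≤ 2 * m) ×
      Σ (List (Fin n)) λ Y → Cov Adj X (AB P (B₀ ++ X)) Y × length Y ≤ D₁ * length X

    core : DN (Result Cl P B₀ D₁ m β)
    core = maxWit Bad β (λ { k (X , u , cl , refl , l , Y , c , le) → small X u cl l Y c le }) 0
        ([] , [] , (λ _ ()) , refl , z≤n , [] , (λ _ _ ()) , z≤n) >>=
      λ { (k , (Xb , ub , clb , refl , lb , Yb , cb , leb) , mx) → return record
        { Xb = Xb ; lXb = small Xb ub clb lb Yb cb leb
        ; good = λ X u cl l Y c → ≮⇒≥ λ lt → contra Xb ub clb lb Yb cb leb mx X u cl l Y c lt } }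
      where
      contra : ∀ Xb → Unique Xb → (∀ v → v ∈ Xb → Cl v) → length Xb ≤ 2 * m → ∀ Yb → Cov Adj Xb (AB P (B₀ ++ Xb)) Yb →
        length Yb ≤ D₁ * length Xb → (∀ j → Bad j → j ≤ length Xb) →
        ∀ X → Unique X → (∀ v → v ∈ X → Cl v × v ∉ Xb) → length X ≤ m → ∀ Y → Cov Adj X (AB P (B₀ ++ Xb)) Y → length Y < D₁ * length X → ⊥
      contra Xb ub clb lb Yb cb leb mx X@[] u cl l Y c lt = n≮0 (≤-trans lt (≤-reflexive (*-zeroʳ D₁)))
      contra Xb ub clb lb Yb cb leb mx X@(x ∷ xs) u cl l Y c lt = <⇒≱ (m<m+n (length Xb) {length X} (s≤s z≤n))
        (subst (_≤ length Xb) (length-++ Xb) (mx (length X₂)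
         (X₂ , uniq-++ ub u (λ a b → proj₂ (cl _ b) a)
         , (λ v i → case ∈-++⁻ Xb i of λ { (inj₁ a) → clb v a ; (inj₂ b) → proj₁ (cl v b) })
         , refl , ≤-trans (≤-reflexive (length-++ Xb)) (≤-trans (+-mono-≤ (≤-trans (small Xb ub clb lb Yb cb leb) β≤m) l) (≤-reflexive (cong (m +_) (sym (+-identityʳ m)))))
         , Yb ++ Y
         , (λ v w i a ab → case ∈-++⁻ Xb i of λ { (inj₁ b) → ∈-++⁺ˡ (cb v w b a (shrink ab)) ; (inj₂ b) → ∈-++⁺ʳ Yb (c v w b a (shrink ab)) })
         , ≤-trans (≤-reflexive (length-++ Yb)) (≤-trans (+-mono-≤ leb (<⇒≤ lt))
             (≤-reflexive (trans (sym (*-distribˡ-+ D₁ (length Xb) (length X))) (cong (D₁ *_) (sym (length-++ Xb)))))))))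
        where
        X₂ = Xb ++ X
        up∈ : ∀ {v} → v ∈ B₀ ++ Xb → v ∈ B₀ ++ X₂
        up∈ i = case ∈-++⁻ B₀ i of λ { (inj₁ a) → ∈-++⁺ˡ a ; (inj₂ b) → ∈-++⁺ʳ B₀ (∈-++⁺ˡ b) }
        shrink : ∀ {w} → AB P (B₀ ++ X₂) w → AB P (B₀ ++ Xb) w
        shrink (a , b , c) = a , (λ i → b (up∈ i)) , λ j i → c j (up∈ i)


-- Bounding the bad list by joinedness or by expansion

blow-length : ∀ {n} {Adj} (nb : Bool → Fin n → Fin n) nb-sym B → length (Core.blow Adj nb nb-sym B) ≡ 3 * length B
blow-length nb _ B = thrice {B = ⊤} B (nb false) (nb true)

module Expand {n : ℕ} (Adj : Fin n → Fin n → Set) (m : ℕ)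
  (joined : ∀ X Y → Unique X → Unique Y → (∀ v → v ∈ X → v ∉ Y) → m ≤ length X → m ≤ length Y →
    Σ (Fin n) λ u → Σ (Fin n) λ v → u ∈ X × v ∈ Y × Adj u v) where

  -- What remains of `PL` outside `X` and its neighbourhood receives no edge from `X`, so it has
  -- fewer than `m` vertices.
  joinCov : ∀ {P : Fin n → Set} X PL Y → Unique X → Unique PL → (∀ v → v ∈ PL → P v) → m ≤ length X → Cov Adj X P Y →
    length PL < length Y + length X + m
  joinCov {P} X PL Y uX uP allP mX c = ≤-<-trans (SV.outs≥ parts uP)
      (subst (λ k → k + length outs < length Y + length X + m) (sym (length-++ Y)) (+-monoʳ-< (length Y + length X) (≰⇒> no-m)))
    where
    parts = SV.split PL (Y ++ X)
    open SV.Parts parts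
    no-m : ¬ m ≤ length outs
    no-m le with joined X outs uX (uouts uP) (λ v i j → outs∉ j (∈-++⁺ʳ Y i)) mX le
    ... | u , w , u∈ , w∈ , a = outs∉ w∈ (∈-++⁺ˡ (c u w u∈ a (allP w (outs⊑ w∈))))

  module _ (nb : Bool → Fin n → Fin n) (nb-sym : ∀ j w → Σ Bool λ i → nb i (nb j w) ≡ w) where
    open Core Adj nb nb-sym

    cov-AB-length : ∀ Y B → length (Y ++ blow B) ≡ length Y + 3 * length B
    cov-AB-length Y B = trans (length-++ Y) (cong (length Y +_) (blow-length {Adj = Adj} nb nb-sym B))

    core-join : ∀ (Cl P : Fin n → Set) PL B₀ D₁ M → Unique PL → (∀ v → v ∈ PL → P v) → m ≤ M →
      D₁ * (2 * M) + 3 * (length B₀ + 2 * M) + 2 * M + m ≤ length PL → DN (Result Cl P B₀ D₁ M m)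
    core-join Cl P PL B₀ D₁ M uP allP mM big = core Cl P B₀ D₁ M m mM small'
      where
      small' : _
      small' X u cl l Y c le = ≮⇒≥ λ lt → <⇒≱ (joinCov X PL (Y ++ blow (B₀ ++ X)) u uP allP (<⇒≤ lt) (cov-AB c))
        (≤-trans (+-monoˡ-≤ m (+-mono-≤ (≤-trans (≤-reflexive (trans (cov-AB-length Y (B₀ ++ X)) (cong (λ k → length Y + 3 * k) (length-++ B₀))))
            (+-mono-≤ (≤-trans le (*-monoʳ-≤ D₁ l)) (*-monoʳ-≤ 3 (+-monoʳ-≤ (length B₀) l)))) l)) big)

    -- A forbidden vertex spoils itself and its two matched neighbours, which costs a set `X` at
    -- most 3(|B₀| + |X|) targets. From expansion D₁ + 4 this leaves D₁|X| + |X| - 3|B₀|, so only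
    -- sets with |X| ≤ 3|B₀| can be bad. Unlike `core-join`, the bound is proportional to `B₀` and
    -- not to `m`, so a starting point outside the bad list can be found among rather few free
    -- ports.
    core-prop : ∀ (Cl P : Fin n → Set) B₀ D₁ M → 3 * length B₀ ≤ M →
      (∀ X → Unique X → (∀ v → v ∈ X → Cl v) → length X ≤ 2 * M → ∀ Y → Cov Adj X P Y → (D₁ + 4) * length X ≤ length Y) →
      DN (Result Cl P B₀ D₁ M (3 * length B₀))
    core-prop Cl P B₀ D₁ M le₀ ex = core Cl P B₀ D₁ M (3 * length B₀) le₀ small'
      where
      arith : ∀ D a b → (D + 4) * a ≤ D * a + 3 * (b + a) → a ≤ 3 * b
      arith D a b h = +-cancelʳ-≤ (D * a + 3 * a) a (3 * b) (≤-trans (≤-reflexive (e₁ D a)) (≤-trans h (≤-reflexive (e₂ D a b))))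
        where
        e₁ : ∀ D a → a + (D * a + 3 * a) ≡ (D + 4) * a
        e₁ = solve-∀
        e₂ : ∀ D a b → D * a + 3 * (b + a) ≡ 3 * b + (D * a + 3 * a)
        e₂ = solve-∀
      small' : _
      small' X u cl l Y c le = arith D₁ (length X) (length B₀) (≤-trans (ex X u cl l (Y ++ blow (B₀ ++ X)) (cov-AB c))
        (≤-trans (≤-reflexive (trans (cov-AB-length Y (B₀ ++ X)) (cong (λ k → length Y + 3 * k) (length-++ B₀)))) (+-monoˡ-≤ _ le)))

-- Rotations of a maximum matching without forbidden cycles

module MaxRot {n : ℕ} (Adj : Fin n → Fin n → Set) (Adj-sym : ∀ {u v} → Adj u v → Adj v u) (irr : ∀ {v} → ¬ Adj v v)
  (R : Fin n → Set) (Lim : ℕ → Set) where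

  CoverFree : M n → List (Port n) → Set
  CoverFree μ F = ∀ z → R (vt z) → μ z ≡ z → z ∈ F

  Minimal : ℕ → Set
  Minimal k = ∀ μ F → PM Adj R μ → NSC Lim μ → CoverFree μ F → k ≤ length F

  record Ok (F₀ : List (Port n)) (μ : M n) (p : Port n) : Set where
    field
      pm    : PM Adj R μ
      nsc   : NSC Lim μ
      fp    : μ p ≡ p
      Rp    : R (vt p)
      cover : ∀ z → R (vt z) → μ z ≡ z → z ≡ p ⊎ z ∈ F₀
    open PM pm public

  -- If one port of `w` is free, the rotation uses the other one, as no walk leads from a free port
  -- to `p`. If both are matched, `hit-one` supplies a port for which no cycle is closed.
  rstep : ∀ {F₀} → Minimal (suc (length F₀)) → ∀ μ p w → Ok F₀ μ p → R w → Adj (vt p) w →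
    DN (Σ Bool λ j → (μ (w , j) ≢ (w , j)) × (p ≢ (w , j)) × Ok F₀ (rot μ p (w , j)) (μ (w , j)))
  rstep {F₀} minl μ p w ok Rw a = decide (μ (w , false) ≟P (w , false)) (μ (w , true) ≟P (w , true))
    where
    open Ok ok
    ne : ∀ {j} → p ≢ (w , j)
    ne refl = irr a
    fin : ∀ j → μ (w , j) ≢ (w , j) → ¬ Hit μ p (sw (w , j)) →
      Σ Bool λ j → (μ (w , j) ≢ (w , j)) × (p ≢ (w , j)) × Ok F₀ (rot μ p (w , j)) (μ (w , j))
    fin j nf nh = j , nf , ne , record
      { pm = rotPM Adj-sym p q pm fp ne a Rp Rw ; nsc = rotNSC p q inv fp ne nh nsc
      ; fp = rot-r μ p q (μq≢p μ p q inv fp ne) nf ; Rp = PM.domμ pm q nf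
      ; cover = λ z Rz e → case rot-free μ p q inv fp ne z e of λ
          { (_ , inj₁ e') → inj₁ e' ; (np , inj₂ e') → case cover z Rz e' of λ
            { (inj₁ e'') → contradiction e'' np ; (inj₂ i) → inj₂ i } } }
      where q = (w , j)
    decide : Dec (μ (w , false) ≡ (w , false)) → Dec (μ (w , true) ≡ (w , true)) →
      DN (Σ Bool λ j → (μ (w , j) ≢ (w , j)) × (p ≢ (w , j)) × Ok F₀ (rot μ p (w , j)) (μ (w , j)))
    decide (yes f) (no nf) = return (fin true nf (hit-free f ne))
    decide (no nf) (yes f) = return (fin false nf (hit-free f ne))
    decide (no nf₀) (no nf₁) = lem (Hit μ p (w , false)) >>= λ where
      (inj₁ h) → return (fin false nf₀ λ h' → hit-one inv p (w , false) (h , h'))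
      (inj₂ nh) → return (fin true nf₁ nh)
    -- Here `w` is isolated, and joining it to `p` would remove two free ports without closing a
    -- cycle, against minimality.
    decide (yes f₀) (yes f₁) with cover (w , false) Rw f₀
    ... | inj₁ e = contradiction (sym e) ne
    ... | inj₂ i with remove i
    ... | F' , l , keep , _ = ⊥-elim (<⇒≱ (≤-trans (n<1+n (length F')) (≤-trans (≤-reflexive (sym l)) (n≤1+n _)))
      (minl (rot μ p q) F' (rotPM Adj-sym p q pm fp ne a Rp Rw) (rotNSC p q inv fp ne (hit-free f₁ ne) nsc)
        λ z Rz e → let (np , c) = rot-free μ p q inv fp ne z e
                       nq : z ≢ q
                       nq e' = ne (trans (sym (rot-q μ p q)) (trans (cong (rot μ p q) (sym e')) (trans e e')))
                   in case cover z Rz (case c of λ { (inj₁ e') → ⊥-elim (nq (trans e' f₀)) ; (inj₂ e') → e' }) of λ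
                      { (inj₁ e') → contradiction e' np ; (inj₂ k) → keep k nq }))
      where q = (w , false)


-- Distance along a matching, and superposition of two distant modifications

module Near {n : ℕ} (μ₀ : M n) (inv₀ : Inv μ₀) where

  walkL : ℕ → Port n → List (Fin n)
  walkL zero p = vt p ∷ []
  walkL (suc k) p = vt p ∷ walkL k (nx μ₀ p)

  walkL-length : ∀ k p → length (walkL k p) ≡ suc k
  walkL-length zero p = refl
  walkL-length (suc k) p = cong suc (walkL-length k (nx μ₀ p))

  ∈-walkL : ∀ {k i} p → i ≤ k → vt (it μ₀ i p) ∈ walkL k p
  ∈-walkL {zero} p z≤n = here refl
  ∈-walkL {suc k} p z≤n = here refl
  ∈-walkL {suc k} p (s≤s le) = there (∈-walkL (nx μ₀ p) le)

  ball : ℕ → List (Fin n) → List (Fin n)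
  ball g [] = []
  ball g (x ∷ xs) = walkL g (x , false) ++ walkL g (x , true) ++ ball g xs

  ball-length : ∀ g xs → length (ball g xs) ≡ 2 * suc g * length xs
  ball-length g [] = sym (*-zeroʳ (2 * suc g))
  ball-length g (x ∷ xs) = trans (length-++ (walkL g (x , false))) (trans (cong₂ _+_ (walkL-length g _)
    (trans (length-++ (walkL g (x , true))) (cong₂ _+_ (walkL-length g _) (ball-length g xs)))) (e (suc g) (length xs)))
    where e : ∀ a b → a + (a + 2 * a * b) ≡ 2 * a * suc b
          e = solve-∀

  Nr : ℕ → Fin n → Fin n → Set
  Nr g x y = Σ Bool λ b → Σ ℕ λ i → i ≤ g × (vt (it μ₀ i (x , b)) ≡ y)

  ∈-ball : ∀ {g x y xs} → x ∈ xs → Nr g x y → y ∈ ball g xs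
  ∈-ball {g} {x} (here refl) (false , i , le , refl) = ∈-++⁺ˡ (∈-walkL (x , false) le)
  ∈-ball {g} {x} (here refl) (true , i , le , refl) = ∈-++⁺ʳ (walkL g (x , false)) (∈-++⁺ˡ (∈-walkL (x , true) le))
  ∈-ball {g} {xs = x' ∷ xs} (there k) nr = ∈-++⁺ʳ (walkL g (x' , false)) (∈-++⁺ʳ (walkL g (x' , true)) (∈-ball k nr))

  nr-refl : ∀ {g x} → Nr g x x
  nr-refl = true , 0 , z≤n , refl

  nr-mono : ∀ {g h x y} → g ≤ h → Nr g x y → Nr h x y
  nr-mono le (b , i , l , e) = b , i , ≤-trans l le , e

  nr-port : ∀ {g} a i → i ≤ g → Nr g (vt a) (vt (it μ₀ i a))
  nr-port (x , b) i le = b , i , le , refl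

  nr-sym : ∀ {g x y} → Nr g x y → Nr g y x
  nr-sym {g} {x} (b , i , le , refl) = subst (Nr g (vt z)) e (nr-port (sw z) i le)
    where
    z = it μ₀ i (x , b)
    e : vt (it μ₀ i (sw z)) ≡ x
    e = cong vt (trans (cong (λ k → it μ₀ i (sw (it μ₀ k (x , b)))) (sym (+-identityʳ i))) (it-back inv₀ i 0 (x , b)))

  walk-index : ∀ {j a} p → a ∈ walkL j p → Σ ℕ λ i → i ≤ j × (vt (it μ₀ i p) ≡ a)
  walk-index {zero} p (here e) = 0 , z≤n , sym e
  walk-index {suc j} p (here e) = 0 , z≤n , sym e
  walk-index {suc j} p (there i) = let (l , le , e) = walk-index (nx μ₀ p) i in suc l , s≤s le , e

  walk-nr : ∀ {j a} p → a ∈ walkL j p → Nr j (vt p) a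
  walk-nr {j} {a} p i = let (l , le , e) = walk-index p i in subst (Nr j (vt p)) e (nr-port p l le)

  nr-step : ∀ {g x} z → Nr g x (vt z) → Nr (suc g) x (vt (μ₀ z))
  nr-step {g} {x} z (b , i , le , e) with same-vt {p = z} {q = it μ₀ i (x , b)} (sym e)
  ... | inj₁ refl = b , suc i , s≤s le , cong vt (it-suc μ₀ i (x , b))
  nr-step {g} {x} z (b , zero , le , e) | inj₂ refl = not b , 1 , s≤s z≤n , refl
  nr-step {g} {x} z (b , suc i , le , e) | inj₂ refl = b , i , ≤-trans (n≤1+n i) (≤-trans le (n≤1+n g))
    , cong vt (trans (sym (inv₀ _)) (cong μ₀ (trans (sym (sw-sw _)) (cong sw (sym (it-suc μ₀ i (x , b)))))))

  NrL : ℕ → List (Fin n) → Fin n → Set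
  NrL g E y = Σ (Fin n) λ x → x ∈ E × Nr g x y

  -- A step of the changed matching is either a step of `μ₀`, which increases the distance by at
  -- most one, or it lands on a changed vertex, which is in `E` itself. Hence walks in the changed
  -- matching also move away from `E` at unit speed.
  nrL-step : ∀ {ν E j} → Inv ν → (∀ z → ν z ≢ μ₀ z → vt z ∈ E) → ∀ z → NrL j E (vt z) → NrL (suc j) E (vt (ν z))
  nrL-step {ν} {E} {j} invν chg z (x , x∈ , nr) with ν z ≟P μ₀ z
  ... | yes e = x , x∈ , subst (λ y → Nr (suc j) x (vt y)) (sym e) (nr-step z nr)
  ... | no ne = vt (ν z) , chg (ν z) (λ e → ne (trans (sym (inv₀ (ν z))) (cong μ₀ (trans (sym e) (invν z))))) , nr-refl

  Far : ℕ → List (Fin n) → List (Fin n) → Set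
  Far g E₁ E₂ = ∀ x y → x ∈ E₁ → y ∈ E₂ → ¬ Nr g x y

  module Combine (g : ℕ) (g≥1 : 1 ≤ g) (μ₁ μ₂ : M n) (inv₁ : Inv μ₁) (inv₂ : Inv μ₂) (E₁ E₂ : List (Fin n))
    (chg₁ : ∀ z → μ₁ z ≢ μ₀ z → vt z ∈ E₁) (chg₂ : ∀ z → μ₂ z ≢ μ₀ z → vt z ∈ E₂) (far : Far g E₁ E₂) where

    μ₁₂ : M n
    μ₁₂ z with SV._∈?_ (vt z) E₁
    ... | yes _ = μ₁ z
    ... | no _ = μ₂ z

    same₁ : ∀ z → vt z ∉ E₁ → μ₁ z ≡ μ₀ z
    same₁ z h with μ₁ z ≟P μ₀ z
    ... | yes e = e
    ... | no ne = ⊥-elim (h (chg₁ z ne))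

    same₂ : ∀ z → vt z ∉ E₂ → μ₂ z ≡ μ₀ z
    same₂ z h with μ₂ z ≟P μ₀ z
    ... | yes e = e
    ... | no ne = ⊥-elim (h (chg₂ z ne))

    at₂ : ∀ z → vt z ∉ E₁ → μ₁₂ z ≡ μ₂ z
    at₂ z h with SV._∈?_ (vt z) E₁
    ... | yes i = ⊥-elim (h i)
    ... | no _ = refl

    at₁ : ∀ z → vt z ∉ E₂ → μ₁₂ z ≡ μ₁ z
    at₁ z h with SV._∈?_ (vt z) E₁
    ... | yes _ = refl
    ... | no k = trans (same₂ z h) (sym (same₁ z k))

    disj : ∀ {x} → x ∈ E₁ → x ∉ E₂
    disj i j = far _ _ i j nr-refl

    apart : ∀ z → vt z ∈ E₁ → vt (μ₀ z) ∉ E₂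
    apart z i j = far _ _ i j (nr-mono g≥1 (nr-port z 1 ≤-refl))

    side : ∀ z → (vt z ∈ E₁ × vt z ∉ E₂) ⊎ (vt z ∉ E₁)
    side z with SV._∈?_ (vt z) E₁
    ... | yes i = inj₁ (i , disj i)
    ... | no k = inj₂ k

    inv₁₂ : Inv μ₁₂
    inv₁₂ z with side z
    ... | inj₁ (i , ni) = trans (cong μ₁₂ (at₁ z ni)) (trans (at₁ (μ₁ z) out) (inv₁ z))
      where
      out : vt (μ₁ z) ∉ E₂
      out j = apart z i (subst (λ y → vt y ∈ E₂) e j)
        where e : μ₁ z ≡ μ₀ z
              e = sym (trans (cong μ₀ (trans (sym (inv₁ z)) (same₁ (μ₁ z) λ k → disj k j))) (inv₀ (μ₁ z)))
    ... | inj₂ ni with side (μ₂ z)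
    ... | inj₂ k = trans (cong μ₁₂ (at₂ z ni)) (trans (at₂ (μ₂ z) k) (inv₂ z))
    ... | inj₁ (k , nk) = trans (cong μ₁₂ (at₂ z ni)) (trans (at₁ (μ₂ z) nk) (trans (cong μ₁ e₁) (inv₁ z)))
      where
      e : μ₀ (μ₂ z) ≡ z
      e = trans (sym (same₂ (μ₂ z) nk)) (inv₂ z)
      e₁ : μ₂ z ≡ μ₁ z
      e₁ = trans (sym (trans (cong μ₀ (sym e)) (inv₀ (μ₂ z)))) (sym (same₁ z ni))

    -- A short cycle that meets `E₁` stays within distance `g` of it, hence off `E₂`, and is a cycle
    -- of `μ₁`; a cycle that avoids `E₁` is one of `μ₂`.
    one-side : ∀ {Lim : ℕ → Set} → (∀ k → Lim k → suc k < g) → NSC Lim μ₁ → NSC Lim μ₂ → NSC Lim μ₁₂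
    one-side {Lim} lim N₁ N₂ P k L C = lem (Σ ℕ λ i → vt (it μ₁₂ i P) ∈ E₁) λ where
        (inj₁ (i , h)) → go (it μ₁₂ i P) h (cyc-shift μ₁₂ {k = k} i C)
        (inj₂ none) → N₂ P k L (transfer μ₂ P (λ i → at₂ _ λ h → none (i , h)) C)
      where
      transfer : ∀ ν P → (∀ i → μ₁₂ (it μ₁₂ i P) ≡ ν (it μ₁₂ i P)) → Cyc μ₁₂ P k → Cyc ν P k
      transfer ν P s (e , f) = trans (sym (it= (suc k))) e , λ i h → f i (trans (s i) (trans (cong ν (it= i)) (trans h (sym (it= i)))))
        where
        it= : ∀ i → it μ₁₂ i P ≡ it ν i P
        it= zero = refl
        it= (suc i) = trans (it-suc μ₁₂ i P) (trans (cong sw (trans (s i) (cong ν (it= i)))) (sym (it-suc ν i P)))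
      go : ∀ P → vt P ∈ E₁ → Cyc μ₁₂ P k → ⊥
      go P h C = N₁ P k L (transfer μ₁ P all C)
        where
        nr : ∀ i → i ≤ suc k → NrL i E₁ (vt (it μ₁₂ i P))
        out : ∀ i → i ≤ suc k → vt (it μ₁₂ i P) ∉ E₂
        out i le j = let (x , x∈ , r) = nr i le in far _ _ x∈ j (nr-mono (≤-trans le (<⇒≤ (lim k L))) r)
        nr zero le = vt P , h , nr-refl
        nr (suc i) le = subst (NrL (suc i) E₁) (trans (cong vt (sym (at₁ _ (out i (<⇒≤ le))))) (cong vt (sym (it-suc μ₁₂ i P))))
          (nrL-step inv₁ chg₁ (it μ₁₂ i P) (nr i (<⇒≤ le)))
        -- The distance estimate covers a single period only; later positions are reduced to it.
        mod : ∀ i → Σ ℕ λ j → j ≤ k × (it μ₁₂ i P ≡ it μ₁₂ j P)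
        mod zero = 0 , z≤n , refl
        mod (suc i) with mod i
        ... | j , le , e with m≤n⇒m<n∨m≡n le
        ... | inj₁ lt = suc j , lt , trans (it-suc μ₁₂ i P) (trans (cong (nx μ₁₂) e) (sym (it-suc μ₁₂ j P)))
        ... | inj₂ refl = 0 , z≤n , trans (it-suc μ₁₂ i P) (trans (cong (nx μ₁₂) e) (trans (sym (it-suc μ₁₂ j P)) (proj₁ C)))
        all : ∀ i → μ₁₂ (it μ₁₂ i P) ≡ μ₁ (it μ₁₂ i P)
        all i = let (j , le , e) = mod i in at₁ _ (subst (λ y → vt y ∉ E₂) (sym e) (out j (≤-trans le (n≤1+n k))))

    -- A short cycle through the new edge would contain a short walk from `q` in `E₂` to `p` in
    -- `E₁`, but such a walk cannot leave the neighbourhood of `E₂`.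
    join-nsc : ∀ {Lim : ℕ → Set} p q → (∀ k → Lim k → suc k < g) → NSC Lim μ₁ → NSC Lim μ₂ →
      vt p ∈ E₁ → vt q ∈ E₂ → μ₁₂ p ≡ p → NSC Lim (rot μ₁₂ p q)
    join-nsc {Lim} p q lim N₁ N₂ p∈ q∈ fp = rotNSC≤ p q inv₁₂ fp (λ { refl → disj p∈ q∈ }) nh (one-side lim N₁ N₂)
      where
      nh : ∀ k → Lim k → (h : Hit μ₁₂ p (sw q)) → ¬ proj₁ h ≤ k
      nh k L (i , e , _) le = out i ≤-refl (subst (λ y → vt y ∈ E₁) (sym e) p∈)
        where
        nr : ∀ j → j ≤ i → NrL j E₂ (vt (it μ₁₂ j (sw q)))
        out : ∀ j → j ≤ i → vt (it μ₁₂ j (sw q)) ∉ E₁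
        out j j≤ h = let (x , x∈ , r) = nr j j≤ in
          far _ _ h x∈ (nr-mono (≤-trans j≤ (≤-trans le (≤-trans (n≤1+n k) (<⇒≤ (lim k L))))) (nr-sym r))
        nr zero _ = vt q , q∈ , nr-refl
        nr (suc j) j< = subst (NrL (suc j) E₂) (trans (cong vt (sym (at₂ _ (out j (<⇒≤ j<))))) (cong vt (sym (it-suc μ₁₂ j (sw q)))))
          (nrL-step inv₂ chg₂ (it μ₁₂ j (sw q)) (nr j (<⇒≤ j<)))

-- A vertex set of prescribed size with at most two boundary edges of the matching

module Half {n : ℕ} {E : Fin n → Fin n → Set} {R : Fin n → Set} (μ : M n) (pm : PM E R μ)
  (RL : List (Fin n)) (uRL : Unique RL) (inRL : ∀ v → R v → v ∈ RL) where
  open PM pm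

  record Arc (h : ℕ) : Set where
    field
      H   : List (Fin n)
      uH  : Unique H
      H⊑  : ∀ v → v ∈ H → v ∈ RL
      lH  : length H ≡ h
      ∂   : List (Port n)
      l∂  : length ∂ ≤ 2
      bd  : ∀ z → vt z ∈ H → vt (μ z) ∉ H → z ∈ ∂

  -- The set is grown one vertex at a time. If an edge leaves it, the far end is added and the
  -- boundary port moves on along the path; if none does, any new vertex opens a fresh component
  -- with its two ports as the whole boundary.
  arc : ∀ h → h ≤ length RL → DN (Arc h)
  arc zero _ = return record { H = [] ; uH = [] ; H⊑ = λ _ () ; lH = refl ; ∂ = [] ; l∂ = z≤n ; bd = λ _ () }
  arc (suc h) le = arc h (<⇒≤ le) >>= λ A → lem (Σ (Port n) λ z → vt z ∈ Arc.H A × vt (μ z) ∉ Arc.H A) >>= extend A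
    where
    extend : (A : Arc h) → (Σ (Port n) λ z → vt z ∈ Arc.H A × vt (μ z) ∉ Arc.H A) ⊎ ¬ (Σ (Port n) λ z → vt z ∈ Arc.H A × vt (μ z) ∉ Arc.H A) → DN (Arc (suc h))
    extend A (inj₁ (z , z∈ , nz)) with remove (Arc.bd A z z∈ nz)
    ... | ∂' , l , keep , _ = return record
        { H = vt (μ z) ∷ H ; uH = uniq-∷ nz uH
        ; H⊑ = λ { _ (here refl) → inRL _ (domμ z λ e → nz (subst (λ y → vt y ∈ H) (sym e) z∈)) ; v (there i) → H⊑ v i }
        ; lH = cong suc lH ; ∂ = sw (μ z) ∷ ∂' ; l∂ = ≤-trans (≤-reflexive (sym l)) l∂ ; bd = bd' }
      where
      open Arc A
      bd' : ∀ y → vt y ∈ vt (μ z) ∷ H → vt (μ y) ∉ vt (μ z) ∷ H → y ∈ sw (μ z) ∷ ∂'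
      bd' y (there i) ny = there (keep (bd y i (λ j → ny (there j))) λ { refl → ny (here refl) })
      bd' y (here e) ny with same-vt {p = y} {q = μ z} e
      ... | inj₁ refl = ⊥-elim (ny (there (subst (λ x → vt x ∈ H) (sym (inv z)) z∈)))
      ... | inj₂ e' = here e'
    extend A (inj₂ none) = return (add (SV.avoid uRL (subst (_< length RL) (sym (Arc.lH A)) le)))
      where
      open Arc A
      add : Σ (Fin n) (λ v → v ∈ RL × v ∉ H) → Arc (suc h)
      add (v , v∈ , nv) = record
        { H = v ∷ H ; uH = uniq-∷ nv uH ; H⊑ = λ { _ (here refl) → v∈ ; w (there i) → H⊑ w i }
        ; lH = cong suc lH ; ∂ = (v , true) ∷ (v , false) ∷ [] ; l∂ = s≤s (s≤s z≤n) ; bd = bd' }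
        where
        bd' : ∀ y → vt y ∈ v ∷ H → vt (μ y) ∉ v ∷ H → y ∈ (v , true) ∷ (v , false) ∷ []
        bd' y (there i) ny = ⊥-elim (none (y , i , λ j → ny (there j)))
        bd' (_ , true) (here refl) ny = here refl
        bd' (_ , false) (here refl) ny = there (here refl)

  crossing : ∀ {h} (A : Arc h) i a → vt a ∈ Arc.H A → vt (it μ i a) ∉ Arc.H A → Σ ℕ λ j → j ≤ i × it μ j a ∈ Arc.∂ A
  crossing A zero a a∈ ni = ⊥-elim (ni a∈)
  crossing A (suc i) a a∈ ni with SV._∈?_ (vt (nx μ a)) (Arc.H A)
  ... | yes k = let (j , le , b) = crossing A i (nx μ a) k ni in suc j , s≤s le , b
  ... | no k = 0 , z≤n , Arc.bd A a a∈ k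


-- A maximum matching without short cycles has few free ports

record Territory (n : ℕ) : Set₁ where
  field
    Adj     : Fin n → Fin n → Set
    Adj-sym : ∀ {u v} → Adj u v → Adj v u
    irr     : ∀ {v} → ¬ Adj v v
    m       : ℕ
    joined  : ∀ X Y → Unique X → Unique Y → (∀ v → v ∈ X → v ∉ Y) → m ≤ length X → m ≤ length Y →
      Σ (Fin n) λ u → Σ (Fin n) λ v → u ∈ X × v ∈ Y × Adj u v
    R       : Fin n → Set
    RL      : List (Fin n)
    uRL     : Unique RL
    inRL    : ∀ v → R v → v ∈ RL
    RLin    : ∀ v → v ∈ RL → R v
    exR     : ∀ X → Unique X → (∀ v → v ∈ X → R v) → length X ≤ 8 * m → ∀ Y → Cov Adj X R Y → 25 * length X ≤ length Y
    bigR    : 2 * (222 * m) ≤ length RL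
    d       : ℕ
    m≤2^d   : m ≤ 2 ^ d
    2^d≤2m  : 2 ^ d ≤ 2 * m
    2^i≤m   : ∀ i → i < d → 2 ^ i ≤ m
    g       : ℕ
    g≥1     : 1 ≤ g

module FewFree {n : ℕ} (S : Territory n) where
  open Territory S

  Lim : ℕ → Set
  Lim k = suc k < g

  open MaxRot Adj Adj-sym irr R Lim
  open Expand Adj m joined

  -- Bound for the number of vertices within walking distance `g`, in both directions, of a trace of
  -- 2d + 3 vertices.
  N₁ : ℕ
  N₁ = 2 * suc g * (2 * d + 3)

  module At (μ₀ : M n) (pm₀ : PM Adj R μ₀) (nsc₀ : NSC Lim μ₀) (Q : ℕ) (Q>N : 4 * N₁ < Q) (m-big : 3 * (Q * N₁ + 4 * suc g) ≤ m) where
    open PM pm₀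
    open Near μ₀ inv
    open Half μ₀ pm₀ RL uRL inRL using (Arc; arc; crossing)

    nb : Bool → Fin n → Fin n
    nb b x = vt (μ₀ (x , b))

    nb-sym : ∀ j w → Σ Bool λ i → nb i (nb j w) ≡ w
    nb-sym j w = proj₂ (μ₀ (w , j)) , cong vt (inv (w , j))

    open Core Adj nb nb-sym

    R-nb : ∀ w j → R w → R (nb j w)
    R-nb w j Rw with μ₀ (w , j) ≟P (w , j)
    ... | yes e = subst R (cong vt (sym e)) Rw
    ... | no ne = domμ (w , j) ne

    record Side (B∂ : List (Fin n)) (Sd : Fin n → Set) : Set where
      field
        sdnb : ∀ w j → Sd w → w ∉ B∂ → nb j w ∉ B∂ → Sd (nb j w)
        PL   : List (Fin n)
        uPL  : Unique PL
        inPL : ∀ v → v ∈ PL → R v × Sd v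
        lPL  : 222 * m ≤ length PL

    -- By `sub` every trace lies, but for its last pivot and its last end, in the common list `BB`.
    -- One expansion statement relative to `BB` therefore serves all candidates, before it is known
    -- which of them will be used.
    record C1 (W BB : List (Fin n)) (F₀ : List (Port n)) (s v : Fin n) : Set where
      field
        w    : Fin n
        μ    : M n
        p    : Port n
        τ    : List (Fin n)
        end  : vt p ≡ v
        ok   : Ok F₀ μ p
        chg  : ∀ z → μ z ≢ μ₀ z → vt z ∈ τ
        offW : ∀ u → u ∈ τ → u ∉ W
        len  : length τ ≤ 2 * d + 3
        strt : s ∈ τ
        tail : v ∈ τ
        sub  : ∀ u → u ∈ τ → u ∈ v ∷ w ∷ [] ⊎ u ∈ BB
        v∉   : v ∉ BB

    record P1 (B∂ W : List (Fin n)) (Sd : Fin n → Set) (F₀ : List (Port n)) (s : Fin n) : Set where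
      field
        BB XB  : List (Fin n)
        XB⊑    : ∀ v → v ∈ XB → v ∈ BB
        B∂⊑    : ∀ v → v ∈ B∂ → v ∈ BB
        W⊑     : ∀ v → v ∈ W → v ∈ BB
        good   : ∀ X → Unique X → (∀ v → v ∈ X → R v × v ∉ XB) → length X ≤ 4 * m → ∀ Y →
                   Cov Adj X (AB (λ v → R v × Sd v) BB) Y → 22 * length X ≤ length Y
        cands  : List (Fin n)
        ucands : Unique cands
        lcands : m ≤ length cands
        cand   : ∀ v → v ∈ cands → C1 W BB F₀ s v

    small-prop : ∀ W → 3 * length W ≤ 4 * m → DN (Result R R W 21 (4 * m) (3 * length W))
    small-prop W le = core-prop nb nb-sym R R W 21 (4 * m) le λ X u cl l Y c → exR X u cl (≤-trans l (≤-reflexive (e m))) Y c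
      where e : ∀ m → 2 * (4 * m) ≡ 8 * m
            e = solve-∀

    -- From an arbitrary free port nothing guarantees neighbours on the prescribed side, so these
    -- rotations may pivot anywhere outside `W`. Their aim is only to reach at least `m` endpoints
    -- outside `BB`, from which rotations confined to the side can continue.
    phase1 : ∀ B∂ W Sd F₀ → Side B∂ Sd → 3 * (length B∂ + length W) ≤ m →
      (res : Result R R W 21 (4 * m) (3 * length W)) → Minimal (suc (length F₀)) →
      ∀ p → Ok F₀ μ₀ p → vt p ∉ W ++ Result.Xb res → DN (P1 B∂ W Sd F₀ (vt p))
    phase1 B∂ W Sd F₀ side le res minl p₀ ok₀ p∉ = Gr.grow ex6 d (λ i lt → ≤-trans (2^i≤m i lt) (m≤n*m m 4)) >>= λ L →
        Gr.newfull L >>= λ (ys , uys , out , cov) →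
        core-join nb nb-sym R P PL (B₀ L) 22 (4 * m) uPL inPL (m≤n*m m 4) (roomy L) >>= λ J → return (fin L ys uys out cov J)
      where
      open Result res
      open Side side
      P : Fin n → Set
      P v = R v × Sd v
      A : Fin n → Set
      A = AB R (W ++ Xb)
      module Gr = Growth Adj μ₀ p₀ inv A (Ok F₀) ok₀ (λ μ p w ok (Rw , _) a i → rstep minl μ p w ok Rw a >>= λ (j , ne , p≢ , ok') →
        return (j , (λ e → ne (trans (i j) e)) , Ok.fp ok , Ok.inv ok , p≢ , subst (Ok F₀ _) (i j) ok'))
      endR : ∀ v → Gr.End v → R v × v ∉ W ++ Xb
      endR v (inj₁ refl) = Ok.Rp ok₀ , p∉
      endR v (inj₂ (w , j , (Rw , _ , nn) , refl)) = R-nb w j Rw , nn j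
      ex21 : Gr.Ex 21 (4 * m)
      ex21 X u l e Y c = good X u (λ v i → proj₁ (endR v (e v i)) , λ k → proj₂ (endR v (e v i)) (∈-++⁺ʳ W k)) l Y c
      ex6 : Gr.Ex 6 (4 * m)
      ex6 X u l e Y c = ≤-trans (*-monoˡ-≤ (length X) {6} {21} (m≤m+n 6 15)) (ex21 X u l e Y c)
      B₀ : Gr.Lev d → List (Fin n)
      B₀ L = B∂ ++ W ++ Gr.Lev.E L
      lB₀ : ∀ L → length (B₀ L) ≤ (length B∂ + length W) + 2 * 2 ^ d
      lB₀ L = ≤-trans (≤-reflexive (trans (length-++ B∂) (cong (length B∂ +_) (length-++ W))))
        (≤-trans (≤-reflexive (sym (+-assoc (length B∂) (length W) _))) (+-monoʳ-≤ (length B∂ + length W) (Gr.Lev.lE L)))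
      -- With at most 5`m` vertices in `B₀`, up to the term that `le` bounds by `m`, the demand is
      -- 176m + m + 12m + 24m + 8m + m = 222m; this is the required size of each side.
      roomy : ∀ L → 22 * (2 * (4 * m)) + 3 * (length (B₀ L) + 2 * (4 * m)) + 2 * (4 * m) + m ≤ length PL
      roomy L = ≤-trans (+-monoˡ-≤ m (+-monoˡ-≤ (2 * (4 * m)) (+-monoʳ-≤ (22 * (2 * (4 * m)))
          (≤-trans (≤-reflexive (*-distribˡ-+ 3 (length (B₀ L)) (2 * (4 * m)))) (+-monoˡ-≤ (3 * (2 * (4 * m))) (≤-trans (*-monoʳ-≤ 3 (lB₀ L))
            (≤-trans (≤-reflexive (*-distribˡ-+ 3 (length B∂ + length W) (2 * 2 ^ d))) (+-mono-≤ le (*-monoʳ-≤ 3 (*-monoʳ-≤ 2 2^d≤2m)))))))))) (≤-trans (≤-reflexive (e m)) lPL)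
        where e : ∀ m → 22 * (2 * (4 * m)) + (m + 3 * (2 * (2 * m)) + 3 * (2 * (4 * m))) + 2 * (4 * m) + m ≡ 222 * m
              e = solve-∀
      fin : (L : Gr.Lev d) (ys : List (Fin n)) → Unique ys → (∀ v → v ∈ ys → v ∉ Gr.Lev.X L × Gr.Nw L v) → Cov Adj (Gr.Lev.X L) A (Gr.hull L ys) →
        Result R P (B₀ L) 22 (4 * m) m → P1 B∂ W Sd F₀ (vt p₀)
      fin L ys uys out cov J = record
        { BB = BB ; XB = XB ; XB⊑ = λ v i → ∈-++⁺ʳ (B₀ L) i ; B∂⊑ = λ v i → ∈-++⁺ˡ (∈-++⁺ˡ i)
        ; W⊑ = λ v i → ∈-++⁺ˡ (∈-++⁺ʳ B∂ (∈-++⁺ˡ i)) ; good = Result.good J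
        ; cands = SV.Parts.outs parts ; ucands = SV.Parts.uouts parts uys ; lcands = many
        ; cand = λ v i → mk v (SV.Parts.outs∉ parts i) (proj₂ (out v (SV.Parts.outs⊑ parts i))) }
        where
        XB = Result.Xb J
        BB = B₀ L ++ XB
        parts = SV.split ys BB
        s = 2 ^ d
        -- Expansion 21 = 25 - 4 against 3(|X| + |ys|) leaves 6·2^d new ends. `BB` swallows at most
        -- 4·2^d of them, so at least 2·2^d ≥ m candidates survive.
        lys : 6 * s ≤ length ys
        lys = +-cancelˡ-≤ s _ _ (*-cancelˡ-≤ 3 (≤-trans (≤-reflexive (e s)) (≤-trans (subst (λ k → 21 * k ≤ length (Gr.hull L ys)) (Gr.Lev.lX L)
                (ex21 (Gr.Lev.X L) (Gr.Lev.uX L) (≤-trans (≤-reflexive (Gr.Lev.lX L)) (≤-trans 2^d≤2m (*-monoˡ-≤ m {2} {4} (m≤m+n 2 2)))) (Gr.endX L) (Gr.hull L ys) cov))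
                (≤-reflexive (trans (Gr.hull-length L ys) (cong (λ k → 3 * (k + length ys)) (Gr.Lev.lX L)))))))
          where e : ∀ s → 3 * (s + 6 * s) ≡ 21 * s
                e = solve-∀
        lBB : length BB ≤ m + 2 * s + m
        lBB = ≤-trans (≤-reflexive (length-++ (B₀ L))) (+-mono-≤ (≤-trans (lB₀ L) (+-monoˡ-≤ (2 * s) (≤-trans (m≤n*m (length B∂ + length W) 3) le))) (Result.lXb J))
        many : m ≤ length (SV.Parts.outs parts)
        many = +-cancelˡ-≤ (4 * s) _ _ (≤-trans (+-monoʳ-≤ (4 * s) (≤-trans m≤2^d (m≤n*m s 2))) (≤-trans (≤-reflexive (sym (*-distribʳ-+ s 4 2)))
           (≤-trans lys (≤-trans (SV.outs≥ parts uys) (+-monoˡ-≤ _ (≤-trans lBB (≤-trans (+-mono-≤ (+-monoˡ-≤ (2 * s) m≤2^d) m≤2^d) (≤-reflexive (e s)))))))))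
          where e : ∀ s → s + 2 * s + s ≡ 4 * s
                e = solve-∀
        mk : ∀ v → v ∉ BB → Gr.Nw L v → C1 W BB F₀ (vt p₀) v
        mk v v∉ (w , c) = record { w = w ; μ = μ ; p = p ; τ = τ ; end = end ; ok = ok ; chg = chg
          ; offW = λ u i k → Data.Sum.[ (λ (_ , nw , _) → nw (∈-++⁺ˡ k)) , (λ ez → proj₂ (endR u ez) (∈-++⁺ˡ k)) ] (zone u i)
          ; len = ≤-trans len (≤-reflexive (trans (cong suc (*-suc 2 d)) (+-comm 3 (2 * d)))) ; strt = strt ; tail = tail
          ; sub = λ u i → case sub u i of λ { (here e) → inj₁ (here e) ; (there (here e)) → inj₁ (there (here e))
                                             ; (there (there k)) → inj₂ (∈-++⁺ˡ (∈-++⁺ʳ B∂ (∈-++⁺ʳ W k))) }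
          ; v∉ = v∉ }
          where open Gr.Ch c

    Zn : List (Fin n) → List (Fin n) → List (Fin n) → (Fin n → Set) → Fin n → Set
    Zn B∂ W N' Sd u = Sd u × u ∉ B∂ × u ∉ W × u ∉ N'

    record C2 (B∂ W N' : List (Fin n)) (Sd : Fin n → Set) (F₀ : List (Port n)) (τ : List (Fin n)) (u : Fin n) : Set where
      field
        μ    : M n
        p    : Port n
        E    : List (Fin n)
        end  : vt p ≡ u
        ok   : Ok F₀ μ p
        chg  : ∀ z → μ z ≢ μ₀ z → vt z ∈ E
        tail : u ∈ E
        τ⊑   : ∀ v → v ∈ τ → v ∈ E
        zone : ∀ v → v ∈ E → v ∈ τ ⊎ Zn B∂ W N' Sd v

    record P2 (B∂ W N' : List (Fin n)) (Sd : Fin n → Set) (F₀ : List (Port n)) (τ : List (Fin n)) : Set where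
      field
        X     : List (Fin n)
        uX    : Unique X
        lX    : m ≤ length X
        chain : ∀ u → u ∈ X → C2 B∂ W N' Sd F₀ τ u

    module _ {B∂ W Sd F₀ s} (side : Side B∂ Sd) (ph : P1 B∂ W Sd F₀ s) (N' : List (Fin n)) where
      open P1 ph
      open Side side

      AL : Fin n → Set
      AL = AB (λ v → R v × Sd v) BB

      ClL : Fin n → Set
      ClL v = R v × v ∉ XB

      second-core : 3 * length N' ≤ 2 * m → DN (Result ClL AL N' 18 (2 * m) (3 * length N'))
      second-core le = core-prop nb nb-sym ClL AL N' 18 (2 * m) le λ X u cl l Y c → good X u cl (≤-trans l (≤-reflexive (e m))) Y c
        where e : ∀ m → 2 * (2 * m) ≡ 4 * m
              e = solve-∀

      phase2 : (res : Result ClL AL N' 18 (2 * m) (3 * length N')) → Minimal (suc (length F₀)) →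
        ∀ v → v ∈ cands → v ∉ N' ++ Result.Xb res → (c : C1 W BB F₀ s v) → DN (P2 B∂ W N' Sd F₀ (C1.τ c))
      phase2 res minl v v∈ v∉ c = G2.grow ex6 d (λ i lt → ≤-trans (2^i≤m i lt) (m≤n*m m 2)) >>= λ L → return record
          { X = G2.Lev.X L ; uX = G2.Lev.uX L ; lX = ≤-trans m≤2^d (≤-reflexive (sym (G2.Lev.lX L)))
          ; chain = λ u i → mk u (G2.Lev.chain L u i) }
        where
        open C1 c renaming (μ to μ₁; p to p₁; v∉ to v∉BB)
        open Result res renaming (good to good₂)
        A₁ A₂ : Fin n → Set
        A₁ = AB AL (N' ++ Xb)
        A₂ = AB A₁ (v ∷ w ∷ [])
        -- The first trace is contained in `BB` together with `v` and `w`, and all of these are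
        -- excluded as pivots.
        offτ : ∀ x → A₂ x → ∀ j → μ₁ (x , j) ≡ μ₀ (x , j)
        offτ x (((_ , nBB , _) , _) , nvw , _) j with μ₁ (x , j) ≟P μ₀ (x , j)
        ... | yes e = e
        ... | no ne = case sub x (chg (x , j) ne) of λ { (inj₁ k) → ⊥-elim (nvw k) ; (inj₂ k) → ⊥-elim (nBB k) }
        module G2 = Growth Adj μ₁ p₁ (Ok.inv ok) A₂ (Ok F₀) ok (λ μ p x ok' ax a i → rstep minl μ p x ok' (proj₁ (proj₁ (proj₁ (proj₁ ax)))) a >>= λ (j , ne , p≢ , ok'') →
          return (j , (λ e → ne (trans (i j) e)) , Ok.fp ok' , Ok.inv ok' , p≢ , subst (Ok F₀ _) (i j) ok''))
        nbs : ∀ x j → A₂ x → G2.nb j x ≡ nb j x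
        nbs x j ax = cong vt (offτ x ax j)
        endCl : ∀ u → G2.End u → ClL u × u ∉ Xb
        endCl u (inj₁ refl) = (Ok.Rp ok , λ k → v∉BB (XB⊑ _ (subst (_∈ XB) end k))) , λ k → v∉ (∈-++⁺ʳ N' (subst (_∈ Xb) end k))
        endCl u (inj₂ (x , j , ax@((((Rx , Sx) , _ , nBB) , _ , nN) , _) , refl)) =
          subst (λ y → ClL y × y ∉ Xb) (sym (nbs x j ax)) ((R-nb x j Rx , λ k → nBB j (XB⊑ _ k)) , λ k → nN j (∈-++⁺ʳ N' k))
        ex6 : G2.Ex 6 (2 * m)
        ex6 [] u l e Y cv = z≤n
        -- Excluding `v` and `w` costs at most 3·2 = 6 targets, and 18|X| - 6 ≥ 6|X| for nonempty
        -- `X`.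
        ex6 X@(x ∷ xs) u l e Y cv = +-cancelʳ-≤ 6 _ _ (≤-trans (≤-trans (≤-reflexive (+-comm (6 * length X) 6)) (≤-trans (+-monoˡ-≤ (6 * length X) (≤-trans (m≤m*n 6 (2 * length X)) (≤-reflexive (ar₁ (length X)))))
            (≤-reflexive (ar₂ (length X))))) (≤-trans (good₂ X u (λ y i → endCl y (e y i)) l (Y ++ blow (v ∷ w ∷ [])) (cov-AB {P = A₁} cv)) (≤-reflexive (cov-AB-length nb nb-sym Y (v ∷ w ∷ [])))))
          where
          ar₁ : ∀ a → 6 * (2 * a) ≡ 12 * a
          ar₁ = solve-∀
          ar₂ : ∀ a → 12 * a + 6 * a ≡ 18 * a
          ar₂ = solve-∀
        zn : ∀ x → A₂ x → Zn B∂ W N' Sd x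
        zn x (((( _ , Sx) , nBB , _) , nN , _) , _) = Sx , (λ k → nBB (B∂⊑ x k)) , (λ k → nBB (W⊑ x k)) , λ k → nN (∈-++⁺ˡ k)
        znb : ∀ x j → A₂ x → Zn B∂ W N' Sd (nb j x)
        znb x j ((((_ , Sx) , nBB , bBB) , nN , bN) , _) = sdnb x j Sx (λ k → nBB (B∂⊑ x k)) (λ k → bBB j (B∂⊑ _ k)) ,
          (λ k → bBB j (B∂⊑ _ k)) , (λ k → bBB j (W⊑ _ k)) , λ k → bN j (∈-++⁺ˡ k)
        mk : ∀ {X E i} u → G2.Ch X E i u → C2 B∂ W N' Sd F₀ τ u
        mk u ch = record { μ = μ ; p = p ; E = τ ++ τ₂ ; end = end₂ ; ok = ok₂ ; chg = chg'
            ; tail = ∈-++⁺ʳ τ tail₂ ; τ⊑ = λ _ → ∈-++⁺ˡ ; zone = λ y i → case ∈-++⁻ τ i of λ { (inj₁ k) → inj₁ k ; (inj₂ k) → zz y (zone₂ y k) } }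
          where
          open G2.Ch ch renaming (τ to τ₂; end to end₂; ok to ok₂; tail to tail₂; zone to zone₂; chg to chg₂; sub to sub₂; strt to strt₂; len to len₂)
          chg' : ∀ z → μ z ≢ μ₀ z → vt z ∈ τ ++ τ₂
          chg' z ne with μ z ≟P μ₁ z
          ... | yes e = ∈-++⁺ˡ (chg z λ e' → ne (trans e e'))
          ... | no ne' = ∈-++⁺ʳ τ (chg₂ z ne')
          zz : ∀ y → G2.Zone y → y ∈ τ ⊎ Zn B∂ W N' Sd y
          zz y (inj₁ ax) = inj₂ (zn y ax)
          zz y (inj₂ (inj₁ refl)) = inj₁ (subst (_∈ τ) (sym end) tail)
          zz y (inj₂ (inj₂ (x , j , ax , refl))) = inj₂ (subst (Zn B∂ W N' Sd) (sym (nbs x j ax)) (znb x j ax))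

    minimal-≤ : ∀ {k l} → l ≤ k → Minimal k → Minimal l
    minimal-≤ le minl μ F pm ns c = ≤-trans le (minl μ F pm ns c)

    without : ∀ {F : List (Port n)} z → z ∈ F → Σ (List (Port n)) λ F' → suc (length F') ≤ length F ×
      (∀ y → y ∈ F → y ≢ z → y ∈ F') × (∀ y → y ∈ F' → y ≢ z × y ∈ F)
    without {F} z i = outs , lt , (λ y j ne → case cover j of λ { (inj₁ k) → case ins∈ k of λ { (here e) → contradiction e ne ; (there ()) } ; (inj₂ k) → k })
        , λ y j → (λ { refl → outs∉ j (here refl) }) , outs⊑ j
      where
      parts = SP.split F (z ∷ [])
      open SP.Parts parts
      lt : suc (length outs) ≤ length F
      lt with cover i
      ... | inj₂ k = ⊥-elim (outs∉ k (here refl))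
      ... | inj₁ k = ≤-trans (+-monoˡ-≤ (length outs) (pos k)) (≤-reflexive (sym size))
        where pos : ∀ {l : List (Port n)} → z ∈ l → 1 ≤ length l
              pos (here _) = s≤s z≤n
              pos (there _) = s≤s z≤n

    module _ (F : List (Port n)) (covF : CoverFree μ₀ F) (minF : Minimal (length F)) where

      -- If all free ports sat on vertices of `L`, the 2|L| ports of `L` would cover them, and
      -- minimality would give |F| ≤ 2|L|.
      freeOutside : ∀ L → 2 * length L < length F → DN (Σ (Port n) λ z → R (vt z) × (μ₀ z ≡ z) × vt z ∉ L)
      freeOutside L lt k = <⇒≱ lt (≤-trans (minF μ₀ (ports L) pm₀ nsc₀ cov) (≤-reflexive (ports-length L)))
        where
        cov : CoverFree μ₀ (ports L)
        cov z Rz e with SV._∈?_ (vt z) L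
        ... | yes i = ∈-ports z i
        ... | no ni = ⊥-elim (k (z , Rz , e , ni))

      ok-start : ∀ z F' → R (vt z) → μ₀ z ≡ z → (∀ y → y ∈ F → y ≢ z → y ∈ F') → Ok F' μ₀ z
      ok-start z F' Rz e keep = record { pm = pm₀ ; nsc = nsc₀ ; fp = e ; Rp = Rz ; cover = cv }
        where
        cv : ∀ y → R (vt y) → μ₀ y ≡ y → y ≡ z ⊎ y ∈ F'
        cv y Ry ey with y ≟P z
        ... | yes e' = inj₁ e'
        ... | no ne = inj₂ (keep y (covF y Ry ey) ne)

      -- The superposed matching has the two reached ends free in place of `x` and `y`. The edge
      -- between them leaves a cover with two free ports fewer and closes no short cycle, contrary
      -- to minimality.
      finish : ∀ {x y B∂ W W' N' N'' Sd Sd' Fx Fy τx τy ux uy} →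
        (∀ z → z ∈ F → z ≢ x → z ∈ Fx) → (∀ z → z ∈ Fx → z ≢ x × z ∈ F) → (∀ z → z ∈ Fy → z ≢ y × z ∈ F) →
        R (vt y) → μ₀ y ≡ y → suc (length Fx) ≤ length F →
        (cx : C2 B∂ W N' Sd Fx τx ux) (cy : C2 B∂ W' N'' Sd' Fy τy uy) →
        vt x ∈ C2.E cx → vt y ∈ C2.E cy → Far g (C2.E cx) (C2.E cy) → Adj ux uy → ⊥
      finish {x} {y} {Fx = Fx} keepx fromx fromy Ry fy lx cx cy x∈ y∈ far a = <⇒≱ (≤-trans lxy (≤-trans (n≤1+n _) lx)) (minF (rot μ₁₂ p q) Fxy pm* nsc* cov*)
        where
        open C2 cx using () renaming (μ to μ₁; p to p; ok to okx; chg to chgx; tail to tailx; end to endx)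
        open C2 cy using () renaming (μ to μ₂; p to q; ok to oky; chg to chgy; tail to taily; end to endy)
        open Combine g g≥1 μ₁ μ₂ (Ok.inv okx) (Ok.inv oky) (C2.E cx) (C2.E cy) chgx chgy far
        p∈ : vt p ∈ C2.E cx
        p∈ = subst (_∈ C2.E cx) (sym endx) tailx
        q∈ : vt q ∈ C2.E cy
        q∈ = subst (_∈ C2.E cy) (sym endy) taily
        q∉ : vt q ∉ C2.E cx
        q∉ i = disj i q∈
        fp : μ₁₂ p ≡ p
        fp = trans (at₁ p (disj p∈)) (Ok.fp okx)
        fq : μ₁₂ q ≡ q
        fq = trans (at₂ q q∉) (Ok.fp oky)
        p≢q : p ≢ q
        p≢q e = q∉ (subst (λ z → vt z ∈ C2.E cx) e p∈)
        pm₁₂ : PM Adj R μ₁₂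
        pm₁₂ = record { inv = inv₁₂
          ; edge = λ z ne → case side z of λ
             { (inj₁ (_ , k)) → subst (λ w → Adj (vt z) (vt w)) (sym (at₁ z k)) (Ok.edge okx z λ e → ne (trans (at₁ z k) e))
             ; (inj₂ k) → subst (λ w → Adj (vt z) (vt w)) (sym (at₂ z k)) (Ok.edge oky z λ e → ne (trans (at₂ z k) e)) }
          ; dom = λ z ne → case side z of λ
             { (inj₁ (_ , k)) → Ok.dom okx z λ e → ne (trans (at₁ z k) e)
             ; (inj₂ k) → Ok.dom oky z λ e → ne (trans (at₂ z k) e) } }
        pm* : PM Adj R (rot μ₁₂ p q)
        pm* = rotPM Adj-sym p q pm₁₂ fp p≢q (subst₂ Adj (sym endx) (sym endy) a) (Ok.Rp okx) (Ok.Rp oky)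
        nsc* : NSC Lim (rot μ₁₂ p q)
        nsc* = join-nsc {Lim = Lim} p q (λ _ l → l) (Ok.nsc okx) (Ok.nsc oky) p∈ q∈ fp
        wo = without {Fx} y (keepx y (covF y Ry fy) λ { refl → disj x∈ y∈ })
        Fxy = proj₁ wo
        lxy : suc (length Fxy) ≤ length Fx
        lxy = proj₁ (proj₂ wo)
        keepxy = proj₁ (proj₂ (proj₂ wo))
        cov* : CoverFree (rot μ₁₂ p q) Fxy
        cov* z Rz e = cv (rot-free μ₁₂ p q inv₁₂ fp p≢q z e)
          where
          z≢q : z ≢ q
          z≢q e' = p≢q (trans (sym (rot-q μ₁₂ p q)) (trans (cong (rot μ₁₂ p q) (sym e')) (trans e e')))
          cv : z ≢ p × (z ≡ μ₁₂ q ⊎ μ₁₂ z ≡ z) → z ∈ Fxy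
          cv (np , inj₁ e') = ⊥-elim (z≢q (trans e' fq))
          cv (np , inj₂ e') with side z
          ... | inj₁ (i , k) = case Ok.cover okx z Rz (trans (sym (at₁ z k)) e') of λ
              { (inj₁ e'') → contradiction e'' np ; (inj₂ l) → keepxy z l λ { refl → k y∈ } }
          ... | inj₂ k = case Ok.cover oky z Rz (trans (sym (at₂ z k)) e') of λ
              { (inj₁ e'') → contradiction e'' z≢q
              ; (inj₂ l) → keepxy z (keepx z (proj₂ (fromy z l)) λ { refl → k x∈ }) (proj₁ (fromy z l)) }

      module _ (big : 8 * (Q * N₁) < length F) (h : ℕ) (A : Arc h) (h≡ : h ≡ 222 * m) where
        open Arc A
        B∂ : List (Fin n)
        B∂ = ball g (map vt ∂)

        lB∂ : length B∂ ≤ 4 * suc g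
        lB∂ = ≤-trans (≤-reflexive (trans (ball-length g (map vt ∂)) (cong (2 * suc g *_) (length-map vt ∂))))
          (≤-trans (*-monoʳ-≤ (2 * suc g) l∂) (≤-reflexive (e (suc g))))
          where e : ∀ a → 2 * a * 2 ≡ 4 * a
                e = solve-∀

        In∂ : ∀ z → z ∈ ∂ → vt z ∈ B∂
        In∂ z i = ∈-ball (∈-map⁺ vt i) nr-refl

        sideH : Side B∂ (_∈ H)
        sideH = record { sdnb = nbH ; PL = H ; uPL = uH ; inPL = λ v i → RLin v (H⊑ v i) , i ; lPL = ≤-reflexive (sym (trans lH h≡)) }
          where
          nbH : ∀ w j → w ∈ H → w ∉ B∂ → nb j w ∉ B∂ → nb j w ∈ H
          nbH w j i a b with SV._∈?_ (nb j w) H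
          ... | yes k = k
          ... | no k = ⊥-elim (a (In∂ (w , j) (bd (w , j) i k)))

        sideC : Side B∂ (_∉ H)
        sideC = record { sdnb = λ w j ni _ b k → b (In∂ (μ₀ (w , j)) (bd (μ₀ (w , j)) k λ k' → ni (subst (λ z → vt z ∈ H) (inv (w , j)) k')))
          ; PL = SV.Parts.outs parts ; uPL = SV.Parts.uouts parts uRL ; inPL = λ v i → RLin v (SV.Parts.outs⊑ parts i) , SV.Parts.outs∉ parts i
          ; lPL = +-cancelˡ-≤ (222 * m) _ _ (≤-trans (≤-reflexive (cong (222 * m +_) (sym (+-identityʳ _)))) (≤-trans bigR (≤-trans (SV.outs≥ parts uRL) (≤-reflexive (cong (_+ length (SV.Parts.outs parts)) (trans lH h≡)))))) }
          where parts = SV.split RL H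

        -- Each trace is a phase-one trace followed by a confined zone. Pairs that involve a
        -- phase-one trace are separated by `W` or `N'`. A walk between the zones leaves `H` through
        -- a port of `∂`, so its far end would lie in the excluded ball `B∂`.
        farC2 : ∀ {W N' Fx Fy τx τy ux uy} (cx : C2 B∂ [] N' (_∈ H) Fx τx ux) (cy : C2 B∂ W [] (_∉ H) Fy τy uy) →
          (∀ a → a ∈ ball g τx → a ∈ W) → (∀ a → a ∈ τy → a ∉ W) → (∀ a → a ∈ ball g τy → a ∈ N') → Far g (C2.E cx) (C2.E cy)
        farC2 cx cy inW offW inN a b a∈ b∈ nr with C2.zone cx a a∈ | C2.zone cy b b∈
        ... | inj₁ i | inj₁ j = offW b j (inW b (∈-ball i nr))
        ... | inj₁ i | inj₂ (_ , _ , nW , _) = nW (inW b (∈-ball i nr))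
        ... | inj₂ (_ , _ , _ , nN) | inj₁ j = nN (inN a (∈-ball j (nr-sym nr)))
        ... | inj₂ (aH , _ , _ , _) | inj₂ (bH , b∂ , _ , _) = cross nr
          where
          cross : Nr g a b → ⊥
          cross (c , i , le , e) with crossing A i (a , c) aH (λ k → bH (subst (_∈ H) e k))
          ... | j , j≤i , z∈ = b∂ (∈-ball (∈-map⁺ vt z∈) (subst (Nr g _) (trans (cong vt (trans (sym (it-+ μ₀ j (i ∸ j) (a , c))) (cong (λ k → it μ₀ k (a , c)) (m+[n∸m]≡n j≤i)))) e)
                (nr-port (it μ₀ j (a , c)) (i ∸ j) (≤-trans (m∸n≤m i j) le))))

        N₁-pos : 1 ≤ N₁
        N₁-pos = *-mono-≤ {1} {2 * suc g} (s≤s z≤n) (≤-trans (s≤s z≤n) (m≤n+m 3 (2 * d)))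
        QN≤ : 3 * (Q * N₁) ≤ m
        QN≤ = ≤-trans (*-monoʳ-≤ 3 (m≤m+n (Q * N₁) (4 * suc g))) m-big
        Q≤QN : Q ≤ Q * N₁
        Q≤QN = ≤-trans (≤-reflexive (sym (*-identityʳ Q))) (*-monoʳ-≤ Q N₁-pos)
        Q≤m : Q ≤ m
        Q≤m = ≤-trans Q≤QN (≤-trans (m≤n*m (Q * N₁) 3) QN≤)
        ball-N₁ : ∀ τ → length τ ≤ 2 * d + 3 → length (ball g τ) ≤ N₁
        ball-N₁ τ l = ≤-trans (≤-reflexive (ball-length g τ)) (*-monoʳ-≤ (2 * suc g) l)
        1≤Q : 1 ≤ Q
        1≤Q = ≤-trans (s≤s z≤n) Q>N
        N₁≤m : 4 * N₁ ≤ m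
        N₁≤m = ≤-trans (<⇒≤ Q>N) Q≤m

        none : ∀ {l : List (Fin n)} {v} → length l ≤ 0 → v ∉ l
        none {[]} _ ()

        lenXb : ∀ W (res : Result R R W 21 (4 * m) (3 * length W)) → length W ≤ Q * N₁ → 2 * length (W ++ Result.Xb res) < length F
        lenXb W res le = ≤-<-trans (≤-trans (*-monoʳ-≤ 2 (≤-trans (≤-reflexive (length-++ W)) (+-mono-≤ le (≤-trans (Result.lXb res) (*-monoʳ-≤ 3 le))))) (≤-reflexive (e (Q * N₁)))) big
          where e : ∀ a → 2 * (a + 3 * a) ≡ 8 * a
                e = solve-∀

        lWB : ∀ (W : List (Fin n)) → length W ≤ Q * N₁ → 3 * (length B∂ + length W) ≤ m
        lWB W le = ≤-trans (*-monoʳ-≤ 3 (≤-trans (+-mono-≤ lB∂ le) (≤-reflexive (+-comm (4 * suc g) _)))) m-big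

        concat-length : ∀ (ts : List (List (Fin n))) b → (∀ t → t ∈ ts → length t ≤ b) → length (Data.List.concat ts) ≤ length ts * b
        concat-length [] b h = z≤n
        concat-length (t ∷ ts) b h = ≤-trans (≤-reflexive (length-++ t)) (+-mono-≤ (h t (here refl)) (concat-length ts b λ t i → h t (there i)))

        ball-mono : ∀ {xs ys} → (∀ v → v ∈ xs → v ∈ ys) → ∀ a → a ∈ ball g xs → a ∈ ball g ys
        ball-mono {x ∷ xs} s a i with ∈-++⁻ (walkL g (x , false)) i
        ... | inj₁ k = ∈-ball (s x (here refl)) (walk-nr (x , false) k)
        ... | inj₂ k' with ∈-++⁻ (walkL g (x , true)) k'
        ... | inj₁ k = ∈-ball (s x (here refl)) (walk-nr (x , true) k)
        ... | inj₂ k = ball-mono (λ v i → s v (there i)) a k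

        -- The two sides must avoid each other's traces, which looks circular. The circle is broken
        -- by fixing `Q` candidates for `x` first: all their traces are few enough for `y` to avoid
        -- together, and once the trace from `y` is chosen, one of the `Q` candidates is still
        -- usable against it.
        run : DN ⊥
        run =
          small-prop [] z≤n >>= λ rx →
          freeOutside ([] ++ Result.Xb rx) (lenXb [] rx z≤n) >>= λ (x , Rx , fx , x∉) →
          start-x rx x Rx fx x∉ (without x (covF x Rx fx))
          where
          start-x : (rx : Result R R [] 21 (4 * m) 0) → ∀ x → R (vt x) → μ₀ x ≡ x → vt x ∉ Result.Xb rx → _ → DN ⊥
          start-x rx x Rx fx x∉ (Fx , lx , keepx , fromx) =
            phase1 B∂ [] (_∈ H) Fx sideH (lWB [] z≤n) rx minx x (ok-start x Fx Rx fx keepx) x∉ >>= λ Px →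
            chooseL (λ v τ → Σ (C1 [] (P1.BB Px) Fx (vt x) v) λ c → C1.τ c ≡ τ) (cs Px) (λ v i → return (_ , P1.cand Px v (∈-take Q i) , refl)) >>= λ ch →
            with-x Px ch
            where
            minx : Minimal (suc (length Fx))
            minx = minimal-≤ lx minF
            cs : P1 B∂ [] (_∈ H) Fx (vt x) → List (Fin n)
            cs Px = take Q (P1.cands Px)
            with-x : (Px : P1 B∂ [] (_∈ H) Fx (vt x)) → _ → DN ⊥
            with-x Px (τs , lτ , f , b) =
              small-prop W (≤-trans (*-monoʳ-≤ 3 lW) (≤-trans QN≤ (m≤n*m m 4))) >>= λ ry →
              freeOutside (W ++ Result.Xb ry) (lenXb W ry lW) >>= λ (y , Ry , fy , y∉) →
              start-y ry y Ry fy y∉ (without y (covF y Ry fy))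
              where
              T = Data.List.concat τs
              W = ball g T
              lcs : length (cs Px) ≡ Q
              lcs = trans (length-take Q (P1.cands Px)) (m≤n⇒m⊓n≡m (≤-trans Q≤m (P1.lcands Px)))
              lT : length T ≤ Q * (2 * d + 3)
              lT = ≤-trans (concat-length τs (2 * d + 3) λ t i → let (v , _ , c , e) = b t i in ≤-trans (≤-reflexive (cong length (sym e))) (C1.len c))
                (≤-reflexive (cong (_* (2 * d + 3)) (trans lτ lcs)))
              lW : length W ≤ Q * N₁
              lW = ≤-trans (≤-reflexive (ball-length g T)) (≤-trans (*-monoʳ-≤ (2 * suc g) lT) (≤-reflexive (e (2 * suc g) Q (2 * d + 3))))
                where e : ∀ a q b → a * (q * b) ≡ q * (a * b)
                      e = solve-∀
              start-y : (ry : Result R R W 21 (4 * m) (3 * length W)) → ∀ y → R (vt y) → μ₀ y ≡ y → vt y ∉ W ++ Result.Xb ry → _ → DN ⊥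
              start-y ry y Ry fy y∉ (Fy , ly , keepy , fromy) =
                phase1 B∂ W (_∉ H) Fy sideC (lWB W lW) ry miny y (ok-start y Fy Ry fy keepy) y∉ >>= λ Py →
                with-y Py (SV.avoid {ys = []} (P1.ucands Py) (≤-trans (≤-trans 1≤Q Q≤m) (P1.lcands Py)))
                where
                miny : Minimal (suc (length Fy))
                miny = minimal-≤ ly minF
                with-y : (Py : P1 B∂ W (_∉ H) Fy (vt y)) → _ → DN ⊥
                with-y Py (y' , y'∈ , _) =
                  second-core sideH Px N' (≤-trans (*-monoʳ-≤ 3 lN') (≤-trans (*-monoˡ-≤ N₁ {3} {4} (m≤m+n 3 1)) (≤-trans N₁≤m (m≤n*m m 2)))) >>= λ rx₂ →
                  second-core sideC Py [] z≤n >>= λ ry₂ →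
                  phase2 sideC Py [] ry₂ miny y' y'∈ (none {l = Result.Xb ry₂} (Result.lXb ry₂)) cy >>= λ Qy →
                  -- The ball `N'` and its bad list have at most N₁ + 3N₁ elements, fewer than `Q`.
                  pick-x rx₂ Qy (SV.avoid {ys = N' ++ Result.Xb rx₂} (uniq-take Q (P1.ucands Px)) (≤-trans (s≤s (≤-trans (≤-reflexive (length-++ N')) (≤-trans (+-mono-≤ lN' (≤-trans (Result.lXb rx₂) (*-monoʳ-≤ 3 lN'))) ≤-refl)))
                     (≤-trans Q>N (≤-reflexive (sym lcs)))))
                  where
                  cy = P1.cand Py y' y'∈
                  N' = ball g (C1.τ cy)
                  lN' : length N' ≤ N₁
                  lN' = ball-N₁ (C1.τ cy) (C1.len cy)
                  pick-x : (rx₂ : Result (ClL sideH Px N') (AL sideH Px N') N' 18 (2 * m) (3 * length N')) → P2 B∂ W [] (_∉ H) Fy (C1.τ cy) → _ → DN ⊥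
                  pick-x rx₂ Qy (v , v∈ , v∉) with f v v∈
                  ... | τ , τ∈ , cx , refl = phase2 sideH Px N' rx₂ minx v (∈-take Q v∈) v∉ cx >>= λ Qx → return (clash Qx)
                    where
                    fr : ∀ {ux uy} (c₁ : C2 B∂ [] N' (_∈ H) Fx (C1.τ cx) ux) (c₂ : C2 B∂ W [] (_∉ H) Fy (C1.τ cy) uy) → Far g (C2.E c₁) (C2.E c₂)
                    fr c₁ c₂ = farC2 c₁ c₂ (ball-mono λ u i → ∈-concat⁺′ i τ∈) (C1.offW cy) (λ _ i → i)
                    clash : P2 B∂ [] N' (_∈ H) Fx (C1.τ cx) → ⊥
                    clash Qx with joined (P2.X Qx) (P2.X Qy) (P2.uX Qx) (P2.uX Qy)
                         (λ u i j → fr (P2.chain Qx u i) (P2.chain Qy u j) u u (C2.tail (P2.chain Qx u i)) (C2.tail (P2.chain Qy u j)) nr-refl) (P2.lX Qx) (P2.lX Qy)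
                    ... | ux , uy , i , j , a = finish {x} {y} keepx fromx fromy Ry fy lx (P2.chain Qx ux i) (P2.chain Qy uy j)
                        (C2.τ⊑ (P2.chain Qx ux i) _ (C1.strt cx)) (C2.τ⊑ (P2.chain Qy uy j) _ (C1.strt cy)) (fr (P2.chain Qx ux i) (P2.chain Qy uy j)) a

      few : ¬ (8 * (Q * N₁) < length F)
      few big = arc (222 * m) (≤-trans (m≤n*m (222 * m) 2) bigR) λ A → run big (222 * m) A refl id


-- Opening all cycles

pos-length : ∀ {A : Set} {x : A} {xs} → x ∈ xs → 1 ≤ length xs
pos-length (here _) = s≤s z≤n
pos-length (there _) = s≤s z≤n

-- Matched ports come in pairs, so the number of free ports has the parity of the number of all
-- ports. This makes the number of path ends even, as their absorption in pairs requires, and also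
-- yields an exact duplicate-free list of them.
free-parity : ∀ {n} (μ : M n) → Inv μ → ∀ fuel zs → length zs ≤ fuel → Unique zs → (∀ z → z ∈ zs → μ z ∈ zs) →
  Σ (List (Port n)) λ F → Unique F × (∀ z → z ∈ zs → μ z ≡ z → z ∈ F) × (∀ z → z ∈ F → μ z ≡ z × z ∈ zs) ×
    Σ ℕ λ k → length zs ≡ length F + 2 * k
free-parity μ inv fuel [] le u cl = [] , [] , (λ _ ()) , (λ _ ()) , 0 , refl
free-parity {n} μ inv (suc fuel) (z ∷ zs) (s≤s le) u cl with μ z ≟P z
... | yes e = let (F , uF , f , h , k , eq) = free-parity μ inv fuel zs le (uniq-tail u) (λ y i → case cl y (there i) of λ
                      { (here e') → ⊥-elim (∉-head u (subst (_∈ zs) (trans (sym (inv y)) (trans (cong μ e') e)) i)) ; (there j) → j })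
              in z ∷ F , uniq-∷ (λ i → ∉-head u (proj₂ (h z i))) uF , (λ { _ (here refl) _ → here refl ; y (there i) fy → there (f y i fy) })
                 , (λ { _ (here refl) → e , here refl ; y (there i) → proj₁ (h y i) , there (proj₂ (h y i)) }) , k , cong suc eq
... | no ne = let (F , uF , f , h , k , eq) = free-parity μ inv fuel outs (≤-trans (m≤n+m (length outs) (length ins)) (≤-trans (≤-reflexive (sym size)) le)) (uouts (uniq-tail u)) closed
              in F , uF , (λ { _ (here refl) fz → ⊥-elim (ne fz) ; y (there i) fy → f y (keep y i λ { refl → ne (trans (sym fy) (inv z)) }) fy })
                 , (λ y i → proj₁ (h y i) , there (outs⊑ (proj₂ (h y i)))) , suc k , trans (cong suc (trans size (trans (cong₂ _+_ one eq) refl))) (arith (length F) k)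
  where
  parts = SP.split zs (μ z ∷ [])
  open SP.Parts parts
  in-zs : μ z ∈ zs
  in-zs = case cl z (here refl) of λ { (here e) → contradiction e ne ; (there j) → j }
  keep : ∀ y → y ∈ zs → y ≢ μ z → y ∈ outs
  keep y i d = case cover i of λ { (inj₁ k) → case ins∈ k of λ { (here e) → contradiction e d ; (there ()) } ; (inj₂ k) → k }
  one : length ins ≡ 1
  one = ≤-antisym (pigeon (uins (uniq-tail u)) ins∈) (case cover in-zs of λ { (inj₁ k) → pos-length k ; (inj₂ k) → ⊥-elim (outs∉ k (here refl)) })
  closed : ∀ y → y ∈ outs → μ y ∈ outs
  closed y i with cl y (there (outs⊑ i))
  ... | here e = ⊥-elim (outs∉ i (here (trans (sym (inv y)) (cong μ e))))
  ... | there j = keep (μ y) j λ e → ∉-head u (subst (_∈ zs) (trans (sym (inv y)) (trans (cong μ e) (inv z))) (outs⊑ i))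
  arith : ∀ a k → suc (1 + (a + 2 * k)) ≡ a + 2 * suc k
  arith = solve-∀

uniq-ports : ∀ {n} {vs : List (Fin n)} → Unique vs → Unique (ports vs)
uniq-ports {vs = []} u = []
uniq-ports {vs = v ∷ vs} u = uniq-∷ (λ { (here ()) ; (there i) → ∉-head u (port-vt i) }) (uniq-∷ (λ i → ∉-head u (port-vt i)) (uniq-ports (uniq-tail u)))
  where
  port-vt : ∀ {vs z} → z ∈ ports vs → vt z ∈ vs
  port-vt {v ∷ vs} (here refl) = here refl
  port-vt {v ∷ vs} (there (here refl)) = here refl
  port-vt {v ∷ vs} (there (there i)) = there (port-vt i)

∈-ports⁻ : ∀ {n} {vs : List (Fin n)} {z} → z ∈ ports vs → vt z ∈ vs
∈-ports⁻ {vs = v ∷ vs} (here refl) = here refl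
∈-ports⁻ {vs = v ∷ vs} (there (here refl)) = here refl
∈-ports⁻ {vs = v ∷ vs} (there (there i)) = there (∈-ports⁻ i)

module Open {n : ℕ} (Adj : Fin n → Fin n → Set) (Adj-sym : ∀ {u v} → Adj u v → Adj v u) (irr : ∀ {v} → ¬ Adj v v)
  (R : Fin n → Set) (g : ℕ) (g≥1 : 1 ≤ g) where

  Lim All-k : ℕ → Set
  Lim k = suc k < g
  All-k _ = ⊤

  module G = MaxRot Adj Adj-sym irr R Lim
  module A = MaxRot Adj Adj-sym irr R All-k

  walk-unique : ∀ {μ : M n} {P K} (inv : Inv μ) → NSC Lim μ → Cyc μ P K → ∀ k → k < g → Unique (Near.walkL μ inv k P)
  walk-unique inv ns C zero lt = uniq-∷ (λ ()) []
  walk-unique {μ} {P} {K} inv ns C (suc k) lt = uniq-∷ new (walk-unique {K = K} inv ns (cyc-shift μ {k = K} 1 C) k (<-trans (n<1+n k) lt))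
    where
    open Near μ inv
    new : vt P ∉ walkL k (nx μ P)
    new i with walk-index (nx μ P) i
    ... | l , le , e with same-vt {p = it μ (suc l) P} {q = P} e
    ... | inj₁ e' = ns P l (≤-<-trans (s≤s le) lt) (e' , proj₂ C)
    ... | inj₂ e' = let (j , f) = palindrome inv (suc l) P e' in proj₂ C j f

  -- `Y` contains all vertices that may still be on a cycle. A cycle has at least `g` vertices there
  -- and cutting it creates two free ports, so each `g` vertices removed from `Y` pay for two free
  -- ports.
  break : ∀ fuel Y → length Y ≤ fuel → Unique Y → ∀ μ F → PM Adj R μ → NSC Lim μ → G.CoverFree μ F → (∀ P k → Cyc μ P k → vt P ∈ Y) →
    DN (Σ (M n) λ μ' → Σ (List (Port n)) λ F' → PM Adj R μ' × NSC All-k μ' × G.CoverFree μ' F' × length F' * g ≤ length F * g + 2 * length Y)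
  break fuel Y le uY μ F pm ns cv cy = lem (Σ (Port n) λ P → Σ ℕ (Cyc μ P)) >>= λ where
      (inj₂ none) → return (μ , F , pm , (λ P k _ C → none (P , k , C)) , cv , m≤m+n _ _)
      (inj₁ (P , k , C)) → go fuel le P k C
    where
    open PM pm
    open Near μ inv using (walkL; walk-index; walkL-length)
    go : ∀ fuel → length Y ≤ fuel → ∀ P k → Cyc μ P k → DN _
    go zero le P k C = ⊥-elim (<⇒≱ (pos-length (cy P k C)) le)
    go (suc fuel) le P k C = break fuel outs (≤-pred (≤-trans (≤-trans (+-monoˡ-≤ (length outs) (≤-trans g≥1 g≤)) (≤-reflexive (sym size))) le)) (uouts uY)
        (cut μ P) (P ∷ μ P ∷ F) (cutPM Adj-sym P pm) (λ P' k' L C' → ns P' k' L (proj₁ (transfer P' k' C'))) cv' (λ P' k' C' → cy' P' k' C') >>= λ (μ' , F' , pm' , ns' , c' , l') →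
        return (μ' , F' , pm' , ns' , c' , ≤-trans l' (≤-trans (≤-reflexive (ar g (length F) (length outs))) (+-monoʳ-≤ (length F * g) (*-monoʳ-≤ 2 (≤-trans (+-monoˡ-≤ (length outs) g≤) (≤-reflexive (sym size)))))))
      where
      O = walkL (pred g) P
      g≡ : suc (pred g) ≡ g
      g≡ = suc-pred g {{>-nonZero g≥1}}
      parts = SV.split Y O
      open SV.Parts parts
      ar : ∀ g f o → suc (suc f) * g + 2 * o ≡ f * g + 2 * (g + o)
      ar = solve-∀
      g≤ : g ≤ length ins
      g≤ = ≤-trans (≤-reflexive (trans (sym g≡) (sym (walkL-length (pred g) P))))
        (pigeon (walk-unique {K = k} inv ns C (pred g) (≤-reflexive g≡)) λ {v} i → let (l , _ , e) = walk-index P i in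
          case cover (subst (_∈ Y) e (cy _ k (cyc-shift μ {k = k} l C))) of λ { (inj₁ j) → j ; (inj₂ j) → ⊥-elim (outs∉ j i) })
      cv' : G.CoverFree (cut μ P) (P ∷ μ P ∷ F)
      cv' z Rz e = case cut-free μ P z e of λ { (inj₁ e') → here e' ; (inj₂ (inj₁ e')) → there (here e') ; (inj₂ (inj₂ e')) → there (there (cv z Rz e')) }
      transfer : ∀ P' k' → Cyc (cut μ P) P' k' → Cyc μ P' k' × (∀ i → it μ i P' ≢ P) × (∀ i → it μ i P' ≢ μ P)
      transfer P' k' (e , f) = (trans (sym (it= (suc k'))) e , λ i h → f i (trans (same i) (trans (cong μ (it= i)) (trans h (sym (it= i))))))
          , (λ i h → nP i (trans (it= i) h)) , (λ i h → nQ i (trans (it= i) h))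
        where
        nP : ∀ i → it (cut μ P) i P' ≢ P
        nP i h = f i (trans (cong (cut μ P) h) (trans (cut-q μ P) (sym h)))
        nQ : ∀ i → it (cut μ P) i P' ≢ μ P
        nQ i h = f i (trans (cong (cut μ P) h) (trans (cut-r μ P) (sym h)))
        same : ∀ i → cut μ P (it (cut μ P) i P') ≡ μ (it (cut μ P) i P')
        same i = cut-o μ P (nP i) (nQ i)
        it= : ∀ i → it (cut μ P) i P' ≡ it μ i P'
        it= zero = refl
        it= (suc i) = trans (it-suc (cut μ P) i P') (trans (cong sw (trans (same i) (cong μ (it= i)))) (sym (it-suc μ i P')))
      cy' : ∀ P' k' → Cyc (cut μ P) P' k' → vt P' ∈ outs
      cy' P' k' C' with transfer P' k' C'
      ... | C₀ , nP , nQ with cover (cy P' k' C₀)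
      ... | inj₂ j = j
      ... | inj₁ j with walk-index P (ins∈ j)
      ... | l , _ , e with same-vt {p = it μ l P} {q = P'} e
      ... | inj₁ refl = ⊥-elim (nP (l * suc k ∸ l) (trans (sym (it-+ μ l (l * suc k ∸ l) P)) (trans (cong (λ x → it μ x P) (m+[n∸m]≡n (m≤m*n l (suc k)))) (it-per μ {P} {k} (proj₁ C) l))))
      ... | inj₂ e' = ⊥-elim (nQ (l + k) (trans (it-+ μ l k P') (trans (cong (it μ k) to-swP) at-μP)))
        where
        to-swP : it μ l P' ≡ sw P
        to-swP = trans (cong (it μ l) (trans (sym (sw-sw P')) (trans (cong sw (sym e')) (cong (λ x → sw (it μ x P)) (sym (+-identityʳ l)))))) (it-back inv l 0 P)
        at-μP : it μ k (sw P) ≡ μ P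
        at-μP = nx-inj {μ = μ} inv (trans (sym (it-suc μ k (sw P))) (trans (proj₁ (cyc-sw inv {k = k} C)) (cong sw (sym (inv P)))))

-- A path cover of the territory with few ends

module Cover {n : ℕ} (S : Territory n) where
  open Territory S
  open Open Adj Adj-sym irr R g g≥1
  open FewFree S using (N₁; module At)

  -- Two different minima are used: the first, over matchings without short cycles, bounds the
  -- number of ends; the second, over acyclic matchings, supplies the minimality on which the later
  -- rotations rely, and by comparison it inherits the bound.
  path-cover : ∀ Q → 4 * N₁ < Q → 3 * (Q * N₁ + 4 * suc g) ≤ m →
    DN (Σ (M n) λ μ → Σ (List (Port n)) λ F → PM Adj R μ × NSC All-k μ × A.CoverFree μ F × A.Minimal (length F) ×
      length F * g ≤ 8 * (Q * N₁) * g + 2 * length RL)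
  path-cover Q Q>N m-big = minWit Long (length (ports RL)) (id , ports RL , pm-id , (λ P k _ C → proj₂ C 0 refl) , cov-id , refl) >>=
    λ { (_ , (μ , F , pm , ns , cv , refl) , mn) → opened μ F pm ns cv (λ μ' F' p' n' c' → mn (length F') (μ' , F' , p' , n' , c' , refl)) }
    where
    Long Acyclic : ℕ → Set
    Long k = Σ (M n) λ μ → Σ (List (Port n)) λ F → PM Adj R μ × NSC Lim μ × G.CoverFree μ F × (length F ≡ k)
    Acyclic k = Σ (M n) λ μ → Σ (List (Port n)) λ F → PM Adj R μ × NSC All-k μ × A.CoverFree μ F × (length F ≡ k)
    pm-id : PM Adj R id
    pm-id = record { inv = λ _ → refl ; edge = λ z ne → ⊥-elim (ne refl) ; dom = λ z ne → ⊥-elim (ne refl) }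
    cov-id : G.CoverFree id (ports RL)
    cov-id z Rz _ = ∈-ports z (inRL _ Rz)
    opened : ∀ μ F → PM Adj R μ → NSC Lim μ → G.CoverFree μ F → G.Minimal (length F) → DN _
    opened μ F pm ns cv mn = break (length RL) RL ≤-refl uRL μ F pm ns cv (λ P k C → inRL _ (PM.dom pm P (proj₂ C 0))) >>=
      λ (μ₁ , F₁ , pm₁ , ns₁ , cv₁ , l₁) → minWit Acyclic (length F₁) (μ₁ , F₁ , pm₁ , ns₁ , cv₁ , refl) >>=
      λ { (_ , (μ₂ , F₂ , pm₂ , ns₂ , cv₂ , refl) , mn₂) → return (μ₂ , F₂ , pm₂ , ns₂ , cv₂
        , (λ μ' F' p' n' c' → mn₂ (length F') (μ' , F' , p' , n' , c' , refl))
        , ≤-trans (*-monoˡ-≤ g (mn₂ (length F₁) (μ₁ , F₁ , pm₁ , ns₁ , cv₁ , refl))) (≤-trans l₁ (+-monoˡ-≤ (2 * length RL) (*-monoˡ-≤ g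
            (≮⇒≥ (At.few μ pm ns Q Q>N m-big F cv mn)))))) }


-- Extendable embeddings

module _ {n : ℕ} where
  ind : Fin n → List (Fin n) → ℕ
  ind u X with SV._∈?_ u X
  ... | yes _ = 1
  ... | no _ = 0

  ind-yes : ∀ {u X} → u ∈ X → ind u X ≡ 1
  ind-yes {u} {X} i with SV._∈?_ u X
  ... | yes _ = refl
  ... | no k = ⊥-elim (k i)

  ind-no : ∀ {u X} → u ∉ X → ind u X ≡ 0
  ind-no {u} {X} i with SV._∈?_ u X
  ... | yes k = ⊥-elim (i k)
  ... | no k = refl

  cnt : List (Fin n) → List (Fin n) → ℕ
  cnt [] X = 0
  cnt (u ∷ U) X = ind u X + cnt U X

  cnt-++ : ∀ U U' X → cnt (U ++ U') X ≡ cnt U X + cnt U' X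
  cnt-++ [] U' X = refl
  cnt-++ (u ∷ U) U' X = trans (cong (ind u X +_) (cnt-++ U U' X)) (sym (+-assoc (ind u X) _ _))

  cnt-none : ∀ U X → (∀ u → u ∈ U → u ∉ X) → cnt U X ≡ 0
  cnt-none [] X h = refl
  cnt-none (u ∷ U) X h = cong₂ _+_ (ind-no {u} {X} (h u (here refl))) (cnt-none U X λ v i → h v (there i))

  cnt-part : ∀ U {X A B} → (∀ u → u ∈ X → u ∈ A ⊎ u ∈ B) → (∀ u → u ∈ A → u ∈ X) → (∀ u → u ∈ B → u ∈ X) →
    (∀ u → u ∈ A → u ∉ B) → cnt U X ≡ cnt U A + cnt U B
  cnt-part [] c a b d = refl
  cnt-part (u ∷ U) {X} {A} {B} c a b d = trans (cong₂ _+_ one (cnt-part U c a b d)) (ar (ind u A) (ind u B) (cnt U A) (cnt U B))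
    where
    ar : ∀ a b c d → (a + b) + (c + d) ≡ (a + c) + (b + d)
    ar = solve-∀
    one : ind u X ≡ ind u A + ind u B
    one with SV._∈?_ u A | SV._∈?_ u B
    ... | yes i | yes j = ⊥-elim (d u i j)
    ... | yes i | no j = ind-yes (a u i)
    ... | no i | yes j = ind-yes (b u j)
    ... | no i | no j = ind-no λ k → Data.Sum.[ i , j ] (c u k)

  cnt-sub : ∀ {ks ps : List (Fin n × Fin n)} X → Unique ks → (∀ k → k ∈ ks → k ∈ ps) → cnt (map proj₂ ks) X ≤ cnt (map proj₂ ps) X
  cnt-sub {[]} X u s = z≤n
  cnt-sub {k ∷ ks} {ps} X u s with ∈-∃++ (s k (here refl))
  ... | as , bs , refl = ≤-trans (+-monoʳ-≤ (ind (proj₂ k) X) (cnt-sub {ks} {as ++ bs} X (uniq-tail u) sub)) (≤-reflexive mid)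
    where
    sub : ∀ j → j ∈ ks → j ∈ as ++ bs
    sub j i with ∈-++⁻ as (s j (there i))
    ... | inj₁ a = ∈-++⁺ˡ a
    ... | inj₂ (here refl) = ⊥-elim (∉-head u i)
    ... | inj₂ (there b) = ∈-++⁺ʳ as b
    mid : ind (proj₂ k) X + cnt (map proj₂ (as ++ bs)) X ≡ cnt (map proj₂ (as ++ k ∷ bs)) X
    mid = go as
      where
      go : ∀ as → ind (proj₂ k) X + cnt (map proj₂ (as ++ bs)) X ≡ cnt (map proj₂ (as ++ k ∷ bs)) X
      go [] = refl
      go (a ∷ as) = trans (ar (ind (proj₂ k) X) (ind (proj₂ a) X) _) (cong (ind (proj₂ a) X +_) (go as))
        where ar : ∀ a b c → a + (b + c) ≡ b + (a + c)
              ar = solve-∀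

  c1 : List (Fin n) → Fin n → ℕ
  c1 U v = cnt U (v ∷ [])

  c1-out : ∀ {U v} → v ∉ U → c1 U v ≡ 0
  c1-out {U} {v} h = cnt-none U (v ∷ []) λ { u i (here refl) → h i }

record Ground (n : ℕ) : Set₁ where
  field
    Adj     : Fin n → Fin n → Set
    Adj-sym : ∀ {u v} → Adj u v → Adj v u
    m D     : ℕ
    joined  : ∀ X Y → Unique X → Unique Y → (∀ v → v ∈ X → v ∉ Y) → m ≤ length X → m ≤ length Y →
      Σ (Fin n) λ u → Σ (Fin n) λ v → u ∈ X × v ∈ Y × Adj u v
    d       : ℕ
    mle     : m ≤ 2 ^ suc d
    6≤D     : 6 ≤ D
    lam     : ℕ

module Extend {n : ℕ} (S : Ground n) where
  open Ground S using (Adj; m; D; joined)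
  open Expand Adj m joined using (joinCov)

  -- The extendability condition of Friedman and Pippenger: outside the occupied set `Ω`, a set `X`
  -- has at least the sum over its members of `D` minus their load. `U` is the multiset of loads;
  -- attaching a leaf charges the old vertex and not the leaf.
  Valid : List (Fin n) → List (Fin n) → Set
  Valid Ω U = ∀ X → Unique X → length X ≤ 8 * m → ∀ Y → Cov Adj X (_∉ Ω) Y → D * length X ≤ length Y + cnt U X

  weaken : ∀ {Ω U Ω' U'} → Valid Ω U → (∀ v → v ∈ Ω' → v ∈ Ω) → (∀ X → cnt U X ≤ cnt U' X) → Valid Ω' U'
  weaken V s c X u l Y cv = ≤-trans (V X u l Y λ a w i ad nw → cv a w i ad λ k → nw (s w k)) (+-monoʳ-≤ (length Y) (c X))

  -- For sets that contain `s`, the freed vertex `y` is a new neighbour and replaces the load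
  -- withdrawn at `s`; for other sets the load is unchanged and freeing a vertex can only help.
  prune : ∀ {Ω₁ U₁ Ω U y s} → Valid Ω₁ U₁ → (∀ v → v ∈ Ω → v ∈ Ω₁) → y ∈ Ω₁ → y ∉ Ω → Adj s y →
    (∀ X → cnt U₁ X ≤ ind s X + cnt U X) → Valid Ω U
  prune {Ω₁} {U₁} {Ω} {U} {y} {s} V sub y∈ y∉ a c X u l Y cv with SV._∈?_ s X
  ... | no ns = ≤-trans (V X u l Y λ b w i ad nw → cv b w i ad λ k → nw (sub w k)) (+-monoʳ-≤ (length Y) (≤-trans (c X) (≤-reflexive (cong (_+ cnt U X) (ind-no ns)))))
  ... | yes ys with remove (cv s y ys a y∉)
  ... | Y' , lY , keep , _ = ≤-trans (V X u l Y' λ b w i ad nw → keep (cv b w i ad λ k → nw (sub w k)) λ { refl → nw y∈ })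
      (≤-trans (+-monoʳ-≤ (length Y') (≤-trans (c X) (≤-reflexive (cong (_+ cnt U X) (ind-yes ys))))) (≤-reflexive (trans (+-suc (length Y') (cnt U X)) (cong (_+ cnt U X) (sym lY)))))

  Room : List (Fin n) → Set
  Room Ω = length Ω + (D * (8 * m) + 8 * m + m) ≤ n

  module _ {Ω U} (V : Valid Ω U) (room : Room Ω) where

    record Crit (X : List (Fin n)) : Set where
      field
        uX : Unique X
        lX : length X ≤ 8 * m
        Y  : List (Fin n)
        cv : Cov Adj X (_∉ Ω) Y
        tight : length Y + cnt U X ≤ D * length X

    -- A critical set with at least `m` members would by joinedness see almost everything outside
    -- `Ω`, far more than the D|X| neighbours it has.
    crit-small : ∀ {X} → Crit X → length X < m
    crit-small {X} C = ≰⇒> λ le → <⇒≱ (joinCov X outs Y uX (uouts uAll) (λ v i → outs∉ i) le cv)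
        (≤-trans (+-monoˡ-≤ m (+-mono-≤ (≤-trans (≤-trans (m≤m+n (length Y) (cnt U X)) tight) (*-monoʳ-≤ D lX)) lX)) big)
      where
      open Crit C
      uAll = Uniqueₚ.allFin⁺ n
      parts = SV.split (allFin n) Ω
      open SV.Parts parts
      big : (D * (8 * m) + 8 * m + m) ≤ length outs
      big = +-cancelˡ-≤ (length Ω) _ _ (≤-trans room (≤-trans (≤-reflexive (sym (length-tabulate id))) (SV.outs≥ parts uAll)))

    -- Submodularity: neighbourhoods satisfy |Y₁ ∪ Y₂| + |Y₁ ∩ Y₂| = |Y₁| + |Y₂| and loads are
    -- additive, while extendability bounds the intersection from below. Since critical sets are
    -- smaller than `m`, the union stays in the range where the condition is known.
    crit-∪ : ∀ {X₁ X₂} → Crit X₁ → Crit X₂ → Σ (List (Fin n)) λ X → Crit X × (∀ v → v ∈ X → v ∈ X₁ ⊎ v ∈ X₂) × (∀ v → v ∈ X₁ ⊎ v ∈ X₂ → v ∈ X)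
    crit-∪ {X₁} {X₂} C₁ C₂ = X₁ ++ OX , record
        { uX = uniq-++ A.uX (PX.uouts B.uX) (λ i j → PX.outs∉ j i)
        ; lX = ≤-trans (≤-reflexive (length-++ X₁)) (≤-trans (+-mono-≤ (<⇒≤ (crit-small C₁)) (≤-trans (≤-trans (m≤n+m (length OX) (length IX)) (≤-reflexive (sym PX.size))) (<⇒≤ (crit-small C₂)))) (≤-trans (≤-reflexive (cong (m +_) (sym (+-identityʳ m)))) (*-monoˡ-≤ m {2} {8} (m≤m+n 2 6))))
        ; Y = A.Y ++ OY
        ; cv = λ u w i a nw → case ∈-++⁻ X₁ i of λ { (inj₁ k) → ∈-++⁺ˡ (A.cv u w k a nw)
             ; (inj₂ k) → case PY.cover (B.cv u w (PX.outs⊑ k) a nw) of λ { (inj₁ l) → ∈-++⁺ˡ (PY.ins∈ l) ; (inj₂ l) → ∈-++⁺ʳ A.Y l } }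
        ; tight = +-cancelʳ-≤ (D * length IX) _ _ (≤-trans (+-monoʳ-≤ (length (A.Y ++ OY) + cnt U (X₁ ++ OX)) inter)
            (≤-trans (≤-reflexive total) (≤-trans (+-mono-≤ A.tight B.tight) (≤-reflexive right)))) }
        , (λ v i → case ∈-++⁻ X₁ i of λ { (inj₁ k) → inj₁ k ; (inj₂ k) → inj₂ (PX.outs⊑ k) })
        , (λ v → λ { (inj₁ i) → ∈-++⁺ˡ i ; (inj₂ j) → case PX.cover j of λ { (inj₁ k) → ∈-++⁺ˡ (PX.ins∈ k) ; (inj₂ k) → ∈-++⁺ʳ X₁ k } })
      where
      module A = Crit C₁
      module B = Crit C₂
      module PX = SV.Parts (SV.split X₂ X₁)
      module PY = SV.Parts (SV.split B.Y A.Y)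
      IX = PX.ins
      OX = PX.outs
      OY = PY.outs
      inter : D * length IX ≤ length PY.ins + cnt U IX
      inter = V IX (PX.uins B.uX) (≤-trans (≤-trans (m≤m+n (length IX) (length OX)) (≤-reflexive (sym PX.size))) B.lX) PY.ins
        λ u w i a nw → case PY.cover (B.cv u w (PX.ins⊑ i) a nw) of λ { (inj₁ k) → k ; (inj₂ k) → ⊥-elim (PY.outs∉ k (A.cv u w (PX.ins∈ i) a nw)) }
      total : length (A.Y ++ OY) + cnt U (X₁ ++ OX) + (length PY.ins + cnt U IX) ≡ (length A.Y + cnt U X₁) + (length B.Y + cnt U X₂)
      total = trans (cong₂ (λ a b → a + b + (length PY.ins + cnt U IX)) (length-++ A.Y) (cnt-part U {X₁ ++ OX} {X₁} {OX} (λ u i → ∈-++⁻ X₁ i) (λ u i → ∈-++⁺ˡ i) (λ u i → ∈-++⁺ʳ X₁ i) (λ u i j → PX.outs∉ j i)))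
        (trans (ar (length A.Y) (length OY) (cnt U X₁) (cnt U OX) (length PY.ins) (cnt U IX))
          (cong₂ (λ a b → length A.Y + cnt U X₁ + (a + b)) (sym PY.size) (sym (cnt-part U {X₂} {IX} {OX} (λ u i → PX.cover i) (λ u i → PX.ins⊑ i) (λ u i → PX.outs⊑ i) (λ u i j → PX.outs∉ j (PX.ins∈ i))))))
        where ar : ∀ a b c d e f → a + b + (c + d) + (e + f) ≡ a + c + ((e + b) + (f + d))
              ar = solve-∀
      right : D * length X₁ + D * length X₂ ≡ D * length (X₁ ++ OX) + D * length IX
      right = trans (cong (λ k → D * length X₁ + D * k) PX.size) (trans (ar (length X₁) (length IX) (length OX)) (cong (λ k → D * k + D * length IX) (sym (length-++ X₁))))
        where ar : ∀ a b c → D * a + D * (b + c) ≡ D * (a + c) + D * b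
              ar a b c = e D a b c
                where e : ∀ D a b c → D * a + D * (b + c) ≡ D * (a + c) + D * b
                      e = solve-∀

    Hits : List (Fin n) → Fin n → Set
    Hits X y = DN (Σ (Fin n) λ u → u ∈ X × Adj u y)

    -- If no free neighbour of `s` can be attached, each is blocked by a critical set that sees it
    -- and omits `s`. The union of these sets is critical and sees all free neighbours of `s`;
    -- adding `s` then gains no neighbour, although `s` still has load to spare, which contradicts
    -- validity.
    leaf : ∀ s → c1 U s < D → DN (Σ (Fin n) λ y → Adj s y × y ∉ Ω × Valid (y ∷ Ω) (s ∷ U))
    leaf s lt k = (enum (λ y → Adj s y × y ∉ Ω) >>= λ (ys , _ , inn , out) → hit ys out >>= λ (X , C , s∉ , h) → final ys inn X C s∉ h) id
      where
      hit1 : ∀ y → Adj s y → y ∉ Ω → DN (Σ (List (Fin n)) λ X → Crit X × s ∉ X × Hits X y)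
      hit1 y a y∉ k' = k (y , a , y∉ , valid)
        where
        valid : Valid (y ∷ Ω) (s ∷ U)
        valid X u l Y cv = ≮⇒≥ λ lt' → k' (X , record { uX = u ; lX = l ; Y = y ∷ Y ; cv = cvy ; tight = ≤-trans (+-monoʳ-≤ (suc (length Y)) (m≤n+m (cnt U X) (ind s X))) (≤-trans (≤-reflexive refl) (lt')) } , s∉ lt' , hits lt')
          where
          cvy : Cov Adj X (_∉ Ω) (y ∷ Y)
          cvy u' w i a' nw with w ≟V y
          ... | yes e = here e
          ... | no ne = there (cv u' w i a' λ { (here e) → ne e ; (there j) → nw j })
          s∉ : length Y + cnt (s ∷ U) X < D * length X → s ∉ X
          s∉ lt' i = <⇒≱ lt' (≤-trans (V X u l (y ∷ Y) cvy) (≤-reflexive (trans (sym (+-suc (length Y) (cnt U X))) (cong (λ j → length Y + (j + cnt U X)) (sym (ind-yes i))))))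
          hits : length Y + cnt (s ∷ U) X < D * length X → Hits X y
          hits lt' no-hit = <⇒≱ lt' (≤-trans (V X u l Y λ u' w i a' nw → cv u' w i a' λ { (here refl) → no-hit (u' , i , a') ; (there j) → nw j })
            (+-monoʳ-≤ (length Y) (m≤n+m (cnt U X) (ind s X))))
      hit : ∀ ys → (∀ y → y ∈ ys → Adj s y × y ∉ Ω) → DN (Σ (List (Fin n)) λ X → Crit X × s ∉ X × (∀ y → y ∈ ys → Hits X y))
      hit [] out = return ([] , record { uX = [] ; lX = z≤n ; Y = [] ; cv = λ _ _ () ; tight = ≤-trans (≤-reflexive (cnt-none U [] λ _ _ ())) z≤n } , (λ ()) , λ _ ())
      hit (y ∷ ys) out = hit ys (λ y i → out y (there i)) >>= λ (X₁ , C₁ , s₁ , h₁) → hit1 y (proj₁ (out y (here refl))) (proj₂ (out y (here refl))) >>= λ (X₂ , C₂ , s₂ , h₂) →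
        let (X , C , f , h) = crit-∪ C₁ C₂ in
        return (X , C , (λ i → Data.Sum.[ s₁ , s₂ ] (f s i)) , λ
          { _ (here refl) → h₂ >>= λ (u , i , a) → return (u , h u (inj₂ i) , a)
          ; y' (there j) → h₁ y' j >>= λ (u , i , a) → return (u , h u (inj₁ i) , a) })
      final : ∀ ys → (∀ y → Adj s y × y ∉ Ω → y ∈ ys) → ∀ X → Crit X → s ∉ X → (∀ y → y ∈ ys → Hits X y) → DN ⊥
      final ys inn X C s∉ h = return (<⇒≱ lt (+-cancelˡ-≤ (D * length X) _ _ (≤-trans (≤-reflexive (ar (length X)))
          (≤-trans (V (s ∷ X) (uniq-∷ s∉ uX) (≤-trans (crit-small C) (m≤n*m m 8)) Y cvs) (≤-trans (≤-reflexive (trans (cong (length Y +_) (cnt-part U {s ∷ X} {X} {s ∷ []}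
            (λ { u (here e) → inj₂ (here e) ; u (there i) → inj₁ i }) (λ u → there) (λ { u (here e) → here e }) (λ { u i (here refl) → s∉ i }))) (sym (+-assoc (length Y) _ _)))) (+-monoˡ-≤ (c1 U s) tight))))))
        where
        open Crit C
        ar : ∀ a → D * a + D ≡ D * suc a
        ar a = trans (+-comm (D * a) D) (sym (*-suc D a))
        cvs : Cov Adj (s ∷ X) (_∉ Ω) Y
        cvs u w (there i) a nw = cv u w i a nw
        cvs u w (here refl) a nw = dn-stable (SV._∈?_ w Y) (h w (inn w (a , nw)) >>= λ (u' , i , a') → return (cv u' w i a' nw))


-- Connecting two vertices through binary trees

Via : ∀ {A : Set} → (A → A → Set) → A → List A → A → Set
Via E u [] v = E u v
Via E u (x ∷ xs) v = E u x × Via E x xs v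

via-++ : ∀ {A : Set} {E : A → A → Set} {u y w} xs {ys} → Via E u xs y → Via E y ys w → Via E u (xs ++ y ∷ ys) w
via-++ [] e v = e , v
via-++ (x ∷ xs) (e , v) w = e , via-++ xs v w

via-rev : ∀ {A : Set} {E : A → A → Set} → (∀ {u v} → E u v → E v u) → ∀ {u w} xs → Via E u xs w → Via E w (reverse xs) u
via-rev s [] e = s e
via-rev {E = E} s {u} {w} (x ∷ xs) (e , v) = subst (λ l → Via E w l u) (sym (Data.List.Properties.unfold-reverse x xs)) (via-++ (reverse xs) (via-rev s xs v) (s e))

uniq-mid : ∀ {A : Set} (as : List A) {c R} → Unique (as ++ c ∷ R) → c ∉ as ++ R × Unique (as ++ R)
uniq-mid [] u = ∉-head u , uniq-tail u
uniq-mid (a ∷ as) {c} {R} u = (λ { (here refl) → ∉-head u (∈-++⁺ʳ as (here refl)) ; (there i) → proj₁ (uniq-mid as (uniq-tail u)) i })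
  , uniq-∷ (λ i → ∉-head u (case ∈-++⁻ as i of λ { (inj₁ k) → ∈-++⁺ˡ k ; (inj₂ k) → ∈-++⁺ʳ as (there k) })) (proj₂ (uniq-mid as (uniq-tail u)))

rev-∈ : ∀ {A : Set} {v : A} {xs} → v ∈ reverse xs → v ∈ xs
rev-∈ {xs = x ∷ xs} i with ∈-++⁻ (reverse xs) (subst (_ ∈_) (Data.List.Properties.unfold-reverse x xs) i)
... | inj₁ k = there (rev-∈ k)
... | inj₂ (here e) = here e

∈-rev : ∀ {A : Set} {v : A} {xs} → v ∈ xs → v ∈ reverse xs
∈-rev {xs = x ∷ xs} (here refl) = subst (_ ∈_) (sym (Data.List.Properties.unfold-reverse x xs)) (∈-++⁺ʳ (reverse xs) (here refl))
∈-rev {xs = x ∷ xs} (there i) = subst (_ ∈_) (sym (Data.List.Properties.unfold-reverse x xs)) (∈-++⁺ˡ (∈-rev i))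

uniq-rev : ∀ {A : Set} {xs : List A} → Unique xs → Unique (reverse xs)
uniq-rev {xs = []} u = []
uniq-rev {xs = x ∷ xs} u = subst Unique (sym (Data.List.Properties.unfold-reverse x xs))
  (uniq-++ (uniq-rev (uniq-tail u)) (uniq-∷ (λ ()) []) λ { i (here refl) → ∉-head u (rev-∈ i) })

module _ {n : ℕ} where
  cnt-mid : ∀ (B : List (Fin n)) u R X → cnt (B ++ u ∷ R) X ≡ ind u X + cnt (B ++ R) X
  cnt-mid [] u R X = refl
  cnt-mid (b ∷ B) u R X = trans (cong (ind b X +_) (cnt-mid B u R X)) (ar (ind b X) (ind u X) _)
    where ar : ∀ a b c → a + (b + c) ≡ b + (a + c)
          ar = solve-∀

  cnt-rev : ∀ (B : List (Fin n)) X → cnt (reverse B) X ≡ cnt B X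
  cnt-rev [] X = refl
  cnt-rev (b ∷ B) X = trans (cong (λ l → cnt l X) (Data.List.Properties.unfold-reverse b B)) (trans (cnt-mid (reverse B) b [] X) (cong (ind b X +_) (trans (cong (λ l → cnt l X) (++-identityʳ (reverse B))) (cnt-rev B X))))

  ∈-fst : ∀ {c u : Fin n} {tg : List (Fin n × Fin n)} → (c , u) ∈ tg → c ∈ map proj₁ tg
  ∈-fst i = ∈-map⁺ proj₁ i

  fst-inj : ∀ {tg : List (Fin n × Fin n)} → Unique (map proj₁ tg) → ∀ {c u u'} → (c , u) ∈ tg → (c , u') ∈ tg → u ≡ u'
  fst-inj u (here refl) (here refl) = refl
  fst-inj u (here refl) (there j) = ⊥-elim (∉-head u (∈-fst j))
  fst-inj u (there i) (here refl) = ⊥-elim (∉-head u (∈-fst i))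
  fst-inj u (there i) (there j) = fst-inj (uniq-tail u) i j

  kp : List (Fin n) → List (Fin n × Fin n) → List (Fin n × Fin n)
  kp K [] = []
  kp K (x ∷ tg) with SV._∈?_ (proj₁ x) K
  ... | yes _ = x ∷ kp K tg
  ... | no _ = kp K tg

  kp-in : ∀ {K tg x} → x ∈ kp K tg → x ∈ tg × proj₁ x ∈ K
  kp-in {K} {y ∷ tg} i with SV._∈?_ (proj₁ y) K
  kp-in {K} {y ∷ tg} (here refl) | yes k = here refl , k
  kp-in {K} {y ∷ tg} (there i) | yes k = let (a , b) = kp-in {K} {tg} i in there a , b
  ... | no _ = let (a , b) = kp-in {K} {tg} i in there a , b

  kp-keeps : ∀ {K tg x} → x ∈ tg → proj₁ x ∈ K → x ∈ kp K tg
  kp-keeps {K} {y ∷ tg} i k with SV._∈?_ (proj₁ y) K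
  kp-keeps {K} {y ∷ tg} (here refl) k | yes _ = here refl
  kp-keeps {K} {y ∷ tg} (there i) k | yes _ = there (kp-keeps i k)
  kp-keeps {K} {y ∷ tg} (here refl) k | no nk = ⊥-elim (nk k)
  kp-keeps {K} {y ∷ tg} (there i) k | no _ = kp-keeps i k

  kp-unique : ∀ {K tg} → Unique (map proj₁ tg) → Unique (kp K tg)
  kp-unique {K} {[]} u = []
  kp-unique {K} {y ∷ tg} u with SV._∈?_ (proj₁ y) K
  ... | yes _ = uniq-∷ (λ i → ∉-head u (∈-fst (proj₁ (kp-in {K} {tg} i)))) (kp-unique {K} {tg} (uniq-tail u))
  ... | no _ = kp-unique {K} {tg} (uniq-tail u)

  data Pth (tg : List (Fin n × Fin n)) (s : Fin n) : Fin n → List (Fin n) → Set where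
    nil  : Pth tg s s []
    cons : ∀ {u y xs} → Pth tg s u xs → (y , u) ∈ tg → Pth tg s y (y ∷ xs)

  pth-mono : ∀ {tg tg' s y xs} → (∀ x → x ∈ tg → x ∈ tg') → Pth tg s y xs → Pth tg' s y xs
  pth-mono f nil = nil
  pth-mono f (cons p i) = cons (pth-mono f p) (f _ i)

  pp : ∀ {tg s y xs} → Pth tg s y xs → List (Fin n × Fin n)
  pp nil = []
  pp (cons {u} {y} p i) = (y , u) ∷ pp p

  pp-has : ∀ {tg s y xs c} (p : Pth tg s y xs) → c ∈ xs → Σ (Fin n) λ u → (c , u) ∈ pp p × (c , u) ∈ tg
  pp-has (cons {u} p i) (here refl) = u , here refl , i
  pp-has (cons p i) (there j) = let (u , a , b) = pp-has p j in u , there a , b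

  pp-cnt : ∀ {tg s y xs} (p : Pth tg s y xs) X → ind y X + cnt (map proj₂ (pp p)) X ≤ ind s X + cnt xs X
  pp-cnt nil X = ≤-refl
  pp-cnt {s = s} (cons {u} {y} {xs} p i) X = ≤-trans (+-monoʳ-≤ (ind y X) (pp-cnt p X)) (≤-reflexive (ar (ind y X) (ind s X) (cnt xs X)))
    where ar : ∀ a b c → a + (b + c) ≡ b + (a + c)
          ar = solve-∀

  -- After pruning to one branch of a tree, only the parents along that branch remain charged: the
  -- root and the inner vertices, once each.
  kept-cnt : ∀ {tg s y xs} → Unique (map proj₁ tg) → (p : Pth tg s y xs) → ∀ X → cnt (map proj₂ (kp xs tg)) X ≤ ind s X + cnt xs X
  kept-cnt {tg} {s} {y} {xs} u p X = ≤-trans (cnt-sub {ks = kp xs tg} {ps = pp p} X (kp-unique {xs} {tg} u) λ k i → sub k i) (≤-trans (m≤n+m _ (ind y X)) (pp-cnt p X))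
    where
    sub : ∀ k → k ∈ kp xs tg → k ∈ pp p
    sub (c , v) i with kp-in {xs} {tg} i
    ... | j , c∈ with pp-has p c∈
    ... | v' , a , b = subst (λ w → (c , w) ∈ pp p) (fst-inj u b j) a

module Tree {n : ℕ} (S : Ground n) where
  open Ground S using (Adj; Adj-sym; m; D; joined)
  open Extend S

  filtV : ∀ K {Ω U} A B tg → Valid (A ++ map proj₁ tg ++ Ω) (B ++ map proj₂ tg ++ U) → Unique (A ++ map proj₁ tg ++ Ω) →
    (∀ c u → (c , u) ∈ tg → Adj u c) →
    Valid (A ++ map proj₁ (kp K tg) ++ Ω) (B ++ map proj₂ (kp K tg) ++ U) × Unique (A ++ map proj₁ (kp K tg) ++ Ω)
  filtV K A B [] V u a = V , u
  filtV K {Ω} {U} A B ((c , p) ∷ tg) V u a with SV._∈?_ c K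
  ... | yes _ = let (V' , u') = filtV K {Ω} {U} (A ++ c ∷ []) (B ++ p ∷ []) tg
                      (subst₂ Valid (sym (++-assoc A (c ∷ []) _)) (sym (++-assoc B (p ∷ []) _)) V) (subst Unique (sym (++-assoc A (c ∷ []) _)) u) (λ x y i → a x y (there i))
                in subst₂ Valid (++-assoc A (c ∷ []) _) (++-assoc B (p ∷ []) _) V' , subst Unique (++-assoc A (c ∷ []) _) u'
  ... | no _ = filtV K A B tg (prune {U₁ = B ++ p ∷ map proj₂ tg ++ U} {U = B ++ map proj₂ tg ++ U} V (λ v i → case ∈-++⁻ A i of λ { (inj₁ k) → ∈-++⁺ˡ k ; (inj₂ k) → ∈-++⁺ʳ A (there k) })
                 (∈-++⁺ʳ A (here refl)) (proj₁ (uniq-mid A u)) (a c p (here refl)) (λ X → ≤-reflexive (cnt-mid B p (map proj₂ tg ++ U) X)))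
                 (proj₂ (uniq-mid A u)) (λ x y i → a x y (there i))

  module _ (Ω U : List (Fin n)) (s : Fin n) (s∈ : s ∈ Ω) (U⊑ : ∀ u → u ∈ U → u ∈ Ω) (2≤D : 2 ≤ D) (L : ℕ) (room : L + length Ω + (D * (8 * m) + 8 * m + m) ≤ n) where

    record TS (tg : List (Fin n × Fin n)) : Set where
      field
        V   : Valid (map proj₁ tg ++ Ω) (map proj₂ tg ++ U)
        uΩ  : Unique (map proj₁ tg ++ Ω)
        adj : ∀ c u → (c , u) ∈ tg → Adj u c
        par : ∀ u → u ∈ map proj₂ tg → u ∈ s ∷ map proj₁ tg
        two : ∀ v → c1 (map proj₂ tg) v ≤ 2

    room-at : ∀ {tg : List (Fin n × Fin n)} → length tg ≤ L → Room (map proj₁ tg ++ Ω)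
    room-at {tg} le = ≤-trans (+-monoˡ-≤ _ (≤-trans (≤-reflexive (trans (length-++ (map proj₁ tg)) (cong (_+ length Ω) (length-map proj₁ tg)))) (+-monoˡ-≤ (length Ω) le))) room

    record Ready (tg : List (Fin n × Fin n)) (f : Fin n) : Set where
      field
        zero-par : c1 (map proj₂ tg) f ≡ 0
        spare    : c1 U f + 2 ≤ D
        known    : f ∈ s ∷ map proj₁ tg

    record Grown (tg : List (Fin n × Fin n)) (Fr : List (Fin n)) : Set where
      field
        tg'  : List (Fin n × Fin n)
        ts   : TS tg'
        F'   : List (Fin n)
        uF'  : Unique F'
        lF'  : length F' ≡ 2 * length Fr
        ltg' : length tg' ≡ length tg + 2 * length Fr
        sub  : ∀ x → x ∈ tg → x ∈ tg'
        new  : ∀ f → f ∈ F' → f ∉ s ∷ map proj₁ tg × (Σ (Fin n) λ u → u ∈ Fr × (f , u) ∈ tg')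
        par' : ∀ u → u ∈ map proj₂ tg' → u ∈ map proj₂ tg ⊎ u ∈ Fr

    grow1 : ∀ {tg} f → TS tg → length tg ≤ L → f ∈ s ∷ map proj₁ tg → c1 (map proj₂ tg) f ≤ 1 → c1 (map proj₂ tg) f + c1 U f < D →
      DN (Σ (Fin n) λ y → y ∉ s ∷ map proj₁ tg × TS ((y , f) ∷ tg))
    grow1 {tg} f t le f∈ one lt = leaf {U = map proj₂ tg ++ U} V (room-at {tg} le) f (subst (_< D) (sym (cnt-++ (map proj₂ tg) U (f ∷ []))) lt) >>= λ (y , a , y∉ , V') →
        return (y , (λ { (here refl) → y∉ (∈-++⁺ʳ (map proj₁ tg) s∈) ; (there i) → y∉ (∈-++⁺ˡ i) }) , record
          { V = V' ; uΩ = uniq-∷ y∉ uΩ ; adj = λ { c u (here refl) → a ; c u (there i) → adj c u i }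
          ; par = λ { u (here refl) → up f∈ ; u (there i) → up (par u i) }
          ; two = λ v → case f ≟V v of λ { (yes refl) → ≤-trans (+-monoˡ-≤ (c1 (map proj₂ tg) f) (≤-reflexive (ind-yes {u = f} {X = f ∷ []} (here refl)))) (s≤s one)
                                         ; (no ne) → ≤-trans (+-monoˡ-≤ (c1 (map proj₂ tg) v) (≤-reflexive (ind-no {u = f} {X = v ∷ []} λ { (here e) → ne e }))) (two v) } })
      where
      open TS t
      up : ∀ {x y} → x ∈ s ∷ map proj₁ tg → x ∈ s ∷ y ∷ map proj₁ tg
      up (here e) = here e
      up (there i) = there (there i)

    kids : ∀ tg Fr → TS tg → Unique Fr → length tg + 2 * length Fr ≤ L → (∀ f → f ∈ Fr → Ready tg f) → DN (Grown tg Fr)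
    kids tg [] t uFr le rd = return record { tg' = tg ; ts = t ; F' = [] ; uF' = [] ; lF' = refl ; ltg' = sym (+-identityʳ _)
      ; sub = λ x i → i ; new = λ _ () ; par' = λ u i → inj₁ i }
    kids tg (f ∷ Fr) t uFr le rd =
      grow1 f t (≤-trans (m≤m+n _ _) le) (Ready.known (rd f (here refl))) (≤-trans (≤-reflexive z₀) z≤n) (≤-trans (≤-reflexive (cong (λ k → suc (k + c1 U f)) z₀)) (≤-trans (≤-trans (n≤1+n _) (≤-reflexive (+-comm 2 (c1 U f)))) sp)) >>= λ (y₁ , n₁ , t₁) →
      grow1 f t₁ (≤-trans (≤-trans (≤-reflexive (+-comm 1 (length tg))) (+-monoʳ-≤ (length tg) (s≤s z≤n))) le) (up (Ready.known (rd f (here refl)))) (≤-reflexive (trans (cong (_+ c1 (map proj₂ tg) f) (ind-yes {u = f} {X = f ∷ []} (here refl))) (cong suc z₀)))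
         (≤-trans (≤-reflexive (cong (λ k → suc (k + c1 U f)) (trans (cong (_+ c1 (map proj₂ tg) f) (ind-yes {u = f} {X = f ∷ []} (here refl))) (cong suc z₀)))) (≤-trans (≤-reflexive (+-comm 2 (c1 U f))) sp)) >>= λ (y₂ , n₂ , t₂) →
      kids ((y₂ , f) ∷ (y₁ , f) ∷ tg) Fr t₂ (uniq-tail uFr) (≤-trans (≤-reflexive (ar (length tg) (length Fr))) le) (ready y₁ y₂) >>= λ G → return (mk y₁ y₂ n₁ n₂ G)
      where
      z₀ = Ready.zero-par (rd f (here refl))
      sp = Ready.spare (rd f (here refl))
      ar : ∀ a b → suc (suc a) + 2 * b ≡ a + 2 * suc b
      ar = solve-∀
      up : ∀ {x y} → x ∈ s ∷ map proj₁ tg → x ∈ s ∷ y ∷ map proj₁ tg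
      up (here e) = here e
      up (there i) = there (there i)
      ready : ∀ y₁ y₂ g → g ∈ Fr → Ready ((y₂ , f) ∷ (y₁ , f) ∷ tg) g
      ready y₁ y₂ g i = record { spare = Ready.spare (rd g (there i))
          ; known = case Ready.known (rd g (there i)) of λ { (here e) → here e ; (there j) → there (there (there j)) }
          ; zero-par = trans (cong₂ (λ a b → a + (b + _)) no-ind no-ind) (Ready.zero-par (rd g (there i))) }
        where no-ind : ind f (g ∷ []) ≡ 0
              no-ind = ind-no {u = f} {X = g ∷ []} λ { (here refl) → ∉-head uFr i }
      mk : ∀ y₁ y₂ → y₁ ∉ s ∷ map proj₁ tg → y₂ ∉ s ∷ y₁ ∷ map proj₁ tg → Grown ((y₂ , f) ∷ (y₁ , f) ∷ tg) Fr → Grown tg (f ∷ Fr)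
      mk y₁ y₂ n₁ n₂ G = record { tg' = tg' ; ts = ts ; F' = y₁ ∷ y₂ ∷ F'
          ; uF' = uniq-∷ (λ { (here refl) → n₂ (there (here refl)) ; (there i) → proj₁ (new _ i) (there (there (here refl))) }) (uniq-∷ (λ i → proj₁ (new _ i) (there (here refl))) uF')
          ; lF' = trans (cong (λ k → suc (suc k)) lF') (sym (*-suc 2 (length Fr))) ; ltg' = trans ltg' (ar (length tg) (length Fr))
          ; sub = λ x i → sub x (there (there i))
          ; new = λ { _ (here refl) → n₁ , f , here refl , sub _ (there (here refl))
                    ; _ (there (here refl)) → (λ { (here e) → n₂ (here e) ; (there i) → n₂ (there (there i)) }) , f , here refl , sub _ (here refl)
                    ; h (there (there i)) → let (a , u , b , c) = new h i in (λ { (here e) → a (here e) ; (there j) → a (there (there (there j))) }) , u , there b , c }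
          ; par' = λ u i → case par' u i of λ { (inj₁ (here refl)) → inj₂ (here refl) ; (inj₁ (there (here refl))) → inj₂ (here refl) ; (inj₁ (there (there j))) → inj₁ j ; (inj₂ j) → inj₂ (there j) } }
        where open Grown G

    record Lv (i : ℕ) : Set where
      field
        tg : List (Fin n × Fin n)
        ts : TS tg
        F  : List (Fin n)
        uF : Unique F
        lF : length F ≡ 2 ^ i
        lt : length tg + 2 ≤ 2 * 2 ^ i
        rd : ∀ f → f ∈ F → Ready tg f
        ph : ∀ f → f ∈ F → Σ (List (Fin n)) λ xs → Pth tg s f xs × Unique xs × (∀ x → x ∈ xs → x ∈ map proj₁ tg) × (length xs ≡ i)

    levels : Valid Ω U → Unique Ω → c1 U s + 2 ≤ D → ∀ i → 2 * 2 ^ i ≤ L → DN (Lv i)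
    levels V uΩ sp zero le = return record { tg = [] ; F = s ∷ [] ; uF = uniq-∷ (λ ()) [] ; lF = refl ; lt = ≤-refl
      ; ts = record { V = V ; uΩ = uΩ ; adj = λ _ _ () ; par = λ _ () ; two = λ _ → z≤n }
      ; rd = λ { _ (here refl) → record { zero-par = refl ; spare = sp ; known = here refl } }
      ; ph = λ { _ (here refl) → [] , nil , [] , (λ _ ()) , refl } }
    levels V uΩ sp (suc i) le = levels V uΩ sp i (≤-trans (*-monoʳ-≤ 2 (m≤n*m (2 ^ i) 2)) le) >>= λ l → kids (Lv.tg l) (Lv.F l) (Lv.ts l) (Lv.uF l) (fits l) (Lv.rd l) >>= λ G → return (next l G)
      where
      fits' : ∀ l → length (Lv.tg l) + 2 * length (Lv.F l) + 2 ≤ 2 * 2 ^ suc i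
      fits' l = ≤-trans (≤-reflexive (trans (cong (λ k → length (Lv.tg l) + 2 * k + 2) (Lv.lF l)) (ar (length (Lv.tg l)) (2 ^ i)))) (≤-trans (+-monoˡ-≤ (2 * 2 ^ i) (Lv.lt l)) (≤-reflexive (ar₂ (2 ^ i))))
        where ar : ∀ a b → a + 2 * b + 2 ≡ a + 2 + 2 * b
              ar = solve-∀
              ar₂ : ∀ b → 2 * b + 2 * b ≡ 2 * (2 * b)
              ar₂ = solve-∀
      fits : ∀ l → length (Lv.tg l) + 2 * length (Lv.F l) ≤ L
      fits l = ≤-trans (≤-trans (m≤m+n _ 2) (fits' l)) le
      next : (l : Lv i) → Grown (Lv.tg l) (Lv.F l) → Lv (suc i)
      next l G = record { tg = tg' ; ts = ts ; F = F' ; uF = uF' ; lF = trans lF' (cong (2 *_) (Lv.lF l))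
          ; lt = ≤-trans (≤-reflexive (cong (_+ 2) ltg')) (fits' l) ; rd = rd' ; ph = ph' }
        where
        open Grown G
        fresh : ∀ f → f ∈ F' → f ∉ Ω
        fresh f i k = let (_ , u , _ , e) = new f i in uniq-disj (map proj₁ tg') (TS.uΩ ts) (∈-fst e) k
        rd' : ∀ f → f ∈ F' → Ready tg' f
        rd' f i = let (f∉ , u , u∈ , e) = new f i in record
          { zero-par = c1-out λ k → case par' f k of λ { (inj₁ j) → f∉ (TS.par (Lv.ts l) f j) ; (inj₂ j) → f∉ (Ready.known (Lv.rd l f j)) }
          ; spare = ≤-trans (≤-reflexive (cong (_+ 2) (c1-out {U = U} λ k → fresh f i (U⊑ f k)))) 2≤D ; known = there (∈-fst e) }
        ph' : ∀ f → f ∈ F' → Σ (List (Fin n)) λ xs → Pth tg' s f xs × Unique xs × (∀ x → x ∈ xs → x ∈ map proj₁ tg') × (length xs ≡ suc i)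
        ph' f i with new f i
        ... | f∉ , u , u∈ , e with Lv.ph l u u∈
        ... | xs , p , ux , sx , lx = f ∷ xs , cons (pth-mono sub p) e , uniq-∷ (λ k → f∉ (there (sx f k))) ux
            , (λ { _ (here refl) → ∈-fst e ; x (there k) → let ((c , w) , j , eq) = ∈-map⁻ proj₁ (sx x k) in subst (_∈ map proj₁ tg') (sym eq) (∈-fst (sub _ j)) }) , cong suc lx

  uncons : ∀ {tg : List (Fin n × Fin n)} {s y xs i} → Pth tg s y xs → length xs ≡ suc i → (∀ c u → (c , u) ∈ tg → Adj u c) →
    Σ (List (Fin n)) λ ys → (xs ≡ y ∷ ys) × Via Adj y ys s × (length ys ≡ i)
  uncons nil () a
  uncons (cons {xs = []} nil i) refl a = [] , refl , Adj-sym (a _ _ i) , refl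
  uncons (cons {u} {xs = x ∷ xs} p i) e a with uncons p refl a
  ... | ys , refl , v , _ = x ∷ xs , refl , (Adj-sym (a _ _ i) , v) , suc-injective e

  kp-∈ : ∀ {v K} {tg : List (Fin n × Fin n)} → v ∈ K → v ∈ map proj₁ tg → v ∈ map proj₁ (kp K tg)
  kp-∈ k i with ∈-map⁻ proj₁ i
  ... | x , j , refl = ∈-map⁺ proj₁ (kp-keeps j k)

  joinPaths : ∀ {d Ω U tg₁ tg₂ s₁ s₂ a b xs₁ xs₂} → Valid (map proj₁ tg₂ ++ map proj₁ tg₁ ++ Ω) (map proj₂ tg₂ ++ map proj₂ tg₁ ++ U) →
    Unique (map proj₁ tg₂ ++ map proj₁ tg₁ ++ Ω) → Unique (map proj₁ tg₁ ++ Ω) → Unique Ω →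
    (∀ c u → (c , u) ∈ tg₁ → Adj u c) → (∀ c u → (c , u) ∈ tg₂ → Adj u c) →
    Pth tg₁ s₁ a xs₁ → Unique xs₁ → (∀ x → x ∈ xs₁ → x ∈ map proj₁ tg₁) →
    Pth tg₂ s₂ b xs₂ → Unique xs₂ → (∀ x → x ∈ xs₂ → x ∈ map proj₁ tg₂) →
    (Σ (List (Fin n)) λ ys → (xs₁ ≡ a ∷ ys) × Via Adj a ys s₁ × (length ys ≡ d)) →
    (Σ (List (Fin n)) λ ys → (xs₂ ≡ b ∷ ys) × Via Adj b ys s₂ × (length ys ≡ d)) → Adj a b →
    Σ (List (Fin n)) λ xs → (length xs ≡ 2 * suc d) × Via Adj s₁ xs s₂ × Unique (xs ++ Ω) × Valid (xs ++ Ω) (s₁ ∷ s₂ ∷ xs ++ U)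
  joinPaths {d} {Ω} {U} {tg₁} {tg₂} {s₁} {s₂} {a} {b} V₂ uΩ₂ uΩ₁ uΩ a₁ a₂ p₁ u₁ in₁ p₂ u₂ in₂ (ys₁ , refl , v₁ , le₁) (ys₂ , refl , v₂ , le₂) ab =
    xs , lxs , via-++ (reverse ys₁) (via-rev Adj-sym ys₁ v₁) (ab , v₂) , uniq-++ uxs uΩ (λ i k → case split i of λ { (inj₁ j) → off₁ j k ; (inj₂ j) → off₂ j (∈-++⁺ʳ (map proj₁ tg₁) k) })
      , weaken {U = map proj₂ (kp (b ∷ ys₂) tg₂) ++ map proj₂ (kp (a ∷ ys₁) tg₁) ++ U} {U' = s₁ ∷ s₂ ∷ (reverse ys₁ ++ a ∷ b ∷ ys₂) ++ U} (proj₁ step₂) sub cntle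
    where
    xs = reverse ys₁ ++ a ∷ b ∷ ys₂
    lxs : length xs ≡ 2 * suc d
    lxs = trans (length-++ (reverse ys₁)) (trans (cong₂ _+_ (trans (length-reverse ys₁) le₁) (cong (λ k → suc (suc k)) le₂)) (ar d))
      where ar : ∀ d → d + suc (suc d) ≡ 2 * suc d
            ar = solve-∀
    split : ∀ {v} → v ∈ xs → v ∈ a ∷ ys₁ ⊎ v ∈ b ∷ ys₂
    split i with ∈-++⁻ (reverse ys₁) i
    ... | inj₁ j = inj₁ (there (rev-∈ j))
    ... | inj₂ (here refl) = inj₁ (here refl)
    ... | inj₂ (there j) = inj₂ j
    off₁ : ∀ {v} → v ∈ a ∷ ys₁ → v ∉ Ω
    off₁ i = uniq-disj (map proj₁ tg₁) uΩ₁ (in₁ _ i)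
    off₂ : ∀ {v} → v ∈ b ∷ ys₂ → v ∉ map proj₁ tg₁ ++ Ω
    off₂ i = uniq-disj (map proj₁ tg₂) uΩ₂ (in₂ _ i)
    uxs : Unique xs
    uxs = uniq-++ (uniq-rev (uniq-tail u₁)) (uniq-∷ (λ i → off₂ i (∈-++⁺ˡ (in₁ a (here refl)))) u₂)
       λ i j → let k = rev-∈ i in case j of λ { (here refl) → ∉-head u₁ k ; (there l) → off₂ l (∈-++⁺ˡ (in₁ _ (there k))) }
    step₁ = filtV (b ∷ ys₂) {map proj₁ tg₁ ++ Ω} {map proj₂ tg₁ ++ U} [] [] tg₂ (V₂) uΩ₂ a₂
    step₂ = filtV (a ∷ ys₁) {Ω} {U} (map proj₁ (kp (b ∷ ys₂) tg₂)) (map proj₂ (kp (b ∷ ys₂) tg₂)) tg₁ (proj₁ step₁) (proj₂ step₁) a₁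
    sub : ∀ v → v ∈ xs ++ Ω → v ∈ map proj₁ (kp (b ∷ ys₂) tg₂) ++ map proj₁ (kp (a ∷ ys₁) tg₁) ++ Ω
    sub v i with ∈-++⁻ xs i
    ... | inj₂ k = ∈-++⁺ʳ (map proj₁ (kp (b ∷ ys₂) tg₂)) (∈-++⁺ʳ (map proj₁ (kp (a ∷ ys₁) tg₁)) k)
    ... | inj₁ k with split k
    ... | inj₁ j = ∈-++⁺ʳ (map proj₁ (kp (b ∷ ys₂) tg₂)) (∈-++⁺ˡ (kp-∈ j (in₁ _ j)))
    ... | inj₂ j = ∈-++⁺ˡ (kp-∈ j (in₂ _ j))
    ufst : ∀ {l r : List (Fin n)} → Unique (l ++ r) → Unique l
    ufst {l} = uniq-++ˡ l
    cntle : ∀ X → cnt (map proj₂ (kp (b ∷ ys₂) tg₂) ++ map proj₂ (kp (a ∷ ys₁) tg₁) ++ U) X ≤ cnt (s₁ ∷ s₂ ∷ xs ++ U) X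
    cntle X = ≤-trans (≤-reflexive (trans (cnt-++ (map proj₂ (kp (b ∷ ys₂) tg₂)) _ X) (cong (cnt (map proj₂ (kp (b ∷ ys₂) tg₂)) X +_) (cnt-++ (map proj₂ (kp (a ∷ ys₁) tg₁)) U X))))
      (≤-trans (+-mono-≤ (kept-cnt (ufst uΩ₂) p₂ X) (+-monoˡ-≤ (cnt U X) (kept-cnt (ufst uΩ₁) p₁ X)))
        (≤-reflexive (trans (ar (ind s₂ X) (ind b X) (cnt ys₂ X) (ind s₁ X) (ind a X) (cnt ys₁ X) (cnt U X)) (cong (λ k → ind s₁ X + (ind s₂ X + k))
          (sym (trans (cnt-++ xs U X) (cong (_+ cnt U X) (trans (cnt-++ (reverse ys₁) (a ∷ b ∷ ys₂) X) (cong (_+ (ind a X + (ind b X + cnt ys₂ X))) (cnt-rev ys₁ X))))))))))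
      where ar : ∀ s b y t a z u → (s + (b + y)) + ((t + (a + z)) + u) ≡ t + (s + ((z + (a + (b + y))) + u))
            ar = solve-∀

  -- Binary trees of depth d + 1 have at least `m` leaves each, so an edge joins a leaf of one to a
  -- leaf of the other. Everything off the resulting path is pruned, which returns the space and the
  -- loads; the room for two full trees, 4·2^(d+1), is needed only temporarily. All paths so
  -- obtained have the same length.
  connect : ∀ d Ω U s₁ s₂ → m ≤ 2 ^ suc d → Valid Ω U → Unique Ω → s₁ ∈ Ω → s₂ ∈ Ω → (∀ u → u ∈ U → u ∈ Ω) →
    c1 U s₁ + 4 ≤ D → c1 U s₂ + 4 ≤ D → 4 * 2 ^ suc d + length Ω + (D * (8 * m) + 8 * m + m) ≤ n →
    DN (Σ (List (Fin n)) λ xs → (length xs ≡ 2 * suc d) × Via Adj s₁ xs s₂ × Unique (xs ++ Ω) × Valid (xs ++ Ω) (s₁ ∷ s₂ ∷ xs ++ U))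
  connect d Ω U s₁ s₂ mle V uΩ s₁∈ s₂∈ U⊑ sp₁ sp₂ room =
      levels Ω U s₁ s₁∈ U⊑ 2≤D L room₁ V uΩ (≤-trans (+-monoʳ-≤ (c1 U s₁) {2} {4} (s≤s (s≤s z≤n))) sp₁) (suc d) ≤-refl >>= λ l₁ → second l₁
    where
    L = 2 * 2 ^ suc d
    2≤D : 2 ≤ D
    2≤D = ≤-trans (≤-trans {2} {4} (s≤s (s≤s z≤n)) (m≤n+m 4 (c1 U s₁))) sp₁
    base = D * (8 * m) + 8 * m + m
    room₁ : L + length Ω + base ≤ n
    room₁ = ≤-trans (+-monoˡ-≤ base (+-monoˡ-≤ (length Ω) (*-monoˡ-≤ (2 ^ suc d) {2} {4} (s≤s (s≤s z≤n))))) room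
    second : Lv Ω U s₁ s₁∈ U⊑ 2≤D L room₁ (suc d) → DN _
    second l₁ = levels Ω₁ U₁ s₂ (∈-++⁺ʳ (map proj₁ tg₁) s₂∈) U₁⊑ 2≤D L room₂ (TS.V ts₁) (TS.uΩ ts₁) sp (suc d) ≤-refl >>= λ l₂ → return (fin l₂)
      where
      open Lv l₁ renaming (tg to tg₁; ts to ts₁; F to F₁; uF to uF₁; lF to lF₁; lt to lt₁; rd to rd₁; ph to ph₁)
      Ω₁ = map proj₁ tg₁ ++ Ω
      U₁ = map proj₂ tg₁ ++ U
      U₁⊑ : ∀ u → u ∈ U₁ → u ∈ Ω₁
      U₁⊑ u i = case ∈-++⁻ (map proj₂ tg₁) i of λ { (inj₁ k) → (case TS.par ts₁ u k of λ { (here refl) → ∈-++⁺ʳ (map proj₁ tg₁) s₁∈ ; (there j) → ∈-++⁺ˡ j })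
                                                  ; (inj₂ k) → ∈-++⁺ʳ (map proj₁ tg₁) (U⊑ u k) }
      room₂ : L + length Ω₁ + base ≤ n
      room₂ = ≤-trans (+-monoˡ-≤ base (≤-trans (+-monoʳ-≤ L (≤-trans (≤-reflexive (trans (length-++ (map proj₁ tg₁)) (cong (_+ length Ω) (length-map proj₁ tg₁)))) (+-monoˡ-≤ (length Ω) (≤-trans (m≤m+n _ 2) lt₁))))
                (≤-reflexive (ar (2 ^ suc d) (length Ω))))) room
        where ar : ∀ a b → 2 * a + (2 * a + b) ≡ 4 * a + b
              ar = solve-∀
      -- The first tree loads any vertex at most twice and the second root needs two children of its
      -- own; together they account for the 4.
      sp : c1 U₁ s₂ + 2 ≤ D
      sp = ≤-trans (+-monoˡ-≤ 2 (≤-trans (≤-reflexive (cnt-++ (map proj₂ tg₁) U (s₂ ∷ []))) (+-monoˡ-≤ (c1 U s₂) (TS.two ts₁ s₂)))) (≤-trans (≤-reflexive (ar (c1 U s₂))) sp₂)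
        where ar : ∀ a → 2 + a + 2 ≡ a + 4
              ar = solve-∀
      fin : Lv Ω₁ U₁ s₂ (∈-++⁺ʳ (map proj₁ tg₁) s₂∈) U₁⊑ 2≤D L room₂ (suc d) → _
      fin l₂ with joined F₁ F₂ uF₁ uF₂ dis (≤-trans mle (≤-reflexive (sym lF₁))) (≤-trans mle (≤-reflexive (sym lF₂)))
        where
        open Lv l₂ renaming (tg to tg₂; ts to ts₂; F to F₂; uF to uF₂; lF to lF₂; lt to lt₂; rd to rd₂; ph to ph₂)
        dis : ∀ v → v ∈ F₁ → v ∉ F₂
        dis v i j with ph₁ v i | ph₂ v j
        ... | xs₁ , p₁ , _ , s₁' , e₁ | xs₂ , p₂ , _ , s₂' , e₂ with uncons p₁ e₁ (TS.adj ts₁) | uncons p₂ e₂ (TS.adj ts₂)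
        ... | _ , refl , _ | _ , refl , _ = uniq-disj (map proj₁ tg₂) (TS.uΩ ts₂) (s₂' v (here refl)) (∈-++⁺ˡ (s₁' v (here refl)))
      ... | a , b , a∈ , b∈ , ab with ph₁ a a∈ | Lv.ph l₂ b b∈
      ... | xs₁ , p₁ , u₁ , in₁ , e₁ | xs₂ , p₂ , u₂ , in₂ , e₂ = joinPaths (TS.V (Lv.ts l₂)) (TS.uΩ (Lv.ts l₂)) (TS.uΩ ts₁) uΩ (TS.adj ts₁) (TS.adj (Lv.ts l₂))
          p₁ u₁ in₁ p₂ u₂ in₂ (uncons p₁ e₁ (TS.adj ts₁)) (uncons p₂ e₂ (TS.adj (Lv.ts l₂))) ab


-- Gadgets and the chain of blocks

-- A list that contains a duplicate-free list and is no longer is a rearrangement of it. This passes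
-- between the order in which vertices were embedded and their order along a path.
uniq-len : ∀ {n} {xs ys : List (Fin n)} → Unique xs → (∀ v → v ∈ xs → v ∈ ys) → length ys ≤ length xs → Unique ys × (∀ v → v ∈ ys → v ∈ xs)
uniq-len {n} {xs} {ys} u s le = uq xs ys u s le , back
  where
  back : ∀ v → v ∈ ys → v ∈ xs
  back v i with SV._∈?_ v xs
  ... | yes k = k
  ... | no k = ⊥-elim (<⇒≱ (pigeon {xs = v ∷ xs} {ys = ys} (uniq-∷ k u) λ { (here refl) → i ; (there j) → s _ j }) le)
  uq : ∀ (xs ys : List (Fin n)) → Unique xs → (∀ v → v ∈ xs → v ∈ ys) → length ys ≤ length xs → Unique ys
  uq xs [] u s le = []
  uq xs (y ∷ ys) u s le = uniq-∷ y∉ (uq outs ys (uouts u) sub le')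
    where
    parts = SV.split xs (y ∷ [])
    open SV.Parts parts
    y∉ : y ∉ ys
    y∉ i = <⇒≱ (≤-trans (s≤s (pigeon {ys = ys} u λ j → case s _ j of λ { (here refl) → i ; (there k) → k })) ≤-refl) le
    sub : ∀ v → v ∈ outs → v ∈ ys
    sub v i = case s v (outs⊑ i) of λ { (here e) → ⊥-elim (outs∉ i (here e)) ; (there k) → k }
    le' : length ys ≤ length outs
    le' = +-cancelˡ-≤ 1 _ _ (≤-trans le (SV.outs≥ parts u))

-- `Ws` and `Ws'` are one vertex set in two orders, without the end vertices c, t1 and t3. It
-- consists of one vertex of a cycle, two rails of d vertices and d rungs of 2(d + 1) vertices, as
-- counted in `lW`.
record Block {n : ℕ} (Adj : Fin n → Fin n → Set) (d lam : ℕ) (e : Fin n) : Set where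
  field
    c t1 t2 t3 : Fin n
    Ws Ws' Ls  : List (Fin n)
    ec  : Adj e c
    vW  : Via Adj c Ws t1
    vW' : Via Adj c Ws' t3
    uW' : Unique Ws'
    W⊑  : ∀ v → v ∈ Ws → v ∈ Ws'
    W⊒  : ∀ v → v ∈ Ws' → v ∈ Ws
    t12 : Adj t1 t2
    t23 : Adj t2 t3
    vL  : Via Adj t1 Ls t2
    lL  : length Ls ≡ lam + 2 * suc d
    lW  : length Ws ≡ suc (2 * d + d * (2 * suc d))
  virt occ : List (Fin n)
  virt = c ∷ t1 ∷ Ls ++ t2 ∷ t3 ∷ []
  occ = virt ++ Ws

data Chain {n : ℕ} (Adj : Fin n → Fin n → Set) (d lam : ℕ) (x : Fin n) : ℕ → Fin n → Set where
  nil  : Chain Adj d lam x 0 x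
  snoc : ∀ {k e} → Chain Adj d lam x k e → (b : Block Adj d lam e) → Chain Adj d lam x (suc k) (Block.t3 b)

occs virts wss : ∀ {n Adj d lam k} {x e : Fin n} → Chain Adj d lam x k e → List (Fin n)
occs nil = []
occs (snoc ch b) = Block.occ b ++ occs ch
virts nil = []
virts (snoc ch b) = virts ch ++ Block.virt b
wss nil = []
wss (snoc ch b) = Block.Ws b ++ wss ch

module Build {n : ℕ} (S : Ground n) where
  open Ground S using (Adj; Adj-sym; m; D; joined; d; mle; 6≤D)
  open Extend S
  open Tree S using (connect)

  base K : ℕ
  base = D * (8 * m) + 8 * m + m
  K = 4 * 2 ^ suc d + base

  record St (Ω U : List (Fin n)) : Set where
    field
      V  : Valid Ω U
      uΩ : Unique Ω
      U⊑ : ∀ u → u ∈ U → u ∈ Ω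

  st-re : ∀ {Ω Ω₂ U} → St Ω U → (∀ v → v ∈ Ω → v ∈ Ω₂) → length Ω₂ ≤ length Ω → St Ω₂ U
  st-re {Ω} {Ω₂} {U} s f le = let (u , g) = uniq-len (St.uΩ s) f le in record { V = weaken {U = U} {U' = U} (St.V s) g (λ X → ≤-refl) ; uΩ = u ; U⊑ = λ v i → f v (St.U⊑ s v i) }

  Rm : ℕ → List (Fin n) → Set
  Rm k Ω = k + length Ω + K ≤ n

  rm-mono : ∀ j k {Ω Ω'} → Rm k Ω → j + length Ω' ≤ k + length Ω → Rm j Ω'
  rm-mono j k r le = ≤-trans (+-monoˡ-≤ K le) r

  c1-≢ : ∀ (s v : Fin n) U → s ≢ v → c1 (s ∷ U) v ≡ c1 U v
  c1-≢ s v U ne = cong (_+ c1 U v) (ind-no {u = s} {X = v ∷ []} λ { (here e) → ne e })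

  c1-≡ : ∀ (s : Fin n) U → c1 (s ∷ U) s ≡ suc (c1 U s)
  c1-≡ s U = cong (_+ c1 U s) (ind-yes {u = s} {X = s ∷ []} (here refl))

  op-leaf : ∀ {Ω U s} → St Ω U → Rm 0 Ω → s ∈ Ω → c1 U s + 4 ≤ D → DN (Σ (Fin n) λ y → Adj s y × St (y ∷ Ω) (s ∷ U))
  op-leaf {Ω} {U} {s} st rm s∈ ld = leaf {Ω = Ω} {U = U} V (≤-trans (+-monoʳ-≤ (length Ω) (m≤n+m base (4 * 2 ^ suc d))) rm) s (≤-trans (≤-trans (≤-reflexive (+-comm 1 (c1 U s))) (+-monoʳ-≤ (c1 U s) {1} {4} (s≤s z≤n))) ld) >>= λ (y , a , y∉ , V') →
    return (y , a , record { V = V' ; uΩ = uniq-∷ y∉ uΩ ; U⊑ = λ { _ (here refl) → there s∈ ; u (there i) → there (U⊑ u i) } })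
    where open St st

  op-conn : ∀ {Ω U} s₁ s₂ → St Ω U → Rm 0 Ω → s₁ ∈ Ω → s₂ ∈ Ω → c1 U s₁ + 4 ≤ D → c1 U s₂ + 4 ≤ D →
    DN (Σ (List (Fin n)) λ xs → (length xs ≡ 2 * suc d) × Via Adj s₁ xs s₂ × St (xs ++ Ω) (s₁ ∷ s₂ ∷ xs ++ U))
  op-conn {Ω} {U} s₁ s₂ st rm i₁ i₂ l₁ l₂ = connect d Ω U s₁ s₂ mle V uΩ i₁ i₂ U⊑ l₁ l₂ (≤-trans (≤-reflexive (ar (4 * 2 ^ suc d) (length Ω) base)) rm) >>= λ (xs , e , v , u , V') →
    return (xs , e , v , record { V = V' ; uΩ = u ; U⊑ = λ { _ (here refl) → ∈-++⁺ʳ xs i₁ ; _ (there (here refl)) → ∈-++⁺ʳ xs i₂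
      ; w (there (there i)) → case ∈-++⁻ xs i of λ { (inj₁ k) → ∈-++⁺ˡ k ; (inj₂ k) → ∈-++⁺ʳ xs (U⊑ w k) } } })
    where
    open St st
    ar : ∀ a b c → a + b + c ≡ b + (a + c)
    ar = solve-∀

  c1-conn : ∀ {Ω U s₁ s₂ xs} {v : Fin n} → Unique (xs ++ Ω) → v ∈ Ω → v ≢ s₁ → v ≢ s₂ → c1 (s₁ ∷ s₂ ∷ xs ++ U) v ≡ c1 U v
  c1-conn {Ω} {U} {s₁} {s₂} {xs} {v} u v∈ n₁ n₂ = trans (c1-≢ s₁ v (s₂ ∷ xs ++ U) (λ e → n₁ (sym e))) (trans (c1-≢ s₂ v (xs ++ U) (λ e → n₂ (sym e)))
    (trans (cnt-++ xs U (v ∷ [])) (cong (_+ c1 U v) (c1-out {U = xs} {v = v} λ i → uniq-disj xs u i v∈))))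

  c1-uniq : ∀ (xs : List (Fin n)) {v} → Unique xs → c1 xs v ≤ 1
  c1-uniq [] u = z≤n
  c1-uniq (x ∷ xs) {v} u = case x ≟V v of λ
    { (yes refl) → ≤-reflexive (trans (c1-≡ x xs) (cong suc (c1-out {U = xs} {v = x} (∉-head u))))
    ; (no ne) → ≤-trans (≤-reflexive (c1-≢ x v xs ne)) (c1-uniq xs (uniq-tail u)) }

  c1-new : ∀ {Ω U s₁ s₂ xs} {v : Fin n} → Unique (xs ++ Ω) → v ∈ xs → (∀ u → u ∈ U → u ∈ Ω) → s₁ ∈ Ω → s₂ ∈ Ω → c1 (s₁ ∷ s₂ ∷ xs ++ U) v ≤ 1
  c1-new {Ω} {U} {s₁} {s₂} {xs} {v} u i U⊑ i₁ i₂ = ≤-trans (≤-reflexive (trans (c1-≢ s₁ v (s₂ ∷ xs ++ U) (λ { refl → out i i₁ })) (trans (c1-≢ s₂ v (xs ++ U) (λ { refl → out i i₂ }))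
      (trans (cnt-++ xs U (v ∷ [])) (trans (cong (c1 xs v +_) (c1-out {U = U} {v = v} λ k → out i (U⊑ v k))) (+-identityʳ _)))))) (c1-uniq xs (uniq-++ˡ xs u))
    where out : ∀ {v} → v ∈ xs → v ∉ Ω
          out = uniq-disj xs u

  data Rungs : List (Fin n) → List (Fin n) → List (Fin n) → Set where
    nil  : Rungs [] [] []
    cons : ∀ {a b As Bs Os} Q → Via Adj a Q b → Rungs As Bs Os → Rungs (a ∷ As) (b ∷ Bs) (Q ++ Os)

  record Lad (As Bs Ω U : List (Fin n)) : Set where
    field
      Os    : List (Fin n)
      rungs : Rungs As Bs Os
      lO    : length Os ≡ length As * (2 * suc d)
      U'    : List (Fin n)
      st    : St (Os ++ Ω) U'
      frame : ∀ v → v ∈ Ω → v ∉ As ++ Bs → c1 U' v ≤ c1 U v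

  lad : ∀ As Bs {Ω U} → length As ≡ length Bs → St Ω U → (∀ v → v ∈ As ++ Bs → v ∈ Ω × c1 U v ≤ 1) → Unique (As ++ Bs) →
    Rm (length As * (2 * suc d)) Ω → DN (Lad As Bs Ω U)
  lad [] [] {Ω} {U} e st lo u rm = return record { Os = [] ; rungs = nil ; lO = refl ; U' = U ; st = st ; frame = λ v _ _ → ≤-refl {c1 U v} }
  lad (a ∷ As) (b ∷ Bs) {Ω} {U} e st lo u rm =
    op-conn a b st (rm-mono 0 (suc (length As) * (2 * suc d)) {Ω = Ω} {Ω' = Ω} rm (m≤n+m _ _)) (proj₁ (lo a a∈)) (proj₁ (lo b b∈)) (load (proj₂ (lo a a∈))) (load (proj₂ (lo b b∈))) >>= λ (Q , lQ , vQ , st₁) →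
    lad As Bs {Q ++ Ω} {a ∷ b ∷ Q ++ U} (suc-injective e) st₁ (λ v i → ∈-++⁺ʳ Q (proj₁ (lo v (wk i))) ,
        ≤-trans (≤-reflexive (c1-conn {Ω} {U} {a} {b} {Q} {v} (St.uΩ st₁) (proj₁ (lo v (wk i))) (λ { refl → ∉-head u (mid i) }) (λ { refl → proj₁ (uniq-mid As (uniq-tail u)) i }))) (proj₂ (lo v (wk i))))
      (proj₂ (uniq-mid As (uniq-tail u))) (rm-mono (length As * (2 * suc d)) (suc (length As) * (2 * suc d)) {Ω = Ω} {Ω' = Q ++ Ω} rm (≤-reflexive (trans (cong (length As * (2 * suc d) +_) (trans (length-++ Q) (cong (_+ length Ω) lQ))) (ar (length As) (2 * suc d) (length Ω))))) >>= λ L →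
    return (fin Q lQ vQ st₁ L)
    where
    a∈ : a ∈ a ∷ As ++ b ∷ Bs
    a∈ = here refl
    b∈ : b ∈ a ∷ As ++ b ∷ Bs
    b∈ = there (∈-++⁺ʳ As (here refl))
    load : ∀ {k} → k ≤ 1 → k + 4 ≤ D
    load h = ≤-trans (+-monoˡ-≤ 4 h) (≤-trans (n≤1+n 5) 6≤D)
    mid : ∀ {v} → v ∈ As ++ Bs → v ∈ As ++ b ∷ Bs
    mid i = case ∈-++⁻ As i of λ { (inj₁ k) → ∈-++⁺ˡ k ; (inj₂ k) → ∈-++⁺ʳ As (there k) }
    wk : ∀ {v} → v ∈ As ++ Bs → v ∈ a ∷ As ++ b ∷ Bs
    wk i = there (mid i)
    ar : ∀ a b c → a * b + (b + c) ≡ suc a * b + c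
    ar = solve-∀
    fin : ∀ Q → length Q ≡ 2 * suc d → Via Adj a Q b → St (Q ++ Ω) (a ∷ b ∷ Q ++ U) → Lad As Bs (Q ++ Ω) (a ∷ b ∷ Q ++ U) → Lad (a ∷ As) (b ∷ Bs) Ω U
    fin Q lQ vQ st₁ L = record { Os = Q ++ Os ; rungs = cons Q vQ rungs ; lO = trans (length-++ Q) (cong₂ _+_ lQ lO) ; U' = U'
        ; st = st-re st₂ (λ v i → case ∈-++⁻ Os i of λ { (inj₁ k) → ∈-++⁺ˡ (∈-++⁺ʳ Q k) ; (inj₂ k) → case ∈-++⁻ Q k of λ { (inj₁ l) → ∈-++⁺ˡ (∈-++⁺ˡ l) ; (inj₂ l) → ∈-++⁺ʳ (Q ++ Os) l } })
            (≤-reflexive (trans (length-++ (Q ++ Os)) (trans (cong (_+ length Ω) (length-++ Q)) (trans (ar₂ (length Q) (length Os) (length Ω)) (sym (trans (length-++ Os) (cong (length Os +_) (length-++ Q))))))))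
        ; frame = λ v v∈ v∉ → ≤-trans (frame v (∈-++⁺ʳ Q v∈) (λ i → v∉ (wk i))) (≤-reflexive (c1-conn {Ω} {U} {a} {b} {Q} {v} (St.uΩ st₁) v∈ (λ e → v∉ (here e)) (λ e → v∉ (there (∈-++⁺ʳ As (here e)))))) }
      where
      open Lad L renaming (st to st₂)
      ar₂ : ∀ a b c → a + b + c ≡ b + (a + c)
      ar₂ = solve-∀

  record Ext (k : ℕ) (s : Fin n) (Ω U : List (Fin n)) : Set where
    field
      xs    : List (Fin n)
      z     : Fin n
      lx    : length xs ≡ k
      via   : ∀ {ys v} → Via Adj z ys v → Via Adj s (xs ++ ys) v
      U'    : List (Fin n)
      st    : St (xs ++ Ω) U'
      z∈    : z ∈ xs ++ Ω
      zld   : c1 U' z + 4 ≤ D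
      zpos  : z ≡ s ⊎ z ∉ Ω
      frame : ∀ v → v ∈ Ω → v ≢ s → c1 U' v ≤ c1 U v

  -- `connect` yields only one length, so the length of the long path is supplied by growing leaf
  -- after leaf. `zpos` and `frame` record that no other old vertex gets an additional load.
  ext : ∀ k s {Ω U} → St Ω U → s ∈ Ω → c1 U s + 4 ≤ D → Rm k Ω → DN (Ext k s Ω U)
  ext zero s {Ω} {U} st s∈ ld rm = return record { xs = [] ; z = s ; lx = refl ; via = λ v → v ; U' = U ; st = st ; z∈ = s∈ ; zld = ld ; zpos = inj₁ refl ; frame = λ v _ _ → ≤-refl {c1 U v} }
  ext (suc k) s {Ω} {U} st s∈ ld rm = op-leaf st (rm-mono 0 (suc k) {Ω = Ω} {Ω' = Ω} rm (m≤n+m _ _)) s∈ ld >>= λ (y , a , st₁) →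
    ext k y {y ∷ Ω} {s ∷ U} st₁ (here refl) (≤-trans (≤-reflexive (cong (_+ 4) (c1-out {U = s ∷ U} {v = y} (y-out st₁)))) (≤-trans (≤-trans (n≤1+n 4) (n≤1+n 5)) 6≤D))
      (rm-mono k (suc k) {Ω = Ω} {Ω' = y ∷ Ω} rm (≤-reflexive (+-suc k (length Ω)))) >>= λ E → return (fin y a st₁ E)
    where
    y-out : ∀ {y} → St (y ∷ Ω) (s ∷ U) → y ∉ s ∷ U
    y-out st₁ (here refl) = ∉-head (St.uΩ st₁) s∈
    y-out st₁ (there i) = ∉-head (St.uΩ st₁) (St.U⊑ st _ i)
    fin : ∀ y → Adj s y → St (y ∷ Ω) (s ∷ U) → Ext k y (y ∷ Ω) (s ∷ U) → Ext (suc k) s Ω U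
    fin y a st₁ E = record { xs = y ∷ xs ; z = z ; lx = cong suc lx ; via = λ v → a , via v ; U' = U'
        ; st = st-re st₂ (λ v i → case ∈-++⁻ xs i of λ { (inj₁ j) → there (∈-++⁺ˡ j) ; (inj₂ (here e)) → here e ; (inj₂ (there j)) → there (∈-++⁺ʳ xs j) }) len
        ; z∈ = case ∈-++⁻ xs z∈ of λ { (inj₁ j) → there (∈-++⁺ˡ j) ; (inj₂ (here e)) → here e ; (inj₂ (there j)) → there (∈-++⁺ʳ xs j) }
        ; zld = zld ; zpos = inj₂ λ i → case zpos of λ { (inj₁ refl) → ∉-head (St.uΩ st₁) i ; (inj₂ ni) → ni (there i) }
        ; frame = λ v v∈ ne → ≤-trans (frame v (there v∈) λ { refl → ∉-head (St.uΩ st₁) v∈ }) (≤-reflexive (c1-≢ s v U λ e → ne (sym e))) }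
      where
      open Ext E renaming (st to st₂)
      len : suc (length (xs ++ Ω)) ≤ length (xs ++ y ∷ Ω)
      len = ≤-reflexive (trans (cong suc (length-++ xs)) (trans (sym (+-suc (length xs) (length Ω))) (sym (length-++ xs))))


-- Hamilton paths of the ladder and assembly of a gadget

via-split : ∀ {A : Set} {E : A → A → Set} {u y w} xs {ys} → Via E u (xs ++ y ∷ ys) w → Via E u xs y × Via E y ys w
via-split [] (e , v) = e , v
via-split (x ∷ xs) (e , v) = let (a , b) = via-split xs v in (e , a) , b

cutAt : ∀ {A : Set} h {k} (l : List A) → length l ≡ h + suc k →
  Σ (List A) λ as → Σ A λ x → Σ (List A) λ bs → (l ≡ as ++ x ∷ bs) × (length as ≡ h) × (length bs ≡ k)
cutAt zero (x ∷ l) e = [] , x , l , refl , refl , suc-injective e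
cutAt (suc h) (x ∷ l) e = let (as , y , bs , a , b , c) = cutAt h l (suc-injective e) in x ∷ as , y , bs , cong (x ∷_) a , cong suc b , c

cutThree : ∀ {A : Set} h {k} (l : List A) → length l ≡ h + suc (suc (suc k)) →
  Σ (List A) λ as → Σ A λ x → Σ A λ y → Σ A λ z → Σ (List A) λ bs → (l ≡ as ++ x ∷ y ∷ z ∷ bs) × (length as ≡ h) × (length bs ≡ k)
cutThree h l e with cutAt h l e
... | as , x , y ∷ z ∷ bs , a , b , c = as , x , y , z , bs , a , b , suc-injective (suc-injective c)

module Blocks {n : ℕ} (S : Ground n) where
  open Ground S
  open Build S

  record Ham (c t1 t3 : Fin n) (L : List (Fin n)) : Set where
    field
      Ws Ws' : List (Fin n)
      vW  : Via Adj c Ws t1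
      vW' : Via Adj c Ws' t3
      inc : ∀ v → v ∈ L → v ∈ Ws × v ∈ Ws'
      lW  : length Ws ≡ length L
      lW' : length Ws' ≡ length L

  -- Going down the ladder the two Hamilton paths swap sides at every rung.
  ham : ∀ {c x y t1 t3 As Bs Os} S PA PB → Rungs As Bs Os → Via Adj x As t1 → Via Adj y Bs t3 → Via Adj c PA x → Via Adj c PB y →
    (∀ v → v ∈ S → v ∈ PA ++ x ∷ [] × v ∈ PB ++ y ∷ []) → suc (length PA) ≡ length S → suc (length PB) ≡ length S → Ham c t1 t3 (S ++ As ++ Bs ++ Os)
  ham {x = x} {y} S PA PB nil vx vy vA vB inc lA lB = record { Ws = PA ++ x ∷ [] ; Ws' = PB ++ y ∷ [] ; vW = via-++ PA vA vx ; vW' = via-++ PB vB vy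
    ; inc = λ v i → inc v (subst (v ∈_) (++-identityʳ S) i)
    ; lW = trans (trans (length-++ PA) (+-comm (length PA) 1)) (trans lA (cong length (sym (++-identityʳ S))))
    ; lW' = trans (trans (length-++ PB) (+-comm (length PB) 1)) (trans lB (cong length (sym (++-identityʳ S)))) }
  ham {c} {x} {y} {t1} {t3} S PA PB (cons {a} {b} {As} {Bs} {Os} Q vQ r) (xa , vx) (yb , vy) vA vB inc lA lB =
      record { Ham H ; inc = λ v i → Ham.inc H v (conv i) ; lW = trans (Ham.lW H) lc ; lW' = trans (Ham.lW' H) lc }
    where
    S' = S ++ a ∷ b ∷ Q
    old : ∀ {v} (P : List (Fin n)) {z u l e} → v ∈ P ++ z ∷ [] → v ∈ (P ++ z ∷ u ∷ l) ++ e ∷ []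
    old P i = ∈-++⁺ˡ (case ∈-++⁻ P i of λ { (inj₁ k) → ∈-++⁺ˡ k ; (inj₂ (here e)) → ∈-++⁺ʳ P (here e) })
    inc' : ∀ v → v ∈ S' → v ∈ (PB ++ y ∷ b ∷ reverse Q) ++ a ∷ [] × v ∈ (PA ++ x ∷ a ∷ Q) ++ b ∷ []
    inc' v i with ∈-++⁻ S i
    ... | inj₁ k = old PB (proj₂ (inc v k)) , old PA (proj₁ (inc v k))
    ... | inj₂ (here refl) = ∈-++⁺ʳ (PB ++ y ∷ b ∷ reverse Q) (here refl) , ∈-++⁺ˡ (∈-++⁺ʳ PA (there (here refl)))
    ... | inj₂ (there (here refl)) = ∈-++⁺ˡ (∈-++⁺ʳ PB (there (here refl))) , ∈-++⁺ʳ (PA ++ x ∷ a ∷ Q) (here refl)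
    ... | inj₂ (there (there k)) = ∈-++⁺ˡ (∈-++⁺ʳ PB (there (there (∈-rev k)))) , ∈-++⁺ˡ (∈-++⁺ʳ PA (there (there k)))
    ar : ∀ p q → suc (p + suc (suc q)) ≡ suc p + suc (suc q)
    ar p q = refl
    H : Ham c t1 t3 (S' ++ As ++ Bs ++ Os)
    H = ham S' (PB ++ y ∷ b ∷ reverse Q) (PA ++ x ∷ a ∷ Q) r vx vy (via-++ PB vB (yb , via-rev Adj-sym Q vQ)) (via-++ PA vA (xa , vQ)) inc'
      (trans (cong suc (trans (length-++ PB) (cong (λ k → length PB + suc (suc k)) (length-reverse Q)))) (trans (cong (_+ suc (suc (length Q))) lB) (sym (length-++ S))))
      (trans (cong suc (length-++ PA)) (trans (cong (_+ suc (suc (length Q))) lA) (sym (length-++ S))))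
    conv : ∀ {v} → v ∈ S ++ (a ∷ As) ++ (b ∷ Bs) ++ Q ++ Os → v ∈ S' ++ As ++ Bs ++ Os
    conv {v} i with ∈-++⁻ S i
    ... | inj₁ k = ∈-++⁺ˡ (∈-++⁺ˡ k)
    ... | inj₂ (here e) = ∈-++⁺ˡ (∈-++⁺ʳ S (here e))
    ... | inj₂ (there k) with ∈-++⁻ As k
    ... | inj₁ l = ∈-++⁺ʳ S' (∈-++⁺ˡ l)
    ... | inj₂ (here e) = ∈-++⁺ˡ (∈-++⁺ʳ S (there (here e)))
    ... | inj₂ (there l) with ∈-++⁻ Bs l
    ... | inj₁ j = ∈-++⁺ʳ S' (∈-++⁺ʳ As (∈-++⁺ˡ j))
    ... | inj₂ j with ∈-++⁻ Q j
    ... | inj₁ q = ∈-++⁺ˡ (∈-++⁺ʳ S (there (there q)))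
    ... | inj₂ o = ∈-++⁺ʳ S' (∈-++⁺ʳ As (∈-++⁺ʳ Bs o))
    lc : length (S' ++ As ++ Bs ++ Os) ≡ length (S ++ (a ∷ As) ++ (b ∷ Bs) ++ Q ++ Os)
    lc = trans (length-++ S') (trans (cong₂ _+_ (length-++ S) (trans (length-++ As) (cong (length As +_) (length-++ Bs))))
      (trans (ar₂ (length S) (length Q) (length As) (length Bs) (length Os))
        (sym (trans (length-++ S) (cong (length S +_) (cong suc (trans (length-++ As) (cong (λ k → length As + suc k) (trans (length-++ Bs) (cong (length Bs +_) (length-++ Q)))))))))))
      where ar₂ : ∀ s q a b o → s + suc (suc q) + (a + (b + o)) ≡ s + suc (a + suc (b + (q + o)))
            ar₂ = solve-∀

  BS : ℕ
  BS = 5 + (lam + 2 * suc d) + (2 * d + d * (2 * suc d))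

  Out : Fin n → List (Fin n) → List (Fin n) → Set
  Out e Ω U₀ = Σ (Block Adj d lam e) λ b → Σ (List (Fin n)) λ U' → St (Block.occ b ++ Ω) U' × (c1 U' (Block.t3 b) + 4 ≤ D) × (∀ v → v ∈ Ω → v ≢ e → c1 U' v ≤ c1 U₀ v)

  occ-length : ∀ {e} (b : Block Adj d lam e) → length (Block.occ b) ≡ BS
  occ-length b = trans (length-++ virt) (trans (cong₂ _+_ (cong (λ k → suc (suc k)) (length-++ Ls)) lW) (trans (cong (λ k → 2 + (k + 2) + suc (2 * d + d * (2 * suc d))) lL) (ar (lam + 2 * suc d) (2 * d + d * (2 * suc d)))))
    where
    open Block b
    ar : ∀ a b → 2 + (a + 2) + suc b ≡ 5 + a + b
    ar = solve-∀

  load1 : ∀ {k} → k ≤ 1 → k + 4 ≤ D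
  load1 h = ≤-trans (+-monoˡ-≤ 4 h) (≤-trans (n≤1+n 5) 6≤D)

  -- The cycle through w is w As t1 t2 t3 (reverse Bs) w.
  module _ (e c w : Fin n) (As : List (Fin n)) (t1 t2 t3 : Fin n) (Bs₀ Ω : List (Fin n)) where
    Cy Ω₄ : List (Fin n)
    Cy = As ++ t1 ∷ t2 ∷ t3 ∷ Bs₀
    Ω₄ = Cy ++ w ∷ c ∷ Ω

    complete : ∀ {Os ls ys U' U₀} → Adj e c → Adj c w → Via Adj w Cy w → length As ≡ d → length Bs₀ ≡ d → Rungs As (reverse Bs₀) Os → length Os ≡ d * (2 * suc d) →
      Via Adj t1 (ls ++ ys) t2 → length ls ≡ lam → length ys ≡ 2 * suc d → St (ys ++ ls ++ Os ++ Ω₄) U' → c1 U' t3 ≤ 1 →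
      (∀ v → v ∈ Ω → v ≢ e → c1 U' v ≤ c1 U₀ v) → Out e Ω U₀
    complete {Os} {ls} {ys} {U'} ec cw vC lA lB r lO vL ll ly st ld fr =
        b , U' , st-re st inn (≤-reflexive lens) , load1 ld , fr
      where
      sp₁ = via-split As vC
      sp₂ = proj₂ sp₁
      H : Ham c t1 t3 (w ∷ As ++ reverse Bs₀ ++ Os)
      H = ham (w ∷ []) [] [] r (proj₁ sp₁) (via-rev Adj-sym Bs₀ (proj₂ (proj₂ sp₂))) cw cw (λ v i → i , i) refl refl
      open Ham H
      WL = w ∷ As ++ reverse Bs₀ ++ Os
      lWL : length WL ≡ suc (2 * d + d * (2 * suc d))
      lWL = cong suc (trans (length-++ As) (trans (cong₂ _+_ lA (trans (length-++ (reverse Bs₀)) (cong₂ _+_ (trans (length-reverse Bs₀) lB) lO))) (ar d (d * (2 * suc d)))))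
        where ar : ∀ d k → d + (d + k) ≡ 2 * d + k
              ar = solve-∀
      uWL : Unique WL
      uWL = proj₁ (uniq-len {xs = w ∷ As ++ Bs₀ ++ Os} big (λ v → λ { (here e) → here e ; (there i) → there (case ∈-++⁻ As i of λ { (inj₁ k) → ∈-++⁺ˡ k
              ; (inj₂ k) → ∈-++⁺ʳ As (case ∈-++⁻ Bs₀ k of λ { (inj₁ l) → ∈-++⁺ˡ (∈-rev l) ; (inj₂ l) → ∈-++⁺ʳ (reverse Bs₀) l }) }) })
              (≤-reflexive (cong suc (trans (length-++ As) (trans (cong (length As +_) (trans (length-++ (reverse Bs₀)) (trans (cong (_+ length Os) (length-reverse Bs₀)) (sym (length-++ Bs₀))))) (sym (length-++ As)))))))
        where
        uO : Unique (Os ++ Ω₄)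
        uO = uniq-++ʳ ls (uniq-++ʳ ys (St.uΩ st))
        uC : Unique Ω₄
        uC = uniq-++ʳ Os uO
        u3 : Unique (As ++ Bs₀)
        u3 = proj₂ (uniq-mid As (proj₂ (uniq-mid As (proj₂ (uniq-mid As (uniq-++ˡ Cy uC))))))
        inCy : ∀ {v} → v ∈ As ++ Bs₀ → v ∈ Cy
        inCy i = case ∈-++⁻ As i of λ { (inj₁ k) → ∈-++⁺ˡ k ; (inj₂ k) → ∈-++⁺ʳ As (there (there (there k))) }
        big : Unique (w ∷ As ++ Bs₀ ++ Os)
        big = uniq-∷ (λ i → case ∈-++⁻ (As ++ Bs₀) (subst (w ∈_) (sym (++-assoc As Bs₀ Os)) i) of λ
                { (inj₁ k) → uniq-disj Cy uC (inCy k) (here refl) ; (inj₂ k) → uniq-disj Os uO k (∈-++⁺ʳ Cy (here refl)) })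
              (subst Unique (++-assoc As Bs₀ Os) (uniq-++ u3 (uniq-++ˡ Os uO) λ i j → uniq-disj Os uO j (∈-++⁺ˡ (inCy i))))
      W₁ = uniq-len uWL (λ v i → proj₁ (inc v i)) (≤-reflexive lW)
      W₂ = uniq-len uWL (λ v i → proj₂ (inc v i)) (≤-reflexive lW')
      b : Block Adj d lam e
      b = record { c = c ; t1 = t1 ; t2 = t2 ; t3 = t3 ; Ws = Ws ; Ws' = Ws' ; Ls = ls ++ ys ; ec = ec ; vW = vW ; vW' = vW' ; uW' = proj₁ W₂
        ; W⊑ = λ v i → proj₂ (inc v (proj₂ W₁ v i)) ; W⊒ = λ v i → proj₁ (inc v (proj₂ W₂ v i)) ; t12 = proj₁ sp₂ ; t23 = proj₁ (proj₂ sp₂)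
        ; vL = vL ; lL = trans (length-++ ls) (cong₂ _+_ ll ly) ; lW = trans lW lWL }
      W∈ : ∀ {v} → v ∈ WL → v ∈ Block.occ b ++ Ω
      W∈ i = ∈-++⁺ˡ (∈-++⁺ʳ (Block.virt b) (proj₁ (inc _ i)))
      V∈ : ∀ {v} → v ∈ Block.virt b → v ∈ Block.occ b ++ Ω
      V∈ i = ∈-++⁺ˡ (∈-++⁺ˡ i)
      inn : ∀ v → v ∈ ys ++ ls ++ Os ++ Ω₄ → v ∈ Block.occ b ++ Ω
      inn v i with ∈-++⁻ ys i
      ... | inj₁ k = V∈ (there (there (∈-++⁺ˡ (∈-++⁺ʳ ls k))))
      ... | inj₂ i₁ with ∈-++⁻ ls i₁
      ... | inj₁ k = V∈ (there (there (∈-++⁺ˡ (∈-++⁺ˡ k))))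
      ... | inj₂ i₂ with ∈-++⁻ Os i₂
      ... | inj₁ k = W∈ (there (∈-++⁺ʳ As (∈-++⁺ʳ (reverse Bs₀) k)))
      ... | inj₂ i₃ with ∈-++⁻ Cy i₃
      ... | inj₂ (here e) = W∈ (here e)
      ... | inj₂ (there (here e)) = V∈ (here e)
      ... | inj₂ (there (there k)) = ∈-++⁺ʳ (Block.occ b) k
      ... | inj₁ k with ∈-++⁻ As k
      ... | inj₁ l = W∈ (there (∈-++⁺ˡ l))
      ... | inj₂ (here e) = V∈ (there (here e))
      ... | inj₂ (there (here e)) = V∈ (there (there (∈-++⁺ʳ (ls ++ ys) (here e))))
      ... | inj₂ (there (there (here e))) = V∈ (there (there (∈-++⁺ʳ (ls ++ ys) (there (here e)))))
      ... | inj₂ (there (there (there l))) = W∈ (there (∈-++⁺ʳ As (∈-++⁺ˡ (∈-rev l))))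
      lens : length (Block.occ b ++ Ω) ≡ length (ys ++ ls ++ Os ++ Ω₄)
      lens = trans (trans (length-++ (Block.occ b)) (cong (_+ length Ω) (occ-length b)))
        (trans (ar lam (2 * suc d) d (d * (2 * suc d)) (length Ω)) (sym (trans (length-++ ys) (cong₂ _+_ ly (trans (length-++ ls) (cong₂ _+_ ll (trans (length-++ Os) (cong₂ _+_ lO
          (trans (length-++ Cy) (cong (_+ suc (suc (length Ω))) (trans (length-++ As) (cong₂ (λ a b → a + suc (suc (suc b))) lA lB)))))))))))) 
        where ar : ∀ l y d o k → 5 + (l + y) + (2 * d + o) + k ≡ y + (l + (o + (d + suc (suc (suc d)) + suc (suc k))))
              ar = solve-∀


-- Embedding the gadgets one after another

module Chains {n : ℕ} (S : Ground n) where
  open Ground S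
  open Build S
  open Blocks S

  rung = 2 * suc d

  module _ (e c w : Fin n) (As : List (Fin n)) (t1 t2 t3 : Fin n) (Bs₀ Ω U U₀ : List (Fin n))
    (ec : Adj e c) (cw : Adj c w) (vC : Via Adj w (Cy e c w As t1 t2 t3 Bs₀ Ω) w) (lA : length As ≡ d) (lB : length Bs₀ ≡ d)
    (st : St (Ω₄ e c w As t1 t2 t3 Bs₀ Ω) U) (lo : ∀ v → v ∈ Cy e c w As t1 t2 t3 Bs₀ Ω → c1 U v ≤ 1)
    (rm : Rm (d * rung + (lam + rung)) (Ω₄ e c w As t1 t2 t3 Bs₀ Ω)) (fr : ∀ v → v ∈ Ω → v ≢ e → c1 U v ≤ c1 U₀ v) where
    private
      Z Y : List (Fin n)
      Z = Cy e c w As t1 t2 t3 Bs₀ Ω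
      Y = Ω₄ e c w As t1 t2 t3 Bs₀ Ω
    u₁ = uniq-mid As (uniq-++ˡ Z (St.uΩ st))
    u₂ = uniq-mid As (proj₂ u₁)
    u₃ = uniq-mid As (proj₂ u₂)
    t1∈ : t1 ∈ Z
    t1∈ = ∈-++⁺ʳ As (here refl)
    t2∈ : t2 ∈ Z
    t2∈ = ∈-++⁺ʳ As (there (here refl))
    t3∈ : t3 ∈ Z
    t3∈ = ∈-++⁺ʳ As (there (there (here refl)))
    AB∈ : ∀ {v} → v ∈ As ++ reverse Bs₀ → v ∈ As ++ Bs₀
    AB∈ i = case ∈-++⁻ As i of λ { (inj₁ k) → ∈-++⁺ˡ k ; (inj₂ k) → ∈-++⁺ʳ As (rev-∈ k) }
    inZ : ∀ {v} → v ∈ As ++ reverse Bs₀ → v ∈ Z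
    inZ i = case ∈-++⁻ As (AB∈ i) of λ { (inj₁ k) → ∈-++⁺ˡ k ; (inj₂ k) → ∈-++⁺ʳ As (there (there (there k))) }
    uAB : Unique (As ++ reverse Bs₀)
    uAB = uniq-++ (uniq-++ˡ As (proj₂ u₃)) (uniq-rev (uniq-++ʳ As (proj₂ u₃))) λ i j → uniq-disj As (proj₂ u₃) i (rev-∈ j)
    t1≢t2 : t1 ≢ t2
    t1≢t2 refl = proj₁ u₁ (∈-++⁺ʳ As (here refl))
    t1≢t3 : t1 ≢ t3
    t1≢t3 refl = proj₁ u₁ (∈-++⁺ʳ As (there (here refl)))
    t2≢t3 : t2 ≢ t3
    t2≢t3 refl = proj₁ u₂ (∈-++⁺ʳ As (here refl))
    t1∉ : t1 ∉ As ++ reverse Bs₀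
    t1∉ i = case ∈-++⁻ As (AB∈ i) of λ { (inj₁ k) → proj₁ u₁ (∈-++⁺ˡ k) ; (inj₂ k) → proj₁ u₁ (∈-++⁺ʳ As (there (there k))) }
    t2∉ : t2 ∉ As ++ reverse Bs₀
    t2∉ i = case ∈-++⁻ As (AB∈ i) of λ { (inj₁ k) → proj₁ u₂ (∈-++⁺ˡ k) ; (inj₂ k) → proj₁ u₂ (∈-++⁺ʳ As (there k)) }
    t3∉ : t3 ∉ As ++ reverse Bs₀
    t3∉ i = proj₁ u₃ (AB∈ i)

    finish : (L : Lad As (reverse Bs₀) Y U) → (E : Ext lam t1 (Lad.Os L ++ Y) (Lad.U' L)) →
      (Σ (List (Fin n)) λ ys → (length ys ≡ rung) × Via Adj (Ext.z E) ys t2 × St (ys ++ Ext.xs E ++ Lad.Os L ++ Y) (Ext.z E ∷ t2 ∷ ys ++ Ext.U' E)) → Out e Ω U₀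
    finish L E (ys , ly , vy , st') = complete e c w As t1 t2 t3 Bs₀ Ω {ls = Ext.xs E} {ys = ys} {U₀ = U₀} ec cw vC lA lB (Lad.rungs L) (trans (Lad.lO L) (cong (_* rung) lA)) (Ext.via E vy) (Ext.lx E) ly st'
      (≤-trans (≤-reflexive (c1-conn {Ext.xs E ++ Lad.Os L ++ Y} {Ext.U' E} {Ext.z E} {t2} {ys} {t3} (St.uΩ st') (∈-++⁺ʳ (Ext.xs E) t3Y) z≢ (λ h → t2≢t3 (sym h))))
        (≤-trans (Ext.frame E t3 t3Y (λ h → t1≢t3 (sym h))) (≤-trans (Lad.frame L t3 (∈-++⁺ˡ t3∈) t3∉) (lo t3 t3∈))))
      (λ v v∈ v≢e → let vY = ∈-++⁺ʳ Z (there (there v∈)) ; vO = ∈-++⁺ʳ (Lad.Os L) vY ; v∉Z = λ i → uniq-disj Z (St.uΩ st) i (there (there v∈)) in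
        ≤-trans (≤-reflexive (c1-conn {Ext.xs E ++ Lad.Os L ++ Y} {Ext.U' E} {Ext.z E} {t2} {ys} {v} (St.uΩ st') (∈-++⁺ʳ (Ext.xs E) vO)
            (λ h → case Ext.zpos E of λ { (inj₁ h') → v∉Z (subst (_∈ Z) (sym (trans h h')) t1∈) ; (inj₂ ni) → ni (subst (_∈ Lad.Os L ++ Y) h vO) }) (λ h → v∉Z (subst (_∈ Z) (sym h) t2∈))))
          (≤-trans (Ext.frame E v vO (λ h → v∉Z (subst (_∈ Z) (sym h) t1∈))) (≤-trans (Lad.frame L v vY (λ i → v∉Z (inZ i))) (fr v v∈ v≢e))))
      where
      t3Y : t3 ∈ Lad.Os L ++ Y
      t3Y = ∈-++⁺ʳ (Lad.Os L) (∈-++⁺ˡ t3∈)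
      z≢ : t3 ≢ Ext.z E
      z≢ h = case Ext.zpos E of λ { (inj₁ h') → t1≢t3 (sym (trans h h')) ; (inj₂ ni) → ni (subst (_∈ Lad.Os L ++ Y) h t3Y) }

    closing : DN (Out e Ω U₀)
    closing = lad As (reverse Bs₀) (trans lA (sym (trans (length-reverse Bs₀) lB))) st (λ v i → ∈-++⁺ˡ (inZ i) , lo v (inZ i)) uAB
        (rm-mono (length As * rung) (d * rung + (lam + rung)) {Ω = Y} {Ω' = Y} rm (+-monoˡ-≤ (length Y) (≤-trans (≤-reflexive (cong (_* rung) lA)) (m≤m+n (d * rung) (lam + rung))))) >>= λ L →
      ext lam t1 (Lad.st L) (∈-++⁺ʳ (Lad.Os L) (∈-++⁺ˡ t1∈)) (load1 (≤-trans (Lad.frame L t1 (∈-++⁺ˡ t1∈) t1∉) (lo t1 t1∈))) (rmE L) >>= λ E →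
      op-conn (Ext.z E) t2 (Ext.st E) (rmC L E) (Ext.z∈ E) (∈-++⁺ʳ (Ext.xs E) (∈-++⁺ʳ (Lad.Os L) (∈-++⁺ˡ t2∈))) (Ext.zld E)
        (load1 (≤-trans (Ext.frame E t2 (∈-++⁺ʳ (Lad.Os L) (∈-++⁺ˡ t2∈)) (λ h → t1≢t2 (sym h))) (≤-trans (Lad.frame L t2 (∈-++⁺ˡ t2∈) t2∉) (lo t2 t2∈)))) >>= λ C →
      return (finish L E C)
      where
      lOs : ∀ L → length (Lad.Os L ++ Y) ≡ d * rung + length Y
      lOs L = trans (length-++ (Lad.Os L)) (cong (_+ length Y) (trans (Lad.lO L) (cong (_* rung) lA)))
      rmE : (L : Lad As (reverse Bs₀) Y U) → Rm lam (Lad.Os L ++ Y)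
      rmE L = rm-mono lam (d * rung + (lam + rung)) {Ω = Y} {Ω' = Lad.Os L ++ Y} rm (≤-trans (≤-reflexive (cong (lam +_) (lOs L))) (≤-trans (m≤m+n _ rung) (≤-reflexive (ar lam (d * rung) (length Y) rung))))
        where ar : ∀ a b c r → a + (b + c) + r ≡ b + (a + r) + c
              ar = solve-∀
      rmC : (L : Lad As (reverse Bs₀) Y U) → (E : Ext lam t1 (Lad.Os L ++ Y) (Lad.U' L)) → Rm 0 (Ext.xs E ++ Lad.Os L ++ Y)
      rmC L E = rm-mono 0 (d * rung + (lam + rung)) {Ω = Y} {Ω' = Ext.xs E ++ Lad.Os L ++ Y} rm
        (≤-trans (≤-reflexive (trans (length-++ (Ext.xs E)) (cong₂ _+_ (Ext.lx E) (lOs L)))) (≤-trans (m≤m+n _ rung) (≤-reflexive (ar lam (d * rung) (length Y) rung))))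
        where ar : ∀ a b c r → a + (b + c) + r ≡ b + (a + r) + c
              ar = solve-∀

  -- From the exit `e` a path e c w is grown, with one more leaf w' at w. Connecting w' back to w
  -- produces a cycle through w, whose two halves become the rails of the ladder and whose three
  -- opposite vertices become t1, t2, t3.
  block : ∀ e {Ω U} → St Ω U → e ∈ Ω → c1 U e + 4 ≤ D → Rm BS Ω → DN (Out e Ω U)
  block e {Ω} {U} st e∈ ld rm =
    op-leaf st (rm-mono 0 BS {Ω = Ω} {Ω' = Ω} rm (m≤n+m _ BS)) e∈ ld >>= λ (c , ec , s₁) →
    op-leaf s₁ (rm-mono 0 BS {Ω = Ω} {Ω' = c ∷ Ω} rm (+-monoˡ-≤ (length Ω) {1} (s≤s z≤n))) (here refl) (zero-load (out s₁ e∈ (St.U⊑ st))) >>= λ (w , cw , s₂) →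
    op-leaf s₂ (rm-mono 0 BS {Ω = Ω} {Ω' = w ∷ c ∷ Ω} rm (+-monoˡ-≤ (length Ω) {2} (s≤s (s≤s z≤n)))) (here refl) (zero-load (out s₂ (here refl) (St.U⊑ s₁))) >>= λ (w' , ww , s₃) →
    op-conn w' w s₃ (rm-mono 0 BS {Ω = Ω} {Ω' = w' ∷ w ∷ c ∷ Ω} rm (+-monoˡ-≤ (length Ω) {3} (s≤s (s≤s (s≤s z≤n))))) (here refl) (there (here refl))
      (zero-load (out s₃ (here refl) (St.U⊑ s₂)))
      (load1 (≤-reflexive (trans (c1-≡ w (c ∷ e ∷ U)) (cong suc (c1-out {U = c ∷ e ∷ U} {v = w} (out s₂ (here refl) (St.U⊑ s₁))))))) >>= λ (xs , lxs , vx , s₄) →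
    -- Apart from w the cycle has 1 + 2(d + 1) = d + 3 + d vertices: two rails of d vertices around
    -- the three exits.
    three c w w' xs ec cw ww lxs vx s₃ s₄ (cutThree d (w' ∷ xs) (trans (cong suc lxs) (ar d)))
    where
    ar : ∀ d → suc (2 * suc d) ≡ d + suc (suc (suc d))
    ar = solve-∀
    zero-load : ∀ {U : List (Fin n)} {v} → v ∉ U → c1 U v + 4 ≤ D
    zero-load {U} {v} h = load1 (≤-trans (≤-reflexive (c1-out {U = U} {v = v} h)) z≤n)
    out : ∀ {y Ω₁ s U₁ U₂} → St (y ∷ Ω₁) U₂ → s ∈ Ω₁ → (∀ u → u ∈ U₁ → u ∈ Ω₁) → y ∉ s ∷ U₁
    out st' s∈ sub (here refl) = ∉-head (St.uΩ st') s∈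
    out st' s∈ sub (there i) = ∉-head (St.uΩ st') (sub _ i)
    three : ∀ c w w' xs → Adj e c → Adj c w → Adj w w' → length xs ≡ rung → Via Adj w' xs w → St (w' ∷ w ∷ c ∷ Ω) (w ∷ c ∷ e ∷ U) → St (xs ++ w' ∷ w ∷ c ∷ Ω) (w' ∷ w ∷ xs ++ w ∷ c ∷ e ∷ U) →
      (Σ (List (Fin n)) λ As → Σ (Fin n) λ t1 → Σ (Fin n) λ t2 → Σ (Fin n) λ t3 → Σ (List (Fin n)) λ Bs → (w' ∷ xs ≡ As ++ t1 ∷ t2 ∷ t3 ∷ Bs) × (length As ≡ d) × (length Bs ≡ d)) → DN (Out e Ω U)
    three c w w' xs ec cw ww lxs vx s₃ s₄ (As , t1 , t2 , t3 , Bs , eq , lA , lB) =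
      closing e c w As t1 t2 t3 Bs Ω U₄ U ec cw (subst (λ l → Via Adj w l w) eq (ww , vx)) lA lB
        (subst (λ l → St (l ++ w ∷ c ∷ Ω) U₄) eq (st-re s₄ (λ v i → case ∈-++⁻ xs i of λ { (inj₁ k) → there (∈-++⁺ˡ k) ; (inj₂ (here h)) → here h ; (inj₂ (there k)) → there (∈-++⁺ʳ xs k) })
          (≤-reflexive (trans (cong suc (length-++ xs)) (trans (sym (+-suc (length xs) _)) (sym (length-++ xs)))))))
        (λ v i → lo v (subst (v ∈_) (sym eq) i))
        (subst (λ l → Rm (d * rung + (lam + rung)) (l ++ w ∷ c ∷ Ω)) eq (rm-mono (d * rung + (lam + rung)) BS {Ω = Ω} {Ω' = (w' ∷ xs) ++ w ∷ c ∷ Ω} rm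
          (≤-reflexive (trans (cong (λ k → d * rung + (lam + rung) + suc k) (trans (length-++ xs) (cong (_+ suc (suc (length Ω))) lxs))) (ar₂ d lam (length Ω) (d * rung))))))
        (λ v v∈ v≢e → ≤-reflexive (trans (c1-conn {w' ∷ w ∷ c ∷ Ω} {w ∷ c ∷ e ∷ U} {w'} {w} {xs} {v} (St.uΩ s₄) (there (there (there v∈))) (λ { refl → ∉-head uw (there (there v∈)) }) (λ { refl → ∉-head (uniq-tail uw) (there v∈) }))
          (trans (c1-≢ w v (c ∷ e ∷ U) (λ { refl → ∉-head (uniq-tail uw) (there v∈) })) (trans (c1-≢ c v (e ∷ U) (λ { refl → ∉-head (uniq-tail (uniq-tail uw)) v∈ })) (c1-≢ e v U (λ h → v≢e (sym h)))))))
      where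
      uw : Unique (w' ∷ w ∷ c ∷ Ω)
      uw = uniq-++ʳ xs (St.uΩ s₄)
      U₄ = w' ∷ w ∷ xs ++ w ∷ c ∷ e ∷ U
      ar₂ : ∀ d l k r → r + (l + 2 * suc d) + suc (2 * suc d + suc (suc k)) ≡ 5 + (l + 2 * suc d) + (2 * d + r) + k
      ar₂ = solve-∀
      lo : ∀ v → v ∈ w' ∷ xs → c1 U₄ v ≤ 1
      lo v (there i) = c1-new {w' ∷ w ∷ c ∷ Ω} {w ∷ c ∷ e ∷ U} {w'} {w} {xs} {v} (St.uΩ s₄) i (St.U⊑ s₃) (here refl) (there (here refl))
      lo v (here refl) = ≤-reflexive (trans (c1-≡ w' (w ∷ xs ++ w ∷ c ∷ e ∷ U)) (cong suc (c1-out {U = w ∷ xs ++ w ∷ c ∷ e ∷ U} {v = w'} no-w')))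
        where
        no-w' : w' ∉ w ∷ xs ++ w ∷ c ∷ e ∷ U
        no-w' (here h) = ∉-head uw (here h)
        no-w' (there i) with ∈-++⁻ xs i
        ... | inj₁ k = uniq-disj xs (St.uΩ s₄) k (here refl)
        ... | inj₂ (here h) = ∉-head uw (here h)
        ... | inj₂ (there (here h)) = ∉-head uw (there (here h))
        ... | inj₂ (there (there (here refl))) = ∉-head uw (there (there e∈))
        ... | inj₂ (there (there (there k))) = ∉-head uw (there (there (St.U⊑ st w' k)))

  chain : ∀ k x {Ω U} → St Ω U → x ∈ Ω → c1 U x + 4 ≤ D → Rm (k * BS) Ω →
    DN (Σ (Fin n) λ e → Σ (Chain Adj d lam x k e) λ ch → Σ (List (Fin n)) λ U' → St (occs ch ++ Ω) U' × (c1 U' e + 4 ≤ D) × e ∈ occs ch ++ Ω × (length (occs ch) ≡ k * BS)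
      × (∀ v → v ∈ virts ch ++ wss ch → v ∈ occs ch) × (∀ v → v ∈ occs ch → v ∈ virts ch ++ wss ch) × (e ≡ x ⊎ e ∈ occs ch) × (∀ v → v ∈ Ω → v ≢ x → c1 U' v ≤ c1 U v))
  chain zero x {Ω} {U} st x∈ ld rm = return (x , nil , U , st , ld , x∈ , refl , (λ _ ()) , (λ _ ()) , inj₁ refl , λ v _ _ → ≤-refl {c1 U v})
  chain (suc k) x {Ω} {U} st x∈ ld rm = chain k x st x∈ ld (rm-mono (k * BS) (suc k * BS) {Ω = Ω} {Ω' = Ω} rm (+-monoˡ-≤ (length Ω) (m≤n+m (k * BS) BS))) >>= λ (e , ch , U₁ , st₁ , ld₁ , e∈ , l₁ , f , g , pos , fr₁) →
    block e st₁ e∈ ld₁ (rm-mono BS (suc k * BS) {Ω = Ω} {Ω' = occs ch ++ Ω} rm (≤-reflexive (trans (cong (BS +_) (trans (length-++ (occs ch)) (cong (_+ length Ω) l₁))) (sym (+-assoc BS (k * BS) (length Ω)))))) >>= λ (b , U₂ , st₂ , ld₂ , fr₂) →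
    return (Block.t3 b , snoc ch b , U₂ , subst (λ l → St l U₂) (sym (++-assoc (Block.occ b) (occs ch) Ω)) st₂ , ld₂ , ∈-++⁺ˡ (∈-++⁺ˡ (∈-++⁺ˡ (t3-in b)))
      , trans (length-++ (Block.occ b)) (cong₂ _+_ (occ-length b) l₁)
      , (λ v i → case ∈-++⁻ (virts ch ++ Block.virt b) i of λ
          { (inj₁ k) → (case ∈-++⁻ (virts ch) k of λ { (inj₁ l) → ∈-++⁺ʳ (Block.occ b) (f v (∈-++⁺ˡ l)) ; (inj₂ l) → ∈-++⁺ˡ (∈-++⁺ˡ l) })
          ; (inj₂ k) → (case ∈-++⁻ (Block.Ws b) k of λ { (inj₁ l) → ∈-++⁺ˡ (∈-++⁺ʳ (Block.virt b) l) ; (inj₂ l) → ∈-++⁺ʳ (Block.occ b) (f v (∈-++⁺ʳ (virts ch) l)) }) })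
      , (λ v i → case ∈-++⁻ (Block.occ b) i of λ
          { (inj₁ k) → (case ∈-++⁻ (Block.virt b) k of λ { (inj₁ l) → ∈-++⁺ˡ (∈-++⁺ʳ (virts ch) l) ; (inj₂ l) → ∈-++⁺ʳ (virts ch ++ Block.virt b) (∈-++⁺ˡ l) })
          ; (inj₂ k) → (case ∈-++⁻ (virts ch) (g v k) of λ { (inj₁ l) → ∈-++⁺ˡ (∈-++⁺ˡ l) ; (inj₂ l) → ∈-++⁺ʳ (virts ch ++ Block.virt b) (∈-++⁺ʳ (Block.Ws b) l) }) })
      , inj₂ (∈-++⁺ˡ (∈-++⁺ˡ (t3-in b)))
      , (λ v v∈ v≢x → ≤-trans (fr₂ v (∈-++⁺ʳ (occs ch) v∈) (λ h → case pos of λ { (inj₁ h') → v≢x (trans h h') ; (inj₂ i) → uniq-disj (occs ch) (St.uΩ st₁) (subst (_∈ occs ch) (sym h) i) v∈ })) (fr₁ v v∈ v≢x)))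
    where
    t3-in : ∀ {e} (b : Block Adj d lam e) → Block.t3 b ∈ Block.virt b
    t3-in b = there (there (∈-++⁺ʳ (Block.Ls b) (there (here refl))))


-- Connectivity along a matching

module _ {n : ℕ} where
  -- `G` restricts the ports that may be used. This expresses connectivity in a part of the
  -- structure, such as everything off a given vertex or edge.
  data Cn (μ : M n) (G : Port n → Set) : Fin n → Fin n → Set where
    here : ∀ {v} → Cn μ G v v
    stp  : ∀ {v u} z → v ≡ vt z → G z → Cn μ G (vt (μ z)) u → Cn μ G v u

  Any-port : Port n → Set
  Any-port _ = ⊤

  cn-trans : ∀ {μ G u v w} → Cn μ G u v → Cn μ G v w → Cn μ G u w
  cn-trans here d = d
  cn-trans (stp z e g c) d = stp z e g (cn-trans c d)

  cn-lift : ∀ {μ G μ' G'} → (∀ z → G z → Cn μ' G' (vt z) (vt (μ z))) → ∀ {u v} → Cn μ G u v → Cn μ' G' u v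
  cn-lift f here = here
  cn-lift f (stp z refl g c) = cn-trans (f z g) (cn-lift f c)

  cn-one : ∀ {μ G} z → G z → Cn μ G (vt z) (vt (μ z))
  cn-one z g = stp z refl g here

  cn-sym : ∀ {μ G} → Inv μ → (∀ z → G z → G (μ z)) → ∀ {u v} → Cn μ G u v → Cn μ G v u
  cn-sym inv gs here = here
  cn-sym {μ} {G} inv gs (stp z refl g c) = cn-trans (cn-sym inv gs c) (subst (Cn μ G (vt (μ z))) (cong vt (inv z)) (cn-one (μ z) (gs z g)))

  cn-rev : ∀ {μ} → Inv μ → ∀ {u v} → Cn μ Any-port u v → Cn μ Any-port v u
  cn-rev inv = cn-sym inv λ _ _ → tt

  Star : (Fin n → Set) → M n → Fin n → Set
  Star Sp μ v = Σ (Fin n) λ s → Sp s × Cn μ Any-port v s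

  star-via : ∀ {Sp μ u v} → Cn μ Any-port u v → Star Sp μ v → Star Sp μ u
  star-via c (s , h , c') = s , h , cn-trans c c'

  module TRot (Sp T : Fin n → Set) (μ : M n) (p : Port n) (w : Fin n) (inv : Inv μ) (irr : ∀ z → μ z ≢ z → vt z ≢ vt (μ z))
    (fp : μ p ≡ p) (p≢w : vt p ≢ w) (w∉ : ¬ Sp w) (mt : ∀ j → μ (w , j) ≢ (w , j)) (Tp : T (vt p)) (Tw : T w) (star : ∀ v → T v → Star Sp μ v) where

    Gw : Port n → Set
    Gw z = vt z ≢ w × vt (μ z) ≢ w

    r : Bool → Fin n
    r j = vt (μ (w , j))

    SA : Fin n → Set
    SA v = Σ (Fin n) λ s → Sp s × Cn μ Gw v s

    at-w : ∀ z → vt (μ z) ≡ w → Σ Bool λ j → vt z ≡ r j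
    at-w z e = proj₂ (μ z) , trans (cong vt (sym (inv z))) (cong (λ v → vt (μ (v , proj₂ (μ z)))) e)

    leave : ∀ {v s} → v ≢ w → Cn μ Any-port v s → (Cn μ Gw v s) ⊎ (Σ Bool λ j → Cn μ Gw v (r j))
    leave ne here = inj₁ here
    leave ne (stp z refl _ c) with vt (μ z) ≟V w
    ... | yes e = let (j , e') = at-w z e in inj₂ (j , subst (Cn μ Gw (vt z)) e' here)
    ... | no ne' with leave ne' c
    ... | inj₁ c' = inj₁ (stp z refl (ne , ne') c')
    ... | inj₂ (j , c') = inj₂ (j , stp z refl (ne , ne') c')

    arrive : ∀ {v s} → Sp s → Cn μ Any-port v s → (v ≢ w × Cn μ Gw v s) ⊎ (Σ Bool λ j → Cn μ Gw (r j) s)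
    arrive h here = inj₁ ((λ { refl → w∉ h }) , here)
    arrive h (stp z refl _ c) with arrive h c
    ... | inj₂ x = inj₂ x
    ... | inj₁ (ne' , c') with vt z ≟V w
    ... | yes refl = inj₂ (proj₂ z , c')
    ... | no ne = inj₁ (ne , stp z refl (ne , ne') c')

    good-side : Σ Bool λ j → SA (r j)
    good-side with star w Tw
    ... | s , h , c with arrive h c
    ... | inj₁ (ne , _) = ⊥-elim (ne refl)
    ... | inj₂ (j , c') = j , s , h , c'

    module _ (j : Bool) where
      q = (w , j)
      q̄ = (w , not j)
      μ' = rot μ p q

      p≢q : p ≢ q
      p≢q e = p≢w (cong vt e)

      inv' : Inv μ'
      inv' = rotInv μ p q inv fp p≢q

      not≢ : ∀ j → not j ≢ j
      not≢ true ()
      not≢ false ()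

      lift : ∀ {u v} → Cn μ Gw u v → Cn μ' Any-port u v
      lift = cn-lift λ z (a , b) → one z a b (z ≟P p)
        where
        one : ∀ z → vt z ≢ w → vt (μ z) ≢ w → Dec (z ≡ p) → Cn μ' Any-port (vt z) (vt (μ z))
        one z a b (yes refl) = subst (Cn μ' Any-port (vt z)) (cong vt (sym fp)) here
        one z a b (no ne) = subst (Cn μ' Any-port (vt z)) (cong vt (rot-o μ p q ne (λ { refl → a refl }) (λ { refl → b (cong vt (inv q)) }))) (cn-one z tt)

      w-p : Cn μ' Any-port w (vt p)
      w-p = subst (Cn μ' Any-port w) (cong vt (rot-q μ p q)) (cn-one q tt)

      p-w : Cn μ' Any-port (vt p) w
      p-w = cn-rev inv' w-p

      w-r : Cn μ' Any-port w (r (not j))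
      w-r = subst (Cn μ' Any-port w) (cong vt (rot-o μ p q {q̄} (λ e → p≢w (cong vt (sym e))) (λ e → not≢ j (cong proj₂ e))
        (λ e → irr q (mt j) (cong vt e)))) (cn-one q̄ tt)

      r-w : Cn μ' Any-port (r (not j)) w
      r-w = cn-rev inv' w-r

      S' : Fin n → Set
      S' = Star Sp μ'

      starSA : ∀ {v} → SA v → S' v
      starSA (s , h , c) = s , h , lift c

      everyone : (∀ i → S' (r i)) → S' w → ∀ v → T v → S' v
      everyone rs sw v Tv with v ≟V w
      ... | yes refl = sw
      ... | no ne with star v Tv
      ... | s , h , c with leave ne c
      ... | inj₁ c' = s , h , lift c'
      ... | inj₂ (i , c') = star-via (lift c') (rs i)

      both : ∀ {i} {P : Bool → Set} → P j → P (not j) → P i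
      both {i} {P} a b with i Data.Bool.≟ j
      ... | yes refl = a
      ... | no ne = subst P (flip i j ne) b
        where flip : ∀ i j → i ≢ j → not j ≡ i
              flip true true ne = ⊥-elim (ne refl)
              flip true false ne = refl
              flip false true ne = refl
              flip false false ne = ⊥-elim (ne refl)

      case-direct : SA (r j) → SA (vt p) → ∀ v → T v → S' v
      case-direct sr sp = everyone (λ i → both {i} {λ i → S' (r i)} (starSA sr) (star-via r-w s₀)) s₀
        where s₀ = star-via w-p (starSA sp)

      case-behind : Cn μ Gw (vt p) (r j) → SA (r (not j)) → ∀ v → T v → S' v
      case-behind c sr = everyone (λ i → both {i} {λ i → S' (r i)} (star-via (cn-trans (cn-rev inv' (lift c)) p-w) s₀) (starSA sr)) s₀
        where s₀ = star-via w-r (starSA sr)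

    -- Delete `w` and consider the pieces left. If the piece of `p` has a special vertex, the
    -- rotation drops the edge from `w` to a neighbour whose piece has one too; then nothing is
    -- lost. Otherwise `p` reached special vertices only through `w`, so its piece contains a
    -- neighbour of `w`. Dropping the edge to that neighbour keeps it attached via `p`, while the
    -- other neighbour must lead to a special vertex.
    trot : DN (Σ Bool λ j → ∀ v → T v → Star Sp (rot μ p (w , j)) v)
    trot = lem (SA (vt p)) >>= λ
      { (inj₁ sp) → return (proj₁ good-side , case-direct (proj₁ good-side) (proj₂ good-side) sp)
      ; (inj₂ np) → return (behind np good-side (leave p≢w (proj₂ (proj₂ (star (vt p) Tp))))) }
      where
      behind : ¬ SA (vt p) → (Σ Bool λ j → SA (r j)) → (Cn μ Gw (vt p) (proj₁ (star (vt p) Tp))) ⊎ (Σ Bool λ j → Cn μ Gw (vt p) (r j)) → Σ Bool λ j → ∀ v → T v → Star Sp (rot μ p (w , j)) v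
      behind np gs (inj₁ c) = ⊥-elim (np (_ , proj₁ (proj₂ (star (vt p) Tp)) , c))
      behind np (i , s , h , c') (inj₂ (j , c)) with i Data.Bool.≟ j
      ... | yes refl = ⊥-elim (np (s , h , cn-trans c c'))
      ... | no ne = j , case-behind j c (subst (λ i → SA (r i)) (flip i j ne) (s , h , c'))
        where flip : ∀ i j → i ≢ j → i ≡ not j
              flip true true ne = ⊥-elim (ne refl)
              flip true false ne = refl
              flip false true ne = refl
              flip false false ne = ⊥-elim (ne refl)

-- Rotations on the chain that keep all components tied to special vertices

module TSide {n : ℕ} (Adj : Fin n → Fin n → Set) (Adj-sym : ∀ {u v} → Adj u v → Adj v u)
  (T Sp : Fin n → Set) (SpP : Port n → Set) (SpP-vt : ∀ z → SpP z → Sp (vt z)) (σ : M n) (σ≢ : ∀ z → SpP z → σ z ≢ z) (σ-SpP : ∀ z → SpP z → SpP (σ z)) where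

  -- `keep` says that the other free ports stay free during rotations from `p`. It lets the second
  -- end of a cut edge start its own rotations afterwards and preserves the ends matched in earlier
  -- rounds.
  record OkT (F₀ : List (Port n)) (μ : M n) (p : Port n) : Set where
    field
      pm    : PM _≢_ T μ
      edgeA : ∀ z → μ z ≢ z → ¬ SpP z → Adj (vt z) (vt (μ z))
      spec  : ∀ z → SpP z → μ z ≡ σ z
      star  : ∀ v → T v → Star Sp μ v
      fp    : μ p ≡ p
      Tp    : T (vt p)
      cover : ∀ z → T (vt z) → μ z ≡ z → z ≡ p ⊎ z ∈ F₀
      keep  : ∀ z → z ∈ F₀ → μ z ≡ z × z ≢ p
    open PM pm public

  tstep : ∀ {F₀} μ p w → OkT F₀ μ p → ¬ Sp w → T w → Adj (vt p) w → vt p ≢ w → (∀ j → μ (w , j) ≢ (w , j)) →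
    DN (Σ Bool λ j → OkT F₀ (rot μ p (w , j)) (μ (w , j)))
  tstep {F₀} μ p w ok w∉ Tw a p≢w mt = TRot.trot Sp T μ p w inv edge fp p≢w w∉ mt Tp Tw star >>= λ (j , st) → return (j , mk j st)
    where
    open OkT ok
    mk : ∀ j → (∀ v → T v → Star Sp (rot μ p (w , j)) v) → OkT F₀ (rot μ p (w , j)) (μ (w , j))
    mk j st = record { pm = rotPM (λ ne e → ne (sym e)) p q pm fp p≢q p≢w Tp Tw ; edgeA = ea ; spec = sp ; star = st
        ; fp = rot-r μ p q rp (mt j) ; Tp = PM.domμ pm q (mt j)
        ; cover = λ z Tz e → let (np , c) = rot-free μ p q inv fp p≢q z e in case c of λ
            { (inj₁ e') → inj₁ e' ; (inj₂ e') → case cover z Tz e' of λ { (inj₁ e'') → contradiction e'' np ; (inj₂ i) → inj₂ i } }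
        ; keep = λ z i → let (f , np) = keep z i in
            trans (rot-o μ p q np (λ { refl → mt j f }) (λ { refl → mt j (trans (sym f) (inv q)) })) f , λ { refl → mt j (trans (sym f) (inv q)) } }
      where
      q = (w , j)
      p≢q : p ≢ q
      p≢q e = p≢w (cong vt e)
      rp : μ q ≢ p
      rp = μq≢p μ p q inv fp p≢q
      ea : ∀ z → rot μ p q z ≢ z → ¬ SpP z → Adj (vt z) (vt (rot μ p q z))
      ea z ne ns with rotCase μ p q z
      ... | atp refl rewrite rot-p μ p q = a
      ... | atq _ refl rewrite rot-q μ p q = Adj-sym a
      ... | atr _ b refl = ⊥-elim (ne (rot-r μ p q rp b))
      ... | off x y c rewrite rot-o μ p q x y c = edgeA z ne ns
      sp : ∀ z → SpP z → rot μ p q z ≡ σ z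
      sp z h = trans (rot-o μ p q (λ { refl → σ≢ p h (trans (sym (spec p h)) fp) }) (λ { refl → w∉ (SpP-vt q h) })
        (λ { refl → w∉ (SpP-vt q (subst SpP (trans (sym (spec (μ q) h)) (inv q)) (σ-SpP (μ q) h))) })) (spec z h)


-- Joining the paths that cover R to the cut structure on T, two ends at a time

record Meeting (n : ℕ) : Set₁ where
  field
    Adj     : Fin n → Fin n → Set
    Adj-sym : ∀ {u v} → Adj u v → Adj v u
    irr     : ∀ {v} → ¬ Adj v v
    m       : ℕ
    joined  : ∀ X Y → Unique X → Unique Y → (∀ v → v ∈ X → v ∉ Y) → m ≤ length X → m ≤ length Y →
      Σ (Fin n) λ u → Σ (Fin n) λ v → u ∈ X × v ∈ Y × Adj u v
    d       : ℕ
    m≤2^d   : m ≤ 2 ^ d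
    2^i≤m   : ∀ i → i < d → 2 ^ i ≤ m
    R T Sp  : Fin n → Set
    RT      : ∀ v → R v → ¬ T v
    exR     : ∀ X → Unique X → (∀ v → v ∈ X → R v) → length X ≤ m → ∀ Y → Cov Adj X R Y → 6 * length X ≤ length Y
    SpP     : Port n → Set
    SpP-vt  : ∀ z → SpP z → Sp (vt z)
    σ       : M n
    σ≢      : ∀ z → SpP z → σ z ≢ z
    σ-SpP   : ∀ z → SpP z → SpP (σ z)
    TL LL   : List (Fin n)
    uTL     : Unique TL
    inTL    : ∀ v → T v → v ∈ TL
    uLL     : Unique LL
    LLT     : ∀ v → v ∈ LL → T v × ¬ Sp v
    sizes   : length TL + 72 * m ≤ 2 * length LL
    sg      : Fin n → List (Fin n)
    len     : ℕ
    sg-len  : ∀ v → length (sg v) ≤ len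
    sg-self : ∀ l → l ∈ LL → l ∈ sg l
    sg-sym  : ∀ l t → l ∈ LL → t ∈ sg l → l ∈ sg t
    σ-inv   : Inv σ
    σ-T     : ∀ l → l ∈ LL → σ (l , true) ≢ (l , true) × T (vt (σ (l , true))) × ¬ SpP (σ (l , true)) × vt (σ (l , true)) ∈ sg l
    cutFact : ∀ l → l ∈ LL → ∀ μ → Inv μ → (∀ z → vt z ∈ sg l → μ z ≡ σ z) → Star Sp (cut μ (l , true)) l × Star Sp (cut μ (l , true)) (vt (σ (l , true)))
    k       : ℕ
    minl    : MaxRot.Minimal Adj Adj-sym irr R (λ _ → ⊤) k
    k≤m     : 2 + k ≤ m
    roomL   : len * (k * (2 * d + 2)) + 3 * m < length LL

module Joining {n : ℕ} (S : Meeting n) where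
  open Meeting S
  open TSide Adj Adj-sym T Sp SpP SpP-vt σ σ≢ σ-SpP
  open MaxRot Adj Adj-sym irr R (λ _ → ⊤)
  open Expand Adj m joined

  record OkR (F₀ : List (Port n)) (μ : M n) (r : Port n) : Set where
    field
      ok   : Ok F₀ μ r
      keep : ∀ z → z ∈ F₀ → μ z ≡ z × z ≢ r

  record TEnd (F₀ : List (Port n)) (μs : M n) (p₀ : Port n) (A : Fin n → Set) (u : Fin n) : Set where
    field
      μ    : M n
      p    : Port n
      τ    : List (Fin n)
      end  : vt p ≡ u
      ok   : OkT F₀ μ p
      chg  : ∀ z → μ z ≢ μs z → vt z ∈ τ
      len  : length τ ≤ suc (2 * d)
      zone : ∀ v → v ∈ τ → A v ⊎ (v ≡ vt p₀) ⊎ (Σ (Fin n) λ w → Σ Bool λ j → A w × (v ≡ vt (μs (w , j))))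

  tgrow : ∀ {F₀} μs p₀ (A : Fin n → Set) → OkT F₀ μs p₀ → (∀ w → A w → ¬ Sp w × T w × (∀ j → μs (w , j) ≢ (w , j))) →
    (∀ X → Unique X → length X ≤ m → (∀ v → v ∈ X → (v ≡ vt p₀) ⊎ Σ (Fin n) λ w → Σ Bool λ j → A w × (v ≡ vt (μs (w , j)))) →
      ∀ Y → Cov Adj X A Y → 6 * length X ≤ length Y) →
    DN (Σ (List (Fin n)) λ X → Unique X × m ≤ length X × (∀ u → u ∈ X → TEnd F₀ μs p₀ A u))
  tgrow {F₀} μs p₀ A ok₀ hA ex = G.grow ex d 2^i≤m >>= λ L → return (G.Lev.X L , G.Lev.uX L , ≤-trans m≤2^d (≤-reflexive (sym (G.Lev.lX L))) ,
      λ u i → let c = G.Lev.chain L u i in record { μ = G.Ch.μ c ; p = G.Ch.p c ; τ = G.Ch.τ c ; end = G.Ch.end c ; ok = G.Ch.ok c ; chg = G.Ch.chg c ; len = G.Ch.len c ; zone = G.Ch.zone c })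
    where
    step : ∀ μ p w → OkT F₀ μ p → A w → Adj (vt p) w → (∀ j → μ (w , j) ≡ μs (w , j)) →
      DN (Σ Bool λ j → (μs (w , j) ≢ (w , j)) × (μ p ≡ p) × (Inv μ) × (p ≢ (w , j)) × OkT F₀ (rot μ p (w , j)) (μs (w , j)))
    step μ p w ok aw a i =
      tstep μ p w ok (proj₁ (hA w aw)) (proj₁ (proj₂ (hA w aw))) a (λ { refl → irr a }) (λ j e → proj₂ (proj₂ (hA w aw)) j (trans (sym (i j)) e)) >>= λ (j , ok') →
      return (j , proj₂ (proj₂ (hA w aw)) j , OkT.fp ok , OkT.inv ok , (λ { refl → irr a }) , subst (OkT F₀ _) (i j) ok')
    module G = Growth Adj μs p₀ (OkT.inv ok₀) A (OkT F₀) ok₀ step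

  rgrow : ∀ {F₀} μs r₀ → Minimal (suc (length F₀)) → OkR F₀ μs r₀ →
    DN (Σ (List (Fin n)) λ X → Unique X × m ≤ length X × (∀ u → u ∈ X → Σ (M n) λ μ → Σ (Port n) λ r → (vt r ≡ u) × OkR F₀ μ r))
  rgrow {F₀} μs r₀ minl ok₀ = G.grow ex d 2^i≤m >>= λ L → return (G.Lev.X L , G.Lev.uX L , ≤-trans m≤2^d (≤-reflexive (sym (G.Lev.lX L))) ,
      λ u i → let c = G.Lev.chain L u i in G.Ch.μ c , G.Ch.p c , G.Ch.end c , G.Ch.ok c)
    where
    step : ∀ μ p w → OkR F₀ μ p → R w → Adj (vt p) w → (∀ j → μ (w , j) ≡ μs (w , j)) →
      DN (Σ Bool λ j → (μs (w , j) ≢ (w , j)) × (μ p ≡ p) × (Inv μ) × (p ≢ (w , j)) × OkR F₀ (rot μ p (w , j)) (μs (w , j)))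
    step μ p w okr Rw a i = rstep minl μ p w ok Rw a >>= λ (j , ne , p≢ , ok') →
        return (j , (λ e → ne (trans (i j) e)) , Ok.fp ok , Ok.inv ok , p≢ , subst (OkR F₀ _) (i j) (record { ok = ok' ; keep = λ z k → let (f , np) = keep z k in
          trans (rot-o μ p (w , j) np (λ { refl → ne f }) (λ { refl → ne (trans (sym f) (Ok.inv ok (w , j))) })) f , λ { refl → ne (trans (sym f) (Ok.inv ok (w , j))) } }))
      where open OkR okr
    module G = Growth Adj μs r₀ (Ok.inv (OkR.ok ok₀)) R (OkR F₀) ok₀ step
    endR : ∀ v → G.End v → R v
    endR v (inj₁ refl) = Ok.Rp (OkR.ok ok₀)
    endR v (inj₂ (w , j , Rw , refl)) with μs (w , j) ≟P (w , j)
    ... | yes e = subst R (cong vt (sym e)) Rw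
    ... | no ne = PM.domμ (Ok.pm (OkR.ok ok₀)) (w , j) ne
    ex : G.Ex 6 m
    ex X u l e Y c = exR X u (λ v i → endR v (e v i)) l Y c

  record Linked₂ (FT FR : List (Port n)) (μs : M n) (p₀ : Port n) (A : Fin n → Set) : Set where
    field
      u   : Fin n
      t   : TEnd FT μs p₀ A u
      μR  : M n
      r   : Port n
      okR : OkR FR μR r
      adj : Adj (vt (TEnd.p t)) (vt r)

  link : ∀ {FT FR} μs p₀ (A : Fin n → Set) → OkT FT μs p₀ → (∀ w → A w → ¬ Sp w × T w × (∀ j → μs (w , j) ≢ (w , j))) →
    (∀ X → Unique X → length X ≤ m → (∀ v → v ∈ X → (v ≡ vt p₀) ⊎ Σ (Fin n) λ w → Σ Bool λ j → A w × (v ≡ vt (μs (w , j)))) →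
      ∀ Y → Cov Adj X A Y → 6 * length X ≤ length Y) →
    ∀ μR r → Minimal (suc (length FR)) → OkR FR μR r → DN (Linked₂ FT FR μs p₀ A)
  link {FT} {FR} μs p₀ A ok hA ex μR r minl okr = tgrow μs p₀ A ok hA ex >>= λ (X , uX , lX , tX) → rgrow μR r minl okr >>= λ (Y , uY , lY , rY) →
      return (mk X Y tX rY (joined X Y uX uY (λ v i j → disj (tX v i) (rY v j)) lX lY))
    where
    disj : ∀ {v} → TEnd FT μs p₀ A v → (Σ (M n) λ μ → Σ (Port n) λ r → (vt r ≡ v) × OkR FR μ r) → ⊥
    disj t (_ , _ , e , o) = RT _ (subst R e (Ok.Rp (OkR.ok o))) (subst T (TEnd.end t) (OkT.Tp (TEnd.ok t)))
    mk : ∀ X Y → (∀ u → u ∈ X → TEnd FT μs p₀ A u) → (∀ u → u ∈ Y → Σ (M n) λ μ → Σ (Port n) λ r → (vt r ≡ u) × OkR FR μ r) →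
      (Σ (Fin n) λ u → Σ (Fin n) λ v → u ∈ X × v ∈ Y × Adj u v) → Linked₂ FT FR μs p₀ A
    mk X Y tX rY (u , v , i , j , a) = let (μ' , r' , e , o) = rY v j in record
      { u = u ; t = tX u i ; μR = μ' ; r = r' ; okR = o ; adj = subst₂ Adj (sym (TEnd.end (tX u i))) (sym e) a }

  -- An old route to a special vertex survives the cut up to the point where it first meets an end
  -- of the removed edge, and both ends are still tied.
  cut-star : ∀ μ a → Inv μ → (∀ v → T v → Star Sp μ v) → Star Sp (cut μ a) (vt a) → Star Sp (cut μ a) (vt (μ a)) → ∀ v → T v → Star Sp (cut μ a) v
  cut-star μ a inv star sa sb v Tv = let (s , h , c) = star v Tv in go h c
    where
    go : ∀ {v s} → Sp s → Cn μ Any-port v s → Star Sp (cut μ a) v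
    go h here = _ , h , here
    go {s = s} h (stp z refl _ c) with z ≟P a | z ≟P μ a
    ... | yes refl | _ = sa
    ... | no _ | yes refl = sb
    ... | no na | no nb = star-via (subst (Cn (cut μ a) Any-port (vt z)) (cong vt (cut-o μ a na nb)) (cn-one z tt)) (go h c)

  module Rounds where

    -- The joining edges are only recorded in `J`. Until the end the matchings on the two
    -- territories stay separate, so the ends already paired remain free ports, and the cover of `R`
    -- keeps exactly `k` of them and remains minimal. `Tch` lists where the chain may have been
    -- altered.
    record GS (rem : ℕ) : Set where
      field
        μT μR : M n
        J     : List (Port n × Port n)
        FR    : List (Port n)
        pmT   : PM _≢_ T μT
        edgeA : ∀ z → μT z ≢ z → ¬ SpP z → Adj (vt z) (vt (μT z))
        spec  : ∀ z → SpP z → μT z ≡ σ z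
        star  : ∀ v → T v → Star Sp μT v
        covT  : ∀ z → T (vt z) → μT z ≡ z → z ∈ map proj₁ J
        keepT : ∀ z → z ∈ map proj₁ J → μT z ≡ z × T (vt z)
        uJT   : Unique (map proj₁ J)
        Tch   : List (Fin n)
        agree : ∀ z → vt z ∉ Tch → μT z ≡ σ z
        lTch  : length Tch ≤ length J * (2 * d + 2)
        pmR   : PM Adj R μR
        nscR  : NSC (λ _ → ⊤) μR
        covR  : CoverFree μR (map proj₂ J ++ FR)
        keepR : ∀ z → z ∈ map proj₂ J ++ FR → μR z ≡ z × R (vt z)
        uR    : Unique (map proj₂ J ++ FR)
        total : length J + length FR ≡ k
        lFR   : length FR ≡ 2 * rem
        adjJ  : ∀ a b → (a , b) ∈ J → Adj (vt a) (vt b)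

    module Round {rem : ℕ} (gs : GS (suc rem)) where
      open GS gs
      open PM pmT using () renaming (inv to invT)

      nb : Bool → Fin n → Fin n
      nb b x = vt (μT (x , b))

      nb-sym : ∀ j w → Σ Bool λ i → nb i (nb j w) ≡ w
      nb-sym j w = proj₂ (μT (w , j)) , cong vt (invT (w , j))

      open Core Adj nb nb-sym
      open Half μT pmT TL uTL inTL using (Arc; arc)

      JT : List (Port n)
      JT = map proj₁ J

      lJ : length J ≤ k
      lJ = ≤-trans (m≤m+n (length J) (length FR)) (≤-reflexive total)

      module WithArc {h : ℕ} (A : Arc h) (h≡ : h + length LL ≡ length TL + 36 * m) where
        open Arc A

        B₀ : List (Fin n)
        B₀ = map vt ∂ ++ map vt JT

        lB₀ : length B₀ ≤ m
        lB₀ = ≤-trans (≤-reflexive (trans (length-++ (map vt ∂)) (cong₂ _+_ (length-map vt ∂) (trans (length-map vt JT) (length-map proj₁ J))))) (≤-trans (+-mono-≤ l∂ lJ) k≤m)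

        Sides : Bool → Fin n → Set
        Sides true v = v ∈ H
        Sides false v = v ∉ H

        P : Bool → Fin n → Set
        P b v = v ∈ LL × Sides b v

        module pH = SV.Parts (SV.split H LL)
        module pC = SV.Parts (SV.split LL H)
        module pT = SV.Parts (SV.split TL LL)

        PL : Bool → List (Fin n)
        PL true = pH.ins
        PL false = pC.outs

        uPL : ∀ b → Unique (PL b)
        uPL true = pH.uins uH
        uPL false = pC.uouts uLL

        inPL : ∀ b v → v ∈ PL b → P b v
        inPL true v i = pH.ins∈ i , pH.ins⊑ i
        inPL false v i = pC.outs⊑ i , pC.outs∉ i

        lPL : ∀ b → 36 * m ≤ length (PL b)
        lPL false = +-cancelˡ-≤ (h + length LL) _ _ (≤-trans (≤-reflexive (cong (_+ 36 * m) h≡)) (≤-trans (≤-reflexive (ar₁ (length TL) m)) (≤-trans sizes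
            (≤-trans (≤-reflexive (ar₂ (length LL))) (≤-trans (+-monoʳ-≤ (length LL) (≤-trans (SV.outs≥ (SV.split LL H) uLL) (≤-reflexive (cong (_+ length pC.outs) lH)))) (≤-reflexive (ar₃ h (length LL) (length pC.outs))))))))
          where
          ar₁ : ∀ t m → t + 36 * m + 36 * m ≡ t + 72 * m
          ar₁ = solve-∀
          ar₂ : ∀ l → 2 * l ≡ l + l
          ar₂ = solve-∀
          ar₃ : ∀ h l o → l + (h + o) ≡ h + l + o
          ar₃ = solve-∀
        lPL true = +-cancelˡ-≤ (length pT.outs) _ _ (≤-trans (≤-reflexive outs≡) (≤-trans (≤-reflexive (trans (sym lH) pH.size)) (≤-trans (≤-reflexive (+-comm (length pH.ins) _)) (+-monoˡ-≤ (length pH.ins) outH))))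
          where
          insT : length pT.ins ≡ length LL
          insT = ≤-antisym (pigeon (pT.uins uTL) pT.ins∈) (pigeon uLL λ i → case pT.cover (inTL _ (proj₁ (LLT _ i))) of λ { (inj₁ k) → k ; (inj₂ k) → ⊥-elim (pT.outs∉ k i) })
          outs≡ : length pT.outs + 36 * m ≡ h
          outs≡ = +-cancelʳ-≡ (length LL) _ _ (trans (ar (length pT.outs) (36 * m) (length LL)) (trans (cong (λ q → q + length pT.outs + 36 * m) (sym insT)) (trans (cong (_+ 36 * m) (sym pT.size)) (sym h≡))))
            where ar : ∀ o a l → o + a + l ≡ l + o + a
                  ar = solve-∀
          outH : length pH.outs ≤ length pT.outs
          outH = pigeon (pH.uouts uH) λ i → case pT.cover (H⊑ _ (pH.outs⊑ i)) of λ { (inj₁ k) → ⊥-elim (pH.outs∉ i (pT.ins∈ k)) ; (inj₂ k) → k }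

        Res : Bool → Set
        Res b = Result (λ _ → ⊤) (P b) B₀ 12 m m

        cores : ∀ b → DN (Res b)
        cores b = core-join nb nb-sym (λ _ → ⊤) (P b) (PL b) B₀ 12 m (uPL b) (inPL b) ≤-refl
          (≤-trans (+-monoˡ-≤ m (+-monoˡ-≤ (2 * m) (+-monoʳ-≤ (12 * (2 * m)) (*-monoʳ-≤ 3 (+-monoˡ-≤ (2 * m) lB₀))))) (≤-trans (≤-reflexive (ar m)) (lPL b)))
          where ar : ∀ m → 12 * (2 * m) + 3 * (m + 2 * m) + 2 * m + m ≡ 36 * m
                ar = solve-∀

        side-nb : ∀ b w j → Sides b w → w ∉ map vt ∂ → nb j w ∉ map vt ∂ → Sides b (nb j w)
        side-nb true w j i a c with SV._∈?_ (nb j w) H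
        ... | yes l = l
        ... | no l = ⊥-elim (a (∈-map⁺ vt (bd (w , j) i l)))
        side-nb false w j ni a c l = c (∈-map⁺ vt (bd (μT (w , j)) l λ l' → ni (subst (λ z → vt z ∈ H) (invT (w , j)) l')))

        module Pivot (b : Bool) (res : Res b) (l l' : Fin n) where
          open Result res

          A₁ A₂ : Fin n → Set
          A₁ = AB (P b) (B₀ ++ Xb)
          A₂ = AB A₁ (l ∷ l' ∷ [])

          hA : ∀ w → A₂ w → ¬ Sp w × T w × (∀ j → μT (w , j) ≢ (w , j))
          hA w (((w∈ , _) , nB , _) , _) = proj₂ (LLT w w∈) , proj₁ (LLT w w∈) , λ j e →
            nB (∈-++⁺ˡ (∈-++⁺ʳ (map vt ∂) (∈-map⁺ vt (covT (w , j) (proj₁ (LLT w w∈)) e))))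

          sideA : ∀ w → A₂ w → Sides b w
          sideA w (((_ , s) , _) , _) = s

          sideN : ∀ w j → A₂ w → Sides b (nb j w)
          sideN w j (((_ , s) , nB , nnB) , _) = side-nb b w j s (λ i → nB (∈-++⁺ˡ (∈-++⁺ˡ i))) (λ i → nnB j (∈-++⁺ˡ (∈-++⁺ˡ i)))

          off-l : ∀ w → A₂ w → w ≢ l × w ≢ l'
          off-l w (_ , n₂ , _) = (λ e → n₂ (here e)) , λ e → n₂ (there (here e))

          ex6 : ∀ (μs : M n) (p₀ : Port n) → vt p₀ ∉ Xb → (∀ w j → A₂ w → μs (w , j) ≡ μT (w , j)) →
            ∀ X → Unique X → length X ≤ m → (∀ v → v ∈ X → (v ≡ vt p₀) ⊎ Σ (Fin n) λ w → Σ Bool λ j → A₂ w × (v ≡ vt (μs (w , j)))) →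
            ∀ Y → Cov Adj X A₂ Y → 6 * length X ≤ length Y
          ex6 μs p₀ p∉ same [] u lX e Y c = z≤n
          -- Excluding the two ends of the cut edge costs at most 6 targets, and 12|X| - 6 ≥ 6|X|
          -- for nonempty `X`.
          ex6 μs p₀ p∉ same X@(x ∷ xs) u lX e Y c = +-cancelʳ-≤ 6 _ _ (≤-trans (≤-trans (+-monoʳ-≤ (6 * length X) (m≤m*n 6 (length X))) (≤-reflexive (ar (length X))))
              (≤-trans (good X u (λ v i → tt , offX v (e v i)) lX (Y ++ blow (l ∷ l' ∷ [])) (cov-AB {P = A₁} c)) (≤-reflexive (cov-AB-length nb nb-sym Y (l ∷ l' ∷ [])))))
            where
            ar : ∀ a → 6 * a + 6 * a ≡ 12 * a
            ar = solve-∀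
            offX : ∀ v → ((v ≡ vt p₀) ⊎ Σ (Fin n) λ w → Σ Bool λ j → A₂ w × (v ≡ vt (μs (w , j)))) → v ∉ Xb
            offX v (inj₁ refl) = p∉
            offX v (inj₂ (w , j , aw@((_ , _ , nn) , _) , refl)) i = nn j (∈-++⁺ʳ B₀ (subst (λ z → vt z ∈ Xb) (same w j aw) i))

        module Step (res₁ : Res true) (res₂ : Res false) (l : Fin n) (l∈ : l ∈ LL)
          (clear : ∀ z → vt z ∈ sg l → μT z ≡ σ z) (l∉ : l ∉ Result.Xb res₁) (l'∉ : vt (σ (l , true)) ∉ Result.Xb res₂)
          (r₁ r₂ : Port n) (FR' : List (Port n)) (FR≡ : FR ≡ r₁ ∷ r₂ ∷ FR') where
          a b : Port n
          a = (l , true)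
          b = σ a
          l' : Fin n
          l' = vt b

          sT = σ-T l l∈

          μa : μT a ≡ b
          μa = clear a (sg-self l l∈)

          ma : μT a ≢ a
          ma e = proj₁ sT (trans (sym μa) e)

          μc : M n
          μc = cut μT a

          module P₁ = Pivot true res₁ l l'
          module P₂ = Pivot false res₂ l l'

          c-same : ∀ z → vt z ≢ l → vt z ≢ l' → μc z ≡ μT z
          c-same z n₁ n₂ = cut-o μT a (λ { refl → n₁ refl }) (λ { refl → n₂ (cong vt μa) })

          nJ : ∀ z → μT z ≢ z → z ∉ JT
          nJ z ne i = ne (proj₁ (keepT z i))

          b≢a : b ≢ a
          b≢a = proj₁ sT

          mb : μT b ≢ b
          mb e = b≢a (sym (trans (sym (invT a)) (trans (cong μT μa) e)))

          cb : μc b ≡ b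
          cb = trans (cong μc (sym μa)) (trans (cut-r μT a) μa)

          starC : ∀ v → T v → Star Sp μc v
          starC = let (s₁ , s₂) = cutFact l l∈ μT invT clear in cut-star μT a invT star s₁ (subst (Star Sp μc) (cong vt (sym μa)) s₂)

          ok₁ : OkT (b ∷ JT) μc a
          ok₁ = record { pm = cutPM (λ ne e → ne (sym e)) a pmT
            ; edgeA = λ z ne ns → edgeC z ne ns (cutCase μT a z)
            ; spec = λ z h → trans (cut-o μT a (λ { refl → proj₂ (LLT l l∈) (SpP-vt a h) }) (λ { refl → proj₁ (proj₂ (proj₂ sT)) (subst SpP μa h) })) (spec z h)
            ; star = starC ; fp = cut-q μT a ; Tp = proj₁ (LLT l l∈)
            ; cover = λ z Tz e → case cut-free μT a z e of λ { (inj₁ e') → inj₁ e' ; (inj₂ (inj₁ e')) → inj₂ (here (trans e' μa)) ; (inj₂ (inj₂ e')) → inj₂ (there (covT z Tz e')) }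
            ; keep = λ { z (here refl) → cb , b≢a
                       ; z (there i) → trans (cut-o μT a (λ { refl → nJ a ma i }) (λ { refl → nJ b mb (subst (_∈ JT) μa i) })) (proj₁ (keepT z i)) , λ { refl → nJ a ma i } } }
            where
            edgeC : ∀ z → μc z ≢ z → ¬ SpP z → CutCase μT a z → Adj (vt z) (vt (μc z))
            edgeC z ne ns (atq refl) = ⊥-elim (ne (cut-q μT a))
            edgeC z ne ns (atr refl) = ⊥-elim (ne (cut-r μT a))
            edgeC z ne ns (off x y) = subst (λ w → Adj (vt z) (vt w)) (sym (cut-o μT a x y)) (edgeA z (λ e → ne (trans (cut-o μT a x y) e)) ns)

          same₁ : ∀ w j → P₁.A₂ w → μc (w , j) ≡ μT (w , j)
          same₁ w j aw = c-same (w , j) (proj₁ (P₁.off-l w aw)) (proj₂ (P₁.off-l w aw))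

          hA₁ : ∀ w → P₁.A₂ w → ¬ Sp w × T w × (∀ j → μc (w , j) ≢ (w , j))
          hA₁ w aw = let (x , y , z) = P₁.hA w aw in x , y , λ j e → z j (trans (sym (same₁ w j aw)) e)

          F₁ : List (Port n)
          F₁ = map proj₂ J ++ r₂ ∷ FR'

          mid∈ : ∀ {z} → z ∈ map proj₂ J ++ FR → z ≡ r₁ ⊎ z ∈ F₁
          mid∈ i = case ∈-++⁻ (map proj₂ J) (subst (λ F → _ ∈ map proj₂ J ++ F) FR≡ i) of λ { (inj₁ x) → inj₂ (∈-++⁺ˡ x) ; (inj₂ (here e)) → inj₁ e ; (inj₂ (there x)) → inj₂ (∈-++⁺ʳ (map proj₂ J) x) }

          ∈mid : ∀ {z} → z ≡ r₁ ⊎ z ∈ F₁ → z ∈ map proj₂ J ++ FR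
          ∈mid i = subst (λ F → _ ∈ map proj₂ J ++ F) (sym FR≡) (case i of λ { (inj₁ refl) → ∈-++⁺ʳ (map proj₂ J) (here refl)
            ; (inj₂ x) → case ∈-++⁻ (map proj₂ J) x of λ { (inj₁ y) → ∈-++⁺ˡ y ; (inj₂ y) → ∈-++⁺ʳ (map proj₂ J) (there y) } })

          uF : Unique (map proj₂ J ++ r₁ ∷ r₂ ∷ FR')
          uF = subst (λ F → Unique (map proj₂ J ++ F)) FR≡ uR

          lF₁ : suc (length F₁) ≡ k
          lF₁ = trans (cong suc (length-++ (map proj₂ J))) (trans (sym (+-suc (length (map proj₂ J)) _)) (trans (cong₂ (λ x y → x + length y) (length-map proj₂ J) (sym FR≡)) total))

          okR₁ : OkR F₁ μR r₁
          okR₁ = record { ok = record { pm = pmR ; nsc = nscR ; fp = proj₁ (keepR r₁ (∈mid (inj₁ refl))) ; Rp = proj₂ (keepR r₁ (∈mid (inj₁ refl))) ; cover = λ z Rz e → mid∈ (covR z Rz e) }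
            ; keep = λ z i → proj₁ (keepR z (∈mid (inj₂ i))) , λ { refl → proj₁ (uniq-mid (map proj₂ J) uF) i } }

          min₁ : Minimal (suc (length F₁))
          min₁ = subst Minimal (sym lF₁) minl

          first : DN (Linked₂ (b ∷ JT) F₁ μc a P₁.A₂)
          first = link μc a P₁.A₂ ok₁ hA₁ (P₁.ex6 μc a l∉ same₁) μR r₁ min₁ okR₁

          module Second (K : Linked₂ (b ∷ JT) F₁ μc a P₁.A₂) where
            open Linked₂ K renaming (r to r₁'; μR to μR₁; okR to okR₁'; adj to adj₁)
            open TEnd t renaming (μ to μ₁; p to a'; τ to τ₁; ok to okT₁; chg to chg₁; len to len₁; zone to zone₁; end to end₁)

            ok₂ : OkT (a' ∷ JT) μ₁ b
            ok₂ = record { OkT okT₁ ; fp = proj₁ (OkT.keep okT₁ b (here refl)) ; Tp = proj₁ (proj₂ sT)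
              ; cover = λ z Tz e → case OkT.cover okT₁ z Tz e of λ { (inj₁ e') → inj₂ (here e') ; (inj₂ (here e')) → inj₁ e' ; (inj₂ (there i)) → inj₂ (there i) }
              ; keep = λ { z (here refl) → OkT.fp okT₁ , (λ e → proj₂ (OkT.keep okT₁ b (here refl)) (sym e))
                         ; z (there i) → proj₁ (OkT.keep okT₁ z (there i)) , λ { refl → nJ b mb i } } }

            same₂ : ∀ w j → P₂.A₂ w → μ₁ (w , j) ≡ μT (w , j)
            same₂ w j aw with μ₁ (w , j) ≟P μc (w , j)
            ... | yes e = trans e (c-same (w , j) (proj₁ (P₂.off-l w aw)) (proj₂ (P₂.off-l w aw)))
            ... | no ne with zone₁ w (chg₁ (w , j) ne)
            ... | inj₁ a₁ = ⊥-elim (P₂.sideA w aw (P₁.sideA w a₁))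
            ... | inj₂ (inj₁ e) = ⊥-elim (proj₁ (P₂.off-l w aw) e)
            ... | inj₂ (inj₂ (w' , j' , a₁ , e)) = ⊥-elim (P₂.sideA w aw (subst (_∈ H) (sym (trans e (cong vt (same₁ w' j' a₁)))) (P₁.sideN w' j' a₁)))

            hA₂ : ∀ w → P₂.A₂ w → ¬ Sp w × T w × (∀ j → μ₁ (w , j) ≢ (w , j))
            hA₂ w aw = let (x , y , z) = P₂.hA w aw in x , y , λ j e → z j (trans (sym (same₂ w j aw)) e)

            F₂ : List (Port n)
            F₂ = r₁' ∷ map proj₂ J ++ FR'

            in₂ : ∀ {z} → z ∈ map proj₂ J ++ r₂ ∷ FR' → z ≡ r₂ ⊎ z ∈ map proj₂ J ++ FR'
            in₂ i = case ∈-++⁻ (map proj₂ J) i of λ { (inj₁ x) → inj₂ (∈-++⁺ˡ x) ; (inj₂ (here e)) → inj₁ e ; (inj₂ (there x)) → inj₂ (∈-++⁺ʳ (map proj₂ J) x) }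

            out₂ : ∀ {z} → z ∈ map proj₂ J ++ FR' → z ∈ F₁
            out₂ i = case ∈-++⁻ (map proj₂ J) i of λ { (inj₁ x) → ∈-++⁺ˡ x ; (inj₂ x) → ∈-++⁺ʳ (map proj₂ J) (there x) }

            r₂∈ : r₂ ∈ F₁
            r₂∈ = ∈-++⁺ʳ (map proj₂ J) (here refl)

            uF₁ : Unique F₁
            uF₁ = proj₂ (uniq-mid (map proj₂ J) uF)

            R∈ : ∀ z → z ∈ F₁ → R (vt z)
            R∈ z i = proj₂ (keepR z (∈mid (inj₂ i)))

            okR₂ : OkR F₂ μR₁ r₂
            okR₂ = record { ok = record { pm = Ok.pm o ; nsc = Ok.nsc o ; fp = proj₁ (OkR.keep okR₁' r₂ r₂∈) ; Rp = R∈ r₂ r₂∈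
                  ; cover = λ z Rz e → case Ok.cover o z Rz e of λ { (inj₁ e') → inj₂ (here e') ; (inj₂ i) → case in₂ i of λ { (inj₁ e') → inj₁ e' ; (inj₂ x) → inj₂ (there x) } } }
              ; keep = λ { z (here refl) → Ok.fp o , (λ e → proj₂ (OkR.keep okR₁' r₂ r₂∈) (sym e))
                         ; z (there i) → proj₁ (OkR.keep okR₁' z (out₂ i)) , λ { refl → proj₁ (uniq-mid (map proj₂ J) uF₁) i } } }
              where o = OkR.ok okR₁'

            min₂ : Minimal (suc (length F₂))
            min₂ = subst Minimal (trans (sym lF₁) (cong suc (trans (length-++ (map proj₂ J)) (trans (+-suc _ _) (cong suc (sym (length-++ (map proj₂ J)))))))) minl

            second : DN (Linked₂ (a' ∷ JT) F₂ μ₁ b P₂.A₂)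
            second = link μ₁ b P₂.A₂ ok₂ hA₂ (P₂.ex6 μ₁ b l'∉ same₂) μR₁ r₂ min₂ okR₂

            module Third (K₂ : Linked₂ (a' ∷ JT) F₂ μ₁ b P₂.A₂) where
              open Linked₂ K₂ renaming (r to r₂'; μR to μR₂; okR to okR₂'; adj to adj₂; t to t₂; u to u₂)
              open TEnd t₂ renaming (μ to μ₂; p to b'; τ to τ₂; ok to okT₂; chg to chg₂; len to len₂; zone to zone₂; end to end₂)
              oR = OkR.ok okR₂'

              Tch' : List (Fin n)
              Tch' = l ∷ l' ∷ τ₁ ++ τ₂ ++ Tch

              agree' : ∀ z → vt z ∉ Tch' → μ₂ z ≡ σ z
              agree' z h with μ₂ z ≟P μ₁ z
              ... | no ne = ⊥-elim (h (there (there (∈-++⁺ʳ τ₁ (∈-++⁺ˡ (chg₂ z ne))))))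
              ... | yes e with μ₁ z ≟P μc z
              ... | no ne = ⊥-elim (h (there (there (∈-++⁺ˡ (chg₁ z ne)))))
              ... | yes e₁ = trans e (trans e₁ (trans (c-same z (λ e' → h (here e')) (λ e' → h (there (here e')))) (agree z λ i → h (there (there (∈-++⁺ʳ τ₁ (∈-++⁺ʳ τ₂ i)))))))

              ltch : length Tch' ≤ suc (suc (length J)) * (2 * d + 2)
              ltch = ≤-trans (s≤s (s≤s (≤-trans (≤-reflexive (trans (length-++ τ₁) (cong (length τ₁ +_) (length-++ τ₂)))) (+-mono-≤ len₁ (+-mono-≤ len₂ lTch))))) (≤-reflexive (ar (2 * d) (length J * (2 * d + 2))))
                where ar : ∀ x y → suc (suc (suc x + (suc x + y))) ≡ (x + 2) + ((x + 2) + y)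
                      ar = solve-∀

              reR : ∀ {z} → z ∈ r₂' ∷ r₁' ∷ map proj₂ J ++ FR' → z ≡ r₂' ⊎ z ∈ F₂
              reR (here e) = inj₁ e
              reR (there i) = inj₂ i

              keepRR : ∀ z → z ∈ r₂' ∷ r₁' ∷ map proj₂ J ++ FR' → μR₂ z ≡ z × R (vt z)
              keepRR z (here refl) = Ok.fp oR , Ok.Rp oR
              keepRR z (there (here refl)) = proj₁ (OkR.keep okR₂' z (here refl)) , Ok.Rp (OkR.ok okR₁')
              keepRR z (there (there i)) = proj₁ (OkR.keep okR₂' z (there i)) , R∈ z (out₂ i)

              next : GS rem
              next = record
                { μT = μ₂ ; μR = μR₂ ; J = (b' , r₂') ∷ (a' , r₁') ∷ J ; FR = FR' ; pmT = OkT.pm okT₂ ; edgeA = OkT.edgeA okT₂ ; spec = OkT.spec okT₂ ; star = OkT.star okT₂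
                ; covT = λ z Tz e → case OkT.cover okT₂ z Tz e of λ { (inj₁ e') → here e' ; (inj₂ i) → there i }
                ; keepT = λ { z (here refl) → OkT.fp okT₂ , OkT.Tp okT₂ ; z (there (here refl)) → proj₁ (OkT.keep okT₂ z (here refl)) , OkT.Tp okT₁
                            ; z (there (there i)) → proj₁ (OkT.keep okT₂ z (there i)) , proj₂ (keepT z i) }
                ; uJT = uniq-∷ (λ i → proj₂ (OkT.keep okT₂ b' i) refl) (uniq-∷ (λ i → proj₂ (OkT.keep okT₁ a' (there i)) refl) uJT)
                ; Tch = Tch' ; agree = agree' ; lTch = ltch ; pmR = Ok.pm oR ; nscR = Ok.nsc oR
                ; covR = λ z Rz e → case Ok.cover oR z Rz e of λ { (inj₁ e') → here e' ; (inj₂ i) → there i }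
                ; keepR = keepRR
                ; uR = uniq-∷ (λ i → proj₂ (OkR.keep okR₂' r₂' i) refl) (uniq-∷ (λ i → proj₂ (OkR.keep okR₁' r₁' (out₂ i)) refl) (proj₂ (uniq-mid (map proj₂ J) uF₁)))
                ; total = trans (trans (sym (trans (cong (λ x → length J + length x) FR≡) (ar (length J) (length FR')))) total) refl
                ; lFR = suc-injective (suc-injective (trans (sym (cong length FR≡)) (trans lFR (*-suc 2 rem))))
                ; adjJ = λ { _ _ (here refl) → adj₂ ; _ _ (there (here refl)) → adj₁ ; x y (there (there i)) → adjJ x y i } }
                where ar : ∀ x y → x + suc (suc y) ≡ suc (suc (x + y))
                      ar = solve-∀

        -- The edge to be cut must lie on an untouched segment, start outside one bad list and end
        -- outside the other. Its end l' determines l as a neighbour of l' in `σ`, through one of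
        -- two ports, so the last condition excludes the images of the second bad list under both.
        avoidList : Res true → Res false → List (Fin n)
        avoidList res₁ res₂ = concatMap sg Tch ++ Result.Xb res₁ ++ map (λ v → vt (σ (v , false))) (Result.Xb res₂) ++ map (λ v → vt (σ (v , true))) (Result.Xb res₂)

        avoid-length : ∀ res₁ res₂ → length (avoidList res₁ res₂) < length LL
        avoid-length res₁ res₂ = ≤-<-trans (≤-trans (≤-reflexive (length-++ (concatMap sg Tch))) (+-mono-≤
            (≤-trans (cm Tch) (*-monoʳ-≤ len (≤-trans lTch (*-monoˡ-≤ (2 * d + 2) lJ))))
            (≤-trans (≤-reflexive (trans (length-++ (Result.Xb res₁)) (cong (length (Result.Xb res₁) +_) (trans (length-++ (map _ (Result.Xb res₂))) (cong₂ _+_ (length-map _ (Result.Xb res₂)) (length-map _ (Result.Xb res₂)))))))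
              (≤-trans (+-mono-≤ (Result.lXb res₁) (+-mono-≤ (Result.lXb res₂) (Result.lXb res₂))) (≤-reflexive (ar m)))))) roomL
          where
          ar : ∀ m → m + (m + m) ≡ 3 * m
          ar = solve-∀
          cm : ∀ ts → length (concatMap sg ts) ≤ len * length ts
          cm [] = z≤n
          cm (t ∷ ts) = ≤-trans (≤-reflexive (length-++ (sg t))) (≤-trans (+-mono-≤ (sg-len t) (cm ts)) (≤-reflexive (sym (*-suc len (length ts)))))

        goRound : ∀ (res₁ : Res true) (res₂ : Res false) → (Σ (Fin n) λ l → l ∈ LL × l ∉ avoidList res₁ res₂) →
          (r₁ r₂ : Port n) (FR' : List (Port n)) → FR ≡ r₁ ∷ r₂ ∷ FR' → DN (GS rem)
        goRound res₁ res₂ (l , l∈ , l∉) r₁ r₂ FR' eq = first >>= λ K → Second.second K >>= λ K₂ → return (Second.Third.next K K₂)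
          where
          clear : ∀ z → vt z ∈ sg l → μT z ≡ σ z
          clear z i = agree z λ t∈ → l∉ (∈-++⁺ˡ (∈-concatMap⁺ sg (Data.List.Membership.Propositional.lose t∈ (sg-sym l (vt z) l∈ i))))
          l'∉ : vt (σ (l , true)) ∉ Result.Xb res₂
          l'∉ i = l∉ (∈-++⁺ʳ (concatMap sg Tch) (∈-++⁺ʳ (Result.Xb res₁) (from (proj₂ (σ (l , true))) refl)))
            where
            from : ∀ c → proj₂ (σ (l , true)) ≡ c → l ∈ map (λ v → vt (σ (v , false))) (Result.Xb res₂) ++ map (λ v → vt (σ (v , true))) (Result.Xb res₂)
            from false e = ∈-++⁺ˡ (subst (_∈ map (λ v → vt (σ (v , false))) (Result.Xb res₂)) (trans (cong (λ c → vt (σ (vt (σ (l , true)) , c))) (sym e)) (cong vt (σ-inv (l , true)))) (∈-map⁺ (λ v → vt (σ (v , false))) i))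
            from true e = ∈-++⁺ʳ (map (λ v → vt (σ (v , false))) (Result.Xb res₂)) (subst (_∈ map (λ v → vt (σ (v , true))) (Result.Xb res₂)) (trans (cong (λ c → vt (σ (vt (σ (l , true)) , c))) (sym e)) (cong vt (σ-inv (l , true)))) (∈-map⁺ (λ v → vt (σ (v , true))) i))
          open Step res₁ res₂ l l∈ clear (λ i → l∉ (∈-++⁺ʳ (concatMap sg Tch) (∈-++⁺ˡ i))) l'∉ r₁ r₂ FR' eq

      LL≤TL : length LL ≤ length TL
      LL≤TL = pigeon uLL λ i → inTL _ (proj₁ (LLT _ i))

      36m≤LL : 36 * m ≤ length LL
      36m≤LL = ≤-trans (*-monoˡ-≤ m {36} {72} (m≤m+n 36 36)) (+-cancelˡ-≤ (length LL) _ _ (≤-trans (+-monoˡ-≤ (72 * m) LL≤TL) (≤-trans sizes (≤-reflexive (cong (length LL +_) (+-identityʳ _))))))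

      round : DN (GS rem)
      round = arc h h≤ >>= λ A → WithArc.cores A h≡ true >>= λ res₁ → WithArc.cores A h≡ false >>= λ res₂ →
          go A res₁ res₂ FR refl lFR
        where
        -- Chosen so that both sides contain 36m vertices of the long paths: inside, h - (|TL| -
        -- |LL|) = 36m; outside, |LL| - h = 2|LL| - |TL| - 36m, which is at least 36m by `sizes`.
        h = (length TL + 36 * m) ∸ length LL
        h≡ : h + length LL ≡ length TL + 36 * m
        h≡ = m∸n+n≡m (≤-trans LL≤TL (m≤m+n _ _))
        h≤ : h ≤ length TL
        h≤ = +-cancelʳ-≤ (length LL) _ _ (≤-trans (≤-reflexive h≡) (+-monoʳ-≤ (length TL) 36m≤LL))
        go : (A : Arc h) (res₁ : WithArc.Res A h≡ true) (res₂ : WithArc.Res A h≡ false) → ∀ F → FR ≡ F → length F ≡ 2 * suc rem → DN (GS rem)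
        go A res₁ res₂ [] eq ()
        go A res₁ res₂ (r ∷ []) eq l = ⊥-elim (no-one rem l)
          where no-one : ∀ r → 1 ≢ 2 * suc r
                no-one r e with trans e (*-suc 2 r)
                ... | ()
        go A res₁ res₂ (r₁ ∷ r₂ ∷ FR') eq _ = WithArc.goRound A h≡ res₁ res₂ (SV.avoid uLL (WithArc.avoid-length A h≡ res₁ res₂)) r₁ r₂ FR' eq

    rounds : ∀ rem → GS rem → DN (GS 0)
    rounds zero gs = return gs
    rounds (suc rem) gs = Round.round gs >>= rounds rem


-- Two-factors: merging cycles, subdividing edges, reading off a Hamilton path

allPorts-length : ∀ n → length (ports (allFin n)) ≡ 2 * n
allPorts-length n = trans (ports-length (allFin n)) (cong (2 *_) (length-tabulate {n = n} (λ i → i)))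

module _ {n : ℕ} (μ : M n) (inv : Inv μ) where
  orbit : ℕ → Port n → List (Port n)
  orbit zero p = []
  orbit (suc k) p = p ∷ orbit k (nx μ p)

  orbit-length : ∀ k p → length (orbit k p) ≡ k
  orbit-length zero p = refl
  orbit-length (suc k) p = cong suc (orbit-length k (nx μ p))

  orbit-index : ∀ {k p z} → z ∈ orbit k p → Σ ℕ λ i → i < k × it μ i p ≡ z
  orbit-index {suc k} (here refl) = 0 , s≤s z≤n , refl
  orbit-index {suc k} (there i) = let (j , lt , e) = orbit-index i in suc j , s≤s lt , e

  -- There are 2n ports, so 2n + 1 consecutive positions repeat; injectivity of a step moves the
  -- repetition back to the start.
  returns : ∀ P → Σ ℕ λ k → it μ (suc k) P ≡ P
  returns P = go (suc (2 * n)) (λ u → <⇒≱ ≤-refl (≤-trans (≤-reflexive (sym (orbit-length (suc (2 * n)) P))) (≤-trans (pigeon u λ {z} _ → ∈-ports z (∈-allFin (vt z))) (≤-reflexive (allPorts-length n)))))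
    where
    go : ∀ k {P} → ¬ Unique (orbit k P) → Σ ℕ λ k → it μ (suc k) P ≡ P
    go zero h = ⊥-elim (h [])
    go (suc k) {P} h with SP._∈?_ P (orbit k (nx μ P))
    ... | yes i = let (j , _ , e) = orbit-index i in j , e
    ... | no ni = let (j , e) = go k λ u → h (uniq-∷ ni u) in j , nx-inj {μ = μ} inv (trans (sym (it-suc μ (suc j) P)) e)

  first-return : ∀ P Q k → it μ k P ≡ Q → Σ ℕ λ i → i ≤ k × it μ i P ≡ Q × (∀ j → j < i → it μ j P ≢ Q)
  first-return P Q zero e = 0 , z≤n , e , λ _ ()
  first-return P Q (suc k) e with P ≟P Q
  ... | yes e' = 0 , z≤n , e' , λ _ ()
  ... | no ne = let (i , le , e₁ , h) = first-return (nx μ P) Q k e in suc i , s≤s le , e₁ , λ { zero _ → ne ; (suc j) (s≤s lt) → h j lt }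

  cn-walk : ∀ {G} i P → (∀ j → j < i → G (it μ j P)) → Cn μ G (vt P) (vt (it μ i P))
  cn-walk zero P h = here
  cn-walk (suc i) P h = stp P refl (h 0 (s≤s z≤n)) (cn-walk i (nx μ P) λ j lt → h (suc j) (s≤s lt))

  -- In a two-factor the ends of an edge a stay connected when that edge is removed.
  around : ∀ a → (∀ j → μ (it μ j (sw a)) ≢ it μ j (sw a)) →
    Σ ℕ λ i → it μ i (sw a) ≡ μ a × (∀ j → j < i → it μ j (sw a) ≢ a × it μ j (sw a) ≢ μ a)
  around a nf with returns (sw a)
  ... | k , e with first-return (sw a) (μ a) k (nx-inj {μ = μ} inv (trans (sym (it-suc μ k (sw a))) (trans e (cong sw (sym (inv a))))))
  ... | i , _ , e₁ , h = i , e₁ , λ j lt → (λ e₂ → let (l , f) = palindrome inv j (sw a) (trans e₂ (sym (sw-sw a))) in nf l f) , h j lt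

module _ {n : ℕ} (Adj : Fin n → Fin n → Set) where
  record Mt (V : Fin n → Set) (X : Port n → Set) (μ : M n) : Set where
    field
      inv  : Inv μ
      full : ∀ z → V (vt z) → μ z ≢ z
      free : ∀ z → ¬ V (vt z) → μ z ≡ z
      edge : ∀ z → V (vt z) → ¬ X z → Adj (vt z) (vt (μ z))

    closed : ∀ z → V (vt z) → DN (V (vt (μ z)))
    closed z h k = full z h (trans (sym (free (μ z) k)) (inv z))

module Swap {n : ℕ} (μ : M n) (inv : Inv μ) (a e : Port n) (a≢e : a ≢ e) (a≢μa : μ a ≢ a) (e≢μe : μ e ≢ e) (a≢μe : a ≢ μ e) where
  b = μ a
  f = μ e

  flip₂ : M n
  flip₂ z with z ≟P a | z ≟P f | z ≟P b | z ≟P e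
  ... | yes _ | _ | _ | _ = f
  ... | no _ | yes _ | _ | _ = a
  ... | no _ | no _ | yes _ | _ = e
  ... | no _ | no _ | no _ | yes _ = b
  ... | no _ | no _ | no _ | no _ = μ z

  b≢e : b ≢ e
  b≢e h = a≢μe (trans (sym (inv a)) (cong μ h))

  b≢f : b ≢ f
  b≢f h = a≢e (trans (sym (inv a)) (trans (cong μ h) (inv e)))

  fa : flip₂ a ≡ f
  fa with a ≟P a
  ... | yes _ = refl
  ... | no ne = contradiction refl ne

  ff : flip₂ f ≡ a
  ff with f ≟P a | f ≟P f
  ... | yes h | _ = contradiction (sym h) a≢μe
  ... | no _ | yes _ = refl
  ... | no _ | no ne = contradiction refl ne

  fb : flip₂ b ≡ e
  fb with b ≟P a | b ≟P f | b ≟P b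
  ... | yes h | _ | _ = contradiction h a≢μa
  ... | no _ | yes h | _ = contradiction h b≢f
  ... | no _ | no _ | yes _ = refl
  ... | no _ | no _ | no ne = contradiction refl ne

  fe : flip₂ e ≡ b
  fe with e ≟P a | e ≟P f | e ≟P b | e ≟P e
  ... | yes h | _ | _ | _ = contradiction (sym h) a≢e
  ... | no _ | yes h | _ | _ = contradiction (sym h) e≢μe
  ... | no _ | no _ | yes h | _ = contradiction (sym h) b≢e
  ... | no _ | no _ | no _ | yes _ = refl
  ... | no _ | no _ | no _ | no ne = contradiction refl ne

  fo : ∀ {z} → z ≢ a → z ≢ f → z ≢ b → z ≢ e → flip₂ z ≡ μ z
  fo {z} h₁ h₂ h₃ h₄ with z ≟P a | z ≟P f | z ≟P b | z ≟P e
  ... | yes h | _ | _ | _ = contradiction h h₁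
  ... | no _ | yes h | _ | _ = contradiction h h₂
  ... | no _ | no _ | yes h | _ = contradiction h h₃
  ... | no _ | no _ | no _ | yes h = contradiction h h₄
  ... | no _ | no _ | no _ | no _ = refl

  data Case (z : Port n) : Set where
    isa : z ≡ a → Case z
    isf : z ≡ f → Case z
    isb : z ≡ b → Case z
    ise : z ≡ e → Case z
    off : z ≢ a → z ≢ f → z ≢ b → z ≢ e → Case z

  case? : ∀ z → Case z
  case? z with z ≟P a | z ≟P f | z ≟P b | z ≟P e
  ... | yes h | _ | _ | _ = isa h
  ... | no _ | yes h | _ | _ = isf h
  ... | no _ | no _ | yes h | _ = isb h
  ... | no _ | no _ | no _ | yes h = ise h
  ... | no h₁ | no h₂ | no h₃ | no h₄ = off h₁ h₂ h₃ h₄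

  flip-inv : Inv flip₂
  flip-inv z with case? z
  ... | isa refl = trans (cong flip₂ fa) ff
  ... | isf refl = trans (cong flip₂ ff) fa
  ... | isb refl = trans (cong flip₂ fb) fe
  ... | ise refl = trans (cong flip₂ fe) fb
  ... | off h₁ h₂ h₃ h₄ = trans (cong flip₂ (fo h₁ h₂ h₃ h₄)) (trans (fo (λ h → h₃ (back h)) (λ h → h₄ (trans (back h) (inv e))) (λ h → h₁ (trans (back h) (inv a))) (λ h → h₂ (back h))) (inv z))
    where back : ∀ {x} → μ z ≡ x → z ≡ μ x
          back h = trans (sym (inv z)) (cong μ h)

  off4 : Port n → Set
  off4 z = z ≢ a × z ≢ f × z ≢ b × z ≢ e

  lift4 : ∀ {u v} → Cn μ off4 u v → Cn flip₂ Any-port u v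
  lift4 = cn-lift λ z (h₁ , h₂ , h₃ , h₄) → subst (λ y → Cn flip₂ Any-port (vt z) (vt y)) (fo h₁ h₂ h₃ h₄) (cn-one z tt)

  -- Exchanging the edges ab, ef for af, be merges two different cycles into one.
  module _ (nfa : ∀ j → μ (it μ j (sw a)) ≢ it μ j (sw a)) (nfe : ∀ j → μ (it μ j (sw e)) ≢ it μ j (sw e)) (apart : ¬ Cn μ Any-port (vt a) (vt e)) where
    walkC : ∀ j p → Cn μ Any-port (vt p) (vt (it μ j p))
    walkC j p = cn-walk μ inv j p λ _ _ → tt

    a-b : Cn flip₂ Any-port (vt a) (vt b)
    a-b with around μ inv a nfa
    ... | i , e₁ , h = lift4 (subst (λ z → Cn μ off4 (vt a) (vt z)) e₁ (cn-walk μ inv i (sw a) λ j lt → proj₁ (h j lt)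
        , (λ x → apart (cn-trans (subst (λ z → Cn μ Any-port (vt a) (vt z)) x (walkC j (sw a))) (cn-rev inv (cn-one e tt)))) , proj₂ (h j lt)
        , (λ x → apart (subst (λ z → Cn μ Any-port (vt a) (vt z)) x (walkC j (sw a))))))

    e-f : Cn flip₂ Any-port (vt e) (vt f)
    e-f with around μ inv e nfe
    ... | i , e₁ , h = lift4 (subst (λ z → Cn μ off4 (vt e) (vt z)) e₁ (cn-walk μ inv i (sw e) λ j lt →
        (λ x → apart (cn-rev inv (subst (λ z → Cn μ Any-port (vt e) (vt z)) x (walkC j (sw e))))) , proj₂ (h j lt)
        , (λ x → apart (cn-rev inv (cn-trans (subst (λ z → Cn μ Any-port (vt e) (vt z)) x (walkC j (sw e))) (cn-rev inv (cn-one a tt))))) , proj₁ (h j lt)))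

    keep-cn : ∀ {u v} → Cn μ Any-port u v → Cn flip₂ Any-port u v
    keep-cn = cn-lift λ z _ → one z (case? z)
      where
      one : ∀ z → Case z → Cn flip₂ Any-port (vt z) (vt (μ z))
      one z (isa refl) = a-b
      one z (isf refl) = subst (λ y → Cn flip₂ Any-port (vt f) (vt y)) (sym (inv e)) (cn-rev flip-inv e-f)
      one z (isb refl) = subst (λ y → Cn flip₂ Any-port (vt b) (vt y)) (sym (inv a)) (cn-rev flip-inv a-b)
      one z (ise refl) = e-f
      one z (off h₁ h₂ h₃ h₄) = subst (λ y → Cn flip₂ Any-port (vt z) (vt y)) (fo h₁ h₂ h₃ h₄) (cn-one z tt)

    merged : Cn flip₂ Any-port (vt a) (vt e)
    merged = cn-trans (subst (λ y → Cn flip₂ Any-port (vt a) (vt y)) fa (cn-one a tt)) (cn-rev flip-inv e-f)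

module Insert {n : ℕ} (μ : M n) (inv : Inv μ) (p : Port n) (mp : μ p ≢ p) (w : Fin n) (fw : ∀ b → μ (w , b) ≡ (w , b)) where
  q w₀ w₁ : Port n
  q = μ p
  w₀ = (w , false)
  w₁ = (w , true)

  -- A vertex closed up to a loop is threaded onto the edge pq by an exchange.
  ν : M n
  ν = rot μ w₀ w₁

  vp : vt p ≢ w
  vp refl = mp (fw (proj₂ p))

  vq : vt q ≢ w
  vq e = mp (trans (sym (subst (λ v → μ (v , proj₂ q) ≡ (v , proj₂ q)) (sym e) (fw (proj₂ q)))) (inv p))

  ν-o : ∀ z → vt z ≢ w → ν z ≡ μ z
  ν-o z ne = rot-o μ w₀ w₁ (λ { refl → ne refl }) (λ { refl → ne refl }) (λ e → ne (cong vt (trans e (fw true))))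

  ν-inv : Inv ν
  ν-inv = rotInv μ w₀ w₁ inv (fw false) (λ ())

  νw : ν w₁ ≡ w₀
  νw = rot-q μ w₀ w₁

  νp : ν p ≡ q
  νp = ν-o p vp

  p≢w₁ : p ≢ w₁
  p≢w₁ refl = vp refl

  open Swap ν ν-inv p w₁ p≢w₁ (λ e → mp (trans (sym νp) e)) (λ e → case trans (sym νw) e of λ ()) (λ e → vp (cong vt (trans e νw))) public
    using () renaming (flip₂ to ins; flip-inv to ins-inv)
  private module S = Swap ν ν-inv p w₁ p≢w₁ (λ e → mp (trans (sym νp) e)) (λ e → case trans (sym νw) e of λ ()) (λ e → vp (cong vt (trans e νw)))

  at-p : ins p ≡ w₀
  at-p = trans S.fa νw

  at-w₀ : ins w₀ ≡ p
  at-w₀ = subst (λ z → ins z ≡ p) νw S.ff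

  at-w₁ : ins w₁ ≡ q
  at-w₁ = trans S.fe νp

  at-q : ins q ≡ w₁
  at-q = subst (λ z → ins z ≡ w₁) νp S.fb

  at-o : ∀ z → z ≢ p → z ≢ q → vt z ≢ w → ins z ≡ μ z
  at-o z n₁ n₂ n₃ = trans (S.fo n₁ (λ { e → n₃ (cong vt (trans e νw)) }) (λ e → n₂ (trans e νp)) (λ { refl → n₃ refl })) (ν-o z n₃)

  p-w : Cn ins Any-port (vt p) w
  p-w = subst (λ z → Cn ins Any-port (vt p) (vt z)) at-p (cn-one p tt)

  w-q : Cn ins Any-port w (vt q)
  w-q = subst (λ z → Cn ins Any-port w (vt z)) at-w₁ (cn-one w₁ tt)

  keep-cn : ∀ {u v} → Cn μ Any-port u v → Cn ins Any-port u v
  keep-cn = cn-lift λ z _ → one z (z ≟P p) (z ≟P q) (vt z ≟V w)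
    where
    one : ∀ z → Dec (z ≡ p) → Dec (z ≡ q) → Dec (vt z ≡ w) → Cn ins Any-port (vt z) (vt (μ z))
    one z (yes refl) _ _ = cn-trans p-w w-q
    one z (no _) (yes refl) _ = subst (λ y → Cn ins Any-port (vt q) (vt y)) (sym (inv p)) (cn-rev ins-inv (cn-trans p-w w-q))
    one z (no _) (no _) (yes refl) = subst (λ y → Cn ins Any-port (vt z) (vt y)) (sym (fw (proj₂ z))) here
    one z (no a) (no b) (no c) = subst (λ y → Cn ins Any-port (vt z) (vt y)) (at-o z a b c) (cn-one z tt)

module Thread {n : ℕ} (Adj : Fin n → Fin n → Set) (Adj-sym : ∀ {u v} → Adj u v → Adj v u) where

  record Threaded (V : Fin n → Set) (X : Port n → Set) (μ : M n) (p : Port n) (W : List (Fin n)) : Set where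
    field
      μ'   : M n
      mt   : Mt Adj (λ v → V v ⊎ v ∈ W) X μ'
      same : ∀ z → z ≢ p → z ≢ μ p → vt z ∉ W → μ' z ≡ μ z
      cn   : ∀ {u v} → Cn μ Any-port u v → Cn μ' Any-port u v
      cnW  : ∀ w → w ∈ W → Cn μ' Any-port w (vt p)

  -- The edge from p to μ p need not be an edge of the graph; it is replaced by the path through W.
  thread : ∀ W {V X μ} p → Mt Adj V (λ z → X z ⊎ (z ≡ p ⊎ z ≡ μ p)) μ → V (vt p) → Unique W → (∀ w → w ∈ W → ¬ V w) → Via Adj (vt p) W (vt (μ p)) → Threaded V X μ p W
  thread [] {V} {X} {μ} p M Vp u out v = record { μ' = μ ; mt = record { inv = inv ; full = λ { z (inj₁ h) → full z h ; z (inj₂ ()) } ; free = λ z h → free z λ k → h (inj₁ k)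
      ; edge = λ { z (inj₁ h) nx → ed z h nx (z ≟P p) (z ≟P μ p) ; z (inj₂ ()) } }
      ; same = λ _ _ _ _ → refl ; cn = λ c → c ; cnW = λ _ () }
    where
    open Mt M
    ed : ∀ z → V (vt z) → ¬ X z → Dec (z ≡ p) → Dec (z ≡ μ p) → Adj (vt z) (vt (μ z))
    ed z h nx (yes refl) _ = v
    ed z h nx (no _) (yes refl) = subst (λ y → Adj (vt (μ p)) (vt y)) (sym (inv p)) (Adj-sym v)
    ed z h nx (no a) (no b) = edge z h λ { (inj₁ x) → nx x ; (inj₂ (inj₁ x)) → a x ; (inj₂ (inj₂ x)) → b x }
  thread (w ∷ W) {V} {X} {μ} p M Vp u out (a , v) = record
      { μ' = μ' ; mt = record { inv = Mt.inv mt ; full = λ z h → Mt.full mt z (re h) ; free = λ z h → Mt.free mt z λ k → h (er k) ; edge = λ z h → Mt.edge mt z (re h) }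
      ; same = λ z n₁ n₂ n₃ → trans (same z (λ { refl → n₃ (here refl) }) (λ e → n₂ (trans e at-w₁)) (λ i → n₃ (there i))) (at-o z n₁ n₂ (λ e → n₃ (here e)))
      ; cn = λ c → cn (keep-cn c)
      ; cnW = λ { _ (here refl) → cn (cn-rev ins-inv p-w) ; x (there i) → cn-trans (cnW x i) (cn (cn-rev ins-inv p-w)) } }
    where
    open Mt M
    open Insert μ inv p (full p Vp) w (λ b → free (w , b) (out w (here refl)))
    V₁ : Fin n → Set
    V₁ x = V x ⊎ (x ≡ w)
    cases : ∀ z → Dec (z ≡ p) → Dec (z ≡ q) → Dec (vt z ≡ w) → (z ≡ p) ⊎ (z ≡ q) ⊎ (z ≡ w₀) ⊎ (z ≡ w₁) ⊎ (z ≢ p × z ≢ q × vt z ≢ w)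
    cases z (yes e) _ _ = inj₁ e
    cases z _ (yes e) _ = inj₂ (inj₁ e)
    cases (_ , false) (no _) (no _) (yes refl) = inj₂ (inj₂ (inj₁ refl))
    cases (_ , true) (no _) (no _) (yes refl) = inj₂ (inj₂ (inj₂ (inj₁ refl)))
    cases z (no x) (no y) (no t) = inj₂ (inj₂ (inj₂ (inj₂ (x , y , t))))
    case-of : ∀ z → (z ≡ p) ⊎ (z ≡ q) ⊎ (z ≡ w₀) ⊎ (z ≡ w₁) ⊎ (z ≢ p × z ≢ q × vt z ≢ w)
    case-of z = cases z (z ≟P p) (z ≟P q) (vt z ≟V w)
    fullI : ∀ z → V₁ (vt z) → ins z ≢ z
    fullI z h e with case-of z
    ... | inj₁ refl = vp (cong vt (trans (sym e) at-p))
    ... | inj₂ (inj₁ refl) = vq (cong vt (trans (sym e) at-q))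
    ... | inj₂ (inj₂ (inj₁ refl)) = vp (cong vt (trans (sym at-w₀) e))
    ... | inj₂ (inj₂ (inj₂ (inj₁ refl))) = vq (cong vt (trans (sym at-w₁) e))
    ... | inj₂ (inj₂ (inj₂ (inj₂ (x , y , t)))) = case h of λ { (inj₁ k) → full z k (trans (sym (at-o z x y t)) e) ; (inj₂ k) → t k }
    freeI : ∀ z → ¬ V₁ (vt z) → ins z ≡ z
    freeI z h = trans (at-o z (λ { refl → h (inj₁ Vp) }) (λ { refl → Mt.closed M p Vp λ k → h (inj₁ k) }) (λ e → h (inj₂ e))) (free z λ k → h (inj₁ k))
    edgeI : ∀ z → V₁ (vt z) → ¬ (X z ⊎ (z ≡ w₁ ⊎ z ≡ ins w₁)) → Adj (vt z) (vt (ins z))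
    edgeI z h nx with case-of z
    ... | inj₁ refl = subst (λ y → Adj (vt p) (vt y)) (sym at-p) a
    ... | inj₂ (inj₁ e) = ⊥-elim (nx (inj₂ (inj₂ (trans e (sym at-w₁)))))
    ... | inj₂ (inj₂ (inj₁ refl)) = subst (λ y → Adj w (vt y)) (sym at-w₀) (Adj-sym a)
    ... | inj₂ (inj₂ (inj₂ (inj₁ e))) = ⊥-elim (nx (inj₂ (inj₁ e)))
    ... | inj₂ (inj₂ (inj₂ (inj₂ (x , y , t)))) = case h of λ
        { (inj₁ k) → subst (λ y → Adj (vt z) (vt y)) (sym (at-o z x y t)) (edge z k λ { (inj₁ s) → nx (inj₁ s) ; (inj₂ (inj₁ s)) → x s ; (inj₂ (inj₂ s)) → y s })
        ; (inj₂ k) → ⊥-elim (t k) }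
    rec : Threaded V₁ X ins w₁ W
    rec = thread W {V₁} {X} {ins} w₁ (record { inv = ins-inv ; full = fullI ; free = freeI ; edge = edgeI }) (inj₂ refl) (uniq-tail u)
      (λ { x i (inj₁ k) → out x (there i) k ; x i (inj₂ refl) → ∉-head u i }) (subst (λ y → Via Adj w W (vt y)) (sym at-w₁) v)
    open Threaded rec
    re : ∀ {x} → V x ⊎ x ∈ w ∷ W → V₁ x ⊎ x ∈ W
    re (inj₁ h) = inj₁ (inj₁ h)
    re (inj₂ (here e)) = inj₁ (inj₂ e)
    re (inj₂ (there i)) = inj₂ i
    er : ∀ {x} → V₁ x ⊎ x ∈ W → V x ⊎ x ∈ w ∷ W
    er (inj₁ (inj₁ h)) = inj₁ h
    er (inj₁ (inj₂ e)) = inj₂ (here e)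
    er (inj₂ i) = inj₂ (there i)


module Extract {n : ℕ} (Adj : Fin n → Fin n → Set) (μ : M n) (inv : Inv μ) (nf : ∀ z → μ z ≢ z) (x y : Fin n)
  (xy : μ (x , false) ≡ (y , true)) (edge : ∀ z → z ≢ (x , false) → z ≢ (y , true) → Adj (vt z) (vt (μ z))) (conn : ∀ v → Cn μ Any-port v x) where
  open Near μ inv using (walkL; walk-index; ∈-walkL)

  s : Port n
  s = (x , true)

  i : ℕ
  i = proj₁ (around μ inv (x , false) λ j → nf _)

  at-end : it μ i s ≡ (y , true)
  at-end = trans (proj₁ (proj₂ (around μ inv (x , false) λ j → nf _))) xy

  before : ∀ j → j < i → it μ j s ≢ (x , false) × it μ j s ≢ (y , true)
  before j lt = let (a , b) = proj₂ (proj₂ (around μ inv (x , false) λ j → nf _)) j lt in a , λ e → b (trans e (sym xy))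

  -- If a vertex recurred through its opposite port, the walk would have turned round at a free
  -- port. If it recurred through the same port, the walk would already have completed the cycle,
  -- and so would have met the port of `y` before step `i`.
  distinct : ∀ j l → j < l → l ≤ i → vt (it μ j s) ≢ vt (it μ l s)
  distinct j l lt le e with same-vt {p = it μ l s} {q = it μ j s} (sym e)
  ... | inj₂ e' = let (k , f) = palindrome inv (l ∸ j) (it μ j s) (trans (sym (it-+ μ j (l ∸ j) s)) (trans (cong (λ k → it μ k s) (m+[n∸m]≡n (<⇒≤ lt))) e')) in nf _ f
  ... | inj₁ e' = proj₂ (before k k<) (trans (nx-inj {μ = μ} inv (trans (sym (it-suc μ k s)) (trans (trans (cong (λ h → it μ h s) k≡) back) (cong sw (sym (inv (x , false))))))) xy)
    where
    k = pred (l ∸ j)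
    k≡ : suc k ≡ l ∸ j
    k≡ = suc-pred (l ∸ j) {{>-nonZero (m<n⇒0<n∸m lt)}}
    k< : k < i
    k< = ≤-trans (≤-reflexive k≡) (≤-trans (m∸n≤m l j) le)
    back : it μ (l ∸ j) s ≡ s
    back = it-inj inv j (trans (sym (it-+ μ (l ∸ j) j s)) (trans (cong (λ h → it μ h s) (m∸n+n≡m (<⇒≤ lt))) e'))

  path : List (Fin n)
  path = walkL i s

  unique : Unique path
  unique = go i s (λ j l lt le → distinct j l lt le)
    where
    go : ∀ k p → (∀ j l → j < l → l ≤ k → vt (it μ j p) ≢ vt (it μ l p)) → Unique (walkL k p)
    go zero p h = uniq-∷ (λ ()) []
    go (suc k) p h = uniq-∷ (λ m → let (l , le , e) = walk-index (nx μ p) m in h 0 (suc l) (s≤s z≤n) (s≤s le) (sym e)) (go k (nx μ p) λ j l lt le → h (suc j) (suc l) (s≤s lt) (s≤s le))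

  starts : head path ≡ just x
  starts = go i
    where go : ∀ k → head (walkL k s) ≡ just x
          go zero = refl
          go (suc k) = refl

  ends : last path ≡ just y
  ends = trans (go i s) (cong (λ z → just (vt z)) at-end)
    where
    go : ∀ k p → last (walkL k p) ≡ just (vt (it μ k p))
    go zero p = refl
    go (suc zero) p = refl
    go (suc (suc k)) p = go (suc k) (nx μ p)

  linked : Linked Adj path
  linked = go i s λ j lt → subst (λ z → Adj (vt (it μ j s)) (vt z)) (sym (it-suc μ j s)) (edge (it μ j s) (proj₁ (before j lt)) (proj₂ (before j lt)))
    where
    go : ∀ k p → (∀ j → j < k → Adj (vt (it μ j p)) (vt (it μ (suc j) p))) → Linked Adj (walkL k p)
    go zero p h = [-]
    go (suc zero) p h = h 0 (s≤s z≤n) ∷ [-]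
    go (suc (suc k)) p h = h 0 (s≤s z≤n) ∷ go (suc k) (nx μ p) λ j lt → h (suc j) (s≤s lt)

  -- The vertices of the walk are closed under passing to neighbours, the virtual edge from `y` to
  -- `x` included, so they exhaust the component of `x`.
  spanning : ∀ v → v ∈ path
  spanning v = go (cn-rev inv (conn v)) (∈-walkL {i} {0} s z≤n)
    where
    step : ∀ z j → j ≤ i → (z ≡ it μ j s) ⊎ (z ≡ sw (it μ j s)) → vt (μ z) ∈ path
    step _ j le (inj₁ refl) = case m≤n⇒m<n∨m≡n le of λ
      { (inj₁ lt) → subst (_∈ path) (cong vt (it-suc μ j s)) (∈-walkL s lt)
      ; (inj₂ e) → subst (λ w → vt w ∈ path) (sym (trans (cong (λ k → μ (it μ k s)) e) (trans (cong μ at-end) (trans (cong μ (sym xy)) (inv (x , false)))))) (∈-walkL {i} {0} s z≤n) }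
    step _ zero le (inj₂ refl) = subst (λ w → vt w ∈ path) (trans at-end (sym xy)) (∈-walkL s ≤-refl)
    step _ (suc j) le (inj₂ refl) = subst (λ w → vt w ∈ path) (trans (sym (inv (it μ j s))) (cong μ (trans (sym (sw-sw (μ (it μ j s)))) (cong sw (sym (it-suc μ j s)))))) (∈-walkL s (<⇒≤ le))
    nbr : ∀ z → vt z ∈ path → vt (μ z) ∈ path
    nbr z m = let (j , le , e) = walk-index s m in step z j le (same-vt {p = z} {q = it μ j s} (sym e))
    go : ∀ {u v} → Cn μ Any-port u v → u ∈ path → v ∈ path
    go here m = m
    go (stp z refl _ c) m = go c (nbr z m)

-- Processing the gadgets one at a time

record Frame (n : ℕ) : Set₁ where
  field
    Adj     : Fin n → Fin n → Set
    Adj-sym : ∀ {u v} → Adj u v → Adj v u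
    d lam   : ℕ
    x y     : Fin n

module Gadgets {n : ℕ} (F : Frame n) where
  open Frame F

  sps : ∀ {k e} → Chain Adj d lam x k e → List (Fin n)
  sps nil = x ∷ []
  sps (snoc ch b) = Block.c b ∷ Block.t1 b ∷ Block.t2 b ∷ Block.t3 b ∷ sps ch

  -- ports of the virtual edges
  spl : ∀ {k e} → Chain Adj d lam x k e → List (Port n)
  spl nil = (x , false) ∷ (y , true) ∷ []
  spl (snoc ch b) = (Block.c b , true) ∷ (Block.t1 b , false) ∷ spl ch

  fps : ∀ {k e} → Chain Adj d lam x k e → List (Port n)
  fps nil = (x , false) ∷ []
  fps (snoc {e = e} ch b) = (e , true) ∷ (Block.c b , true) ∷ (Block.t2 b , true) ∷ fps ch

  Facts : ∀ {k e} → Chain Adj d lam x k e → M n → Set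
  Facts nil μ = μ (x , false) ≡ (y , true)
  Facts (snoc {e = e} ch b) μ = (μ (e , true) ≡ (Block.c b , false)) × (μ (Block.c b , true) ≡ (Block.t1 b , false)) × (μ (Block.t2 b , true) ≡ (Block.t3 b , false)) × Facts ch μ

  facts-mono : ∀ {k e} (ch : Chain Adj d lam x k e) {μ μ'} → (∀ z → z ∈ fps ch → μ' z ≡ μ z) → Facts ch μ → Facts ch μ'
  facts-mono nil s f = trans (s _ (here refl)) f
  facts-mono (snoc ch b) s (f₁ , f₂ , f₃ , f) = trans (s _ (here refl)) f₁ , trans (s _ (there (here refl))) f₂ , trans (s _ (there (there (here refl)))) f₃
    , facts-mono ch (λ z i → s z (there (there (there i)))) f

  end∈ : ∀ {k e} (ch : Chain Adj d lam x k e) → e ∈ x ∷ virts ch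
  end∈ nil = here refl
  end∈ (snoc ch b) = there (∈-++⁺ʳ (virts ch) (there (there (∈-++⁺ʳ (Block.Ls b) (there (here refl))))))

  end-sp : ∀ {k e} (ch : Chain Adj d lam x k e) → e ∈ sps ch
  end-sp nil = here refl
  end-sp (snoc ch b) = there (there (there (here refl)))

  module _ {e : Fin n} (b : Block Adj d lam e) where
    open Block b
    c∈ : c ∈ virt
    c∈ = here refl
    t1∈ : t1 ∈ virt
    t1∈ = there (here refl)
    t2∈ : t2 ∈ virt
    t2∈ = there (there (∈-++⁺ʳ Ls (here refl)))
    t3∈ : t3 ∈ virt
    t3∈ = there (there (∈-++⁺ʳ Ls (there (here refl))))

  fps-vt : ∀ {k e} (ch : Chain Adj d lam x k e) z → z ∈ fps ch → vt z ∈ x ∷ virts ch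
  fps-vt nil z (here refl) = here refl
  fps-vt (snoc ch b) z (here refl) = up (end∈ ch)
    where up : ∀ {v} → v ∈ x ∷ virts ch → v ∈ x ∷ virts ch ++ Block.virt b
          up (here e) = here e
          up (there i) = there (∈-++⁺ˡ i)
  fps-vt (snoc ch b) z (there (here refl)) = there (∈-++⁺ʳ (virts ch) (c∈ b))
  fps-vt (snoc ch b) z (there (there (here refl))) = there (∈-++⁺ʳ (virts ch) (t2∈ b))
  fps-vt (snoc ch b) z (there (there (there i))) = case fps-vt ch z i of λ { (here e) → here e ; (there j) → there (∈-++⁺ˡ j) }

  record State {k e} (ch : Chain Adj d lam x k e) : Set where
    field
      μ     : M n
      mt    : Mt Adj (_∉ wss ch) (_∈ spl ch) μ
      facts : Facts ch μ
      star  : ∀ v → v ∉ wss ch → Star (_∈ sps ch) μ v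

  record Mid {e : Fin n} (b : Block Adj d lam e) (V : Fin n → Set) (X : Port n → Set) (μ : M n) : Set where
    open Block b
    field
      μ₁   : M n
      tgt  : Fin n
      is-t : (tgt ≡ t1) ⊎ (tgt ≡ t3)
      at-a : μ₁ (c , true) ≡ (tgt , false)
      W    : List (Fin n)
      uW   : Unique W
      W⊑'  : ∀ v → v ∈ W → v ∈ Ws
      ⊒W   : ∀ v → v ∈ Ws → v ∈ W
      via  : Via Adj c W tgt
      mt₁  : Mt Adj V (λ z → X z ⊎ (z ≡ (c , true) ⊎ z ≡ μ₁ (c , true))) μ₁
      same : ∀ z → vt z ∉ virt → μ₁ z ≡ μ z
      same' : ∀ z → vt z ∉ c ∷ t1 ∷ t2 ∷ t3 ∷ [] → μ₁ z ≡ μ z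
      cn   : ∀ {u v} → Cn μ Any-port u v → Cn μ₁ Any-port u v
      ct2  : Cn μ₁ Any-port c t2


module Process {n : ℕ} (F : Frame n) where
  open Frame F
  open Gadgets F
  open Thread Adj Adj-sym

  mid : ∀ {e V X μ} (b : Block Adj d lam e) → (let open Block b) → Mt Adj V (λ z → z ∈ (c , true) ∷ (t1 , false) ∷ [] ⊎ X z) μ →
    V c → V t1 → V t2 → V t3 → Unique (c ∷ t1 ∷ t2 ∷ t3 ∷ []) → Unique Ws → μ (c , true) ≡ (t1 , false) → μ (t2 , true) ≡ (t3 , false) → DN (Mid b V X μ)
  mid {e} {V} {X} {μ} b M Vc V1 V2 V3 u uW fc f2 = lem (Cn μ Any-port c t2) >>= λ
      { (inj₁ yes-c) → return (stay yes-c) ; (inj₂ no-c) → return (flipped no-c) }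
    where
    open Block b
    open Mt M
    stay : Cn μ Any-port c t2 → Mid b V X μ
    stay h = record { μ₁ = μ ; tgt = t1 ; is-t = inj₁ refl ; at-a = fc ; W = Ws ; uW = uW ; W⊑' = λ _ i → i ; ⊒W = λ _ i → i ; via = vW
      ; mt₁ = record { inv = inv ; full = full ; free = free ; edge = λ z Vz nx → edge z Vz λ
          { (inj₁ (here e')) → nx (inj₂ (inj₁ e')) ; (inj₁ (there (here e'))) → nx (inj₂ (inj₂ (trans e' (sym fc)))) ; (inj₂ k) → nx (inj₁ k) } }
      ; same = λ _ _ → refl ; same' = λ _ _ → refl ; cn = λ c → c ; ct2 = h }
    flipped : ¬ Cn μ Any-port c t2 → Mid b V X μ
    flipped h = record { μ₁ = S.flip₂ ; tgt = t3 ; is-t = inj₂ refl ; at-a = trans S.fa f2 ; W = Ws' ; uW = uW' ; W⊑' = W⊒ ; ⊒W = W⊑ ; via = vW'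
        ; mt₁ = record { inv = S.flip-inv ; full = fullF ; free = freeF ; edge = edgeF }
        ; same = λ z ni → sameF z (λ { refl → ni (c∈ b) }) (λ { refl → ni (t3∈ b) }) (λ { refl → ni (t1∈ b) }) (λ { refl → ni (t2∈ b) })
        ; same' = λ z ni → sameF z (λ { refl → ni (here refl) }) (λ { refl → ni (there (there (there (here refl)))) }) (λ { refl → ni (there (here refl)) }) (λ { refl → ni (there (there (here refl))) })
        ; cn = S.keep-cn nfa nfe h ; ct2 = S.merged nfa nfe h }
      where
      a e₂ : Port n
      a = (c , true)
      e₂ = (t2 , true)
      c≢t2 : c ≢ t2
      c≢t2 refl = ∉-head u (there (here refl))
      c≢t3 : c ≢ t3
      c≢t3 refl = ∉-head u (there (there (here refl)))
      module S = Swap μ inv a e₂ (λ e → c≢t2 (cong vt e)) (full a Vc) (full e₂ V2) (λ e → c≢t3 (cong vt (trans e f2)))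
      stays : ∀ j p → V (vt p) → DN (V (vt (it μ j p)))
      stays zero p Vp = return Vp
      stays (suc j) p Vp = closed p Vp >>= λ V' → stays j (nx μ p) V'
      nfa : ∀ j → μ (it μ j (sw a)) ≢ it μ j (sw a)
      nfa j h = stays j (sw a) Vc λ V' → full _ V' h
      nfe : ∀ j → μ (it μ j (sw e₂)) ≢ it μ j (sw e₂)
      nfe j h = stays j (sw e₂) V2 λ V' → full _ V' h
      sameF : ∀ z → z ≢ (c , true) → z ≢ (t3 , false) → z ≢ (t1 , false) → z ≢ (t2 , true) → S.flip₂ z ≡ μ z
      sameF z h₁ h₂ h₃ h₄ = S.fo h₁ (λ e → h₂ (trans e f2)) (λ e → h₃ (trans e fc)) h₄
      fullF : ∀ z → V (vt z) → S.flip₂ z ≢ z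
      fullF z Vz e with S.case? z
      ... | S.isa refl = c≢t3 (sym (cong vt (trans (sym f2) (trans (sym S.fa) e))))
      ... | S.isf refl = c≢t3 (cong vt (trans (sym S.ff) (trans e f2)))
      ... | S.isb refl = ∉-head (uniq-tail u) (here (cong vt (trans (sym fc) (trans (sym e) S.fb))))
      ... | S.ise refl = ∉-head (uniq-tail u) (here (cong vt (trans (sym fc) (trans (sym S.fe) e))))
      ... | S.off h₁ h₂ h₃ h₄ = full z Vz (trans (sym (S.fo h₁ h₂ h₃ h₄)) e)
      freeF : ∀ z → ¬ V (vt z) → S.flip₂ z ≡ z
      freeF z nV = trans (sameF z (λ { refl → nV Vc }) (λ { refl → nV V3 }) (λ { refl → nV V1 }) (λ { refl → nV V2 })) (free z nV)
      edgeF : ∀ z → V (vt z) → ¬ (X z ⊎ (z ≡ a ⊎ z ≡ S.flip₂ a)) → Adj (vt z) (vt (S.flip₂ z))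
      edgeF z Vz nx with S.case? z
      ... | S.isa e = ⊥-elim (nx (inj₂ (inj₁ e)))
      ... | S.isf e = ⊥-elim (nx (inj₂ (inj₂ (trans e (sym S.fa)))))
      ... | S.isb refl = subst₂ Adj (sym (cong vt fc)) (sym (cong vt S.fb)) t12
      ... | S.ise refl = subst (Adj t2) (sym (cong vt (trans S.fe fc))) (Adj-sym t12)
      ... | S.off h₁ h₂ h₃ h₄ = subst (λ w → Adj (vt z) (vt w)) (sym (S.fo h₁ h₂ h₃ h₄)) (edge z Vz λ
          { (inj₁ (here e)) → h₁ e ; (inj₁ (there (here e))) → h₃ (trans e (sym fc)) ; (inj₂ k) → nx (inj₁ k) })

  uniq4 : ∀ {e} (b : Block Adj d lam e) → Unique (Block.virt b) → Unique (Block.c b ∷ Block.t1 b ∷ Block.t2 b ∷ Block.t3 b ∷ [])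
  uniq4 b u = uniq-∷ (λ { (here e) → ∉-head u (here e) ; (there i) → ∉-head u (there (∈-++⁺ʳ (Block.Ls b) i)) })
    (uniq-∷ (λ i → ∉-head (uniq-tail u) (∈-++⁺ʳ (Block.Ls b) i)) (uniq-++ʳ (Block.Ls b) (uniq-tail (uniq-tail u))))

  -- Afterwards c, t1, t2 and t3 all lie in the component of the exit `e` of the preceding gadget.
  -- They can therefore give up their special status, `e` being special for the shorter chain; when
  -- all gadgets are done, `x` alone is left.
  one-gadget : ∀ {k e} (ch : Chain Adj d lam x k e) (b : Block Adj d lam e) → Unique (x ∷ virts (snoc ch b) ++ wss (snoc ch b)) → State (snoc ch b) → DN (State ch)
  one-gadget {k} {e} ch b u st = mid {V = _∉ wss (snoc ch b)} {X = _∈ spl ch} {μ = μ} b (record { Mt mt ; edge = λ z Vz nx → Mt.edge mt z Vz (λ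
        { (here e) → nx (inj₁ (here e)) ; (there (here e)) → nx (inj₁ (there (here e))) ; (there (there i)) → nx (inj₂ i) }) })
      (inV (c∈ b)) (inV (t1∈ b)) (inV (t2∈ b)) (inV (t3∈ b)) (uniq4 b uV) uWs (proj₁ (proj₂ facts)) (proj₁ (proj₂ (proj₂ facts))) >>= λ K → return (after K)
    where
    open State st
    open Block b
    uP : Unique ((x ∷ virts ch) ++ virt)
    uP = uniq-++ˡ (x ∷ virts (snoc ch b)) u
    uV : Unique virt
    uV = uniq-++ʳ (x ∷ virts ch) uP
    uWW : Unique (Ws ++ wss ch)
    uWW = uniq-++ʳ (x ∷ virts (snoc ch b)) u
    uWs : Unique Ws
    uWs = uniq-++ˡ Ws uWW
    inV : ∀ {v} → v ∈ virt → v ∉ wss (snoc ch b)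
    inV i = uniq-disj (x ∷ virts (snoc ch b)) u (there (∈-++⁺ʳ (virts ch) i))
    old : ∀ {v} → v ∈ x ∷ virts ch → v ∉ virt
    old i = uniq-disj (x ∷ virts ch) uP i
    oldW : ∀ {v} → v ∈ x ∷ virts ch → v ∉ wss (snoc ch b)
    oldW (here e) = uniq-disj (x ∷ virts (snoc ch b)) u (here e)
    oldW (there i) = uniq-disj (x ∷ virts (snoc ch b)) u (there (∈-++⁺ˡ i))
    after : Mid b (_∉ wss (snoc ch b)) (_∈ spl ch) μ → State ch
    after K = record { μ = μ' ; mt = record { inv = Mt.inv mtT ; full = λ z h → Mt.full mtT z (to h) ; free = λ z h → Mt.free mtT z λ k → h (from k) ; edge = λ z h → Mt.edge mtT z (to h) }
        ; facts = facts-mono ch unaffected (proj₂ (proj₂ (proj₂ facts))) ; star = star' }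
      where
      open Mid K
      T₁ = thread W {X = _∈ spl ch} (c , true) mt₁ (inV (c∈ b)) (Mid.uW K) (λ w i k → k (∈-++⁺ˡ (W⊑' w i))) (subst (λ z → Via Adj c W (vt z)) (sym at-a) via)
      open Threaded T₁ renaming (mt to mtT; same to sameT; cn to cnT)
      to : ∀ {v} → v ∉ wss ch → v ∉ wss (snoc ch b) ⊎ v ∈ W
      to {v} h with SV._∈?_ v W
      ... | yes i = inj₂ i
      ... | no ni = inj₁ λ j → case ∈-++⁻ Ws j of λ { (inj₁ k) → ni (⊒W v k) ; (inj₂ k) → h k }
      from : ∀ {v} → v ∉ wss (snoc ch b) ⊎ v ∈ W → v ∉ wss ch
      from (inj₁ h) k = h (∈-++⁺ʳ Ws k)
      from (inj₂ i) k = uniq-disj Ws uWW (W⊑' _ i) k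
      tgt∈ : tgt ∈ virt
      tgt∈ = case is-t of λ { (inj₁ refl) → t1∈ b ; (inj₂ refl) → t3∈ b }
      -- The exchange and the insertion take place inside this gadget, so the edges required by the
      -- earlier gadgets are intact.
      unaffected : ∀ z → z ∈ fps ch → μ' z ≡ μ z
      unaffected z i = trans (sameT z (λ { refl → old v∈ (c∈ b) }) (λ e → old v∈ (subst (_∈ virt) (cong vt (sym (trans e at-a))) tgt∈)) (λ j → oldW v∈ (∈-++⁺ˡ (W⊑' _ j)))) (same z (old v∈))
        where v∈ = fps-vt ch z i
      c-e : Cn μ' Any-port c e
      c-e = cnT (cn (cn-rev (Mt.inv mt) (subst (λ z → Cn μ Any-port e (vt z)) (proj₁ facts) (cn-one (e , true) tt))))
      t1-c : Cn μ' Any-port t1 c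
      t1-c = cnT (cn (cn-rev (Mt.inv mt) (subst (λ z → Cn μ Any-port c (vt z)) (proj₁ (proj₂ facts)) (cn-one (c , true) tt))))
      t2-c : Cn μ' Any-port t2 c
      t2-c = cnT (cn-rev (Mt.inv mt₁) ct2)
      t3-c : Cn μ' Any-port t3 c
      t3-c = cn-trans (cnT (cn (cn-rev (Mt.inv mt) (subst (λ z → Cn μ Any-port t2 (vt z)) (proj₁ (proj₂ (proj₂ facts))) (cn-one (t2 , true) tt))))) t2-c
      conv : ∀ {s} → s ∈ sps (snoc ch b) → Star (_∈ sps ch) μ' s
      conv (here refl) = e , end-sp ch , c-e
      conv (there (here refl)) = e , end-sp ch , cn-trans t1-c c-e
      conv (there (there (here refl))) = e , end-sp ch , cn-trans t2-c c-e
      conv (there (there (there (here refl)))) = e , end-sp ch , cn-trans t3-c c-e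
      conv (there (there (there (there i)))) = _ , i , here
      star' : ∀ v → v ∉ wss ch → Star (_∈ sps ch) μ' v
      star' v h with to h
      ... | inj₁ k = let (s , s∈ , c) = star v k in star-via (cnT (cn c)) (conv s∈)
      ... | inj₂ i = star-via (cnW v i) (conv (here refl))

  all-gadgets : ∀ {k e} (ch : Chain Adj d lam x k e) → Unique (x ∷ virts ch ++ wss ch) → State ch → DN (State nil)
  all-gadgets nil u st = return st
  all-gadgets (snoc ch b) u st = one-gadget ch b u st >>= all-gadgets ch (shrink (uniq-++ˡ (x ∷ virts (snoc ch b)) u) (uniq-++ʳ (x ∷ virts (snoc ch b)) u) λ i j → uniq-disj (x ∷ virts (snoc ch b)) u i j)
    where
    shrink : Unique (x ∷ virts (snoc ch b)) → Unique (wss (snoc ch b)) → (∀ {v} → v ∈ x ∷ virts (snoc ch b) → v ∉ wss (snoc ch b)) → Unique ((x ∷ virts ch) ++ wss ch)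
    shrink u₁ u₂ dj = uniq-++ (uniq-++ˡ (x ∷ virts ch) u₁) (uniq-++ʳ (Block.Ws b) u₂) λ
      { (here e) j → dj (here e) (∈-++⁺ʳ (Block.Ws b) j) ; (there i) j → dj (there (∈-++⁺ˡ i)) (∈-++⁺ʳ (Block.Ws b) j) }

  record HamP : Set where
    field
      path     : List (Fin n)
      unique   : Unique path
      spanning : ∀ (v : Fin n) → v ∈ path
      starts   : head path ≡ just x
      ends     : last path ≡ just y
      edges    : Linked Adj path

  to-path : State nil → HamP
  to-path st = record { path = E.path ; unique = E.unique ; spanning = E.spanning ; starts = E.starts ; ends = E.ends ; edges = E.linked }
    where
    open State st
    onEdge : ∀ z → z ≢ (x , false) → z ≢ (y , true) → Adj (vt z) (vt (μ z))
    onEdge z n₁ n₂ = Mt.edge mt z (λ ()) λ { (here e) → n₁ e ; (there (here e)) → n₂ e }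
    reach : ∀ v → Cn μ Any-port v x
    reach v = case star v (λ ()) of λ { (_ , here refl , c) → c }
    module E = Extract Adj μ (Mt.inv mt) (λ z → Mt.full mt z λ ()) x y facts onEdge reach


-- The matching of a path, oriented from the true port to the false port of the next vertex

module _ {n : ℕ} where
  Run : M n → Fin n → List (Fin n) → Fin n → Set
  Run μ = Via λ a b → μ (a , true) ≡ (b , false)

  via-map : ∀ {Q Q' : Fin n → Fin n → Set} {u w} xs → (∀ a b → a ∈ u ∷ xs → Q a b → Q' a b) → Via Q u xs w → Via Q' u xs w
  via-map [] f q = f _ _ (here refl) q
  via-map (x ∷ xs) f (q , v) = f _ _ (here refl) q , via-map xs (λ a b i → f a b (there i)) v

  run-cn : ∀ {μ u w} xs → Run μ u xs w → Cn μ Any-port u w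
  run-cn {μ} {u} [] e = subst (λ z → Cn μ Any-port u (vt z)) e (cn-one (u , true) tt)
  run-cn {μ} {u} (x ∷ xs) (e , v) = cn-trans (subst (λ z → Cn μ Any-port u (vt z)) e (cn-one (u , true) tt)) (run-cn xs v)

  run-cn-all : ∀ {μ u w} xs → Run μ u xs w → ∀ v → v ∈ u ∷ xs ++ w ∷ [] → Cn μ Any-port u v
  run-cn-all xs r v (here refl) = here
  run-cn-all {μ} {u} [] e v (there (here refl)) = run-cn [] e
  run-cn-all {μ} {u} (x ∷ xs) (e , r) v (there i) = cn-trans (run-cn {μ} {u} {x} [] e) (run-cn-all xs r v i)

  pathM : List (Fin n) → M n
  pathM [] = id
  pathM (u ∷ []) = id
  pathM (u ∷ v ∷ l) = rot (pathM (v ∷ l)) (u , true) (v , false)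

  record PathM (u : Fin n) (xs : List (Fin n)) (w : Fin n) (Q : Fin n → Fin n → Set) (μ : M n) : Set where
    field
      inv  : Inv μ
      out  : ∀ z → vt z ∉ u ∷ xs ++ w ∷ [] → μ z ≡ z
      strt : μ (u , false) ≡ (u , false)
      stop : μ (w , true) ≡ (w , true)
      run  : Run μ u xs w
      free : ∀ z → vt z ∈ u ∷ xs ++ w ∷ [] → μ z ≡ z → z ≡ (u , false) ⊎ z ≡ (w , true)
      edge : ∀ z → μ z ≢ z → (Σ (Fin n) λ a → Σ (Fin n) λ b → Q a b × ((z ≡ (a , true) × μ z ≡ (b , false)) ⊎ (z ≡ (b , false) × μ z ≡ (a , true))))

  joinM : ∀ {Q : Fin n → Fin n → Set} {u v : Fin n} {w l μ} → Inv μ → Q u v → u ≢ v → u ∉ l → v ∈ l → w ∈ l →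
    (∀ z → vt z ∉ l → μ z ≡ z) → μ (v , false) ≡ (v , false) → μ (w , true) ≡ (w , true) →
    (∀ z → vt z ∈ l → μ z ≡ z → z ≡ (v , false) ⊎ z ≡ (w , true)) →
    (∀ z → μ z ≢ z → (Σ (Fin n) λ a → Σ (Fin n) λ b → Q a b × ((z ≡ (a , true) × μ z ≡ (b , false)) ⊎ (z ≡ (b , false) × μ z ≡ (a , true))))) →
    let μ' = rot μ (u , true) (v , false) in
    Inv μ' × (∀ z → vt z ∉ u ∷ l → μ' z ≡ z) × μ' (u , false) ≡ (u , false) × μ' (w , true) ≡ (w , true) × μ' (u , true) ≡ (v , false) × (∀ a → a ∈ l → μ' (a , true) ≡ μ (a , true)) ×
    (∀ z → vt z ∈ u ∷ l → μ' z ≡ z → z ≡ (u , false) ⊎ z ≡ (w , true)) ×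
    (∀ z → μ' z ≢ z → (Σ (Fin n) λ a → Σ (Fin n) λ b → Q a b × ((z ≡ (a , true) × μ' z ≡ (b , false)) ⊎ (z ≡ (b , false) × μ' z ≡ (a , true)))))
  joinM {Q} {u} {v} {w} {l} {μ} inv q u≢v u∉ v∈ w∈ out fv fw fr ed =
      rotInv μ p r inv fp p≢r , (λ z ni → trans (keepz z (λ { refl → ni (here refl) }) (λ { refl → ni (there v∈) })) (out z λ i → ni (there i)))
      , trans (keepz (u , false) (λ ()) (λ { refl → u∉ v∈ })) (out _ u∉) , trans (keepz (w , true) (λ { refl → u∉ w∈ }) (λ ())) fw , rot-p μ p r
      , (λ a i → keepz (a , true) (λ { refl → u∉ i }) (λ ())) , free' , edge'
    where
    p r : Port n
    p = (u , true)
    r = (v , false)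
    fp : μ p ≡ p
    fp = out p u∉
    p≢r : p ≢ r
    p≢r ()
    μ' = rot μ p r
    keepz : ∀ z → z ≢ p → z ≢ r → μ' z ≡ μ z
    keepz z a b = rot-o μ p r a b λ e → b (trans e fv)
    Edge : Port n → Set
    Edge z = Σ (Fin n) λ a → Σ (Fin n) λ b → Q a b × ((z ≡ (a , true) × μ' z ≡ (b , false)) ⊎ (z ≡ (b , false) × μ' z ≡ (a , true)))
    freeD : ∀ z → vt z ∈ u ∷ l → μ' z ≡ z → Dec (z ≡ p) → Dec (z ≡ r) → z ≡ (u , false) ⊎ z ≡ (w , true)
    freeD z i e (yes refl) _ = ⊥-elim (p≢r (trans (sym e) (rot-p μ p r)))
    freeD z i e (no _) (yes refl) = ⊥-elim (p≢r (trans (sym (rot-q μ p r)) e))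
    freeD (_ , true) (here refl) e (no a) (no b) = ⊥-elim (a refl)
    freeD (_ , false) (here refl) e (no a) (no b) = inj₁ refl
    freeD z (there i) e (no a) (no b) = case fr z i (trans (sym (keepz z a b)) e) of λ { (inj₁ h) → ⊥-elim (b h) ; (inj₂ h) → inj₂ h }
    free' : ∀ z → vt z ∈ u ∷ l → μ' z ≡ z → z ≡ (u , false) ⊎ z ≡ (w , true)
    free' z i e = freeD z i e (z ≟P p) (z ≟P r)
    edgeD : ∀ z → μ' z ≢ z → Dec (z ≡ p) → Dec (z ≡ r) → Edge z
    edgeD z ne (yes refl) _ = u , v , q , inj₁ (refl , rot-p μ p r)
    edgeD z ne (no _) (yes refl) = u , v , q , inj₂ (refl , rot-q μ p r)
    edgeD z ne (no a) (no b) with ed z (λ e → ne (trans (keepz z a b) e))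
    ... | x , y , qq , inj₁ (h , h') = x , y , qq , inj₁ (h , trans (keepz z a b) h')
    ... | x , y , qq , inj₂ (h , h') = x , y , qq , inj₂ (h , trans (keepz z a b) h')
    edge' : ∀ z → μ' z ≢ z → Edge z
    edge' z ne = edgeD z ne (z ≟P p) (z ≟P r)

  path-matching : ∀ {Q : Fin n → Fin n → Set} u xs w → Unique (u ∷ xs ++ w ∷ []) → Via Q u xs w → Σ (M n) (PathM u xs w Q)
  path-matching {Q} u [] w un q =
    let (i , o , s , e , j , _ , f , ed) = joinM {Q} {u} {w} {w} {w ∷ []} {id} (λ _ → refl) q (λ { refl → ∉-head un (here refl) }) (∉-head un) (here refl) (here refl) (λ _ _ → refl) refl refl
             (λ { (_ , true) (here refl) _ → inj₂ refl ; (_ , false) (here refl) _ → inj₁ refl }) (λ z ne → ⊥-elim (ne refl))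
    in _ , record { inv = i ; out = o ; strt = s ; stop = e ; run = j ; free = f ; edge = ed }
  path-matching {Q} u (v ∷ xs) w un (q , vq) with path-matching {Q} v xs w (uniq-tail un) vq
  ... | μ , pm = 
    let open PathM pm
        (i , o , s , e , j , same , f , ed) = joinM {Q} {u} {v} {w} {v ∷ xs ++ w ∷ []} {μ} inv q (λ { refl → ∉-head un (here refl) }) (∉-head un) (here refl) (there (∈-++⁺ʳ xs (here refl))) out strt stop free edge
    in _ , record { inv = i ; out = o ; strt = s ; stop = e
       ; run = j , via-map xs (λ a b a∈ h → trans (same a (case a∈ of λ { (here x) → here x ; (there x) → there (∈-++⁺ˡ x) })) h) run ; free = f ; edge = ed }

-- Consecutive pairs along a chain, its segments and special vertices

module ChainFacts {n : ℕ} (F : Frame n) where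
  open Frame F
  open Gadgets F

  VFacts : ∀ {k e} → (Fin n → Fin n → Set) → Chain Adj d lam x k e → Set
  VFacts Q nil = ⊤
  VFacts Q (snoc {e = e} ch b) = Q e (Block.c b) × Q (Block.c b) (Block.t1 b) × Via Q (Block.t1 b) (Block.Ls b) (Block.t2 b) × Q (Block.t2 b) (Block.t3 b) × VFacts Q ch

  to-facts : ∀ {Q k e w} (ch : Chain Adj d lam x k e) l → Via Q x (virts ch ++ l) w → VFacts Q ch × Via Q e l w
  to-facts nil l v = tt , v
  to-facts {Q} {w = w} (snoc {e = e} ch b) l v with to-facts ch (Block.virt b ++ l) (subst (λ z → Via Q x z w) (++-assoc (virts ch) (Block.virt b) l) v)
  ... | F , q₁ , q₂ , v' with via-split (Block.Ls b) (subst (λ z → Via Q (Block.t1 b) z w) (++-assoc (Block.Ls b) (Block.t2 b ∷ Block.t3 b ∷ []) l) v')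
  ... | v₁ , q₃ , v₂ = (q₁ , q₂ , v₁ , q₃ , F) , v₂

  from-facts : ∀ {Q k e w} (ch : Chain Adj d lam x k e) l → VFacts Q ch → Via Q e l w → Via Q x (virts ch ++ l) w
  from-facts nil l F v = v
  from-facts {Q} {w = w} (snoc ch b) l (q₁ , q₂ , v₁ , q₃ , F) v = subst (λ z → Via Q x z w) (sym (++-assoc (virts ch) (Block.virt b) l))
    (from-facts ch (Block.virt b ++ l) F (q₁ , q₂ , subst (λ z → Via Q (Block.t1 b) z w) (sym (++-assoc (Block.Ls b) (Block.t2 b ∷ Block.t3 b ∷ []) l)) (via-++ (Block.Ls b) v₁ (q₃ , v))))

  -- Ports of the edges that no rotation may remove: the virtual edges, the edge t2 t3 used in the
  -- exchange, and the edge e c that ties a gadget to the preceding one.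
  spP : ∀ {k e} → Chain Adj d lam x k e → List (Port n)
  spP nil = (x , false) ∷ (y , true) ∷ []
  spP (snoc {e = e} ch b) = (e , true) ∷ (Block.c b , false) ∷ (Block.c b , true) ∷ (Block.t1 b , false) ∷ (Block.t2 b , true) ∷ (Block.t3 b , false) ∷ spP ch

  lls : ∀ {k e} → Chain Adj d lam x k e → List (Fin n)
  lls nil = []
  lls (snoc ch b) = Block.Ls b ++ lls ch

  seg : ∀ {e} → Block Adj d lam e → List (Fin n)
  seg b = Block.t1 b ∷ Block.Ls b ++ Block.t2 b ∷ []

  sg : ∀ {k e} → Chain Adj d lam x k e → Fin n → List (Fin n)
  sg nil t = []
  sg (snoc ch b) t with SV._∈?_ t (seg b)
  ... | yes _ = seg b
  ... | no _ = sg ch t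

  spl⊑spP : ∀ {k e} (ch : Chain Adj d lam x k e) {z} → z ∈ spl ch → z ∈ spP ch
  spl⊑spP nil i = i
  spl⊑spP (snoc ch b) (here e) = there (there (here e))
  spl⊑spP (snoc ch b) (there (here e)) = there (there (there (here e)))
  spl⊑spP (snoc ch b) (there (there i)) = there (there (there (there (there (there (spl⊑spP ch i))))))

  spP-vt : ∀ {k e} (ch : Chain Adj d lam x k e) z → z ∈ spP ch → vt z ∈ y ∷ sps ch
  spP-vt nil z (here refl) = there (here refl)
  spP-vt nil z (there (here refl)) = here refl
  spP-vt (snoc ch b) z (here refl) = there (there (there (there (there (end-sp ch)))))
  spP-vt (snoc ch b) z (there (here refl)) = there (here refl)
  spP-vt (snoc ch b) z (there (there (here refl))) = there (here refl)
  spP-vt (snoc ch b) z (there (there (there (here refl)))) = there (there (here refl))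
  spP-vt (snoc ch b) z (there (there (there (there (here refl))))) = there (there (there (here refl)))
  spP-vt (snoc ch b) z (there (there (there (there (there (here refl)))))) = there (there (there (there (here refl))))
  spP-vt (snoc ch b) z (there (there (there (there (there (there i)))))) = case spP-vt ch z i of λ { (here e) → here e ; (there j) → there (there (there (there (there j)))) }

  spP-σ : ∀ {k e} (ch : Chain Adj d lam x k e) {σ : M n} → Inv σ → Facts ch σ → ∀ z → z ∈ spP ch → σ z ∈ spP ch × σ z ≢ z
  spP-σ nil {σ} inv f z (here refl) = subst (λ w → w ∈ spP nil × w ≢ z) (sym f) (there (here refl) , λ ())
  spP-σ nil {σ} inv f z (there (here refl)) = subst (λ w → w ∈ spP nil × w ≢ z) (trans (sym (inv _)) (cong σ f)) (here refl , λ ())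
  spP-σ (snoc ch b) {σ} inv (f₁ , f₂ , f₃ , f) z i = go i
    where
    P : Port n → Set
    P w = w ∈ spP (snoc ch b) × w ≢ z
    rv : ∀ {a b} → σ a ≡ b → a ≡ σ b
    rv e = trans (sym (inv _)) (cong σ e)
    go : z ∈ spP (snoc ch b) → P (σ z)
    go (here refl) = subst P (sym f₁) (there (here refl) , λ ())
    go (there (here refl)) = subst P (rv f₁) (here refl , λ ())
    go (there (there (here refl))) = subst P (sym f₂) (there (there (there (here refl))) , λ ())
    go (there (there (there (here refl)))) = subst P (rv f₂) (there (there (here refl)) , λ ())
    go (there (there (there (there (here refl))))) = subst P (sym f₃) (there (there (there (there (there (here refl))))) , λ ())
    go (there (there (there (there (there (here refl)))))) = subst P (rv f₃) (there (there (there (there (here refl)))) , λ ())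
    go (there (there (there (there (there (there j)))))) = let (a , c) = spP-σ ch inv f z j in there (there (there (there (there (there a))))) , c

  facts-of : ∀ {k e μ} (ch : Chain Adj d lam x k e) → μ (x , false) ≡ (y , true) → VFacts (λ a b → μ (a , true) ≡ (b , false)) ch → Facts ch μ
  facts-of nil f F = f
  facts-of (snoc ch b) f (q₁ , q₂ , _ , q₃ , F) = q₁ , q₂ , q₃ , facts-of ch f F

  adj-facts : ∀ {k e} (ch : Chain Adj d lam x k e) → VFacts (λ a b → Adj a b ⊎ ((a , true) ∈ spP ch × (b , false) ∈ spP ch)) ch
  adj-facts nil = tt
  adj-facts (snoc ch b) = inj₁ ec , inj₂ (there (there (here refl)) , there (there (there (here refl)))) , via-map Ls (λ _ _ _ a → inj₁ a) vL , inj₁ t23 , lift ch (adj-facts ch)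
    where
    open Block b
    up : ∀ {z} → z ∈ spP ch → z ∈ spP (snoc ch b)
    up i = there (there (there (there (there (there i)))))
    lift : ∀ {j f} (ch' : Chain Adj d lam x j f) → VFacts (λ a b → Adj a b ⊎ ((a , true) ∈ spP ch × (b , false) ∈ spP ch)) ch' → VFacts (λ a b' → Adj a b' ⊎ ((a , true) ∈ spP (snoc ch b) × (b' , false) ∈ spP (snoc ch b))) ch'
    lift nil F = tt
    lift (snoc ch' b') (q₁ , q₂ , v , q₃ , F) = u q₁ , u q₂ , via-map (Block.Ls b') (λ _ _ _ → u) v , u q₃ , lift ch' F
      where u : ∀ {p q} → Adj p q ⊎ ((p , true) ∈ spP ch × (q , false) ∈ spP ch) → Adj p q ⊎ ((p , true) ∈ spP (snoc ch b) × (q , false) ∈ spP (snoc ch b))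
            u (inj₁ a) = inj₁ a
            u (inj₂ (a , c)) = inj₂ (up a , up c)


-- The long segments of the chain and the effect of cutting one

module Segments {n : ℕ} (F : Frame n) where
  open Frame F
  open Gadgets F
  open ChainFacts F

  seg-virt : ∀ {e} (b : Block Adj d lam e) {v} → v ∈ seg b → v ∈ Block.virt b
  seg-virt b (here e) = there (here e)
  seg-virt b (there i) = there (there (case ∈-++⁻ (Block.Ls b) i of λ { (inj₁ k) → ∈-++⁺ˡ k ; (inj₂ (here e)) → ∈-++⁺ʳ (Block.Ls b) (here e) }))

  sps-virt : ∀ {k e} (ch : Chain Adj d lam x k e) {v} → v ∈ sps ch → v ∈ x ∷ virts ch
  sps-virt nil i = i
  sps-virt (snoc ch b) (here refl) = there (∈-++⁺ʳ (virts ch) (c∈ b))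
  sps-virt (snoc ch b) (there (here refl)) = there (∈-++⁺ʳ (virts ch) (t1∈ b))
  sps-virt (snoc ch b) (there (there (here refl))) = there (∈-++⁺ʳ (virts ch) (t2∈ b))
  sps-virt (snoc ch b) (there (there (there (here refl)))) = there (∈-++⁺ʳ (virts ch) (t3∈ b))
  sps-virt (snoc ch b) (there (there (there (there i)))) = case sps-virt ch i of λ { (here e) → here e ; (there j) → there (∈-++⁺ˡ j) }

  lls-virt : ∀ {k e} (ch : Chain Adj d lam x k e) {v} → v ∈ lls ch → v ∈ virts ch
  lls-virt (snoc ch b) i = case ∈-++⁻ (Block.Ls b) i of λ { (inj₁ k) → ∈-++⁺ʳ (virts ch) (there (there (∈-++⁺ˡ k))) ; (inj₂ k) → ∈-++⁺ˡ (lls-virt ch k) }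

  sg-virt : ∀ {k e} (ch : Chain Adj d lam x k e) t {v} → v ∈ sg ch t → v ∈ virts ch
  sg-virt (snoc ch b) t i with SV._∈?_ t (seg b)
  ... | yes _ = ∈-++⁺ʳ (virts ch) (seg-virt b i)
  ... | no _ = ∈-++⁺ˡ (sg-virt ch t i)

  module _ {k e} (ch : Chain Adj d lam x k e) (b : Block Adj d lam e) (u : Unique (x ∷ virts (snoc ch b))) where
    open Block b
    u-ch : Unique (x ∷ virts ch)
    u-ch = uniq-++ˡ (x ∷ virts ch) u
    u-b : Unique virt
    u-b = uniq-++ʳ (x ∷ virts ch) u
    sep : ∀ {v} → v ∈ x ∷ virts ch → v ∉ virt
    sep = uniq-disj (x ∷ virts ch) u
    u-seg : Unique (t1 ∷ Ls ++ t2 ∷ [])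
    u-seg = uniq-∷ (λ i → ∉-head (uniq-tail u-b) (case ∈-++⁻ Ls i of λ { (inj₁ k) → ∈-++⁺ˡ k ; (inj₂ (here e)) → ∈-++⁺ʳ Ls (here e) }))
      (uniq-++ (uniq-++ˡ Ws₀ u₂) (uniq-∷ (λ ()) []) λ { i (here refl) → uniq-disj Ls u₂ i (here refl) })
      where Ws₀ = Ls
            u₂ = uniq-tail (uniq-tail u-b)

  uLLs : ∀ {k e} (ch : Chain Adj d lam x k e) → Unique (x ∷ virts ch) → Unique (lls ch)
  uLLs nil u = []
  uLLs (snoc ch b) u = uniq-++ (uniq-++ˡ (Block.Ls b) (uniq-tail (uniq-tail (u-b ch b u)))) (uLLs ch (u-ch ch b u))
    λ i j → sep ch b u (there (lls-virt ch j)) (there (there (∈-++⁺ˡ i)))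

  lls-sps : ∀ {k e} (ch : Chain Adj d lam x k e) → Unique (x ∷ virts ch) → ∀ {v} → v ∈ lls ch → v ∉ sps ch
  lls-sps (snoc ch b) u {v} i j with ∈-++⁻ (Block.Ls b) i
  ... | inj₁ k = inL j
    where
    open Block b
    ub = u-b ch b u
    inL : v ∉ sps (snoc ch b)
    inL (here refl) = ∉-head ub (there (∈-++⁺ˡ k))
    inL (there (here refl)) = ∉-head (uniq-tail ub) (∈-++⁺ˡ k)
    inL (there (there (here refl))) = uniq-disj Ls (uniq-tail (uniq-tail ub)) k (here refl)
    inL (there (there (there (here refl)))) = uniq-disj Ls (uniq-tail (uniq-tail ub)) k (there (here refl))
    inL (there (there (there (there l)))) = sep ch b u (sps-virt ch l) (there (there (∈-++⁺ˡ k)))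
  ... | inj₂ k = inC j
    where
    v∈ : v ∈ x ∷ virts ch
    v∈ = there (lls-virt ch k)
    inC : v ∉ sps (snoc ch b)
    inC (here refl) = sep ch b u v∈ (c∈ b)
    inC (there (here refl)) = sep ch b u v∈ (t1∈ b)
    inC (there (there (here refl))) = sep ch b u v∈ (t2∈ b)
    inC (there (there (there (here refl)))) = sep ch b u v∈ (t3∈ b)
    inC (there (there (there (there l)))) = lls-sps ch (u-ch ch b u) k l

  sg-yes : ∀ {k e} (ch : Chain Adj d lam x k e) b {t} → t ∈ seg b → sg (snoc ch b) t ≡ seg b
  sg-yes ch b {t} i with SV._∈?_ t (seg b)
  ... | yes _ = refl
  ... | no ni = ⊥-elim (ni i)

  sg-no : ∀ {k e} (ch : Chain Adj d lam x k e) b {t} → t ∉ seg b → sg (snoc ch b) t ≡ sg ch t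
  sg-no ch b {t} ni with SV._∈?_ t (seg b)
  ... | yes i = ⊥-elim (ni i)
  ... | no _ = refl

  L-seg : ∀ {e} (b : Block Adj d lam e) {l} → l ∈ Block.Ls b → l ∈ seg b
  L-seg b i = there (∈-++⁺ˡ i)

  not-seg : ∀ {k e} (ch : Chain Adj d lam x k e) b → Unique (x ∷ virts (snoc ch b)) → ∀ {v} → v ∈ virts ch → v ∉ seg b
  not-seg ch b u i j = sep ch b u (there i) (seg-virt b j)

  sg-length : ∀ {k e} (ch : Chain Adj d lam x k e) t → length (sg ch t) ≤ 2 + (lam + 2 * suc d)
  sg-length nil t = z≤n
  sg-length (snoc ch b) t with SV._∈?_ t (seg b)
  ... | yes _ = ≤-reflexive (cong suc (trans (length-++ (Block.Ls b)) (trans (+-comm _ 1) (cong suc (Block.lL b)))))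
  ... | no _ = sg-length ch t

  sg-self : ∀ {k e} (ch : Chain Adj d lam x k e) → Unique (x ∷ virts ch) → ∀ l → l ∈ lls ch → l ∈ sg ch l
  sg-self (snoc ch b) u l i with ∈-++⁻ (Block.Ls b) i
  ... | inj₁ k = subst (l ∈_) (sym (sg-yes ch b (L-seg b k))) (L-seg b k)
  ... | inj₂ k = subst (l ∈_) (sym (sg-no ch b (not-seg ch b u (lls-virt ch k)))) (sg-self ch (u-ch ch b u) l k)

  sg-sym : ∀ {k e} (ch : Chain Adj d lam x k e) → Unique (x ∷ virts ch) → ∀ l t → l ∈ lls ch → t ∈ sg ch l → l ∈ sg ch t
  sg-sym (snoc ch b) u l t i j with ∈-++⁻ (Block.Ls b) i
  ... | inj₁ k = subst (l ∈_) (sym (sg-yes ch b (subst (t ∈_) (sg-yes ch b (L-seg b k)) j))) (L-seg b k)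
  ... | inj₂ k = let t∈ = subst (t ∈_) (sg-no ch b (not-seg ch b u (lls-virt ch k))) j in
      subst (l ∈_) (sym (sg-no ch b (not-seg ch b u (sg-virt ch l t∈)))) (sg-sym ch (u-ch ch b u) l t k t∈)

  record Cut (σ : M n) (S : List (Fin n)) (seg' : List (Fin n)) (l : Fin n) : Set where
    field
      l'   : Fin n
      next : σ (l , true) ≡ (l' , false)
      l'∈  : l' ∈ seg'
      ends : ∀ μ → Inv μ → (∀ z → vt z ∈ seg' → μ z ≡ σ z) → Star (_∈ S) (cut μ (l , true)) l × Star (_∈ S) (cut μ (l , true)) l'

  -- An edge removed from an intact segment leaves two stretches, one ending at t1 and one at t2,
  -- and both of these vertices are special. The segment must be unaltered, since only there is the
  -- old order known to hold.
  cut-run : ∀ {σ : M n} {S t1 Ls t2} → Run σ t1 Ls t2 → Unique (t1 ∷ Ls ++ t2 ∷ []) → t1 ∈ S → t2 ∈ S → ∀ l → l ∈ Ls → Cut σ S (t1 ∷ Ls ++ t2 ∷ []) l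
  cut-run {σ} {S} {t1} {Ls} {t2} r u s₁ s₂ l i with ∈-∃++ i
  ... | as , bs , refl = go bs r u
    where
    go : ∀ bs → Run σ t1 (as ++ l ∷ bs) t2 → Unique (t1 ∷ (as ++ l ∷ bs) ++ t2 ∷ []) → Cut σ S (t1 ∷ (as ++ l ∷ bs) ++ t2 ∷ []) l
    go bs r u = record { l' = proj₁ nx₁ ; next = proj₁ (proj₂ nx₁) ; l'∈ = there (proj₁ (proj₂ (proj₂ nx₁))) ; ends = λ μ inv ag → (t1 , s₁ , back μ inv ag) , (t2 , s₂ , proj₂ (proj₂ (proj₂ nx₁)) μ inv ag) }
      where
      sp = via-split as r
      SG = t1 ∷ (as ++ l ∷ bs) ++ t2 ∷ []
      mid-l : l ∈ as ++ l ∷ bs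
      mid-l = ∈-++⁺ʳ as (here refl)
      u' : Unique (as ++ l ∷ bs)
      u' = uniq-++ˡ (as ++ l ∷ bs) (uniq-tail u)
      keepr : ∀ (μ : M n) → (∀ z → vt z ∈ SG → μ z ≡ σ z) → ∀ {l'} → σ (l , true) ≡ (l' , false) → ∀ a → a ∈ SG → a ≢ l → cut μ (l , true) (a , true) ≡ σ (a , true)
      keepr μ ag nx a a∈ ne = trans (cut-o μ (l , true) (λ { refl → ne refl }) (λ e → case trans e (trans (ag (l , true) (there (∈-++⁺ˡ mid-l))) nx) of λ ())) (ag (a , true) a∈)
      nxt : ∀ bs → Run σ l bs t2 → Σ (Fin n) λ l' → σ (l , true) ≡ (l' , false)
      nxt [] e = t2 , e
      nxt (b ∷ bs) (e , _) = b , e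
      nx₁ : Σ (Fin n) λ l' → (σ (l , true) ≡ (l' , false)) × (l' ∈ (as ++ l ∷ bs) ++ t2 ∷ []) × (∀ μ → Inv μ → (∀ z → vt z ∈ SG → μ z ≡ σ z) → Cn (cut μ (l , true)) Any-port l' t2)
      nx₁ = fwd bs refl (proj₂ sp)
        where
        fwd : ∀ cs → cs ≡ bs → Run σ l cs t2 → Σ (Fin n) λ l' → (σ (l , true) ≡ (l' , false)) × (l' ∈ (as ++ l ∷ bs) ++ t2 ∷ []) × (∀ μ → Inv μ → (∀ z → vt z ∈ SG → μ z ≡ σ z) → Cn (cut μ (l , true)) Any-port l' t2)
        fwd [] e r' = t2 , r' , ∈-++⁺ʳ (as ++ l ∷ bs) (here refl) , λ _ _ _ → here
        fwd (c ∷ cs) refl (e , r') = c , e , ∈-++⁺ˡ (∈-++⁺ʳ as (there (here refl))) , λ μ inv ag →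
          run-cn cs (via-map cs (λ a b a∈ h → trans (keepr μ ag e a (there (∈-++⁺ˡ (∈-++⁺ʳ as (there a∈)))) (λ { refl → ∉-head (uniq-++ʳ as u') a∈ })) h) r')
      back : ∀ μ → Inv μ → (∀ z → vt z ∈ SG → μ z ≡ σ z) → Cn (cut μ (l , true)) Any-port l t1
      back μ inv ag = cn-rev (cutInv μ (l , true) inv) (run-cn as (via-map as (λ a b a∈ h → trans (keepr μ ag (proj₂ (nxt bs (proj₂ sp))) a (inS a∈) (ne a∈)) h) (proj₁ sp)))
        where
        inS : ∀ {a} → a ∈ t1 ∷ as → a ∈ SG
        inS (here e) = here e
        inS (there k) = there (∈-++⁺ˡ (∈-++⁺ˡ k))
        ne : ∀ {a} → a ∈ t1 ∷ as → a ≢ l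
        ne (here refl) refl = ∉-head u (∈-++⁺ˡ mid-l)
        ne (there k) refl = uniq-disj as u' k (here refl)

  cut-mono : ∀ {σ S S' sg' l} → (∀ {v} → v ∈ S → v ∈ S') → Cut σ S sg' l → Cut σ S' sg' l
  cut-mono f c = record { Cut c ; ends = λ μ inv ag → let ((s , i , p) , (s' , i' , p')) = Cut.ends c μ inv ag in (s , f i , p) , (s' , f i' , p') }

  cuts : ∀ {k e} (ch : Chain Adj d lam x k e) {σ : M n} → Unique (x ∷ virts ch) → VFacts (λ a b → σ (a , true) ≡ (b , false)) ch → ∀ l → l ∈ lls ch → Cut σ (sps ch) (sg ch l) l
  cuts (snoc ch b) {σ} u (_ , _ , r , _ , F) l i with ∈-++⁻ (Block.Ls b) i
  ... | inj₁ k = subst (λ s → Cut σ (sps (snoc ch b)) s l) (sym (sg-yes ch b (L-seg b k)))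
      (cut-run r (u-seg ch b u) (there (here refl)) (there (there (here refl))) l k)
  ... | inj₂ k = subst (λ s → Cut σ (sps (snoc ch b)) s l) (sym (sg-no ch b (not-seg ch b u (lls-virt ch k))))
      (cut-mono (λ j → there (there (there (there j)))) (cuts ch (u-ch ch b u) F l k))

  lls-length : ∀ {k e} (ch : Chain Adj d lam x k e) → length (lls ch) ≡ k * (lam + 2 * suc d)
  lls-length nil = refl
  lls-length (snoc ch b) = trans (length-++ (Block.Ls b)) (cong₂ _+_ (Block.lL b) (lls-length ch))

  virts-length : ∀ {k e} (ch : Chain Adj d lam x k e) → length (virts ch) ≡ k * (4 + (lam + 2 * suc d))
  virts-length nil = refl
  virts-length (snoc {k} ch b) = trans (length-++ (virts ch)) (trans (cong₂ _+_ (virts-length ch) (cong (λ z → suc (suc z)) (trans (length-++ (Block.Ls b)) (cong (_+ 2) (Block.lL b)))))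
    (ar (k * (4 + (lam + 2 * suc d))) (lam + 2 * suc d)))
    where ar : ∀ a l → a + suc (suc (l + 2)) ≡ 4 + l + a
          ar = solve-∀


-- Adding the joining edges

via-neq : ∀ {n} {Q : Fin n → Fin n → Set} {u w} xs → Unique (u ∷ xs ++ w ∷ []) → Via Q u xs w → Via (λ a b → a ≢ b × Q a b) u xs w
via-neq [] un q = (λ { refl → ∉-head un (here refl) }) , q
via-neq (x ∷ xs) un (q , v) = ((λ { refl → ∉-head un (here refl) }) , q) , via-neq xs (uniq-tail un) v

joinAll : ∀ {n} → List (Port n × Port n) → M n → M n
joinAll [] μ = μ
joinAll ((a , b) ∷ J) μ = rot (joinAll J μ) a b

joinAll-spec : ∀ {n} (T : Fin n → Set) (J : List (Port n × Port n)) μ → Inv μ → (∀ a b → (a , b) ∈ J → T (vt a) × ¬ T (vt b) × μ a ≡ a × μ b ≡ b) →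
  Unique (map proj₁ J) → Unique (map proj₂ J) →
  Inv (joinAll J μ) × (∀ z → z ∉ map proj₁ J → z ∉ map proj₂ J → joinAll J μ z ≡ μ z) × (∀ a b → (a , b) ∈ J → joinAll J μ a ≡ b × joinAll J μ b ≡ a)
joinAll-spec T [] μ inv h u₁ u₂ = inv , (λ _ _ _ → refl) , λ _ _ ()
joinAll-spec {n} T ((a , b) ∷ J) μ inv h u₁ u₂ = rotInv ν a b inv' fa a≢b , other , pairs
  where
  IH = joinAll-spec T J μ inv (λ p q i → h p q (there i)) (uniq-tail u₁) (uniq-tail u₂)
  ν = joinAll J μ
  inv' = proj₁ IH
  Ta = proj₁ (h a b (here refl))
  nb = proj₁ (proj₂ (h a b (here refl)))
  T₁ : ∀ {z} → z ∈ map proj₁ J → T (vt z)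
  T₁ i with ∈-map⁻ proj₁ i
  ... | (p , q) , j , refl = proj₁ (h p q (there j))
  T₂ : ∀ {z} → z ∈ map proj₂ J → ¬ T (vt z)
  T₂ i with ∈-map⁻ proj₂ i
  ... | (p , q) , j , refl = proj₁ (proj₂ (h p q (there j)))
  fa : ν a ≡ a
  fa = trans (proj₁ (proj₂ IH) a (∉-head u₁) (λ i → T₂ i Ta)) (proj₁ (proj₂ (proj₂ (h a b (here refl)))))
  fb : ν b ≡ b
  fb = trans (proj₁ (proj₂ IH) b (λ i → nb (T₁ i)) (∉-head u₂)) (proj₂ (proj₂ (proj₂ (h a b (here refl)))))
  a≢b : a ≢ b
  a≢b e = nb (subst (λ z → T (vt z)) e Ta)
  keepz : ∀ z → z ≢ a → z ≢ b → rot ν a b z ≡ ν z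
  keepz z x y = rot-o ν a b x y λ e → y (trans e fb)
  other : ∀ z → z ∉ a ∷ map proj₁ J → z ∉ b ∷ map proj₂ J → rot ν a b z ≡ μ z
  other z x y = trans (keepz z (λ e → x (here e)) (λ e → y (here e))) (proj₁ (proj₂ IH) z (λ i → x (there i)) (λ i → y (there i)))
  pairs : ∀ p q → (p , q) ∈ (a , b) ∷ J → rot ν a b p ≡ q × rot ν a b q ≡ p
  pairs p q (here refl) = rot-p ν a b , rot-q ν a b
  pairs p q (there i) = let (e₁ , e₂) = proj₂ (proj₂ IH) p q i in
      trans (keepz p (λ { refl → ∉-head u₁ (∈-map⁺ proj₁ i) }) (λ { refl → nb (proj₁ (h p q (there i))) })) e₁
    , trans (keepz q (λ { refl → proj₁ (proj₂ (h p q (there i))) Ta }) (λ { refl → ∉-head u₂ (∈-map⁺ proj₂ i) })) e₂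


module Corners {n : ℕ} (F : Frame n) where
  open Frame F
  open Gadgets F
  open ChainFacts F

  xy∈spP : ∀ {k e} (c : Chain Adj d lam x k e) → (x , false) ∈ spP c × (y , true) ∈ spP c
  xy∈spP nil = here refl , there (here refl)
  xy∈spP (snoc c b) = let (p , q) = xy∈spP c in there (there (there (there (there (there p))))) , there (there (there (there (there (there q)))))

  x-sp : ∀ {k e} (c : Chain Adj d lam x k e) → x ∈ sps c
  x-sp nil = here refl
  x-sp (snoc c b) = there (there (there (there (x-sp c))))

  real : ∀ {k e} (c : Chain Adj d lam x k e) {μ : M n} → Inv μ → Facts c μ → ∀ z → z ∈ spP c → z ∉ spl c → Adj (vt z) (vt (μ z))
  real nil inv f z i ni = ⊥-elim (ni i)
  real (snoc {e = e'} c b) {μ} inv (f₁ , f₂ , f₃ , f) z i ni = go i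
    where
    open Block b renaming (c to cc)
    rv : ∀ {a b} → μ a ≡ b → μ b ≡ a
    rv h = trans (cong μ (sym h)) (inv _)
    go : z ∈ spP (snoc c b) → Adj (vt z) (vt (μ z))
    go (here refl) = subst (λ w → Adj e' (vt w)) (sym f₁) ec
    go (there (here refl)) = subst (λ w → Adj cc (vt w)) (sym (rv f₁)) (Adj-sym ec)
    go (there (there (here refl))) = ⊥-elim (ni (here refl))
    go (there (there (there (here refl)))) = ⊥-elim (ni (there (here refl)))
    go (there (there (there (there (here refl))))) = subst (λ w → Adj t2 (vt w)) (sym f₃) t23
    go (there (there (there (there (there (here refl)))))) = subst (λ w → Adj t3 (vt w)) (sym (rv f₃)) (Adj-sym t23)
    go (there (there (there (there (there (there j)))))) = real c inv f z j (λ l → ni (there (there l)))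

  fps⊑ : ∀ {k e} (c : Chain Adj d lam x k e) {z} → z ∈ fps c → z ∈ spP c
  fps⊑ nil (here e) = here e
  fps⊑ (snoc c b) (here e) = here e
  fps⊑ (snoc c b) (there (here e)) = there (there (here e))
  fps⊑ (snoc c b) (there (there (here e))) = there (there (there (there (here e))))
  fps⊑ (snoc c b) (there (there (there i))) = there (there (there (there (there (there (fps⊑ c i))))))


-- The union of the two matchings and the joining edges is a two-factor in which everything is tied to a special vertex

record Pieces {n : ℕ} (F : Frame n) {kb : ℕ} {e : Fin n} (ch : Chain (Frame.Adj F) (Frame.d F) (Frame.lam F) (Frame.x F) kb e) (TL : List (Fin n)) : Set where
  open Frame F
  open Gadgets F using (Facts; sps)
  open ChainFacts F using (spP)
  field
    offW  : ∀ v → v ∈ TL → v ∉ wss ch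
    σ     : M n
    σ-inv : Inv σ
    Fσ    : Facts ch σ
    σy    : σ (y , true) ≡ (x , false)
    spT   : ∀ z → z ∈ spP ch → vt z ∈ TL
    μT μR : M n
    J     : List (Port n × Port n)
    pmT   : PM _≢_ (_∈ TL) μT
    edgeA : ∀ z → μT z ≢ z → z ∉ spP ch → Adj (vt z) (vt (μT z))
    spec  : ∀ z → z ∈ spP ch → μT z ≡ σ z
    star  : ∀ v → v ∈ TL → Star (_∈ y ∷ sps ch) μT v
    covT  : ∀ z → vt z ∈ TL → μT z ≡ z → z ∈ map proj₁ J
    keepT : ∀ z → z ∈ map proj₁ J → μT z ≡ z × vt z ∈ TL
    uJT   : Unique (map proj₁ J)
    pmR   : PM Adj (λ v → v ∉ TL × v ∉ wss ch) μR
    nscR  : NSC (λ _ → ⊤) μR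
    covR  : ∀ z → vt z ∉ TL × vt z ∉ wss ch → μR z ≡ z → z ∈ map proj₂ J
    keepR : ∀ z → z ∈ map proj₂ J → μR z ≡ z × (vt z ∉ TL × vt z ∉ wss ch)
    uJR   : Unique (map proj₂ J)
    adjJ  : ∀ a b → (a , b) ∈ J → Adj (vt a) (vt b)

module Assemble {n : ℕ} (F : Frame n) {kb : ℕ} {e : Fin n} (ch : Chain (Frame.Adj F) (Frame.d F) (Frame.lam F) (Frame.x F) kb e) (TL : List (Fin n)) (P : Pieces F ch TL) where
  open Frame F
  open Pieces P
  open Gadgets F
  open ChainFacts F
  open Corners F

  T R : Fin n → Set
  T v = v ∈ TL
  R v = v ∉ TL × v ∉ wss ch

  μU : M n
  μU z with SV._∈?_ (vt z) TL
  ... | yes _ = μT z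
  ... | no _ = μR z

  U-T : ∀ z → T (vt z) → μU z ≡ μT z
  U-T z i with SV._∈?_ (vt z) TL
  ... | yes _ = refl
  ... | no ni = ⊥-elim (ni i)

  U-R : ∀ z → ¬ T (vt z) → μU z ≡ μR z
  U-R z ni with SV._∈?_ (vt z) TL
  ... | yes i = ⊥-elim (ni i)
  ... | no _ = refl

  T-stays : ∀ z → T (vt z) → T (vt (μT z))
  T-stays z i with μT z ≟P z
  ... | yes e = subst (λ w → T (vt w)) (sym e) i
  ... | no ne = PM.domμ pmT z ne

  R-stays : ∀ z → ¬ T (vt z) → ¬ T (vt (μR z))
  R-stays z ni with μR z ≟P z
  ... | yes e = subst (λ w → ¬ T (vt w)) (sym e) ni
  ... | no ne = proj₁ (PM.domμ pmR z ne)

  U-inv : Inv μU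
  U-inv z with SV._∈?_ (vt z) TL
  ... | yes i = trans (U-T (μT z) (T-stays z i)) (PM.inv pmT z)
  ... | no ni = trans (U-R (μR z) (R-stays z ni)) (PM.inv pmR z)

  inJ₁ : ∀ {a b} → (a , b) ∈ J → a ∈ map proj₁ J
  inJ₁ = ∈-map⁺ proj₁
  inJ₂ : ∀ {a b} → (a , b) ∈ J → b ∈ map proj₂ J
  inJ₂ i = ∈-map⁺ proj₂ i

  spec-J : Inv (joinAll J μU) × (∀ z → z ∉ map proj₁ J → z ∉ map proj₂ J → joinAll J μU z ≡ μU z) × (∀ a b → (a , b) ∈ J → joinAll J μU a ≡ b × joinAll J μU b ≡ a)
  spec-J = joinAll-spec T J μU U-inv (λ a b i → let (fa , Ta) = keepT a (inJ₁ i) ; (fb , (nTb , _)) = keepR b (inJ₂ i) in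
      Ta , nTb , trans (U-T a Ta) fa , trans (U-R b nTb) fb) uJT uJR

  μF : M n
  μF = joinAll J μU

  J₁-T : ∀ {z} → z ∈ map proj₁ J → T (vt z) × μT z ≡ z
  J₁-T i = let (f , t) = keepT _ i in t , f

  J₂-R : ∀ {z} → z ∈ map proj₂ J → R (vt z) × μR z ≡ z
  J₂-R i = let (f , t) = keepR _ i in t , f

  F-T : ∀ z → T (vt z) → z ∉ map proj₁ J → μF z ≡ μT z
  F-T z t ni = trans (proj₁ (proj₂ spec-J) z ni (λ i → proj₁ (proj₁ (J₂-R i)) t)) (U-T z t)

  F-R : ∀ z → ¬ T (vt z) → z ∉ map proj₂ J → μF z ≡ μR z
  F-R z nt ni = trans (proj₁ (proj₂ spec-J) z (λ i → nt (proj₁ (J₁-T i))) ni) (U-R z nt)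

  data Kind (z : Port n) : Set where
    kT  : T (vt z) → μT z ≢ z → μF z ≡ μT z → Kind z
    kR  : R (vt z) → μR z ≢ z → μF z ≡ μR z → Kind z
    kJ₁ : ∀ b → (z , b) ∈ J → Kind z
    kJ₂ : ∀ a → (a , z) ∈ J → Kind z
    kW  : vt z ∈ wss ch → μF z ≡ z → Kind z

  kind : ∀ z → Kind z
  kind z with SV._∈?_ (vt z) TL
  ... | yes t with SP._∈?_ z (map proj₁ J)
  ... | yes i with ∈-map⁻ proj₁ i
  ... | (a , b) , j , refl = kJ₁ b j
  kind z | yes t | no ni = kT t (λ h → ni (covT z t h)) (F-T z t ni)
  kind z | no nt with SP._∈?_ z (map proj₂ J)
  ... | yes i with ∈-map⁻ proj₂ i
  ... | (a , b) , j , refl = kJ₂ a j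
  kind z | no nt | no ni with SV._∈?_ (vt z) (wss ch)
  ... | yes w = kW w (trans (F-R z nt ni) (outR w))
    where outR : vt z ∈ wss ch → μR z ≡ z
          outR w with μR z ≟P z
          ... | yes h = h
          ... | no ne = ⊥-elim (proj₂ (PM.dom pmR z ne) w)
  ... | no nw = kR (nt , nw) (λ h → ni (covR z (nt , nw) h)) (F-R z nt ni)

  cross : ∀ {a b} → (a , b) ∈ J → a ≢ b
  cross i refl = proj₁ (proj₁ (J₂-R (∈-map⁺ proj₂ i))) (proj₁ (J₁-T (∈-map⁺ proj₁ i)))

  edgeF : ∀ z → vt z ∉ wss ch → z ∉ spl ch → Adj (vt z) (vt (μF z))
  edgeF z nw ns with kind z
  ... | kT t ne h = subst (λ w → Adj (vt z) (vt w)) (sym h) (edT (SP._∈?_ z (spP ch)))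
    where
    edT : Dec (z ∈ spP ch) → Adj (vt z) (vt (μT z))
    edT (no n') = edgeA z ne n'
    edT (yes s) = subst (λ w → Adj (vt z) (vt w)) (sym (spec z s)) (real ch σ-inv Fσ z s ns)
  ... | kR r ne h = subst (λ w → Adj (vt z) (vt w)) (sym h) (PM.edge pmR z ne)
  ... | kJ₁ b j = subst (λ w → Adj (vt z) (vt w)) (sym (proj₁ (proj₂ (proj₂ spec-J) z b j))) (adjJ z b j)
  ... | kJ₂ a j = subst (λ w → Adj (vt z) (vt w)) (sym (proj₂ (proj₂ (proj₂ spec-J) a z j))) (Adj-sym (adjJ a z j))
  ... | kW w _ = ⊥-elim (nw w)

  fullF : ∀ z → vt z ∉ wss ch → μF z ≢ z
  fullF z nw h with kind z
  ... | kT _ ne h' = ne (trans (sym h') h)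
  ... | kR _ ne h' = ne (trans (sym h') h)
  ... | kJ₁ b j = cross j (trans (sym h) (proj₁ (proj₂ (proj₂ spec-J) z b j)))
  ... | kJ₂ a j = cross j (trans (sym (proj₂ (proj₂ (proj₂ spec-J) a z j))) h)
  ... | kW w _ = nw w

  freeF : ∀ z → ¬ vt z ∉ wss ch → μF z ≡ z
  freeF z h with kind z
  ... | kT t _ _ = ⊥-elim (h (offW (vt z) t))
  ... | kR (_ , nw) _ _ = ⊥-elim (h nw)
  ... | kJ₁ b j = ⊥-elim (h (offW (vt z) (proj₁ (J₁-T (∈-map⁺ proj₁ j)))))
  ... | kJ₂ a j = ⊥-elim (h (proj₂ (proj₁ (J₂-R (∈-map⁺ proj₂ j)))))
  ... | kW _ h' = h'

  spF : ∀ z → z ∈ spP ch → μF z ≡ σ z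
  spF z s = trans (F-T z t (λ i → proj₂ (spP-σ ch σ-inv Fσ z s) (trans (sym (spec z s)) (proj₂ (J₁-T i))))) (spec z s)
    where t : T (vt z)
          t = spT z s

  liftT : ∀ {u v} → Cn μT Any-port u v → Cn μF Any-port u v
  liftT = cn-lift λ z _ → one z (μT z ≟P z)
    where
    one : ∀ z → Dec (μT z ≡ z) → Cn μF Any-port (vt z) (vt (μT z))
    one z (yes h) = subst (λ w → Cn μF Any-port (vt z) (vt w)) (sym h) here
    one z (no ne) = subst (λ w → Cn μF Any-port (vt z) (vt w)) (F-T z (PM.dom pmT z ne) (λ i → ne (proj₂ (J₁-T i)))) (cn-one z tt)

  liftR : ∀ {u v} → Cn μR Any-port u v → Cn μF Any-port u v
  liftR = cn-lift λ z _ → one z (μR z ≟P z)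
    where
    one : ∀ z → Dec (μR z ≡ z) → Cn μF Any-port (vt z) (vt (μR z))
    one z (yes h) = subst (λ w → Cn μF Any-port (vt z) (vt w)) (sym h) here
    one z (no ne) = subst (λ w → Cn μF Any-port (vt z) (vt w)) (F-R z (proj₁ (PM.dom pmR z ne)) (λ i → ne (proj₂ (J₂-R i)))) (cn-one z tt)

  starT : ∀ v → T v → Star (_∈ sps ch) μF v
  starT v t with star v t
  ... | s , there s∈ , c = s , s∈ , liftT c
  -- During the absorption `y` also counted as special; for the gadgets it is replaced by `x`, to
  -- which the virtual edge leads.
  ... | s , here refl , c = x , x-sp ch , cn-trans (liftT c) (subst (λ w → Cn μF Any-port y (vt w)) (trans (spF (y , true) (proj₂ (xy∈spP ch))) σy) (cn-one (y , true) tt))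

  -- A walk that met no free port would return to its start and be a cycle, and the cover has none.
  -- So every path of the cover reaches an end, and every end has a joining edge into the chain.
  reach-free : ∀ v → R v → DN (Σ (Port n) λ z → (μR z ≡ z) × R (vt z) × Cn μR Any-port v (vt z))
  reach-free v Rv = lem (Σ ℕ λ i → μR (it μR i (v , false)) ≡ it μR i (v , false)) >>= λ
      { (inj₁ (i , h)) → return (it μR i (v , false) , h , stays i (v , false) Rv , cn-walk μR (PM.inv pmR) i (v , false) (λ _ _ → tt))
      ; (inj₂ none) → ⊥-elim (let (k' , r) = returns μR (PM.inv pmR) (v , false) in nscR (v , false) k' tt (r , λ i h → none (i , h))) }
    where
    stays : ∀ i p → R (vt p) → R (vt (it μR i p))
    stays zero p r = r
    stays (suc i) p r with μR p ≟P p
    ... | yes h = stays i (nx μR p) (subst (λ w → R (vt w)) (sym h) r)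
    ... | no ne = stays i (nx μR p) (PM.domμ pmR p ne)

  starF : ∀ v → v ∉ wss ch → DN (Star (_∈ sps ch) μF v)
  starF v nw with SV._∈?_ v TL
  ... | yes t = return (starT v t)
  ... | no nt = reach-free v (nt , nw) >>= λ (z , fz , Rz , c) → return (via-J z c (covR z Rz fz))
    where
    via-J : ∀ z → Cn μR Any-port v (vt z) → z ∈ map proj₂ J → Star (_∈ sps ch) μF v
    via-J z c i with ∈-map⁻ proj₂ i
    ... | (a , b) , j , refl = star-via (cn-trans (liftR c) (subst (λ w → Cn μF Any-port (vt b) (vt w)) (proj₂ (proj₂ (proj₂ spec-J) a b j)) (cn-one b tt)))
        (starT (vt a) (proj₁ (J₁-T (∈-map⁺ proj₁ j))))

  state : DN (State ch)
  state = dn-all (λ v → lem (v ∉ wss ch) >>= λ { (inj₁ h) → starF v h >>= λ st → return (λ _ → st) ; (inj₂ h) → return (λ h' → ⊥-elim (h h')) }) >>= λ st → return record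
    { μ = μF ; mt = record { inv = proj₁ spec-J ; full = fullF ; free = freeF ; edge = edgeF } ; facts = facts-mono ch (λ z i → spF z (fps⊑ ch i)) Fσ ; star = st }
    where
    dn-all : ∀ {P : Fin n → Set} → (∀ v → DN (P v)) → DN (∀ v → P v)
    dn-all {P} h = chooseL (λ v (_ : ⊤) → P v) (allFin n) (λ v _ → h v >>= λ p → return (tt , p)) >>= λ (_ , _ , f , _) → return λ v → proj₂ (proj₂ (f v (∈-allFin v)))



-- The closed chain as the initial structure, and the run of the later phases

record Strand (n : ℕ) : Set₁ where
  field
    Adj     : Fin n → Fin n → Set
    Adj-sym : ∀ {u v} → Adj u v → Adj v u
    irr     : ∀ {v} → ¬ Adj v v
    m       : ℕ
    joined  : ∀ X Y → Unique X → Unique Y → (∀ v → v ∈ X → v ∉ Y) → m ≤ length X → m ≤ length Y →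
      Σ (Fin n) λ u → Σ (Fin n) λ v → u ∈ X × v ∈ Y × Adj u v
    dl      : ℕ
    m≤2^d   : m ≤ 2 ^ dl
    2^i≤m   : ∀ i → i < dl → 2 ^ i ≤ m
    d lam   : ℕ
    x y     : Fin n
    {kb}    : ℕ
    {e}     : Fin n
    ch      : Chain Adj d lam x kb e
    zs      : List (Fin n)
    un      : Unique (x ∷ (virts ch ++ zs) ++ y ∷ [])
    unW     : Unique (wss ch)
    offW    : ∀ v → v ∈ x ∷ (virts ch ++ zs) ++ y ∷ [] → v ∉ wss ch
    vz      : Via Adj e zs y

  frame : Frame n
  frame = record { Adj = Adj ; Adj-sym = Adj-sym ; d = d ; lam = lam ; x = x ; y = y }

module Weave {n : ℕ} (S : Strand n) where
  open Strand S

  open Gadgets frame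
  open ChainFacts frame
  open Segments frame
  open Corners frame

  TL : List (Fin n)
  TL = x ∷ (virts ch ++ zs) ++ y ∷ []

  T R Sp : Fin n → Set
  T v = v ∈ TL
  R v = v ∉ TL × v ∉ wss ch
  Sp v = v ∈ y ∷ sps ch

  SpP : Port n → Set
  SpP z = z ∈ spP ch

  Q : Fin n → Fin n → Set
  Q a b = Adj a b ⊎ ((a , true) ∈ spP ch × (b , false) ∈ spP ch)

  pmx = path-matching {Q = λ a b → a ≢ b × Q a b} x (virts ch ++ zs) y un
    (via-neq (virts ch ++ zs) un (from-facts ch zs (adj-facts ch) (via-map zs (λ _ _ _ a → inj₁ a) vz)))

  σ₀ : M n
  σ₀ = proj₁ pmx

  module P₀ = PathM (proj₂ pmx)

  x≢y : x ≢ y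
  x≢y refl = ∉-head un (∈-++⁺ʳ (virts ch ++ zs) (here refl))

  px py : Port n
  px = (x , false)
  py = (y , true)

  σ : M n
  -- The virtual edge x y closes the path into a single cycle, so on the chain every port is matched
  -- and everything is tied to `x` at the outset.
  σ = rot σ₀ px py

  σ-inv : Inv σ
  σ-inv = rotInv σ₀ px py P₀.inv P₀.strt λ ()

  σ-o : ∀ z → z ≢ px → z ≢ py → σ z ≡ σ₀ z
  σ-o z a b = rot-o σ₀ px py a b λ h → b (trans h P₀.stop)

  σx : σ px ≡ py
  σx = rot-p σ₀ px py

  u-chain : Unique (x ∷ virts ch)
  u-chain = uniq-++ˡ (x ∷ virts ch) (subst Unique (cong (x ∷_) (++-assoc (virts ch) zs (y ∷ []))) un)

  σ-run : Run σ x (virts ch ++ zs) y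
  σ-run = via-map (virts ch ++ zs) (λ a b i h → trans (σ-o (a , true) (λ ()) (λ { refl → y∉ i })) h) P₀.run
    where y∉ : y ∉ x ∷ virts ch ++ zs
          y∉ i = uniq-disj (x ∷ virts ch ++ zs) un i (here refl)

  VF : VFacts (λ a b → σ (a , true) ≡ (b , false)) ch
  VF = proj₁ (to-facts ch zs σ-run)

  Fσ : Facts ch σ
  Fσ = facts-of ch σx VF

  σ-full : ∀ z → T (vt z) → σ z ≢ z
  σ-full z i h with rotCase σ₀ px py z
  ... | atp refl = case trans (sym h) σx of λ ()
  ... | atq _ refl = case trans (sym h) (rot-q σ₀ px py) of λ ()
  ... | atr _ b refl = b P₀.stop
  ... | off a b _ = case P₀.free z i (trans (sym (σ-o z a b)) h) of λ { (inj₁ e) → a e ; (inj₂ e) → b e }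

  σ-dom : ∀ z → σ z ≢ z → T (vt z)
  σ-dom z ne with SV._∈?_ (vt z) TL
  ... | yes i = i
  ... | no ni = ⊥-elim (ne (trans (σ-o z (λ { refl → ni (here refl) }) (λ { refl → ni (∈-++⁺ʳ (x ∷ virts ch ++ zs) (here refl)) })) (P₀.out z ni)))

  σ-edge : ∀ z → σ z ≢ z → ¬ SpP z → Adj (vt z) (vt (σ z))
  σ-edge z ne ns with P₀.edge z (λ h → ne (trans (σ-o z (λ h → ns (subst SpP (sym h) (proj₁ (xy∈spP ch)))) (λ h → ns (subst SpP (sym h) (proj₂ (xy∈spP ch))))) h))
  ... | a , b , (_ , q) , inj₁ (refl , h) = case q of λ { (inj₁ ad) → subst (λ w → Adj a (vt w)) (sym (trans σz h)) ad ; (inj₂ (s , _)) → ⊥-elim (ns s) }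
    where σz = σ-o z (λ h → ns (subst SpP (sym h) (proj₁ (xy∈spP ch)))) (λ h → ns (subst SpP (sym h) (proj₂ (xy∈spP ch))))
  ... | a , b , (_ , q) , inj₂ (refl , h) = case q of λ { (inj₁ ad) → subst (λ w → Adj b (vt w)) (sym (trans σz h)) (Adj-sym ad) ; (inj₂ (_ , s)) → ⊥-elim (ns s) }
    where σz = σ-o z (λ h → ns (subst SpP (sym h) (proj₁ (xy∈spP ch)))) (λ h → ns (subst SpP (sym h) (proj₂ (xy∈spP ch))))

  σ-pm : PM _≢_ T σ
  σ-pm = record { inv = σ-inv ; dom = σ-dom ; edge = ne-edge }
    where
    ne-edge : ∀ z → σ z ≢ z → vt z ≢ vt (σ z)
    ne-edge z ne h with SP._∈?_ z (spP ch)
    ... | no ns = irr (subst (Adj (vt z)) (sym h) (σ-edge z ne ns))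
    ... | yes s with same-vt {p = σ z} {q = z} (sym h)
    ... | inj₁ e = ne e
    ... | inj₂ e with rotCase σ₀ px py z
    ... | atp refl = x≢y (cong vt (trans (sym (trans e refl)) σx))
    ... | atq _ refl = x≢y (sym (cong vt (trans (sym e) (rot-q σ₀ px py))))
    ... | atr _ b refl = b P₀.stop
    ... | off a b _ with P₀.edge z (λ h' → ne (trans (σ-o z a b) h'))
    ... | u , v , (u≢v , _) , inj₁ (h₁ , h₂) = u≢v (trans (sym (cong vt h₁)) (trans h (cong vt (trans (σ-o z a b) h₂))))
    ... | u , v , (u≢v , _) , inj₂ (h₁ , h₂) = u≢v (sym (trans (sym (cong vt h₁)) (trans h (cong vt (trans (σ-o z a b) h₂)))))

  σ-star : ∀ v → T v → Star Sp σ v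
  σ-star v i = x , there (x-sp ch) , cn-rev σ-inv (run-cn-all (virts ch ++ zs) σ-run v i)

  R-T : ∀ v → R v → ¬ T v
  R-T v (a , _) = a

  module WithR (exR : ∀ X → Unique X → (∀ v → v ∈ X → R v) → length X ≤ m → ∀ Y → Cov Adj X R Y → 6 * length X ≤ length Y)
    (sizes : length TL + 72 * m ≤ 2 * length (lls ch)) (k : ℕ) (k≤m : 2 + k ≤ m)
    (roomL : (2 + (lam + 2 * suc d)) * (k * (2 * dl + 2)) + 3 * m < length (lls ch)) (minl : MaxRot.Minimal Adj Adj-sym irr R (λ _ → ⊤) k) where

    LLT : ∀ v → v ∈ lls ch → T v × ¬ Sp v
    LLT v i = there (∈-++⁺ˡ (∈-++⁺ˡ (lls-virt ch i))) , λ
      { (here refl) → uniq-disj (x ∷ virts ch ++ zs) un (there (∈-++⁺ˡ (lls-virt ch i))) (here refl) ; (there j) → lls-sps ch u-chain i j }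

    cut-at : ∀ l → l ∈ lls ch → Cut σ (sps ch) (sg ch l) l
    cut-at = cuts ch u-chain VF

    σ-T : ∀ l → l ∈ lls ch → σ (l , true) ≢ (l , true) × T (vt (σ (l , true))) × ¬ SpP (σ (l , true)) × vt (σ (l , true)) ∈ sg ch l
    σ-T l i = σ-full (l , true) (proj₁ (LLT l i)) , subst T (sym (cong vt next)) (there (∈-++⁺ˡ (∈-++⁺ˡ (sg-virt ch l l'∈))))
        , (λ s → proj₂ (LLT l i) (spP-vt ch (l , true) (subst SpP (σ-inv (l , true)) (proj₁ (spP-σ ch σ-inv Fσ _ s))))) , subst (_∈ sg ch l) (sym (cong vt next)) l'∈
      where open Cut (cut-at l i)

    cutFact : ∀ l → l ∈ lls ch → ∀ μ → Inv μ → (∀ z → vt z ∈ sg ch l → μ z ≡ σ z) → Star Sp (cut μ (l , true)) l × Star Sp (cut μ (l , true)) (vt (σ (l , true)))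
    cutFact l i μ inv ag = let ((s , s∈ , c) , (s' , s∈' , c')) = Cut.ends (cut-at l i) μ inv ag in
      (s , there s∈ , c) , (s' , there s∈' , subst (λ v → Cn (cut μ (l , true)) Any-port v s') (sym (cong vt (Cut.next (cut-at l i)))) c')

    meeting : Meeting n
    meeting = record { Adj = Adj ; Adj-sym = Adj-sym ; irr = irr ; m = m ; joined = joined ; d = dl ; m≤2^d = m≤2^d ; 2^i≤m = 2^i≤m ; R = R ; T = T ; Sp = Sp
      ; RT = R-T ; exR = exR ; SpP = SpP ; SpP-vt = spP-vt ch ; σ = σ ; σ≢ = λ z s → proj₂ (spP-σ ch σ-inv Fσ z s) ; σ-SpP = λ z s → proj₁ (spP-σ ch σ-inv Fσ z s)
      ; TL = TL ; LL = lls ch ; uTL = un ; inTL = λ v i → i ; uLL = uLLs ch u-chain ; LLT = LLT ; sizes = sizes ; sg = sg ch ; len = 2 + (lam + 2 * suc d)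
      ; sg-len = sg-length ch ; sg-self = sg-self ch u-chain ; sg-sym = sg-sym ch u-chain ; σ-inv = σ-inv ; σ-T = σ-T ; cutFact = cutFact ; k = k ; minl = minl ; k≤m = k≤m ; roomL = roomL }

    GSt : ℕ → Set
    GSt = Joining.Rounds.GS meeting

    run-rounds : ∀ rem → GSt rem → DN (GSt 0)
    run-rounds = Joining.Rounds.rounds meeting

    closing-state : GSt 0 → DN (Gadgets.State frame ch)
    closing-state gs = Assemble.state frame ch TL (record { offW = offW ; σ = σ ; σ-inv = σ-inv ; Fσ = Fσ ; σy = rot-q σ₀ px py
        ; spT = λ z s → σ-dom z (proj₂ (spP-σ ch σ-inv Fσ z s)) ; μT = μT gs ; μR = μR gs ; J = J gs ; pmT = pmT gs ; edgeA = edgeA gs ; spec = spec gs ; star = star gs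
        ; covT = covT gs ; keepT = keepT gs ; uJT = uJT gs ; pmR = pmR gs ; nscR = nscR gs ; covR = λ z r h → subst (z ∈_) J≡ (covR gs z r h)
        ; keepR = λ z i → keepR gs z (∈-++⁺ˡ i) ; uJR = uniq-++ˡ (map proj₂ (J gs)) (uR gs) ; adjJ = adjJ gs })
      where
      open Joining.Rounds.GS
      nil-of : ∀ (F : List (Port n)) → length F ≡ 0 → F ≡ []
      nil-of [] _ = refl
      J≡ : map proj₂ (J gs) ++ FR gs ≡ map proj₂ (J gs)
      J≡ = trans (cong (map proj₂ (J gs) ++_) (nil-of (FR gs) (lFR gs))) (++-identityʳ _)

    weave : (μR : M n) → PM Adj R μR → NSC (λ _ → ⊤) μR → (F : List (Port n)) → Unique F → (∀ z → R (vt z) → μR z ≡ z → z ∈ F) → (∀ z → z ∈ F → μR z ≡ z × R (vt z)) →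
      length F ≡ k → ∀ rem → length F ≡ 2 * rem → DN (Process.HamP frame)
    weave μR pmR nscR F uF cov kp' lF rem ev = run-rounds rem start >>= closing-state >>= λ st →
        Process.all-gadgets frame ch (uniq-++ u-chain unW λ i → offW _ (case i of λ { (here h) → here h ; (there j) → there (∈-++⁺ˡ (∈-++⁺ˡ j)) })) st >>= λ st₀ → return (Process.to-path frame st₀)
      where
      start : GSt rem
      start = record { μT = σ ; μR = μR ; J = [] ; FR = F ; pmT = σ-pm ; edgeA = σ-edge ; spec = λ _ _ → refl ; star = σ-star
        ; covT = λ z t h → ⊥-elim (σ-full z t h) ; keepT = λ _ () ; uJT = [] ; Tch = [] ; agree = λ _ _ → refl ; lTch = z≤n ; pmR = pmR ; nscR = nscR
        ; covR = cov ; keepR = kp' ; uR = uF ; total = lF ; lFR = ev ; adjJ = λ _ _ () }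


-- The spanning path from the expansion properties

occs-length : ∀ {n Adj d lam k} {x e : Fin n} (ch : Chain Adj d lam x k e) → length (occs ch) ≡ length (virts ch) + length (wss ch)
occs-length nil = refl
occs-length (snoc ch b) = trans (length-++ (Block.virt b ++ Block.Ws b))
  (trans (cong₂ _+_ (length-++ (Block.virt b)) (occs-length ch))
  (trans (ar (length (Block.virt b)) (length (Block.Ws b)) (length (virts ch)) (length (wss ch)))
    (sym (cong₂ _+_ (length-++ (virts ch)) (length-++ (Block.Ws b))))))
  where
  ar : ∀ a b c d → (a + b) + (c + d) ≡ (c + a) + (b + d)
  ar = solve-∀

record Host (n : ℕ) : Set₁ where
  field
    Adj     : Fin n → Fin n → Set
    Adj-sym : ∀ {u v} → Adj u v → Adj v u
    irr     : ∀ {v} → ¬ Adj v v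
    m D     : ℕ
    joined  : ∀ X Y → Unique X → Unique Y → (∀ v → v ∈ X → v ∉ Y) → m ≤ length X → m ≤ length Y →
      Σ (Fin n) λ u → Σ (Fin n) λ v → u ∈ X × v ∈ Y × Adj u v
    6≤D     : 6 ≤ D
    25≤D    : 25 ≤ D
    expands : ∀ X → Unique X → length X ≤ 8 * m → ∀ Y → Cov Adj X (λ _ → ⊤) Y → (2 + D) * length X ≤ length Y
    d       : ℕ
    m≤2^d   : m ≤ 2 ^ suc d
    2^d≤2m  : 2 ^ suc d ≤ 2 * m
    2^i≤m   : ∀ i → i < suc d → 2 ^ i ≤ m
    g       : ℕ
    g≥1     : 1 ≤ g
    Q       : ℕ
    Q>N     : 4 * (2 * suc g * (2 * suc d + 3)) < Q
    m-big   : 3 * (Q * (2 * suc g * (2 * suc d + 3)) + 4 * suc g) ≤ m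
    lam kb  : ℕ
  BS : ℕ
  BS = 5 + (lam + 2 * suc d) + (2 * d + d * (2 * suc d))
  field
    room    : kb * BS + 2 + (4 * 2 ^ suc d + (D * (8 * m) + 8 * m + m)) ≤ n
    roomR   : 2 * (222 * m) + (2 * suc d + (kb * BS + 2)) ≤ n
    sizes   : (2 + (kb * (4 + (lam + 2 * suc d)) + 2 * suc d)) + 72 * m ≤ 2 * (kb * (lam + 2 * suc d))
    fewFree : ∀ k → k * g ≤ 8 * (Q * (2 * suc g * (2 * suc d + 3))) * g + 2 * n →
      2 + k ≤ m × (2 + (lam + 2 * suc d)) * (k * (2 * suc d + 2)) + 3 * m < kb * (lam + 2 * suc d)

module Hamilton {n : ℕ} (H : Host n) (x y : Fin n) (x≢y : x ≢ y) where
  open Host H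
  ground : Ground n
  ground = record { Adj = Adj ; Adj-sym = Adj-sym ; m = m ; D = D ; joined = joined ; d = d ; mle = m≤2^d ; 6≤D = 6≤D ; lam = lam }

  frame : Frame n
  frame = record { Adj = Adj ; Adj-sym = Adj-sym ; d = d ; lam = lam ; x = x ; y = y }

  open Build ground using (St; op-conn)

  -- The expansion 2 + D drops to D because `x` and `y` are occupied from the start.
  st₀ : St (x ∷ y ∷ []) []
  st₀ = record { V = V ; uΩ = uniq-∷ (λ { (here e) → x≢y e }) (uniq-∷ (λ ()) []) ; U⊑ = λ _ () }
    where
    V : ∀ X → Unique X → length X ≤ 8 * m → ∀ Y → Cov Adj X (_∉ x ∷ y ∷ []) Y → D * length X ≤ length Y + 0
    V [] u l Y c = ≤-trans (≤-reflexive (*-zeroʳ D)) z≤n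
    V X@(_ ∷ X') u l Y c = ≤-trans (+-cancelˡ-≤ 2 _ _ (≤-trans (+-monoˡ-≤ (D * length X) (≤-trans (m≤m*n 2 (length X)) ≤-refl))
        (≤-trans (≤-reflexive (sym (*-distribʳ-+ (length X) 2 D))) (expands X u l (x ∷ y ∷ Y) cov)))) (≤-reflexive (sym (+-identityʳ (length Y))))
      where
      cov : Cov Adj X (λ _ → ⊤) (x ∷ y ∷ Y)
      cov u w i a _ = case SV._∈?_ w (x ∷ y ∷ []) of λ
        { (yes (here e)) → here e ; (yes (there (here e))) → there (here e) ; (no k) → there (there (c u w i a k)) }

  record Spine : Set where
    field
      {e}  : Fin n
      ch   : Chain Adj d lam x kb e
      zs   : List (Fin n)
      vz   : Via Adj e zs y
      un   : Unique (x ∷ (virts ch ++ zs) ++ y ∷ [])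
      unW  : Unique (wss ch)
      offW : ∀ v → v ∈ x ∷ (virts ch ++ zs) ++ y ∷ [] → v ∉ wss ch
      lz   : length zs ≡ 2 * suc d
      Ω U  : List (Fin n)
      st   : St Ω U
      Ω⊑   : ∀ v → v ∈ Ω → v ∈ (x ∷ (virts ch ++ zs) ++ y ∷ []) ++ wss ch
      ⊑Ω   : ∀ v → v ∈ (x ∷ (virts ch ++ zs) ++ y ∷ []) ++ wss ch → v ∈ Ω
      lΩ   : length Ω ≡ 2 * suc d + (kb * BS + 2)

  spine : DN Spine
  spine = Chains.chain ground kb x st₀ (here refl) (≤-trans (s≤s (s≤s (s≤s (s≤s z≤n)))) 6≤D) room >>=
    λ (e , ch , U₁ , st₁ , ld , e∈ , l₁ , f , g , _ , fr) → op-conn e y st₁ (room' ch l₁) e∈ (∈-++⁺ʳ (occs ch) (there (here refl))) ld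
      (≤-trans (+-monoˡ-≤ 4 (fr y (there (here refl)) (λ k → x≢y (sym k)))) (≤-trans (s≤s (s≤s (s≤s (s≤s z≤n)))) 6≤D)) >>=
    λ (zs , lz , vz , st₂) → return (build ch l₁ g zs lz vz st₂)
    where
    room' : ∀ {e} (ch : Chain Adj d lam x kb e) → length (occs ch) ≡ kb * BS →
      length (occs ch ++ x ∷ y ∷ []) + (4 * 2 ^ suc d + (D * (8 * m) + 8 * m + m)) ≤ n
    room' ch l = ≤-trans (≤-reflexive (cong (_+ (4 * 2 ^ suc d + (D * (8 * m) + 8 * m + m))) (trans (length-++ (occs ch)) (cong (_+ 2) l)))) room
    build : ∀ {e} (ch : Chain Adj d lam x kb e) → length (occs ch) ≡ kb * BS → (∀ v → v ∈ occs ch → v ∈ virts ch ++ wss ch) → ∀ zs →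
      length zs ≡ 2 * suc d → Via Adj e zs y → ∀ {U} → St (zs ++ occs ch ++ x ∷ y ∷ []) U → Spine
    build ch l₁ occs⊑ zs lz vz {U} st = record { ch = ch ; zs = zs ; vz = vz ; un = uniq-++ˡ TL uTW ; unW = uniq-++ʳ TL uTW
        ; offW = λ v i → uniq-disj TL uTW i ; lz = lz ; Ω = Ω ; U = U ; st = st ; Ω⊑ = into ; ⊑Ω = proj₂ both
        ; lΩ = trans (length-++ zs) (cong₂ _+_ lz (trans (length-++ (occs ch)) (cong (_+ 2) l₁))) }
      where
      TL Ω : List (Fin n)
      TL = x ∷ (virts ch ++ zs) ++ y ∷ []
      Ω = zs ++ occs ch ++ x ∷ y ∷ []
      into : ∀ v → v ∈ Ω → v ∈ TL ++ wss ch
      into v i = case ∈-++⁻ zs i of λ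
        { (inj₁ k) → there (∈-++⁺ˡ (∈-++⁺ˡ (∈-++⁺ʳ (virts ch) k)))
        ; (inj₂ k) → (case ∈-++⁻ (occs ch) k of λ
          { (inj₁ j) → (case ∈-++⁻ (virts ch) (occs⊑ v j) of λ { (inj₁ j') → there (∈-++⁺ˡ (∈-++⁺ˡ (∈-++⁺ˡ j'))) ; (inj₂ j') → ∈-++⁺ʳ TL j' })
          ; (inj₂ (here e)) → here e
          ; (inj₂ (there (here e))) → ∈-++⁺ˡ (there (∈-++⁺ʳ (virts ch ++ zs) (here e))) }) }
      ar : ∀ a b c → suc (a + b + 1) + c ≡ b + (a + c + 2)
      ar = solve-∀
      len : length (TL ++ wss ch) ≡ length Ω
      len = trans (length-++ TL) (trans (cong (λ k → suc k + length (wss ch)) (trans (length-++ (virts ch ++ zs)) (cong (_+ 1) (length-++ (virts ch)))))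
        (trans (ar (length (virts ch)) (length zs) (length (wss ch)))
          (sym (trans (length-++ zs) (cong (length zs +_) (trans (length-++ (occs ch)) (cong (_+ 2) (occs-length ch))))))))
      both : Unique (TL ++ wss ch) × (∀ v → v ∈ TL ++ wss ch → v ∈ Ω)
      both = uniq-len (St.uΩ st) into (≤-reflexive len)
      uTW : Unique (TL ++ wss ch)
      uTW = proj₁ both

  module OffSpine (sp : Spine) where
    open Spine sp

    TL : List (Fin n)
    TL = x ∷ (virts ch ++ zs) ++ y ∷ []

    R : Fin n → Set
    R v = v ∉ TL × v ∉ wss ch

    R∉Ω : ∀ v → R v → v ∉ Ω
    R∉Ω v (a , b) i = case ∈-++⁻ TL (Ω⊑ v i) of λ { (inj₁ k) → a k ; (inj₂ k) → b k }

    ∉Ω-R : ∀ v → v ∉ Ω → R v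
    ∉Ω-R v h = (λ i → h (⊑Ω v (∈-++⁺ˡ i))) , λ i → h (⊑Ω v (∈-++⁺ʳ TL i))

    -- The loads sit on occupied vertices only. For sets off the chain the extendability condition
    -- is therefore plain expansion, and its targets are again off the chain.
    exD : ∀ X → Unique X → (∀ v → v ∈ X → R v) → length X ≤ 8 * m → ∀ Y → Cov Adj X R Y → D * length X ≤ length Y
    exD X u r l Y c = ≤-trans (St.V st X u l Y (λ u w i a h → c u w i a (∉Ω-R w h))) (≤-reflexive
      (trans (cong (length Y +_) (cnt-none U X λ v i j → R∉Ω v (r v j) (St.U⊑ st v i))) (+-identityʳ (length Y))))

    parts : SV.Parts (allFin n) Ω
    parts = SV.split (allFin n) Ω

    RL : List (Fin n)
    RL = SV.Parts.outs parts

    uRL : Unique RL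
    uRL = SV.Parts.uouts parts (Uniqueₚ.allFin⁺ n)

    inRL : ∀ v → R v → v ∈ RL
    inRL v r = case SV.Parts.cover parts (∈-allFin v) of λ { (inj₁ k) → ⊥-elim (R∉Ω v r (SV.Parts.ins∈ parts k)) ; (inj₂ k) → k }

    RLin : ∀ v → v ∈ RL → R v
    RLin v i = ∉Ω-R v (SV.Parts.outs∉ parts i)

    |RL|≤n : length RL ≤ n
    |RL|≤n = ≤-trans (pigeon uRL (λ {v} _ → ∈-allFin v)) (≤-reflexive (length-tabulate {n = n} id))

    bigR : 2 * (222 * m) ≤ length RL
    bigR = +-cancelʳ-≤ (2 * suc d + (kb * BS + 2)) _ _ (≤-trans roomR (≤-trans (≤-reflexive (sym (length-tabulate {n = n} id)))
      (≤-trans (SV.outs≥ parts (Uniqueₚ.allFin⁺ n)) (≤-reflexive (trans (cong (_+ length RL) lΩ) (+-comm _ (length RL)))))))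

    l-lls : length (ChainFacts.lls frame ch) ≡ kb * (lam + 2 * suc d)
    l-lls = Segments.lls-length frame ch

    l-TL : length TL ≡ 2 + (kb * (4 + (lam + 2 * suc d)) + 2 * suc d)
    l-TL = trans (cong suc (trans (length-++ (virts ch ++ zs)) (trans (cong (_+ 1) (trans (length-++ (virts ch)) (cong₂ _+_ (Segments.virts-length frame ch) lz)))
      (+-comm _ 1)))) refl

    strand : Strand n
    strand = record { Adj = Adj ; Adj-sym = Adj-sym ; irr = irr ; m = m ; joined = joined ; dl = suc d ; m≤2^d = m≤2^d ; 2^i≤m = 2^i≤m ; d = d ; lam = lam
      ; x = x ; y = y ; ch = ch ; zs = zs ; un = un ; unW = unW ; offW = offW ; vz = vz }

    territory : Territory n
    territory = record { Adj = Adj ; Adj-sym = Adj-sym ; irr = irr ; m = m ; joined = joined ; R = R ; RL = RL ; uRL = uRL ; inRL = inRL ; RLin = RLin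
      ; exR = λ X u r l Y c → ≤-trans (*-monoˡ-≤ (length X) 25≤D) (exD X u r l Y c) ; bigR = bigR
      ; d = suc d ; m≤2^d = m≤2^d ; 2^d≤2m = 2^d≤2m ; 2^i≤m = 2^i≤m ; g = g ; g≥1 = g≥1 }

    finish : ∀ μ F → PM Adj R μ → NSC (λ _ → ⊤) μ → MaxRot.CoverFree Adj Adj-sym irr R (λ _ → ⊤) μ F → MaxRot.Minimal Adj Adj-sym irr R (λ _ → ⊤) (length F) →
      length F * g ≤ 8 * (Q * (2 * suc g * (2 * suc d + 3))) * g + 2 * length RL → DN (Process.HamP frame)
    finish μ F pm ns cv mn few = end (free-parity μ (PM.inv pm) (length (ports RL)) (ports RL) ≤-refl (uniq-ports uRL) closed)
      where
      closed : ∀ z → z ∈ ports RL → μ z ∈ ports RL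
      closed z i = case μ z ≟P z of λ { (yes e) → subst (_∈ ports RL) (sym e) i ; (no ne) → ∈-ports (μ z) (inRL _ (PM.domμ pm z ne)) }
      end : (Σ (List (Port n)) λ F → Unique F × (∀ z → z ∈ ports RL → μ z ≡ z → z ∈ F) × (∀ z → z ∈ F → μ z ≡ z × z ∈ ports RL) ×
        Σ ℕ λ k → length (ports RL) ≡ length F + 2 * k) → DN (Process.HamP frame)
      end (F' , uF , f , h , kk , eq) = Weave.WithR.weave strand
          (λ X u r l Y c → ≤-trans (*-monoˡ-≤ (length X) 6≤D) (exD X u r (≤-trans l (m≤n*m m 8)) Y c))
          (≤-trans (≤-reflexive (cong (_+ 72 * m) l-TL)) (≤-trans sizes (≤-reflexive (cong (2 *_) (sym l-lls)))))
          (length F') (proj₁ cond) (≤-trans (proj₂ cond) (≤-reflexive (sym l-lls)))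
          (λ μ' G p n' c → ≤-trans F'≤F (mn μ' G p n' c))
          μ pm ns F' uF (λ z r e → f z (∈-ports z (inRL _ r)) e) (λ z i → proj₁ (h z i) , RLin _ (∈-ports⁻ (proj₂ (h z i)))) refl (length RL ∸ kk) even
        where
        F'≤F : length F' ≤ length F
        F'≤F = pigeon uF λ {z} i → cv z (RLin _ (∈-ports⁻ (proj₂ (h z i)))) (proj₁ (h z i))
        cond : 2 + length F' ≤ m × (2 + (lam + 2 * suc d)) * (length F' * (2 * suc d + 2)) + 3 * m < kb * (lam + 2 * suc d)
        cond = fewFree (length F') (≤-trans (*-monoˡ-≤ g F'≤F) (≤-trans few (+-monoʳ-≤ (8 * (Q * (2 * suc g * (2 * suc d + 3))) * g) (*-monoʳ-≤ 2 |RL|≤n))))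
        -- From 2|RL| = |F'| + 2·kk, where kk is the number of matched pairs of ports.
        even : length F' ≡ 2 * (length RL ∸ kk)
        even = trans (sym (m+n∸n≡m (length F') (2 * kk))) (trans (cong (_∸ 2 * kk) (trans (sym eq) (ports-length RL))) (sym (*-distribˡ-∸ 2 (length RL) kk)))

    ham : DN (Process.HamP frame)
    ham = Cover.path-cover territory Q Q>N m-big >>= λ (μ , F , pm , ns , cv , mn , few) → finish μ F pm ns cv mn few

  hamilton-path : DN (Process.HamP frame)
  hamilton-path = spine >>= λ sp → OffSpine.ham sp


-- Numerical constants

log₂-bounds : ∀ m → 1 ≤ m → Σ ℕ λ d → m ≤ 2 ^ d × 2 ^ d ≤ 2 * m
log₂-bounds (suc zero) _ = 0 , ≤-refl , s≤s z≤n
log₂-bounds (suc (suc m)) _ with log₂-bounds (suc m) (s≤s z≤n)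
... | d , lo , hi with suc (suc m) ≤? 2 ^ d
... | yes le = d , le , ≤-trans hi (*-monoʳ-≤ 2 (n≤1+n (suc m)))
... | no gt = suc d , ≤-trans (+-mono-≤ {1} {2 ^ d} (m^n>0 2 d) lo) (≤-reflexive (cong (2 ^ d +_) (sym (+-identityʳ _)))) , *-monoʳ-≤ 2 (<⇒≤ (≰⇒> gt))

suc≤2^ : ∀ t → suc t ≤ 2 ^ t
suc≤2^ zero = ≤-refl
suc≤2^ (suc t) = ≤-trans (+-mono-≤ {1} {2 ^ t} (m^n>0 2 t) (suc≤2^ t)) (≤-reflexive (cong (2 ^ t +_) (sym (+-identityʳ _))))

2^-collect : ∀ a b c → 2 ^ a * (2 ^ b) ^ c ≡ 2 ^ (a + b * c)
2^-collect a b c = trans (cong (2 ^ a *_) (^-*-assoc 2 b c)) (sym (^-distribˡ-+-* 2 a (b * c)))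

-- With t = ⌊s/16⌋ one has s ≤ 16 · 2^t, so s¹¹ ≤ 2^(44 + 11t), while s ≥ 16t and t ≥ 32.
poly≤exp : ∀ a s → a + 44 ≤ 32 * 5 → 512 ≤ s → 2 ^ a * s ^ 11 ≤ 2 ^ s
poly≤exp a s small big = ≤-trans (*-monoʳ-≤ (2 ^ a) (^-monoˡ-≤ 11 s≤)) (≤-trans (≤-reflexive (2^-collect a (t + 4) 11))
    (^-monoʳ-≤ 2 (≤-trans fits (≤-trans (m≤n+m (t * 16) (s % 16)) (≤-reflexive (sym (m≡m%n+[m/n]*n s 16)))))))
  where
  t : ℕ
  t = s / 16
  t≥ : 32 ≤ t
  t≥ = /-monoˡ-≤ 16 big
  s≤ : s ≤ 2 ^ (t + 4)
  s≤ = ≤-trans (≤-reflexive (m≡m%n+[m/n]*n s 16)) (≤-trans (+-monoˡ-≤ (t * 16) (<⇒≤ (m%n<n s 16)))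
    (≤-trans (*-monoˡ-≤ 16 (suc≤2^ t)) (≤-reflexive (sym (^-distribˡ-+-* 2 t 4)))))
  ar : ∀ a t → a + (t + 4) * 11 ≡ a + 44 + t * 11
  ar = solve-∀
  ar' : ∀ t → t * 5 + t * 11 ≡ t * 16
  ar' = solve-∀
  fits : a + (t + 4) * 11 ≤ t * 16
  fits = ≤-trans (≤-reflexive (ar a t)) (≤-trans (+-monoˡ-≤ (t * 11) (≤-trans small (*-monoˡ-≤ 5 t≥))) (≤-reflexive (ar' t)))

module Constants (d m n : ℕ) (big : 512 ≤ suc d) (hi : 2 ^ suc d ≤ 2 * m) (n-lo : 1000 * m ≤ n) (n-hi : n ≤ 2000 * m) where
  s q g N₁ Q lam kb L : ℕ
  s = suc d
  q = s * s
  -- The factor 12s³ is the cost of one end: (2 + L)(2s + 2) ≤ 4s²·3s. The factor 8000 absorbs the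
  -- term 2n ≤ 4000m.
  g = 8000 * 12 * s ^ 3
  N₁ = 2 * suc g * (2 * s + 3)
  Q = suc (4 * N₁)
  lam = 2 * q
  -- Since `lam` is 2q, the long paths have together about 80m vertices, and at least 78m after
  -- rounding; a whole gadget has at most 5q vertices, so all of them fit into 200m.
  kb = (40 * m) / q
  L = lam + 2 * s

  mono : ∀ {a b i j} → a ≤ b → i ≤ j → 2 ^ a * s ^ i ≤ 2 ^ b * s ^ j
  mono le le' = *-mono-≤ (^-monoʳ-≤ 2 le) (^-monoʳ-≤ s le')

  times : ∀ a b i j → (2 ^ a * s ^ i) * (2 ^ b * s ^ j) ≡ 2 ^ (a + b) * s ^ (i + j)
  times a b i j = trans (ar (2 ^ a) (s ^ i) (2 ^ b) (s ^ j)) (sym (cong₂ _*_ (^-distribˡ-+-* 2 a b) (^-distribˡ-+-* s i j)))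
    where ar : ∀ a x b y → (a * x) * (b * y) ≡ (a * b) * (x * y)
          ar = solve-∀

  scale : ∀ a b i → 2 ^ a * (2 ^ b * s ^ i) ≡ 2 ^ (a + b) * s ^ i
  scale a b i = trans (sym (*-assoc (2 ^ a) (2 ^ b) (s ^ i))) (cong (_* s ^ i) (sym (^-distribˡ-+-* 2 a b)))

  s≥ : ∀ {c} → c ≤ 512 → c ≤ s
  s≥ le = ≤-trans le big

  sq≥ : ∀ c → c ≤ 512 → c * s ≤ q
  sq≥ c le = *-monoˡ-≤ s (s≥ le)

  -- The exponent 11 is 3 + 8: the largest quantity to be kept below `m` is 96s³·Q·N₁, where `N₁`
  -- and `Q` both have order s⁴.
  top : 2 ^ 50 * s ^ 11 ≤ m
  top = *-cancelˡ-≤ 2 (≤-trans (≤-reflexive (scale 1 50 11)) (≤-trans (poly≤exp 51 s (≤ᵇ⇒≤ 95 160 tt) big) hi))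

  q≤m : q ≤ m
  q≤m = ≤-trans (≤-reflexive (trans (cong (s *_) (sym (*-identityʳ s))) (sym (*-identityˡ (s ^ 2))))) (≤-trans (mono {0} {50} {2} {11} z≤n (s≤s (s≤s z≤n))) top)

  160≤q : 160 ≤ q
  160≤q = ≤-trans (m≤m*n 160 s) (sq≥ 160 (≤ᵇ⇒≤ 160 512 tt))

  2+2s≤m : 2 + 2 * s ≤ m
  2+2s≤m = ≤-trans (+-monoˡ-≤ (2 * s) (m≤m*n 2 s)) (≤-trans (≤-reflexive (sym (*-distribʳ-+ s 2 2))) (≤-trans (sq≥ 4 (≤ᵇ⇒≤ 4 512 tt)) q≤m))

  sg≤ : suc g ≤ 2 ^ 17 * s ^ 3
  sg≤ = ≤-trans (+-monoˡ-≤ g (m^n>0 s 3)) (*-monoˡ-≤ (s ^ 3) {suc (8000 * 12)} {2 ^ 17} (≤ᵇ⇒≤ (suc (8000 * 12)) (2 ^ 17) tt))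

  N₁≤ : N₁ ≤ 2 ^ 20 * s ^ 4
  N₁≤ = ≤-trans (*-mono-≤ (≤-trans (*-monoʳ-≤ 2 sg≤) (≤-reflexive (scale 1 17 3))) lin) (≤-reflexive (times 18 2 3 1))
    where
    lin : 2 * s + 3 ≤ 2 ^ 2 * s ^ 1
    lin = ≤-trans (+-monoʳ-≤ (2 * s) (≤-trans (s≥ (≤ᵇ⇒≤ 3 512 tt)) (m≤n*m s 2))) (≤-reflexive (trans (sym (*-distribʳ-+ s 2 2)) (cong (4 *_) (sym (*-identityʳ s)))))

  Q≤ : Q ≤ 2 ^ 23 * s ^ 4
  Q≤ = ≤-trans (+-mono-≤ (*-mono-≤ (m^n>0 2 20) (m^n>0 s 4)) (*-monoʳ-≤ 4 N₁≤)) (≤-trans (*-monoˡ-≤ (2 ^ 20 * s ^ 4) {5} {8} (≤ᵇ⇒≤ 5 8 tt)) (≤-reflexive (scale 3 20 4)))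

  QN≤ : Q * N₁ ≤ 2 ^ 43 * s ^ 8
  QN≤ = ≤-trans (*-mono-≤ Q≤ N₁≤) (≤-reflexive (times 23 20 4 4))

  m-big : 3 * (Q * N₁ + 4 * suc g) ≤ m
  m-big = ≤-trans (*-monoʳ-≤ 3 (+-mono-≤ QN≤ (≤-trans (*-monoʳ-≤ 4 sg≤) (≤-trans (≤-reflexive (scale 2 17 3)) (mono {19} {43} {3} {8} (≤ᵇ⇒≤ 19 43 tt) (≤ᵇ⇒≤ 3 8 tt))))))
    (≤-trans (≤-reflexive (ar (2 ^ 43 * s ^ 8))) (≤-trans (*-monoˡ-≤ (2 ^ 43 * s ^ 8) {6} {8} (≤ᵇ⇒≤ 6 8 tt)) (≤-trans (≤-reflexive (scale 3 43 8)) (≤-trans (mono {46} {50} {8} {11} (≤ᵇ⇒≤ 46 50 tt) (≤ᵇ⇒≤ 8 11 tt)) top))))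
    where ar : ∀ x → 3 * (x + x) ≡ 6 * x
          ar = solve-∀

  kbq-hi : kb * q ≤ 40 * m
  kbq-hi = m/n*n≤m (40 * m) q

  kbq-lo : 39 * m ≤ kb * q
  kbq-lo = +-cancelˡ-≤ m _ _ (≤-trans (≤-reflexive (m≡m%n+[m/n]*n (40 * m) q)) (+-monoˡ-≤ (kb * q) (≤-trans (<⇒≤ (m%n<n (40 * m) q)) q≤m)))

  LL-lo : 78 * m ≤ kb * L
  LL-lo = ≤-trans (≤-reflexive (*-assoc 2 39 m)) (≤-trans (*-monoʳ-≤ 2 kbq-lo) (≤-trans (≤-reflexive (ar kb q)) (*-monoʳ-≤ kb (m≤m+n lam (2 * s)))))
    where ar : ∀ k q → 2 * (k * q) ≡ k * (2 * q)
          ar = solve-∀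

  -- Outside the long paths the chain with virtual edges has only 4`kb` + 2 + 2s vertices, at most
  -- 2m, so 74m vertices on the long paths would suffice.
  sizes : (2 + (kb * (4 + L) + 2 * s)) + 72 * m ≤ 2 * (kb * L)
  sizes = ≤-trans (≤-reflexive (ar kb L s (72 * m))) (≤-trans (+-monoʳ-≤ (kb * L) (≤-trans (+-mono-≤ (+-mono-≤ 4kb≤m 2+2s≤m) (≤-refl {72 * m}))
      (≤-trans (≤-trans (≤-reflexive (ar' m)) (*-monoˡ-≤ m {74} {78} (≤ᵇ⇒≤ 74 78 tt))) LL-lo))) (≤-reflexive (cong (kb * L +_) (sym (+-identityʳ (kb * L))))))
    where
    4kb≤m : kb * 4 ≤ m
    4kb≤m = *-cancelˡ-≤ 40 (≤-trans (≤-reflexive (ar₂ kb)) (≤-trans (*-monoʳ-≤ kb 160≤q) kbq-hi))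
      where ar₂ : ∀ k → 40 * (k * 4) ≡ k * 160
            ar₂ = solve-∀
    ar : ∀ k L s t → (2 + (k * (4 + L) + 2 * s)) + t ≡ k * L + ((k * 4 + (2 + 2 * s)) + t)
    ar = solve-∀
    ar' : ∀ m → m + m + 72 * m ≡ 74 * m
    ar' = solve-∀

  BS : ℕ
  BS = 5 + L + (2 * d + d * (2 * s))

  kbBS≤ : kb * BS ≤ 200 * m
  kbBS≤ = ≤-trans (*-monoʳ-≤ kb BS≤) (≤-trans (≤-reflexive (ar kb q)) (≤-trans (*-monoʳ-≤ 5 kbq-hi) (≤-reflexive (sym (*-assoc 5 40 m)))))
    where
    ar : ∀ k q → k * (5 * q) ≡ 5 * (k * q)
    ar = solve-∀
    ar' : ∀ s → 5 + (2 * (s * s) + 2 * s) + (2 * s + s * (2 * s)) ≡ (4 * s + 5) + 4 * (s * s)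
    ar' = solve-∀
    BS≤ : BS ≤ 5 * q
    BS≤ = ≤-trans (+-monoʳ-≤ (5 + L) (+-mono-≤ (*-monoʳ-≤ 2 (n≤1+n d)) (*-monoˡ-≤ (2 * s) (n≤1+n d)))) (≤-trans (≤-reflexive (ar' s))
      (+-monoˡ-≤ (4 * q) (≤-trans (+-monoʳ-≤ (4 * s) (m≤m*n 5 s)) (≤-trans (≤-reflexive (sym (*-distribʳ-+ s 4 5))) (sq≥ 9 (≤ᵇ⇒≤ 9 512 tt))))))

  room : kb * BS + 2 + (4 * 2 ^ s + (25 * (8 * m) + 8 * m + m)) ≤ n
  room = ≤-trans (+-mono-≤ (+-mono-≤ kbBS≤ (≤-trans (m≤m+n 2 (2 * s)) 2+2s≤m)) (+-monoˡ-≤ (25 * (8 * m) + 8 * m + m) (*-monoʳ-≤ 4 hi)))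
      (≤-trans (≤-reflexive (ar m)) (≤-trans (*-monoˡ-≤ m {418} {1000} (≤ᵇ⇒≤ 418 1000 tt)) n-lo))
    where ar : ∀ m → 200 * m + m + (4 * (2 * m) + (25 * (8 * m) + 8 * m + m)) ≡ 418 * m
          ar = solve-∀

  roomR : 2 * (222 * m) + (2 * s + (kb * BS + 2)) ≤ n
  roomR = ≤-trans (≤-reflexive (ar (2 * (222 * m)) (2 * s) (kb * BS))) (≤-trans (+-mono-≤ (+-monoʳ-≤ (2 * (222 * m)) kbBS≤) 2+2s≤m)
      (≤-trans (≤-reflexive (ar' m)) (≤-trans (*-monoˡ-≤ m {645} {1000} (≤ᵇ⇒≤ 645 1000 tt)) n-lo)))
    where
    ar : ∀ a b c → a + (b + (c + 2)) ≡ a + c + (2 + b)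
    ar = solve-∀
    ar' : ∀ m → 2 * (222 * m) + 200 * m + m ≡ 645 * m
    ar' = solve-∀

  -- Division of the hypothesis by 8000 gives 12s³k ≤ 96s³QN₁ + m ≤ 2m, and 12s³k bounds the
  -- vertices on all the segments that can be touched.
  fewFree : ∀ k → k * g ≤ 8 * (Q * N₁) * g + 2 * n → 2 + k ≤ m × (2 + L) * (k * (2 * s + 2)) + 3 * m < kb * L
  fewFree k le = *-cancelˡ-≤ 6 six , ≤-trans (s≤s (≤-trans (+-monoˡ-≤ (3 * m) (≤-trans expand 12s³k≤2m)) (≤-reflexive (sym (*-distribʳ-+ m 2 3)))))
      (≤-trans (+-monoˡ-≤ (5 * m) (≤-trans (s≤s z≤n) 2+2s≤m)) (≤-trans (*-monoˡ-≤ m {6} {78} (≤ᵇ⇒≤ 6 78 tt)) LL-lo))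
    where
    ar₁ : ∀ a b c k → a * ((b * c) * k) ≡ k * (a * b * c)
    ar₁ = solve-∀
    ar₂ : ∀ a b c e X t → e * X * (a * b * c) + a * t ≡ a * (e * (b * c) * X + t)
    ar₂ = solve-∀
    12s³k≤2m : 12 * s ^ 3 * k ≤ 2 * m
    12s³k≤2m = ≤-trans (*-cancelˡ-≤ 8000 (≤-trans (≤-reflexive (ar₁ 8000 12 (s ^ 3) k)) (≤-trans le (≤-trans (+-monoʳ-≤ (8 * (Q * N₁) * g)
        (≤-trans (*-monoʳ-≤ 2 n-hi) (≤-trans (≤-reflexive (sym (*-assoc 2 2000 m))) (*-monoˡ-≤ m {4000} {8000} (≤ᵇ⇒≤ 4000 8000 tt)))))
        (≤-reflexive (ar₂ 8000 12 (s ^ 3) 8 (Q * N₁) m))))))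
      (≤-trans (+-monoˡ-≤ m (≤-trans (*-mono-≤ (≤-trans (≤-reflexive (sym (*-assoc 8 12 (s ^ 3)))) (*-monoˡ-≤ (s ^ 3) {96} {2 ^ 7} (≤ᵇ⇒≤ 96 (2 ^ 7) tt))) QN≤)
        (≤-trans (≤-reflexive (times 7 43 3 8)) top))) (≤-reflexive (cong (m +_) (sym (+-identityʳ m)))))
    ar₃ : ∀ s k → (4 * (s * s)) * (k * (3 * s)) ≡ 12 * (s * (s * (s * 1))) * k
    ar₃ = solve-∀
    quad : 2 + L ≤ 4 * q
    quad = ≤-trans (≤-reflexive (ar₄ lam (2 * s))) (≤-trans (+-monoʳ-≤ lam (≤-trans (+-monoˡ-≤ (2 * s) (m≤m*n 2 s)) (≤-trans (≤-reflexive (sym (*-distribʳ-+ s 2 2)))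
        (≤-trans (sq≥ 4 (≤ᵇ⇒≤ 4 512 tt)) (m≤n*m q 2))))) (≤-reflexive (sym (*-distribʳ-+ q 2 2))))
      where ar₄ : ∀ a b → 2 + (a + b) ≡ a + (2 + b)
            ar₄ = solve-∀
    lin : 2 * s + 2 ≤ 3 * s
    lin = ≤-trans (+-monoʳ-≤ (2 * s) (s≥ (≤ᵇ⇒≤ 2 512 tt))) (≤-reflexive (+-comm (2 * s) s))
    expand : (2 + L) * (k * (2 * s + 2)) ≤ 12 * s ^ 3 * k
    expand = ≤-trans (*-mono-≤ quad (*-monoʳ-≤ k lin)) (≤-reflexive (ar₃ s k))
    six : 6 * (2 + k) ≤ 6 * m
    six = ≤-trans (≤-reflexive (*-distribˡ-+ 6 2 k)) (≤-trans (+-mono-≤ (≤-trans (≤-trans (≤ᵇ⇒≤ 12 160 tt) 160≤q) q≤m)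
        (≤-trans (*-monoˡ-≤ k {6} {12 * s ^ 3} (≤-trans (≤ᵇ⇒≤ 6 12 tt) (*-monoʳ-≤ 12 {1} {s ^ 3} (m^n>0 s 3)))) 12s³k≤2m)) (*-monoˡ-≤ m {3} {6} (≤ᵇ⇒≤ 3 6 tt)))


-- Subsets as duplicate-free lists, and the expander hypotheses in that form

open import Defs using (Graph; adj; symm; irrefl; N; anyFin; ℕtoℚ; two; IsExpander; HamiltonPath; HamiltonConnected)
import Data.Bool as Bool
import Data.Bool.Properties as Boolₚ
open import Data.Fin.Subset using (Subset; ∣_∣)
import Data.Integer as ℤ
import Data.Integer.Properties as ℤₚ
import Data.List.Relation.Unary.AllPairs as AllPairs
import Data.List.Relation.Unary.Linked as Linked
open import Data.List.Relation.Unary.Linked.Properties using (AllPairs⇒Linked)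
import Data.Maybe.Properties as Maybeₚ
open import Data.Nat.Coprimality using (1-coprimeTo) renaming (sym to coprime-sym)
open import Data.Rational using (ℚ; 0ℚ; mkℚ)
import Data.Rational as ℚ
import Data.Rational.Properties as ℚₚ
import Data.Vec as Vec
import Data.Vec.Properties as Vecₚ
open import Relation.Nullary.Decidable using (does; map′; _×-dec_; ¬?)

elems : ∀ {n} → Subset n → List (Fin n)
elems Vec.[] = []
elems (true Vec.∷ S) = Fin.zero ∷ map Fin.suc (elems S)
elems (false Vec.∷ S) = map Fin.suc (elems S)

elems-length : ∀ {n} (S : Subset n) → length (elems S) ≡ ∣ S ∣
elems-length Vec.[] = refl
elems-length (true Vec.∷ S) = cong suc (trans (length-map Fin.suc (elems S)) (elems-length S))
elems-length (false Vec.∷ S) = trans (length-map Fin.suc (elems S)) (elems-length S)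

elems-∈ : ∀ {n} (S : Subset n) {v} → v ∈ elems S → Vec.lookup S v ≡ true
elems-∈ (true Vec.∷ S) (here refl) = refl
elems-∈ (true Vec.∷ S) (there i) with ∈-map⁻ Fin.suc i
... | _ , j , refl = elems-∈ S j
elems-∈ (false Vec.∷ S) i with ∈-map⁻ Fin.suc i
... | _ , j , refl = elems-∈ S j

∈-elems : ∀ {n} (S : Subset n) {v} → Vec.lookup S v ≡ true → v ∈ elems S
∈-elems (true Vec.∷ S) {Fin.zero} e = here refl
∈-elems (true Vec.∷ S) {Fin.suc v} e = there (∈-map⁺ Fin.suc (∈-elems S e))
∈-elems (false Vec.∷ S) {Fin.suc v} e = ∈-map⁺ Fin.suc (∈-elems S e)

elems-unique : ∀ {n} (S : Subset n) → Unique (elems S)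
elems-unique Vec.[] = []
elems-unique (true Vec.∷ S) = uniq-∷ (λ i → case ∈-map⁻ Fin.suc i of λ { (_ , _ , ()) }) (Uniqueₚ.map⁺ Finₚ.suc-injective (elems-unique S))
elems-unique (false Vec.∷ S) = Uniqueₚ.map⁺ Finₚ.suc-injective (elems-unique S)

ofList : ∀ {n} → List (Fin n) → Subset n
ofList X = Vec.tabulate λ v → does (SV._∈?_ v X)

ofList-∈ : ∀ {n} {X : List (Fin n)} {v} → Vec.lookup (ofList X) v ≡ true → v ∈ X
ofList-∈ {X = X} {v} e = go (SV._∈?_ v X) (trans (sym (Vecₚ.lookup∘tabulate _ v)) e)
  where go : ∀ {A : Set} (d : Dec A) → does d ≡ true → A
        go (yes a) _ = a

∈-ofList : ∀ {n} {X : List (Fin n)} {v} → v ∈ X → Vec.lookup (ofList X) v ≡ true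
∈-ofList {X = X} {v} i = trans (Vecₚ.lookup∘tabulate _ v) (go (SV._∈?_ v X))
  where go : (d : Dec (v ∈ X)) → does d ≡ true
        go (yes _) = refl
        go (no k) = ⊥-elim (k i)

ofList-size : ∀ {n} {X : List (Fin n)} → Unique X → ∣ ofList X ∣ ≡ length X
ofList-size {X = X} u = trans (sym (elems-length (ofList X))) (≤-antisym (pigeon {ys = X} (elems-unique (ofList X)) λ i → ofList-∈ {X = X} (elems-∈ (ofList X) i))
  (pigeon {ys = elems (ofList X)} u λ i → ∈-elems (ofList X) (∈-ofList {X = X} i)))

anyFin-∃ : ∀ {n} (f : Fin n → Bool) → anyFin f ≡ true → Σ (Fin n) λ u → f u ≡ true
anyFin-∃ {suc n} f e with f Fin.zero in eq
... | true = Fin.zero , eq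
... | false = let (u , h) = anyFin-∃ (f ∘ Fin.suc) e in Fin.suc u , h

∧-true : ∀ {a b} → (a Bool.∧ b) ≡ true → a ≡ true × b ≡ true
∧-true {true} {true} _ = refl , refl

N-∈ : ∀ {n} (G : Graph n) (X : List (Fin n)) {v} → v ∈ elems (N G (ofList X)) → Σ (Fin n) λ u → u ∈ X × adj G u v ≡ true
N-∈ G X {v} i =
  let (u , h) = anyFin-∃ _ (proj₂ (∧-true {not (Vec.lookup (ofList X) v)} (trans (sym (Vecₚ.lookup∘tabulate _ v)) (elems-∈ (N G (ofList X)) i))))
      (a , b) = ∧-true {Vec.lookup (ofList X) u} h
  in u , ofList-∈ {X = X} a , b

-- Natural numbers inside the rationals

ι≡ : ∀ k → ℕtoℚ k ≡ mkℚ (ℤ.+ k) 0 (coprime-sym (1-coprimeTo k))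
ι≡ k = ℚₚ.normalize-coprime (coprime-sym (1-coprimeTo k))

ι-mono-≤ : ∀ {a b} → a ≤ b → ℕtoℚ a ℚ.≤ ℕtoℚ b
ι-mono-≤ {a} {b} le = subst₂ ℚ._≤_ (sym (ι≡ a)) (sym (ι≡ b)) (ℚ.*≤* (subst₂ ℤ._≤_ (sym (ℤₚ.*-identityʳ (ℤ.+ a))) (sym (ℤₚ.*-identityʳ (ℤ.+ b))) (ℤ.+≤+ le)))

ι-cancel-≤ : ∀ {a b} → ℕtoℚ a ℚ.≤ ℕtoℚ b → a ≤ b
ι-cancel-≤ {a} {b} le = ℤₚ.drop‿+≤+ (subst₂ ℤ._≤_ (ℤₚ.*-identityʳ (ℤ.+ a)) (ℤₚ.*-identityʳ (ℤ.+ b)) (ℚₚ.drop-*≤* (subst₂ ℚ._≤_ (ι≡ a) (ι≡ b) le)))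

ι-* : ∀ a b → ℕtoℚ a ℚ.* ℕtoℚ b ≡ ℕtoℚ (a * b)
ι-* a b = trans (cong₂ ℚ._*_ (ι≡ a) (ι≡ b)) (cong (ℚ._/ 1) (sym (ℤₚ.pos-* a b)))

ι-nonNeg : ∀ a → ℚ.NonNegative (ℕtoℚ a)
ι-nonNeg a = ℚ.nonNegative (ι-mono-≤ {0} {a} z≤n)

module Scaled (c : ℕ) (C : ℚ) (c≤C : ℕtoℚ c ℚ.≤ C) where
  ι-scale : ∀ k → ℕtoℚ (c * k) ℚ.≤ C ℚ.* ℕtoℚ k
  ι-scale k = subst (ℚ._≤ C ℚ.* ℕtoℚ k) (ι-* c k) (ℚₚ.*-monoʳ-≤-nonNeg (ℕtoℚ k) {{ι-nonNeg k}} c≤C)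

  ι-scale₂ : ∀ k → ℕtoℚ (2 * (c * k)) ℚ.≤ two ℚ.* C ℚ.* ℕtoℚ k
  ι-scale₂ k = subst₂ ℚ._≤_ (ι-* 2 (c * k)) (sym (ℚₚ.*-assoc two C (ℕtoℚ k))) (ℚₚ.*-monoˡ-≤-nonNeg two {{ι-nonNeg 2}} (ι-scale k))

  C-nonNeg : ℚ.NonNegative C
  C-nonNeg = ℚ.nonNegative (ℚₚ.≤-trans (ι-mono-≤ {0} {c} z≤n) c≤C)

  mono₂ : ∀ {k l} → k ≤ l → two ℚ.* C ℚ.* ℕtoℚ k ℚ.≤ two ℚ.* C ℚ.* ℕtoℚ l
  mono₂ {k} {l} le = subst₂ ℚ._≤_ (sym (ℚₚ.*-assoc two C (ℕtoℚ k))) (sym (ℚₚ.*-assoc two C (ℕtoℚ l)))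
    (ℚₚ.*-monoˡ-≤-nonNeg two {{ι-nonNeg 2}} (ℚₚ.*-monoˡ-≤-nonNeg C {{C-nonNeg}} (ι-mono-≤ le)))

-- A finite search makes the double negation removable.
search : ∀ {n} k {P : List (Fin n) → Set} → (∀ l → Dec (P l)) → Dec (Σ (List (Fin n)) λ l → length l ≡ k × P l)
search zero P? = map′ (λ p → [] , refl , p) (λ { ([] , _ , p) → p }) (P? [])
search (suc k) P? = map′ (λ (v , l , e , p) → v ∷ l , cong suc e , p) (λ { (v ∷ l , e , p) → v , l , suc-injective e , p })
  (Finₚ.any? λ v → search k λ l → P? (v ∷ l))

last-snoc : ∀ {A : Set} (xs : List A) {y} → last (xs ++ y ∷ []) ≡ just y
last-snoc [] = refl
last-snoc (x ∷ []) = refl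
last-snoc (x ∷ x' ∷ xs) = last-snoc (x' ∷ xs)

quotient-≥ : ∀ e {n} → e * 1000 ≤ n → e ≤ n / 1000
quotient-≥ e le = ≤-trans (≤-reflexive (sym (m*n/n≡m e 1000))) (/-monoˡ-≤ 1000 le)

exponent-≥ : ∀ e {s} → 2 ^ e ≤ 2 ^ s → e ≤ s
exponent-≥ e le = ≮⇒≥ λ lt → <⇒≱ (^-monoʳ-< 2 (s≤s (s≤s z≤n)) lt) le

-- From the expander hypotheses to the combinatorial ones

module Expander (t c : ℕ) (512≤t : 512 ≤ t) (c-big : 2 ^ t * 1000 ≤ c) (1000≤c : 1000 ≤ c) (C : ℚ) (c≤C : ℕtoℚ c ℚ.≤ C) {n : ℕ} (G : Graph n) (ex : IsExpander C G) (x y : Fin n) (x≢y : x ≢ y) where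
  open Scaled c C c≤C

  Adj : Fin n → Fin n → Set
  Adj u v = adj G u v ≡ true

  Adj-sym : ∀ {u v} → Adj u v → Adj v u
  Adj-sym {u} {v} a = trans (symm G v u) a

  irr : ∀ {v} → ¬ Adj v v
  irr {v} a = case trans (sym a) (irrefl G v) of λ ()

  edge : ∀ X Y → Unique X → Unique Y → (∀ v → v ∈ X → v ∉ Y) → ℕtoℚ n ℚ.≤ two ℚ.* C ℚ.* ℕtoℚ (length X) → ℕtoℚ n ℚ.≤ two ℚ.* C ℚ.* ℕtoℚ (length Y) →
    Σ (Fin n) λ u → Σ (Fin n) λ v → u ∈ X × v ∈ Y × Adj u v
  edge X Y uX uY dj bX bY = let (u , v , i , j , a) = IsExpander.connected ex (ofList X) (ofList Y)
                                  (λ v i j → dj v (ofList-∈ {X = X} (Vecₚ.[]=⇒lookup i)) (ofList-∈ {X = Y} (Vecₚ.[]=⇒lookup j)))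
                                  (subst (λ k → ℕtoℚ n ℚ.≤ two ℚ.* C ℚ.* ℕtoℚ k) (sym (ofList-size uX)) bX)
                                  (subst (λ k → ℕtoℚ n ℚ.≤ two ℚ.* C ℚ.* ℕtoℚ k) (sym (ofList-size uY)) bY)
                            in u , v , ofList-∈ {X = X} (Vecₚ.[]=⇒lookup i) , ofList-∈ {X = Y} (Vecₚ.[]=⇒lookup j) , a

  Good : List (Fin n) → Set
  Good l = Unique l × (∀ v → v ∈ l) × head l ≡ just x × last l ≡ just y × Linked Adj l

  good? : ∀ l → Dec (Good l)
  good? l = AllPairs.allPairs? (λ u v → ¬? (u Finₚ.≟ v)) l ×-dec Finₚ.all? (λ v → SV._∈?_ v l) ×-dec Maybeₚ.≡-dec Finₚ._≟_ (head l) (just x)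
    ×-dec Maybeₚ.≡-dec Finₚ._≟_ (last l) (just y) ×-dec Linked.linked? (λ u v → adj G u v Boolₚ.≟ true) l

  pack : Σ (List (Fin n)) Good → HamiltonPath G x y
  pack (l , u , s , h , e , k) = record { path = l ; unique = u ; spanning = s ; starts = h ; ends = e ; edges = k }

  recover : DN (Σ (List (Fin n)) Good) → HamiltonPath G x y
  -- A duplicate-free list of all vertices has length exactly n, so it suffices to search lists of
  -- that length.
  recover h = let (l , _ , p) = dn-stable (search n good?) (h >>= λ (l , p) → return (l
                    , ≤-antisym (≤-trans (pigeon (proj₁ p) (λ {v} _ → ∈-allFin v)) (≤-reflexive (length-tabulate {n = n} id)))
                        (≤-trans (≤-reflexive (sym (length-tabulate {n = n} id))) (pigeon (Uniqueₚ.allFin⁺ n) (λ {v} _ → proj₁ (proj₂ p) v))) , p))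
              in pack (l , p)

  complete : ℕtoℚ n ℚ.≤ two ℚ.* C ℚ.* ℕtoℚ 1 → HamiltonPath G x y
  complete small = pack (x ∷ outs ++ y ∷ [] , u , span , refl , last-snoc (x ∷ outs) , AllPairs⇒Linked (AllPairs.map adjacent u))
    where
    open SV.Parts (SV.split (allFin n) (x ∷ y ∷ []))
    adjacent : ∀ {u v} → u ≢ v → Adj u v
    adjacent {u} {v} ne = case edge (u ∷ []) (v ∷ []) (uniq-∷ (λ ()) []) (uniq-∷ (λ ()) []) (λ { _ (here refl) (here e) → ne e }) small small of λ
      { (_ , _ , here refl , here refl , a) → a }
    u : Unique (x ∷ outs ++ y ∷ [])
    u = uniq-∷ (λ i → case ∈-++⁻ outs i of λ { (inj₁ j) → outs∉ j (here refl) ; (inj₂ (here e)) → x≢y e })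
          (uniq-++ (uouts (Uniqueₚ.allFin⁺ n)) (uniq-∷ (λ ()) []) λ { i (here refl) → outs∉ i (there (here refl)) })
    span : ∀ v → v ∈ x ∷ outs ++ y ∷ []
    span v = case cover (∈-allFin v) of λ
      { (inj₁ i) → (case ins∈ i of λ { (here e) → here e ; (there (here e)) → there (∈-++⁺ʳ outs (here e)) }) ; (inj₂ i) → there (∈-++⁺ˡ i) }

  module Large (n-big : 2 * c ≤ n) where
    m : ℕ
    m = n / 1000

    n-lo : 1000 * m ≤ n
    n-lo = ≤-trans (≤-reflexive (*-comm 1000 m)) (m/n*n≤m n 1000)

    n<' : n ≤ 1000 + m * 1000
    n<' = ≤-trans (≤-reflexive (m≡m%n+[m/n]*n n 1000)) (+-monoˡ-≤ (m * 1000) (<⇒≤ (m%n<n n 1000)))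

    m-big : 2 ^ t ≤ m
    m-big = quotient-≥ (2 ^ t) (≤-trans c-big (≤-trans (m≤n*m c 2) n-big))

    1≤m : 1 ≤ m
    1≤m = ≤-trans (m^n>0 2 t) m-big

    n-hi : n ≤ 2000 * m
    n-hi = ≤-trans n<' (≤-trans (+-monoˡ-≤ (m * 1000) (*-monoʳ-≤ 1000 1≤m)) (≤-reflexive (trans (cong (1000 * m +_) (*-comm m 1000)) (sym (*-distribʳ-+ m 1000 1000)))))

    enough : ∀ {k} → m ≤ k → ℕtoℚ n ℚ.≤ two ℚ.* C ℚ.* ℕtoℚ k
    enough {k} le = ℚₚ.≤-trans (ι-mono-≤ (≤-trans n-hi (≤-trans (≤-reflexive (*-assoc 2 1000 m)) (*-monoʳ-≤ 2 (*-mono-≤ 1000≤c le))))) (ι-scale₂ k)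

    joined : ∀ X Y → Unique X → Unique Y → (∀ v → v ∈ X → v ∉ Y) → m ≤ length X → m ≤ length Y → Σ (Fin n) λ u → Σ (Fin n) λ v → u ∈ X × v ∈ Y × Adj u v
    joined X Y uX uY dj lX lY = edge X Y uX uY dj (enough lX) (enough lY)

    -- Below the threshold n/2C this is condition (a). Above it, the vertices outside `X` and its
    -- neighbourhood have no edge to `X`, so by (b) they are fewer than |X| or at most equal in
    -- number. This leaves at least n - 16m neighbours, and 1000 - 16 ≥ 27·8.
    expands : ∀ X → Unique X → length X ≤ 8 * m → ∀ Y → Cov Adj X (λ _ → ⊤) Y → 27 * length X ≤ length Y
    expands X u l Y cov with two ℚ.* C ℚ.* ℕtoℚ (length X) ℚₚ.<? ℕtoℚ n
    ... | yes small = ≤-trans (*-monoˡ-≤ (length X) (≤-trans (m≤m+n 27 973) 1000≤c)) (≤-trans (ι-cancel-≤ (ℚₚ.≤-trans (ι-scale (length X)) grow))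
        (≤-trans (≤-reflexive (sym (elems-length (N G (ofList X))))) (pigeon (elems-unique (N G (ofList X))) λ i → let (w , j , a) = N-∈ G X i in cov w _ j a tt)))
      where
      grow : C ℚ.* ℕtoℚ (length X) ℚ.≤ ℕtoℚ ∣ N G (ofList X) ∣
      grow = subst (λ k → C ℚ.* ℕtoℚ k ℚ.≤ ℕtoℚ ∣ N G (ofList X) ∣) (ofList-size u) (IsExpander.expand ex (ofList X)
        (subst (λ k → two ℚ.* C ℚ.* ℕtoℚ k ℚ.< ℕtoℚ n) (sym (ofList-size u)) small))
    ... | no large = ≤-trans (*-monoʳ-≤ 27 l) (+-cancelˡ-≤ (16 * m) _ _ (≤-trans (≤-reflexive (ar m)) (≤-trans (*-monoˡ-≤ m {232} {1000} (≤ᵇ⇒≤ 232 1000 tt)) (≤-trans n-lo all))))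
      where
      ar : ∀ m → 16 * m + 27 * (8 * m) ≡ 232 * m
      ar = solve-∀
      ar' : ∀ m y → 8 * m + y + 8 * m ≡ 16 * m + y
      ar' = solve-∀
      parts : SV.Parts (allFin n) (X ++ Y)
      parts = SV.split (allFin n) (X ++ Y)
      Z : List (Fin n)
      Z = SV.Parts.outs parts
      Z-small : length Z ≤ length X
      Z-small = ≮⇒≥ λ lt → let (a , b , i , j , e) = edge X Z u (SV.Parts.uouts parts (Uniqueₚ.allFin⁺ n)) (λ v i j → SV.Parts.outs∉ parts j (∈-++⁺ˡ i))
                                                       (ℚₚ.≮⇒≥ large) (ℚₚ.≤-trans (ℚₚ.≮⇒≥ large) (mono₂ (<⇒≤ lt)))
                           in SV.Parts.outs∉ parts j (∈-++⁺ʳ X (cov a b i e tt))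
      all : n ≤ 16 * m + length Y
      all = ≤-trans (≤-reflexive (sym (length-tabulate {n = n} id))) (≤-trans (SV.outs≥ parts (Uniqueₚ.allFin⁺ n))
        (≤-trans (≤-reflexive (cong (_+ length Z) (length-++ X))) (≤-trans (+-mono-≤ (+-monoˡ-≤ (length Y) l) (≤-trans Z-small l)) (≤-reflexive (ar' m (length Y))))))

    hamiltonian : HamiltonPath G x y
    hamiltonian = go (log₂-bounds m 1≤m)
      where
      go : Σ ℕ (λ s → m ≤ 2 ^ s × 2 ^ s ≤ 2 * m) → HamiltonPath G x y
      go (s , lo , hi) = finish s lo hi (≤-trans 512≤t (exponent-≥ t (≤-trans m-big lo)))
        where
        finish : ∀ s → m ≤ 2 ^ s → 2 ^ s ≤ 2 * m → 512 ≤ s → HamiltonPath G x y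
        finish zero lo hi ()
        finish (suc d) lo hi 512≤s = recover (Hamilton.hamilton-path host x y x≢y >>= λ p →
          return (Process.HamP.path p , Process.HamP.unique p , Process.HamP.spanning p , Process.HamP.starts p , Process.HamP.ends p , Process.HamP.edges p))
          where
          module K = Constants d m n 512≤s hi n-lo n-hi
          host : Host n
          host = record { Adj = Adj ; Adj-sym = λ {u} {v} → Adj-sym {u} {v} ; irr = λ {v} → irr {v} ; m = m ; D = 25 ; joined = joined ; 6≤D = ≤ᵇ⇒≤ 6 25 tt ; 25≤D = ≤-refl ; expands = expands
            ; d = d ; m≤2^d = lo ; 2^d≤2m = hi ; 2^i≤m = λ i lt → *-cancelˡ-≤ 2 (≤-trans (^-monoʳ-≤ 2 lt) hi)
            ; g = K.g ; g≥1 = ≤-trans (m^n>0 K.s 3) (m≤n*m (K.s ^ 3) (8000 * 12)) ; Q = K.Q ; Q>N = ≤-refl ; m-big = K.m-big ; lam = K.lam ; kb = K.kb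
            ; room = K.room ; roomR = K.roomR ; sizes = K.sizes ; fewFree = K.fewFree }

  hamilton-path : HamiltonPath G x y
  hamilton-path with two ℚ.* C ℚ.* ℕtoℚ 1 ℚₚ.<? ℕtoℚ n
  ... | no small = complete (ℚₚ.≮⇒≥ small)
  ... | yes large = Large.hamiltonian (subst (λ k → 2 * k ≤ n) (*-identityʳ c) (ι-cancel-≤ (ℚₚ.≤-trans (ι-scale₂ 1) (ℚₚ.<⇒≤ large))))

expanders-hamilton-connected : ∀ t c → 512 ≤ t → 2 ^ t * 1000 ≤ c → 1000 ≤ c → Σ ℚ λ C₀ → (0ℚ ℚ.< C₀) ×
  (∀ (C : ℚ) → C₀ ℚ.≤ C → ∀ {n : ℕ} (G : Graph n) → IsExpander C G → HamiltonConnected G)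
expanders-hamilton-connected t c 512≤t c-big 1000≤c = ℕtoℚ c , ℚₚ.≰⇒> (λ le → <⇒≱ (≤-trans (s≤s z≤n) 1000≤c) (ι-cancel-≤ {c} {0} le))
  , λ C c≤C G ex x y x≢y → Expander.hamilton-path t c 512≤t c-big 1000≤c C c≤C G ex x y x≢y

theorem7p1 : Σ ℚ λ C₀ → (0ℚ ℚ.< C₀) ×
               (∀ (C : ℚ) → C₀ ℚ.≤ C → ∀ {n : ℕ} (G : Graph n) →
                 IsExpander C G → HamiltonConnected G)
-- In the case n ≥ 2·C₀ this value gives m ≥ 2^512, and m ≤ 2^s then gives s ≥ 512, as the estimates
-- of powers of s against `m` require.
theorem7p1 = expanders-hamilton-connected 512 (2 ^ 512 * 1000) ≤-refl ≤-refl (m≤n*m 1000 (2 ^ 512) {{m^n≢0 2 512}})
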